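{- For every positive integer $\ell$ there is an integer $d_\ell$ such that for every $4$-edge-connected eulerian multigraph $G$ with minimum degree at least $d_\ell$ and every simple subgraph $G'$ of $G$, the multigraph $G$ admits an eulerian tour $\mathcal{E}$ such that every segment of $\mathcal{E}$ of length at most $\ell$ consisting only of edges of $G'$ is a path.
   Context: Multigraphs may have multiple edges and loops; a loop contributes two to the degree of its vertex. A multigraph is eulerian if it is connected and all degrees are even, i.e. it has an eulerian tour (closed walk using each edge exactly once). A simple subgraph is one with no loops and no multiple edges. Given an eulerian tour $\mathcal{E}$, a segment of length $t$ of $\mathcal{E}$ is a walk $e_1e_2\dots e_t$ in which each $e_i,e_{i+1}$ are consecutive edges of $\mathcal{E}$ (cyclically). A path is a walk with no repeated vertex. -}

module Defs where

open import Data.Nat using (ℕ; zero; suc; _+_; _*_; _≤_; _<_)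
open import Data.Nat.DivMod using (_mod_)
open import Data.Fin using (Fin; toℕ) renaming (_≟_ to _≟ᶠ_)
open import Data.Bool using (Bool; true; false; if_then_else_)
open import Data.List using (List; map; allFin; length)
open import Data.Nat.ListAction using (sum)
open import Data.List.Membership.Propositional using (_∈_)
open import Data.Product using (_×_; _,_; proj₁; proj₂; ∃; Σ)
open import Data.Sum using (_⊎_)
open import Relation.Nullary using (¬_; does)
open import Relation.Binary.PropositionalEquality using (_≡_; _≢_)
open import Function.Definitions using (Bijective)

-- A finite multigraph: vertices Fin n, edges Fin m, each edge has two
-- (unordered) endpoints; an edge with equal endpoints is a loop.
record Multigraph : Set where
  field
    n    : ℕ
    m    : ℕ
    ends : Fin m → Fin n × Fin n
open Multigraph public

Joins : (G : Multigraph) → Fin (m G) → Fin (n G) → Fin (n G) → Set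
Joins G e u v = (ends G e ≡ (u , v)) ⊎ (ends G e ≡ (v , u))

[_≟_] : ∀ {k} → Fin k → Fin k → ℕ
[ u ≟ v ] = if does (u ≟ᶠ v) then 1 else 0

-- degree: each end of an edge at v counts once, so a loop counts twice
deg : (G : Multigraph) → Fin (n G) → ℕ
deg G v = sum (map (λ e → [ proj₁ (ends G e) ≟ v ] + [ proj₂ (ends G e) ≟ v ]) (allFin (m G)))

data Reach (G : Multigraph) (allowed : Fin (m G) → Set) : Fin (n G) → Fin (n G) → Set where
  here : ∀ {u} → Reach G allowed u u
  step : ∀ {u w v} (e : Fin (m G)) → allowed e → Joins G e u w → Reach G allowed w v → Reach G allowed u v

ConnectedVia : (G : Multigraph) → (Fin (m G) → Set) → Set
ConnectedVia G allowed = ∀ u v → Reach G allowed u v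

Connected : Multigraph → Set
Connected G = ConnectedVia G (λ _ → Fin (m G))

Even : ℕ → Set
Even k = ∃ λ j → k ≡ 2 * j

Eulerian : Multigraph → Set
Eulerian G = Connected G × (∀ v → Even (deg G v))

-- k-edge-connected (Diestel): at least 2 vertices, and G - F is connected
-- for every set F of fewer than k edges.
EdgeConnected : ℕ → Multigraph → Set
EdgeConnected k G =
  (2 ≤ n G) × (∀ (F : List (Fin (m G))) → length F < k → ConnectedVia G (λ e → ¬ (e ∈ F)))

MinDegreeAtLeast : ℕ → Multigraph → Set
MinDegreeAtLeast d G = ∀ v → d ≤ deg G v

-- a subgraph of G given by its edge set S (vertices are irrelevant here)
-- is simple: no loops and no two distinct parallel edges
Simple : (G : Multigraph) → (Fin (m G) → Bool) → Set
Simple G S =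
  (∀ e → S e ≡ true → proj₁ (ends G e) ≢ proj₂ (ends G e)) ×
  (∀ e f → S e ≡ true → S f ≡ true → e ≢ f →
     ¬ Joins G f (proj₁ (ends G e)) (proj₂ (ends G e)))

cyc : ∀ {m} → Fin m → ℕ → Fin m
cyc {suc k'} i k = (toℕ i + k) mod (suc k')

record EulerTour (G : Multigraph) : Set where
  field
    seq  : Fin (m G) → Fin (m G)
    bij  : Bijective _≡_ _≡_ seq
    vtx  : Fin (m G) → Fin (n G)
    fits : ∀ i → Joins G (seq i) (vtx i) (vtx (cyc i 1))
open EulerTour public

-- Every segment of T of length t with 1 ≤ t ≤ ℓ whose edges all lie in S is a
-- path: the segment starting at position i is the walk
-- vtx i, seq i, vtx (i+1), ..., seq (i+t-1), vtx (i+t)  (indices cyclic),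
-- and being a path means its t+1 vertices are pairwise distinct.
GoodTour : (G : Multigraph) → (Fin (m G) → Bool) → ℕ → EulerTour G → Set
GoodTour G S ℓ T =
  ∀ (i : Fin (m G)) (t : ℕ) → 1 ≤ t → t ≤ ℓ →
  (∀ k → k < t → S (seq T (cyc i k)) ≡ true) →
  ∀ j k → j ≤ t → k ≤ t → j ≢ k → vtx T (cyc i j) ≢ vtx T (cyc i k)

{-# OPTIONS --safe #-}

-- A balanced orientation of G enters every proper vertex set at least twice, so by Edmonds'
-- theorem it contains two arc-disjoint spanning arborescences.  The first one together with
-- part of the second is a connected spanning subgraph Z with all degrees even, whose
-- indegrees are at most 2.  Cutting an eulerian tour of Z at the heads of its arcs gives
-- links of at most two edges, boundedly many at each vertex, which connect all vertices.
--
-- The other edges are oriented anew and divided evenly into at least ℓ levels.  Joining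
-- the arcs entering a vertex at one level to those leaving it at the next one yields long
-- trails; the local lemma provides joinings such that these are paths as far as they run
-- in G', and such that at every vertex only a small proportion of the trails meets any
-- other given vertex.
--
-- Finally the ends of trails and links are paired at each vertex.  Exchanging two pairs
-- conflicts with few others, so starting from any pairing one first removes all short closed
-- segments and then merges different closed trails through a vertex.  The links make
-- the result a single tour.

module Submission where

open import Defs
open import Data.Nat using (ℕ; zero; suc; _+_; _*_; _∸_; _^_; _≤_; _<_; z≤n; s≤s; NonZero; _≤?_; _<?_; >-nonZero; ≢-nonZero; >-nonZero⁻¹)
import Data.Nat.Properties as ℕP
import Data.Nat.DivMod as DM
import Data.Nat.Divisibility as Dv
open import Data.Nat.Tactic.RingSolver using (solve-∀)
open import Data.Fin using (Fin; zero; suc; toℕ; fromℕ<; _↑ˡ_; _↑ʳ_; splitAt; join; combine; remQuot; _≟_)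
import Data.Fin.Properties as FP
open import Data.Bool using (Bool; true; false; if_then_else_; _∧_; _∨_; not; _xor_)
import Data.Bool.Properties as BP
open import Data.List using (List; []; _∷_; _++_; length; concatMap; tabulate)
import Data.List as L
open import Data.Nat.ListAction using (sum)
import Data.List.Properties as LP
open import Data.List.Membership.Propositional using (_∈_)
open import Data.List.Membership.Propositional.Properties using (∈-++⁺ˡ; ∈-++⁺ʳ; ∈-tabulate⁺; ∈-map⁺)
open import Data.List.Relation.Unary.Any using (here; there)
open import Data.List.Relation.Unary.All using (All; []; _∷_)
open import Data.Vec using (Vec; []; _∷_; lookup; _[_]≔_)
import Data.Vec.Properties as VP
open import Data.Maybe using (Maybe; just; nothing)
import Data.Maybe.Properties as MP
open import Data.Product using (_×_; _,_; proj₁; proj₂; ∃; Σ; Σ-syntax)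
import Data.Product.Properties as PP
open import Data.Sum using (_⊎_; inj₁; inj₂; [_,_]′)
import Data.Sum.Properties as SP
open import Data.Empty using (⊥; ⊥-elim)
open import Function using (_∘_; id; case_of_)
open import Relation.Nullary using (¬_; Dec; yes; no; does)
open import Relation.Nullary.Decidable using (dec-true; dec-false)
open import Relation.Binary using (DecidableEquality; tri<; tri≈; tri>)
open import Relation.Binary.PropositionalEquality using (_≡_; _≢_; refl; sym; trans; cong; cong₂; subst; subst₂; module ≡-Reasoning)

-- Finite sums and counting

-- Degrees are not bounded above, while the local lemma needs bounded dependencies. The arcs at a
-- vertex are therefore treated in groups of bounded size, and every bound is a proportion of the
-- degree: in the end at most the fraction `K / x` of the trails at a vertex meets a given vertex,
-- where `16 * (suc ℓ * K) ≤ x`. Equal groups require the number of arcs at a vertex and level to be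
-- a multiple of the group size, so auxiliary loops pad it. A trail must be cut at such a loop;
-- hence loops carry a label of their own, which is kept rare in the same way as a vertex.
--
-- Exchanges unite only closed trails that have exchangeable transitions at a common vertex, so the
-- long trails alone might never become one tour. The links give every vertex an exchangeable
-- transition and lead from vertex to vertex. They have to be few at each vertex although outdegrees
-- in an arborescence are unbounded: hence the cuts at heads. Being entered twice, as
-- 4-edge-connectivity ensures, is what provides the second arborescence that repairs the parities.

sumF : ∀ {n} → (Fin n → ℕ) → ℕ
sumF {zero}  f = 0
sumF {suc n} f = f zero + sumF (λ i → f (suc i))

⟦_⟧ : Bool → ℕ
⟦ b ⟧ = if b then 1 else 0

cnt : ∀ {n} → (Fin n → Bool) → ℕ
cnt p = sumF (λ i → ⟦ p i ⟧)

+-interchange : ∀ a b c d → (a + b) + (c + d) ≡ (a + c) + (b + d)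
+-interchange = solve-∀

sum-cong : ∀ {n} {f g : Fin n → ℕ} → (∀ i → f i ≡ g i) → sumF f ≡ sumF g
sum-cong {zero}  h = refl
sum-cong {suc n} h = cong₂ _+_ (h zero) (sum-cong (λ i → h (suc i)))

sum-mono : ∀ {n} {f g : Fin n → ℕ} → (∀ i → f i ≤ g i) → sumF f ≤ sumF g
sum-mono {zero}  h = z≤n
sum-mono {suc n} h = ℕP.+-mono-≤ (h zero) (sum-mono (λ i → h (suc i)))

sum-+ : ∀ {n} (f g : Fin n → ℕ) → sumF (λ i → f i + g i) ≡ sumF f + sumF g
sum-+ {zero}  f g = refl
sum-+ {suc n} f g = trans (cong (f zero + g zero +_) (sum-+ (λ i → f (suc i)) (λ i → g (suc i))))
                          (+-interchange (f zero) (g zero) _ _)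

sum-* : ∀ {n} c (f : Fin n → ℕ) → sumF (λ i → c * f i) ≡ c * sumF f
sum-* {zero}  c f = sym (ℕP.*-zeroʳ c)
sum-* {suc n} c f = trans (cong (c * f zero +_) (sum-* c (λ i → f (suc i))))
                          (sym (ℕP.*-distribˡ-+ c (f zero) _))

sum-const : ∀ n c → sumF {n} (λ _ → c) ≡ n * c
sum-const zero    c = refl
sum-const (suc n) c = cong (c +_) (sum-const n c)

sum-0 : ∀ {n} {f : Fin n → ℕ} → (∀ i → f i ≡ 0) → sumF f ≡ 0
sum-0 {zero}  h = refl
sum-0 {suc n} h = cong₂ _+_ (h zero) (sum-0 (λ i → h (suc i)))

sum-swap : ∀ {n k} (f : Fin n → Fin k → ℕ) →
           sumF (λ i → sumF (λ j → f i j)) ≡ sumF (λ j → sumF (λ i → f i j))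
sum-swap {zero}  {k} f = sym (sum-0 {k} (λ _ → refl))
sum-swap {suc n} {k} f =
  trans (cong (sumF (f zero) +_) (sum-swap (λ i → f (suc i))))
        (sym (sum-+ (f zero) (λ j → sumF (λ i → f (suc i) j))))

sum-↑ : ∀ a {b} (f : Fin (a + b) → ℕ) →
        sumF f ≡ sumF (λ i → f (i ↑ˡ b)) + sumF (λ j → f (a ↑ʳ j))
sum-↑ zero    f = refl
sum-↑ (suc a) f = trans (cong (f zero +_) (sum-↑ a (λ i → f (suc i)))) (sym (ℕP.+-assoc (f zero) _ _))

sum-combine : ∀ a {b} (f : Fin (a * b) → ℕ) →
              sumF f ≡ sumF {a} (λ i → sumF {b} (λ j → f (combine i j)))
sum-combine zero    f = refl
sum-combine (suc a) {b} f = trans (sum-↑ b f) (cong (sumF (λ i → f (i ↑ˡ (a * b))) +_)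
                                          (sum-combine a (λ i → f (b ↑ʳ i))))

term≤sum : ∀ {n} (f : Fin n → ℕ) k → f k ≤ sumF f
term≤sum f zero    = ℕP.m≤m+n _ _
term≤sum f (suc k) = ℕP.≤-trans (term≤sum (λ i → f (suc i)) k) (ℕP.m≤n+m _ (f zero))

sum-agree : ∀ {n} (f g : Fin n → ℕ) k → (∀ i → i ≢ k → f i ≡ g i) → sumF f + g k ≡ sumF g + f k
sum-agree {suc n} f g zero h
  rewrite sum-cong {f = λ i → f (suc i)} {g = λ i → g (suc i)} (λ i → h (suc i) (λ ())) =
  lem (f zero) (g zero) _
  where lem : ∀ a b c → a + c + b ≡ b + c + a
        lem = solve-∀
sum-agree {suc n} f g (suc k) h
  rewrite h zero (λ ()) =
  trans (ℕP.+-assoc (g zero) _ _)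
  (trans (cong (g zero +_) (sum-agree (λ i → f (suc i)) (λ i → g (suc i)) k
                             (λ i ne → h (suc i) (λ { refl → ne refl }))))
         (sym (ℕP.+-assoc (g zero) _ _)))

eqb : ∀ {n} → Fin n → Fin n → Bool
eqb i j = does (i ≟ j)

does⇒ : ∀ {P : Set} (d : Dec P) → does d ≡ true → P
does⇒ (yes p) _ = p

does⇒¬ : ∀ {P : Set} (d : Dec P) → does d ≡ false → ¬ P
does⇒¬ (no np) _ = np

eqb-refl : ∀ {n} (i : Fin n) → eqb i i ≡ true
eqb-refl i = dec-true (i ≟ i) refl

does-sym : ∀ {A : Set} (_≈?_ : DecidableEquality A) x y → does (x ≈? y) ≡ does (y ≈? x)
does-sym _≈?_ x y with x ≈? y
... | yes refl = sym (dec-true (x ≈? x) refl)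
... | no ne    = sym (dec-false (y ≈? x) (λ e → ne (sym e)))

sum-delta : ∀ {n} (k : Fin n) (f : Fin n → ℕ) → sumF (λ j → ⟦ eqb k j ⟧ * f j) ≡ f k
sum-delta {suc n} zero    f = trans (cong₂ _+_ (ℕP.*-identityˡ (f zero)) (sum-0 {n} (λ _ → refl))) (ℕP.+-identityʳ _)
sum-delta {suc n} (suc k) f = sum-delta k (λ j → f (suc j))

∧-true : ∀ {a b} → a ∧ b ≡ true → a ≡ true × b ≡ true
∧-true {true} {true} _ = refl , refl

∧-intro : ∀ {a b} → a ≡ true → b ≡ true → a ∧ b ≡ true
∧-intro refl refl = refl

∨-true : ∀ {a b} → a ∨ b ≡ true → a ≡ true ⊎ b ≡ true
∨-true {true}  _ = inj₁ refl
∨-true {false} h = inj₂ h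

∨-introˡ : ∀ {a b} → a ≡ true → a ∨ b ≡ true
∨-introˡ refl = refl

∨-introʳ : ∀ {a b} → b ≡ true → a ∨ b ≡ true
∨-introʳ {true}  _ = refl
∨-introʳ {false} h = h

not-true : ∀ {a} → not a ≡ true → a ≡ false
not-true {false} _ = refl

t≢f : ∀ {a} → a ≡ true → a ≡ false → ⊥
t≢f refl ()

¬t⇒f : ∀ {a} → ¬ (a ≡ true) → a ≡ false
¬t⇒f {true}  h = ⊥-elim (h refl)
¬t⇒f {false} h = refl

bool-ext : ∀ {a b} → (a ≡ true → b ≡ true) → (b ≡ true → a ≡ true) → a ≡ b
bool-ext {true}  {true}  f g = refl
bool-ext {true}  {false} f g = sym (f refl)
bool-ext {false} {true}  f g = g refl
bool-ext {false} {false} f g = refl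

⟦⟧-mono : ∀ {a b} → (a ≡ true → b ≡ true) → ⟦ a ⟧ ≤ ⟦ b ⟧
⟦⟧-mono {false} h = z≤n
⟦⟧-mono {true} {true}  h = s≤s z≤n
⟦⟧-mono {true} {false} h with h refl
... | ()

cnt-cong : ∀ {n} {p q : Fin n → Bool} → (∀ i → p i ≡ q i) → cnt p ≡ cnt q
cnt-cong h = sum-cong (λ i → cong ⟦_⟧ (h i))

cnt-mono : ∀ {n} {p q : Fin n → Bool} → (∀ i → p i ≡ true → q i ≡ true) → cnt p ≤ cnt q
cnt-mono h = sum-mono (λ i → ⟦⟧-mono (h i))

cnt-pos : ∀ {n} {p : Fin n → Bool} i → p i ≡ true → 1 ≤ cnt p
cnt-pos {p = p} i h = ℕP.≤-trans (ℕP.≤-reflexive (cong ⟦_⟧ (sym h))) (term≤sum (λ i → ⟦ p i ⟧) i)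

cnt-zero : ∀ {n} {p : Fin n → Bool} → (∀ i → p i ≡ false) → cnt p ≡ 0
cnt-zero h = sum-0 (λ i → cong ⟦_⟧ (h i))

find? : ∀ {n} (p : Fin n → Bool) → (∃ λ i → p i ≡ true) ⊎ (∀ i → p i ≡ false)
find? {zero} p = inj₂ (λ ())
find? {suc n} p with p zero in eq
... | true = inj₁ (zero , eq)
... | false with find? (λ i → p (suc i))
...   | inj₁ (i , h) = inj₁ (suc i , h)
...   | inj₂ h = inj₂ (λ { zero → eq ; (suc i) → h i })

cnt-find : ∀ {n} {p : Fin n → Bool} → 1 ≤ cnt p → ∃ λ i → p i ≡ true
cnt-find {p = p} h with find? p
... | inj₁ r = r
... | inj₂ z = ⊥-elim (ℕP.<⇒≢ h (sym (cnt-zero z)))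

⟦⟧-split : ∀ a b → ⟦ a ⟧ ≡ ⟦ a ∧ b ⟧ + ⟦ a ∧ not b ⟧
⟦⟧-split true  true  = refl
⟦⟧-split true  false = refl
⟦⟧-split false _     = refl

cnt-split : ∀ {n} (p q : Fin n → Bool) → cnt p ≡ cnt (λ i → p i ∧ q i) + cnt (λ i → p i ∧ not (q i))
cnt-split p q = trans (sum-cong (λ i → ⟦⟧-split (p i) (q i)))
                      (sum-+ (λ i → ⟦ p i ∧ q i ⟧) (λ i → ⟦ p i ∧ not (q i) ⟧))

cnt-pick : ∀ {n} (p q : Fin n → Bool) → cnt q < cnt p → ∃ λ i → p i ≡ true × q i ≡ false
cnt-pick p q h with find? (λ i → p i ∧ not (q i))
... | inj₁ (i , e) = i , proj₁ (∧-true e) , not-true (proj₂ (∧-true {p i} e))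
... | inj₂ z = ⊥-elim (ℕP.<⇒≱ h (ℕP.≤-trans (ℕP.≤-reflexive (cnt-split p q))
      (ℕP.≤-trans (ℕP.≤-reflexive (trans (cong (cnt (λ i → p i ∧ q i) +_) (cnt-zero z)) (ℕP.+-identityʳ _)))
                  (cnt-mono (λ i e → proj₂ (∧-true {p i} e))))))

cnt-∨ : ∀ {n} (p q : Fin n → Bool) → cnt (λ i → p i ∨ q i) ≤ cnt p + cnt q
cnt-∨ p q = ℕP.≤-trans (sum-mono (λ i → lem (p i) (q i)))
                 (ℕP.≤-reflexive (sum-+ (λ i → ⟦ p i ⟧) (λ i → ⟦ q i ⟧)))
  where lem : ∀ a b → ⟦ a ∨ b ⟧ ≤ ⟦ a ⟧ + ⟦ b ⟧
        lem true  b = s≤s z≤n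
        lem false b = ℕP.≤-refl

cnt-strict : ∀ {n} {p q : Fin n → Bool} → (∀ i → p i ≡ true → q i ≡ true) →
             ∀ i → p i ≡ false → q i ≡ true → cnt p < cnt q
cnt-strict {p = p} {q} h i pf qt = begin-strict
  cnt p                                                    ≡⟨ cnt-cong (λ j → bool-ext (λ e → ∧-intro (h j e) e) (λ e → proj₂ (∧-true {q j} e))) ⟩
  cnt (λ j → q j ∧ p j)                                    <⟨ ℕP.m<m+n _ (cnt-pos i (∧-intro qt (cong not pf))) ⟩
  cnt (λ j → q j ∧ p j) + cnt (λ j → q j ∧ not (p j))      ≡⟨ cnt-split q p ⟨
  cnt q                                                    ∎
  where open ℕP.≤-Reasoning

cnt≤n : ∀ {n} (p : Fin n → Bool) → cnt p ≤ n
cnt≤n {n} p = ℕP.≤-trans (sum-mono {g = λ _ → 1} (λ i → lem (p i)))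
                         (ℕP.≤-reflexive (trans (sum-const n 1) (ℕP.*-identityʳ n)))
  where lem : ∀ b → ⟦ b ⟧ ≤ 1
        lem true  = ℕP.≤-refl
        lem false = z≤n

cnt-unique : ∀ {n} (p : Fin n → Bool) → (∀ i j → p i ≡ true → p j ≡ true → i ≡ j) → cnt p ≤ 1
cnt-unique {zero} p h = z≤n
cnt-unique {suc n} p h with p zero in eq
... | true  = s≤s (ℕP.≤-reflexive (cnt-zero (λ i → ¬t⇒f (λ e → case h zero (suc i) eq e of λ ()))))
... | false = cnt-unique (λ i → p (suc i)) (λ i j a b → FP.suc-injective (h (suc i) (suc j) a b))

cnt-eqb≤1 : ∀ {n} (u : Fin n) → cnt (eqb u) ≤ 1
cnt-eqb≤1 u = cnt-unique (eqb u) (λ i j a b → trans (sym (does⇒ (u ≟ i) a)) (does⇒ (u ≟ j) b))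

-- Each i counted by p is charged to its image, and an image is charged at most once.
cnt-inj : ∀ {n k} {p : Fin n → Bool} {q : Fin k → Bool} (f : Fin n → Fin k) →
          (∀ i → p i ≡ true → q (f i) ≡ true) →
          (∀ i j → p i ≡ true → p j ≡ true → f i ≡ f j → i ≡ j) → cnt p ≤ cnt q
cnt-inj {p = p} {q} f pq inj = begin
  sumF (λ i → ⟦ p i ⟧)                                    ≡⟨ sum-cong (λ i → sum-delta (f i) (λ _ → ⟦ p i ⟧)) ⟨
  sumF (λ i → sumF (λ j → ⟦ eqb (f i) j ⟧ * ⟦ p i ⟧))     ≡⟨ sum-swap (λ i j → ⟦ eqb (f i) j ⟧ * ⟦ p i ⟧) ⟩
  sumF (λ j → sumF (λ i → ⟦ eqb (f i) j ⟧ * ⟦ p i ⟧))     ≤⟨ sum-mono col ⟩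
  sumF (λ j → ⟦ q j ⟧)                                    ∎
  where
  open ℕP.≤-Reasoning
  ⟦⟧* : ∀ a b → ⟦ a ⟧ * ⟦ b ⟧ ≡ ⟦ a ∧ b ⟧
  ⟦⟧* true  b = ℕP.*-identityˡ _
  ⟦⟧* false b = refl
  col : ∀ j → sumF (λ i → ⟦ eqb (f i) j ⟧ * ⟦ p i ⟧) ≤ ⟦ q j ⟧
  col j with q j in eq
  ... | true  = ℕP.≤-trans (ℕP.≤-reflexive (sum-cong (λ i → ⟦⟧* (eqb (f i) j) (p i))))
                 (cnt-unique (λ i → eqb (f i) j ∧ p i) (λ i i' a b →
                   inj i i' (proj₂ (∧-true {eqb (f i) j} a)) (proj₂ (∧-true {eqb (f i') j} b))
                     (trans (does⇒ (f i ≟ j) (proj₁ (∧-true a))) (sym (does⇒ (f i' ≟ j) (proj₁ (∧-true b)))))))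
  ... | false = ℕP.≤-reflexive (trans (sum-cong (λ i → ⟦⟧* (eqb (f i) j) (p i)))
                 (cnt-zero (λ i → ¬t⇒f (λ e → t≢f (pq i (proj₂ (∧-true {eqb (f i) j} e)))
                   (trans (cong q (does⇒ (f i ≟ j) (proj₁ (∧-true e)))) eq)))))

-- Double counting along the fibres of `φ`. With `φ` the tails or the heads of arcs and `w` the
-- indicator of a vertex set, it turns balance at vertices into balance of the set.
sum-push : ∀ {k n} (φ : Fin k → Fin n) (w : Fin n → ℕ) →
           sumF (λ e → w (φ e)) ≡ sumF (λ v → cnt (λ e → eqb (φ e) v) * w v)
sum-push φ w = begin
  sumF (λ e → w (φ e))                                ≡⟨ sum-cong (λ e → sum-delta (φ e) w) ⟨
  sumF (λ e → sumF (λ v → ⟦ eqb (φ e) v ⟧ * w v))     ≡⟨ sum-swap (λ e v → ⟦ eqb (φ e) v ⟧ * w v) ⟩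
  sumF (λ v → sumF (λ e → ⟦ eqb (φ e) v ⟧ * w v))     ≡⟨ sum-cong (λ v → sum-cong (λ e → ℕP.*-comm ⟦ eqb (φ e) v ⟧ (w v))) ⟩
  sumF (λ v → sumF (λ e → w v * ⟦ eqb (φ e) v ⟧))     ≡⟨ sum-cong (λ v → sum-* (w v) (λ e → ⟦ eqb (φ e) v ⟧)) ⟩
  sumF (λ v → w v * cnt (λ e → eqb (φ e) v))          ≡⟨ sum-cong (λ v → ℕP.*-comm (w v) _) ⟩
  sumF (λ v → cnt (λ e → eqb (φ e) v) * w v)          ∎
  where open ≡-Reasoning

cnt-sub : ∀ {n} (p : Fin n → Bool) k → k ≤ cnt p →
          ∃ λ (q : Fin n → Bool) → (∀ i → q i ≡ true → p i ≡ true) × cnt q ≡ k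
cnt-sub {n} p zero _ = (λ _ → false) , (λ _ ()) , cnt-zero {n} (λ _ → refl)
cnt-sub {zero} p (suc k) ()
cnt-sub {suc n} p (suc k) le with p zero in eq
... | true with cnt-sub (λ i → p (suc i)) k (ℕP.≤-pred le)
...   | q , h , c = (λ { zero → true ; (suc i) → q i }) , (λ { zero _ → eq ; (suc i) e → h i e }) , cong suc c
cnt-sub {suc n} p (suc k) le | false with cnt-sub (λ i → p (suc i)) (suc k) le
...   | q , h , c = (λ { zero → false ; (suc i) → q i }) , (λ { (suc i) e → h i e }) , c

-- Balanced orientations

upd : ∀ {m} {A : Set} → (Fin m → A) → Fin m → A → Fin m → A
upd f k x i = if does (i ≟ k) then x else f i

upd-eq : ∀ {m} {A : Set} (f : Fin m → A) k x → upd f k x k ≡ x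
upd-eq f k x rewrite eqb-refl k = refl

upd-ne : ∀ {m} {A : Set} (f : Fin m → A) k x i → i ≢ k → upd f k x i ≡ f i
upd-ne f k x i ne rewrite dec-false (i ≟ k) ne = refl

_◂_ : ∀ {m} {A : Set} → A → (Fin m → A) → Fin (suc m) → A
(x ◂ f) zero    = x
(x ◂ f) (suc i) = f i

-- With `o` deciding which end of an edge comes first, `pick o s t` and `pick o t s` are the tails
-- and the heads of an orientation.
pick : ∀ {m} {A : Set} → (Fin m → Bool) → (Fin m → A) → (Fin m → A) → Fin m → A
pick o s t e = if o e then s e else t e

cmp? : ∀ x y → Σ Bool λ b → if b then x ≤ y else y < x
cmp? x y with x ≤? y
... | yes le = true , le
... | no nle = false , ℕP.≰⇒> nle

module _ {A : Set} (_≈?_ : DecidableEquality A) where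

  fib : ∀ {m} → (Fin m → A) → A → ℕ
  fib f a = cnt (λ e → does (f e ≈? a))

  private
    δ : A → A → ℕ
    δ x a = ⟦ does (x ≈? a) ⟧

    -- Accounts for the detour in `orient`, once for tails and once for heads: replacing the edge
    -- `uw` by the path `u v w`, in either direction, adds one tail and one head at the inner vertex
    -- `v` and nothing else. `z` is the counted end of the first edge.
    fib-move : ∀ {m} (X Y : Fin m → A) k z v → (∀ i → i ≢ k → X i ≡ Y i) →
               (z ≡ Y k × X k ≡ v) ⊎ (z ≡ v × X k ≡ Y k) → ∀ a →
               δ z a + fib X a ≡ δ v a + fib Y a
    fib-move X Y k z v ag c a with sum-agree (λ e → δ (X e) a) (λ e → δ (Y e) a) k (λ i ne → cong (λ x → δ x a) (ag i ne))
    fib-move X Y k z v ag (inj₁ (refl , refl)) a | eq =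
      trans (ℕP.+-comm (δ z a) _) (trans eq (ℕP.+-comm (fib Y a) _))
    fib-move X Y k z v ag (inj₂ (refl , e)) a | eq rewrite e =
      cong (δ z a +_) (ℕP.+-cancelʳ-≡ (δ (Y k) a) _ _ eq)

    Bal : ℕ → ℕ → Set
    Bal x y = x ≤ suc y × y ≤ suc x

    bal-shift : ∀ c {x y x' y'} → x ≡ c + x' → y ≡ c + y' → Bal x' y' → Bal x y
    bal-shift c {x' = x'} {y'} refl refl (p , q) =
      ℕP.≤-trans (ℕP.+-monoʳ-≤ c p) (ℕP.≤-reflexive (ℕP.+-suc c y')) ,
      ℕP.≤-trans (ℕP.+-monoʳ-≤ c q) (ℕP.≤-reflexive (ℕP.+-suc c x'))

  -- Split off: if the first edge uv meets another edge vw, orient the graph in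
  -- which the two are replaced by uw, and traverse the detour in that direction.
  orient : ∀ {m} (s t : Fin m → A) → ∃ λ (o : Fin m → Bool) → ∀ a →
           fib (pick o s t) a ≤ suc (fib (pick o t s) a) × fib (pick o t s) a ≤ suc (fib (pick o s t) a)
  orient {zero} s t = (λ ()) , λ a → z≤n , z≤n
  orient {suc m} s t with s zero ≈? t zero
  ... | yes u≡v with orient (s ∘ suc) (t ∘ suc)
  ...   | o' , bal = (true ◂ o') , λ a →
          bal-shift (δ (s zero) a) refl (cong (λ x → δ x a + fib (pick o' (t ∘ suc) (s ∘ suc)) a) (sym u≡v)) (bal a)
  orient {suc m} s t | no u≢v with find? (λ k → does (s (suc k) ≈? t zero))
  ... | inj₁ (k , sk) with orient (upd (s ∘ suc) k (s zero)) (t ∘ suc)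
  ...   | o' , bal = (o' k ◂ o') , λ a →
          bal-shift (δ (t zero) a)
            (fib-move (pick o' ss ts) (pick o' ss' ts) k _ (t zero) (λ i ne → outp i ne) outc a)
            (fib-move (pick o' ts ss) (pick o' ts ss') k _ (t zero) (λ i ne → inp i ne) inc a) (bal a)
    where
    ss = s ∘ suc
    ts = t ∘ suc
    ss' = upd ss k (s zero)
    outp : ∀ i → i ≢ k → pick o' ss ts i ≡ pick o' ss' ts i
    outp i ne rewrite upd-ne ss k (s zero) i ne = refl
    inp : ∀ i → i ≢ k → pick o' ts ss i ≡ pick o' ts ss' i
    inp i ne rewrite upd-ne ss k (s zero) i ne = refl
    outc : ((if o' k then s zero else t zero) ≡ pick o' ss' ts k × pick o' ss ts k ≡ t zero) ⊎
           ((if o' k then s zero else t zero) ≡ t zero × pick o' ss ts k ≡ pick o' ss' ts k)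
    outc with o' k
    ... | true  = inj₁ (sym (upd-eq ss k (s zero)) , does⇒ (_ ≈? _) sk)
    ... | false = inj₂ (refl , refl)
    inc : ((if o' k then t zero else s zero) ≡ pick o' ts ss' k × pick o' ts ss k ≡ t zero) ⊎
          ((if o' k then t zero else s zero) ≡ t zero × pick o' ts ss k ≡ pick o' ts ss' k)
    inc with o' k
    ... | true  = inj₂ (refl , refl)
    ... | false = inj₁ (sym (upd-eq ss k (s zero)) , does⇒ (_ ≈? _) sk)
  orient {suc m} s t | no u≢v | inj₂ ns with find? (λ k → does (t (suc k) ≈? t zero))
  ... | inj₁ (k , tk) with orient (s ∘ suc) (upd (t ∘ suc) k (s zero))
  ...   | o' , bal = (not (o' k) ◂ o') , λ a →
          bal-shift (δ (t zero) a)
            (fib-move (pick o' ss ts) (pick o' ss ts') k _ (t zero) (λ i ne → outp i ne) outc a)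
            (fib-move (pick o' ts ss) (pick o' ts' ss) k _ (t zero) (λ i ne → inp i ne) inc a) (bal a)
    where
    ss = s ∘ suc
    ts = t ∘ suc
    ts' = upd ts k (s zero)
    outp : ∀ i → i ≢ k → pick o' ss ts i ≡ pick o' ss ts' i
    outp i ne rewrite upd-ne ts k (s zero) i ne = refl
    inp : ∀ i → i ≢ k → pick o' ts ss i ≡ pick o' ts' ss i
    inp i ne rewrite upd-ne ts k (s zero) i ne = refl
    outc : ((if not (o' k) then s zero else t zero) ≡ pick o' ss ts' k × pick o' ss ts k ≡ t zero) ⊎
           ((if not (o' k) then s zero else t zero) ≡ t zero × pick o' ss ts k ≡ pick o' ss ts' k)
    outc with o' k
    ... | true  = inj₂ (refl , refl)
    ... | false = inj₁ (sym (upd-eq ts k (s zero)) , does⇒ (_ ≈? _) tk)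
    inc : ((if not (o' k) then t zero else s zero) ≡ pick o' ts' ss k × pick o' ts ss k ≡ t zero) ⊎
          ((if not (o' k) then t zero else s zero) ≡ t zero × pick o' ts ss k ≡ pick o' ts' ss k)
    inc with o' k
    ... | true  = inj₁ (sym (upd-eq ts k (s zero)) , does⇒ (_ ≈? _) tk)
    ... | false = inj₂ (refl , refl)
  orient {suc m} s t | no u≢v | inj₂ ns | inj₂ nt with orient (s ∘ suc) (t ∘ suc)
  ... | o' , bal = (b ◂ o') , fin
    where
    X = pick o' (s ∘ suc) (t ∘ suc)
    Y = pick o' (t ∘ suc) (s ∘ suc)
    -- No other edge meets the second end of the first edge, so any direction is balanced there; the
    -- direction is chosen to suit the first end.
    cb = cmp? (fib X (s zero)) (fib Y (s zero))
    b = proj₁ cb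
    X0 : fib X (t zero) ≡ 0
    X0 = cnt-zero (λ i → h i)
      where h : ∀ i → does (X i ≈? t zero) ≡ false
            h i with o' i
            ... | true  = ns i
            ... | false = nt i
    Y0 : fib Y (t zero) ≡ 0
    Y0 = cnt-zero (λ i → h i)
      where h : ∀ i → does (Y i ≈? t zero) ≡ false
            h i with o' i
            ... | true  = nt i
            ... | false = ns i
    δ≤1 : ∀ x a → δ x a ≤ 1
    δ≤1 x a with does (x ≈? a)
    ... | true  = ℕP.≤-refl
    ... | false = z≤n
    Goal : A → Set
    Goal a = Bal (δ (if b then s zero else t zero) a + fib X a) (δ (if b then t zero else s zero) a + fib Y a)
    atv : Goal (t zero)
    atv rewrite X0 | Y0 | ℕP.+-identityʳ (δ (if b then s zero else t zero) (t zero))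
                        | ℕP.+-identityʳ (δ (if b then t zero else s zero) (t zero)) =
      ℕP.≤-trans (δ≤1 _ _) (s≤s z≤n) , ℕP.≤-trans (δ≤1 _ _) (s≤s z≤n)
    atu : Goal (s zero)
    atu with b | proj₂ cb
    ... | true | le rewrite dec-true (s zero ≈? s zero) refl | dec-false (t zero ≈? s zero) (λ e → u≢v (sym e)) =
          s≤s le , ℕP.≤-trans (proj₂ (bal (s zero))) (ℕP.n≤1+n _)
    ... | false | gt rewrite dec-true (s zero ≈? s zero) refl | dec-false (t zero ≈? s zero) (λ e → u≢v (sym e)) =
          ℕP.≤-trans (proj₁ (bal (s zero))) (ℕP.n≤1+n _) , ℕP.≤-trans gt (ℕP.n≤1+n _)
    other : ∀ a → s zero ≢ a → t zero ≢ a → Goal a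
    other a nu nv with b
    ... | true  rewrite dec-false (s zero ≈? a) nu | dec-false (t zero ≈? a) nv = bal a
    ... | false rewrite dec-false (s zero ≈? a) nu | dec-false (t zero ≈? a) nv = bal a
    fin : ∀ a → Goal a
    fin a with s zero ≈? a | t zero ≈? a
    ... | yes refl | _        = atu
    ... | no _     | yes refl = atv
    ... | no nu    | no nv    = other a nu nv

  orient-sum : ∀ {m} (o : Fin m → Bool) (s t : Fin m → A) a →
               fib (pick o s t) a + fib (pick o t s) a ≡ fib s a + fib t a
  orient-sum o s t a = trans (sym (sum-+ (λ e → δ (pick o s t e) a) (λ e → δ (pick o t s e) a)))
                      (trans (sum-cong (λ e → h e)) (sum-+ (λ e → δ (s e) a) (λ e → δ (t e) a)))
    where h : ∀ e → δ (pick o s t e) a + δ (pick o t s e) a ≡ δ (s e) a + δ (t e) a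
          h e with o e
          ... | true  = refl
          ... | false = ℕP.+-comm (δ (t e) a) _

even-balanced : ∀ {x y} k → x + y ≡ 2 * k → x ≤ suc y → y ≤ suc x → x ≡ k × y ≡ k
even-balanced {x} {y} k e p q = ℕP.≤-antisym (le x y e p) (ge x y e q) , ℕP.≤-antisym (le y x e' q) (ge y x e' p)
  where
  e' : y + x ≡ 2 * k
  e' = trans (ℕP.+-comm y x) e
  le : ∀ x y → x + y ≡ 2 * k → x ≤ suc y → x ≤ k
  le x y e p with x ≤? k
  ... | yes h = h
  ... | no h = ⊥-elim (ℕP.<⇒≢ (ℕP.≤-trans (ℕP.≤-reflexive (lem k)) (ℕP.+-mono-≤ (ℕP.≰⇒> h) (ℕP.≤-pred (ℕP.≤-trans (ℕP.≰⇒> h) p)))) (sym e))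
    where lem : ∀ k → suc (2 * k) ≡ suc k + k
          lem = solve-∀
  ge : ∀ x y → x + y ≡ 2 * k → y ≤ suc x → k ≤ x
  ge x y e q with k ≤? x
  ... | yes h = h
  ... | no h = ⊥-elim (ℕP.<⇒≢ (ℕP.≤-trans (s≤s (ℕP.+-mono-≤ (ℕP.≤-refl {x}) q)) (ℕP.≤-trans (ℕP.≤-reflexive (lem x)) (ℕP.*-monoʳ-≤ 2 (ℕP.≰⇒> h)))) e)
    where lem : ∀ x → suc (x + suc x) ≡ 2 * suc x
          lem = solve-∀

-- Permutations and their orbits

record Perm (k : ℕ) : Set where
  constructor perm
  field
    to from : Fin k → Fin k
    ft : ∀ i → from (to i) ≡ i
    tf : ∀ i → to (from i) ≡ i
open Perm public

to-inj : ∀ {k} (π : Perm k) {i j} → to π i ≡ to π j → i ≡ j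
to-inj π {i} {j} e = trans (sym (ft π i)) (trans (cong (from π) e) (ft π j))

from-inj : ∀ {k} (π : Perm k) {i j} → from π i ≡ from π j → i ≡ j
from-inj π {i} {j} e = trans (sym (tf π i)) (trans (cong (to π) e) (tf π j))

idP : ∀ {k} → Perm k
idP = perm id id (λ _ → refl) (λ _ → refl)

cnt-perm : ∀ {k} (π : Perm k) (p : Fin k → Bool) → cnt (λ i → p (to π i)) ≡ cnt p
cnt-perm π p = ℕP.≤-antisym
  (cnt-inj (to π) (λ _ h → h) (λ _ _ _ _ e → to-inj π e))
  (cnt-inj (from π) (λ i h → trans (cong p (tf π i)) h) (λ _ _ _ _ e → from-inj π e))

module _ {A : Set} (_≈?_ : DecidableEquality A) where

  -- Greedy matching: the first slot takes any element with its key, and this key is then erased by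
  -- `nothing`, so the fibres still agree for the remaining slots. The value `nothing` also hides
  -- elements that are not to be numbered.
  enumerate : ∀ {N M} (f : Fin N → Maybe A) (g : Fin M → A) →
    (∀ a → cnt (λ e → does (MP.≡-dec _≈?_ (f e) (just a))) ≡ fib _≈?_ g a) →
    Σ[ φ ∈ (Fin M → Fin N) ] ((∀ s → f (φ s) ≡ just (g s)) ×
      (∀ s s' → φ s ≡ φ s' → s ≡ s') × (∀ e a → f e ≡ just a → ∃ λ s → φ s ≡ e))
  enumerate {M = zero} f g eq = (λ ()) , (λ ()) , (λ ()) ,
    λ e a h → ⊥-elim (ℕP.<⇒≢ (cnt-pos {p = λ e → does (MP.≡-dec _≈?_ (f e) (just a))} e (dec-true (MP.≡-dec _≈?_ _ _) h)) (sym (eq a)))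
  enumerate {N} {suc M} f g eq = φ , φok , φinj , φsur
    where
    P : (Fin N → Maybe A) → A → Fin N → Bool
    P f a e = does (MP.≡-dec _≈?_ (f e) (just a))
    found : ∃ λ e → P f (g zero) e ≡ true
    found = cnt-find {p = P f (g zero)} (ℕP.≤-trans (ℕP.≤-trans (ℕP.≤-reflexive (cong ⟦_⟧ (sym (dec-true (g zero ≈? g zero) refl)))) (ℕP.m≤m+n _ _)) (ℕP.≤-reflexive (sym (eq (g zero)))))
    e₀ = proj₁ found
    fe₀ : f e₀ ≡ just (g zero)
    fe₀ = does⇒ (MP.≡-dec _≈?_ _ _) (proj₂ found)
    f' = upd f e₀ nothing
    eq' : ∀ a → cnt (P f' a) ≡ fib _≈?_ (g ∘ suc) a
    eq' a with sum-agree (λ e → ⟦ P f a e ⟧) (λ e → ⟦ P f' a e ⟧) e₀ (λ i ne → cong (λ x → ⟦ does (MP.≡-dec _≈?_ x (just a)) ⟧) (sym (upd-ne f e₀ nothing i ne)))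
    ... | ag rewrite upd-eq f e₀ nothing | fe₀ | ℕP.+-identityʳ (cnt (P f a)) =
      ℕP.+-cancelʳ-≡ (⟦ P f a e₀ ⟧) _ _ (trans (cong (λ z → cnt (P f' a) + ⟦ z ⟧) hz) (trans (sym ag) (trans (eq a) (trans (ℕP.+-comm ⟦ does (g zero ≈? a) ⟧ _) (cong (λ z → fib _≈?_ (g ∘ suc) a + ⟦ z ⟧) (sym hz'))))))
      where
      hz' : P f a e₀ ≡ does (g zero ≈? a)
      hz' = trans (cong (λ x → does (MP.≡-dec _≈?_ x (just a))) fe₀) refl
      hz : P f a e₀ ≡ does (MP.≡-dec _≈?_ (just (g zero)) (just a))
      hz = cong (λ x → does (MP.≡-dec _≈?_ x (just a))) fe₀
    ih = enumerate f' (g ∘ suc) eq'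
    φ' = proj₁ ih
    φ'ne : ∀ s → φ' s ≢ e₀
    φ'ne s e with trans (sym (proj₁ (proj₂ ih) s)) (trans (cong f' e) (upd-eq f e₀ nothing))
    ... | ()
    φ : Fin (suc M) → Fin N
    φ = e₀ ◂ φ'
    φok : ∀ s → f (φ s) ≡ just (g s)
    φok zero = fe₀
    φok (suc s) = trans (sym (upd-ne f e₀ nothing (φ' s) (φ'ne s))) (proj₁ (proj₂ ih) s)
    φinj : ∀ s s' → φ s ≡ φ s' → s ≡ s'
    φinj zero zero e = refl
    φinj zero (suc s') e = ⊥-elim (φ'ne s' (sym e))
    φinj (suc s) zero e = ⊥-elim (φ'ne s e)
    φinj (suc s) (suc s') e = cong suc (proj₁ (proj₂ (proj₂ ih)) s s' e)
    φsur : ∀ e a → f e ≡ just a → ∃ λ s → φ s ≡ e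
    φsur e a h with e ≟ e₀
    ... | yes refl = zero , refl
    ... | no ne with proj₂ (proj₂ (proj₂ ih)) e a (trans (upd-ne f e₀ nothing e ne) h)
    ...   | s , es = suc s , es

  -- With `f` the heads and `g` the tails of a balanced orientation, the permutation continues every
  -- arc by one leaving its head: a decomposition into closed trails.
  perm-of-fibres : ∀ {m} (f g : Fin m → A) → (∀ a → fib _≈?_ f a ≡ fib _≈?_ g a) →
                   Σ[ π ∈ Perm m ] (∀ e → g (to π e) ≡ f e)
  perm-of-fibres f g eq with enumerate (just ∘ g) f (λ a → sym (eq a))
  ... | φ , ok , inj , sur = perm φ (λ e → proj₁ (sur e (g e) refl))
          (λ i → inj _ _ (proj₂ (sur (φ i) (g (φ i)) refl))) (λ e → proj₂ (sur e (g e) refl)) ,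
        λ e → MP.just-injective (ok e)

τ : ∀ {k} → Fin k → Fin k → Fin k → Fin k
τ x y i = if does (i ≟ x) then y else (if does (i ≟ y) then x else i)

τ-x : ∀ {k} (x y : Fin k) → τ x y x ≡ y
τ-x x y rewrite eqb-refl x = refl

τ-y : ∀ {k} (x y : Fin k) → τ x y y ≡ x
τ-y x y with y ≟ x
... | yes e = e
... | no _ rewrite eqb-refl y = refl

τ-other : ∀ {k} (x y i : Fin k) → i ≢ x → i ≢ y → τ x y i ≡ i
τ-other x y i nx ny rewrite dec-false (i ≟ x) nx | dec-false (i ≟ y) ny = refl

τ-invol : ∀ {k} (x y i : Fin k) → τ x y (τ x y i) ≡ i
τ-invol x y i = go (i ≟ x) (i ≟ y)
  where
  go : Dec (i ≡ x) → Dec (i ≡ y) → τ x y (τ x y i) ≡ i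
  go (yes refl) _          = trans (cong (τ x y) (τ-x x y)) (τ-y x y)
  go (no _)     (yes refl) = trans (cong (τ x y) (τ-y x y)) (τ-x x y)
  go (no nx)    (no ny)    = trans (cong (τ x y) (τ-other x y i nx ny)) (τ-other x y i nx ny)

τ-key : ∀ {k} {B : Set} (f : Fin k → B) x y → f x ≡ f y → ∀ i → f (τ x y i) ≡ f i
τ-key f x y e i = go (i ≟ x) (i ≟ y)
  where
  go : Dec (i ≡ x) → Dec (i ≡ y) → f (τ x y i) ≡ f i
  go (yes refl) _          = trans (cong f (τ-x x y)) (sym e)
  go (no _)     (yes refl) = trans (cong f (τ-y x y)) e
  go (no nx)    (no ny)    = cong f (τ-other x y i nx ny)

swapP : ∀ {k} → Perm k → Fin k → Fin k → Perm k
swapP π x y = perm (to π ∘ τ x y) (τ x y ∘ from π)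
  (λ i → trans (cong (τ x y) (ft π _)) (τ-invol x y i))
  (λ j → trans (cong (to π) (τ-invol x y _)) (tf π j))

-- Corrects one image after the other, by an exchange with the arc `y` that holds the wanted image.
-- An image corrected earlier is not disturbed, because `nx` is injective where it is defined.
extend-partial : ∀ {m n} (tl hd : Fin m → Fin n) (π : Perm m) → (∀ e → tl (to π e) ≡ hd e) →
  (nx : Fin m → Maybe (Fin m)) → (∀ e e' → nx e ≡ just e' → tl e' ≡ hd e) →
  (∀ e₁ e₂ e' → nx e₁ ≡ just e' → nx e₂ ≡ just e' → e₁ ≡ e₂) →
  Σ[ π' ∈ Perm m ] ((∀ e → tl (to π' e) ≡ hd e) × (∀ e e' → nx e ≡ just e' → to π' e ≡ e'))
extend-partial {m} tl hd π ok nx nxok nxinj with go m ℕP.≤-refl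
  where
  go : ∀ k → k ≤ m → Σ[ π' ∈ Perm m ] ((∀ e → tl (to π' e) ≡ hd e) ×
         (∀ e e' → toℕ e < k → nx e ≡ just e' → to π' e ≡ e'))
  go zero _ = π , ok , λ _ _ ()
  go (suc k) k<m with go k (ℕP.<⇒≤ k<m) | nx (fromℕ< k<m) in eq
  ... | π' , ok' , h | nothing = π' , ok' , λ e e' lt q → case ℕP.m<1+n⇒m<n∨m≡n lt of λ
          { (inj₁ l) → h e e' l q
          ; (inj₂ r) → case trans (sym eq) (trans (cong nx (FP.toℕ-injective (trans (FP.toℕ-fromℕ< k<m) (sym r)))) q) of λ () }
  ... | π' , ok' , h | just z = swapP π' x y , ok'' , h''
    where
    x = fromℕ< k<m
    y = from π' z
    hxy : hd x ≡ hd y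
    hxy = trans (sym (nxok x z eq)) (trans (cong tl (sym (tf π' z))) (ok' y))
    ok'' : ∀ e → tl (to π' (τ x y e)) ≡ hd e
    ok'' e = trans (ok' _) (τ-key hd x y hxy e)
    h'' : ∀ e e' → toℕ e < suc k → nx e ≡ just e' → to π' (τ x y e) ≡ e'
    h'' e e' lt q with e ≟ x
    ... | yes refl = trans (tf π' z) (MP.just-injective (trans (sym eq) q))
    ... | no ne = trans (cong (to π') (lem (e ≟ y))) hold
      where
      hold : to π' e ≡ e'
      hold = h e e' (ℕP.≤∧≢⇒< (ℕP.≤-pred lt) (λ r → ne (FP.toℕ-injective (trans r (sym (FP.toℕ-fromℕ< k<m)))))) q
      ney : e ≢ y
      ney r = ne (nxinj e x z (trans q (cong just (trans (sym hold) (trans (cong (to π') r) (tf π' z))))) eq)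
      lem : Dec (e ≡ y) → (if does (e ≟ y) then x else e) ≡ e
      lem _ rewrite dec-false (e ≟ y) ney = refl
... | π' , ok' , h = π' , ok' , λ e e' → h e e' (FP.toℕ<n e)

-- Reachable sets and the fusion of orbits

anyF : ∀ {n} → (Fin n → Bool) → Bool
anyF p with find? p
... | inj₁ _ = true
... | inj₂ _ = false

anyF-intro : ∀ {n} (p : Fin n → Bool) i → p i ≡ true → anyF p ≡ true
anyF-intro p i h with find? p
... | inj₁ _ = refl
... | inj₂ z = ⊥-elim (t≢f h (z i))

anyF-elim : ∀ {n} (p : Fin n → Bool) → anyF p ≡ true → ∃ λ i → p i ≡ true
anyF-elim p h with find? p
... | inj₁ r = r

find₂? : ∀ {n k} (p : Fin n → Fin k → Bool) → (∃ λ i → ∃ λ j → p i j ≡ true) ⊎ (∀ i j → p i j ≡ false)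
find₂? p with find? (λ i → anyF (p i))
... | inj₁ (i , h) = inj₁ (i , anyF-elim (p i) h)
... | inj₂ z = inj₂ (λ i j → ¬t⇒f (λ e → t≢f (anyF-intro (p i) j e) (z i)))

data Star {n} (E : Fin n → Fin n → Bool) (r : Fin n) : Fin n → Set where
  ε   : Star E r r
  _▸_ : ∀ {v w} → Star E r v → E v w ≡ true → Star E r w

-- Reachability as a Boolean set, so that it can be counted and complemented; the `Star` witnesses
-- express minimality. The fuel bounds the number of vertices not yet in the set.
closure : ∀ {n} (E : Fin n → Fin n → Bool) r → Σ[ C ∈ (Fin n → Bool) ]
  (C r ≡ true × (∀ v w → C v ≡ true → E v w ≡ true → C w ≡ true) × (∀ v → C v ≡ true → Star E r v))
closure {n} E r = go n (eqb r) (eqb-refl r) (λ v h → subst (Star E r) (does⇒ (r ≟ v) h) ε)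
                     (ℕP.m≤m+n n _)
  where
  go : ∀ k (C : Fin n → Bool) → C r ≡ true → (∀ v → C v ≡ true → Star E r v) → n ≤ k + cnt C →
       Σ[ C ∈ (Fin n → Bool) ]
       (C r ≡ true × (∀ v w → C v ≡ true → E v w ≡ true → C w ≡ true) × (∀ v → C v ≡ true → Star E r v))
  go k C cr sd le with find₂? (λ v w → C v ∧ (E v w ∧ not (C w)))
  ... | inj₂ z = C , cr , (λ v w a b → closed v w a b (z v w)) , sd
    where closed : ∀ v w → C v ≡ true → E v w ≡ true → C v ∧ (E v w ∧ not (C w)) ≡ false → C w ≡ true
          closed v w a b q rewrite a | b with C w
          ... | true = refl
  ... | inj₁ (v , w , h) = grow k le
    where
    cv = proj₁ (∧-true {C v} h)
    ev = proj₁ (∧-true {E v w} (proj₂ (∧-true {C v} h)))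
    cw : C w ≡ false
    cw = not-true (proj₂ (∧-true {E v w} (proj₂ (∧-true {C v} h))))
    C' = upd C w true
    sub : ∀ i → C i ≡ true → C' i ≡ true
    sub i ci with i ≟ w
    ... | yes _ = refl
    ... | no _ = ci
    lt : cnt C < cnt C'
    lt = cnt-strict sub w cw (upd-eq C w true)
    sd' : ∀ i → C' i ≡ true → Star E r i
    sd' i ci with i ≟ w
    ... | yes refl = sd v cv ▸ ev
    ... | no _ = sd i ci
    grow : ∀ k → n ≤ k + cnt C → _
    grow zero le = ⊥-elim (ℕP.<⇒≱ lt (ℕP.≤-trans (cnt≤n C') le))
    grow (suc k) le = go k C' (sub r cr) sd' (ℕP.≤-trans le (ℕP.≤-trans (ℕP.≤-reflexive (sym (ℕP.+-suc k _))) (ℕP.+-monoʳ-≤ k lt)))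

-- Otherwise the preimage of `C` would be strictly larger than `C`, against `cnt-perm`.
perm-closed-back : ∀ {k} (π : Perm k) (C : Fin k → Bool) → (∀ i → C i ≡ true → C (to π i) ≡ true) →
                   ∀ i → C (to π i) ≡ true → C i ≡ true
perm-closed-back π C cl i h with C i in eq
... | true = refl
... | false = ⊥-elim (ℕP.<⇒≱ (cnt-strict {p = C} {q = λ i → C (to π i)} cl i eq h)
                             (ℕP.≤-reflexive (cnt-perm π C)))

-- Only the forward closure is taken; `perm-closed-back` makes it closed under inverses.
orbit : ∀ {k} → Perm k → Fin k → Fin k → Bool
orbit π e₀ = proj₁ (closure (λ a b → eqb (to π a) b) e₀)

orbit-base : ∀ {k} (π : Perm k) e₀ → orbit π e₀ e₀ ≡ true
orbit-base π e₀ = proj₁ (proj₂ (closure (λ a b → eqb (to π a) b) e₀))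

orbit-to : ∀ {k} (π : Perm k) e₀ i → orbit π e₀ i ≡ true → orbit π e₀ (to π i) ≡ true
orbit-to π e₀ i h = proj₁ (proj₂ (proj₂ (closure (λ a b → eqb (to π a) b) e₀))) i _ h (eqb-refl (to π i))

orbit-least : ∀ {k} (π : Perm k) e₀ (D : Fin k → Bool) → D e₀ ≡ true →
              (∀ i → D i ≡ true → D (to π i) ≡ true) → ∀ i → orbit π e₀ i ≡ true → D i ≡ true
orbit-least π e₀ D d0 dcl i h = go (proj₂ (proj₂ (proj₂ (closure (λ a b → eqb (to π a) b) e₀))) i h)
  where go : ∀ {i} → Star (λ a b → eqb (to π a) b) e₀ i → D i ≡ true
        go ε = d0
        go {i} (_▸_ {v = v} s e) = trans (cong D (sym (does⇒ (to π v ≟ i) e))) (dcl v (go s))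

-- Exchanging the images of points of two different orbits fuses the orbits.
orbit-swap : ∀ {k} (π : Perm k) e₀ x y → orbit π e₀ x ≡ true → orbit π e₀ y ≡ false →
             cnt (orbit π e₀) < cnt (orbit (swapP π x y) e₀)
orbit-swap {k} π e₀ x y ox oy = cnt-strict (λ i oi → proj₂ (∧-true {O i} (O⊆ i oi))) y oy (yin x∈)
  where
  O = orbit π e₀
  O' = orbit (swapP π x y) e₀
  oto = orbit-to π e₀
  oback = perm-closed-back π O oto
  at-x : to (swapP π x y) x ≡ to π y
  at-x = cong (to π) (τ-x x y)
  at-y : to (swapP π x y) y ≡ to π x
  at-y = cong (to π) (τ-y x y)
  at-o : ∀ i → i ≢ x → i ≢ y → to (swapP π x y) i ≡ to π i
  at-o i a b = cong (to π) (τ-other x y i a b)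
  step' : ∀ i j → O' i ≡ true → to (swapP π x y) i ≡ j → O' j ≡ true
  step' i j h refl = orbit-to (swapP π x y) e₀ i h
  -- If `x` but not `y` were in the new orbit, the part of it outside the old orbit would be closed
  -- under `π` and contain `to π y`, the new image of `x`; going back along `π`, it would contain
  -- `y`.
  yin : O' x ≡ true → O' y ≡ true
  yin xi with O' y in eq
  ... | true = refl
  ... | false = ⊥-elim (t≢f (proj₁ (∧-true {O' y} (perm-closed-back π B Bcl y
                  (∧-intro (step' x _ xi at-x) (cong not (¬t⇒f (λ h → t≢f (oback y h) oy))))))) eq)
    where
    B : Fin k → Bool
    B i = O' i ∧ not (O i)
    Bcl : ∀ i → B i ≡ true → B (to π i) ≡ true
    Bcl i h = ∧-intro (step' i _ (proj₁ (∧-true {O' i} h)) (at-o i nx ny)) (cong not (¬t⇒f (λ q → t≢f (oback i q) oi)))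
      where oi = not-true (proj₂ (∧-true {O' i} h))
            nx : i ≢ x
            nx refl = t≢f ox oi
            ny : i ≢ y
            ny refl = t≢f (proj₁ (∧-true {O' i} h)) eq
  ny : ∀ i → O i ≡ true → i ≢ y
  ny i oi refl = t≢f oi oy
  D : Fin k → Bool
  D i = O i ∧ O' i
  D-off : ∀ i → D i ≡ true → i ≢ x → D (to π i) ≡ true
  D-off i h nx = ∧-intro (oto i (proj₁ (∧-true {O i} h)))
                   (step' i _ (proj₂ (∧-true {O i} h)) (at-o i nx (ny i (proj₁ (∧-true {O i} h)))))
  D0 : D e₀ ≡ true
  D0 = ∧-intro (orbit-base π e₀) (orbit-base (swapP π x y) e₀)
  x∈ : O' x ≡ true
  x∈ with O' x in eq
  ... | true = refl
  ... | false = ⊥-elim (t≢f (proj₂ (∧-true {O x} (orbit-least π e₀ D D0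
                  (λ i h → D-off i h (λ { refl → t≢f (proj₂ (∧-true {O i} h)) eq })) x ox))) eq)
  O⊆ : ∀ i → O i ≡ true → D i ≡ true
  O⊆ = orbit-least π e₀ D D0 Dcl
    where
    Dcl : ∀ i → D i ≡ true → D (to π i) ≡ true
    Dcl i h with i ≟ x
    ... | no nx = D-off i h nx
    ... | yes refl = ∧-intro (oto x ox) (step' y _ (yin x∈) at-y)

-- Each exchange enlarges the orbit of `e₀`, so at most `m` are made. The hypothesis may answer with
-- a pair other than the one found, since exchanging the given pair may violate `Inv` where another
-- pair does not.
merge-orbits : ∀ {m n} (Inv : Perm m → Set) (e₀ : Fin m) (J : Fin m → Bool) (key : Fin m → Fin n) →
  (∀ π → Inv π → (O : Fin m → Bool) → ∀ x y → O x ≡ true → O y ≡ false → J x ≡ true → J y ≡ true →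
     key x ≡ key y → ∃ λ x' → ∃ λ y' → O x' ≡ true × O y' ≡ false × Inv (swapP π x' y')) →
  ∀ π → Inv π → Σ[ π' ∈ Perm m ] (Inv π' × (∀ x y → J x ≡ true → J y ≡ true → key x ≡ key y →
     orbit π' e₀ x ≡ true → orbit π' e₀ y ≡ true))
merge-orbits {m} Inv e₀ J key sw π inv = go m π inv (ℕP.m≤m+n m _)
  where
  go : ∀ k π → Inv π → m ≤ k + cnt (orbit π e₀) → _
  go k π inv le with find₂? (λ x y → (orbit π e₀ x ∧ not (orbit π e₀ y)) ∧ ((J x ∧ J y) ∧ eqb (key x) (key y)))
  ... | inj₂ z = π , inv , λ x y jx jy kxy ox → cl x y jx jy kxy ox (z x y)
    where cl : ∀ x y → J x ≡ true → J y ≡ true → key x ≡ key y → orbit π e₀ x ≡ true →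
               (orbit π e₀ x ∧ not (orbit π e₀ y)) ∧ ((J x ∧ J y) ∧ eqb (key x) (key y)) ≡ false → orbit π e₀ y ≡ true
          cl x y jx jy kxy ox q rewrite jx | jy | ox | dec-true (key x ≟ key y) kxy with orbit π e₀ y
          ... | true = refl
  ... | inj₁ (x , y , h) = grow k le
    where
    a = ∧-true {orbit π e₀ x ∧ not (orbit π e₀ y)} h
    b = ∧-true {orbit π e₀ x} (proj₁ a)
    c = ∧-true {J x ∧ J y} (proj₂ a)
    d = ∧-true {J x} (proj₁ c)
    r = sw π inv (orbit π e₀) x y (proj₁ b) (not-true (proj₂ b)) (proj₁ d) (proj₂ d) (does⇒ (_ ≟ _) (proj₂ c))
    π' = swapP π (proj₁ r) (proj₁ (proj₂ r))
    lt : cnt (orbit π e₀) < cnt (orbit π' e₀)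
    lt = orbit-swap π e₀ _ _ (proj₁ (proj₂ (proj₂ r))) (proj₁ (proj₂ (proj₂ (proj₂ r))))
    grow : ∀ k → m ≤ k + cnt (orbit π e₀) → _
    grow zero le = ⊥-elim (ℕP.<⇒≱ lt (ℕP.≤-trans (cnt≤n (orbit π' e₀)) le))
    grow (suc k) le = go k π' (proj₂ (proj₂ (proj₂ (proj₂ r))))
      (ℕP.≤-trans le (ℕP.≤-trans (ℕP.≤-reflexive (sym (ℕP.+-suc k _))) (ℕP.+-monoʳ-≤ k lt)))

-- The cyclic sequence given by a single orbit

iter : ∀ {m} → Perm m → ℕ → Fin m → Fin m
iter π zero    e = e
iter π (suc k) e = to π (iter π k e)

iter-+ : ∀ {m} (π : Perm m) a b e → iter π (a + b) e ≡ iter π a (iter π b e)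
iter-+ π zero    b e = refl
iter-+ π (suc a) b e = cong (to π) (iter-+ π a b e)

iter-inj : ∀ {m} (π : Perm m) a {e f} → iter π a e ≡ iter π a f → e ≡ f
iter-inj π zero    h = h
iter-inj π (suc a) h = iter-inj π a (to-inj π h)

module SingleOrbit {m'} (π : Perm (suc m')) (e₀ : Fin (suc m')) (all : ∀ e → orbit π e₀ e ≡ true) where
  private m₁ = suc m'

  hits : ∀ e → ∃ λ k → iter π k e₀ ≡ e
  hits e = go (proj₂ (proj₂ (proj₂ (closure (λ a b → eqb (to π a) b) e₀))) e (all e))
    where go : ∀ {i} → Star (λ a b → eqb (to π a) b) e₀ i → ∃ λ k → iter π k e₀ ≡ i
          go ε = 0 , refl
          go {i} (_▸_ {v = v} s e) with go s
          ... | k , h = suc k , trans (cong (to π) h) (does⇒ (to π v ≟ i) e)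

  iter-mul : ∀ p → iter π p e₀ ≡ e₀ → ∀ q → iter π (q * p) e₀ ≡ e₀
  iter-mul p h zero    = refl
  iter-mul p h (suc q) = trans (iter-+ π p (q * p) e₀) (trans (cong (iter π p) (iter-mul p h q)) h)

  iter-% : ∀ p .{{_ : NonZero p}} → iter π p e₀ ≡ e₀ → ∀ k → iter π (k DM.% p) e₀ ≡ iter π k e₀
  iter-% p h k = sym (trans (cong (λ z → iter π z e₀) (DM.m≡m%n+[m/n]*n k p))
    (trans (iter-+ π (k DM.% p) _ e₀) (cong (iter π (k DM.% p)) (iter-mul p h (k DM./ p)))))

  -- Every element is reached within one period, so a period is at least as long as the whole set.
  period-big : ∀ p → iter π (suc p) e₀ ≡ e₀ → m₁ ≤ suc p
  period-big p h = FP.injective⇒≤ {f = f} inj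
    where
    f : Fin m₁ → Fin (suc p)
    f e = fromℕ< (DM.m%n<n (proj₁ (hits e)) (suc p))
    fe : ∀ e → iter π (toℕ (f e)) e₀ ≡ e
    fe e = trans (cong (λ z → iter π z e₀) (FP.toℕ-fromℕ< (DM.m%n<n (proj₁ (hits e)) (suc p))))
                 (trans (iter-% (suc p) h (proj₁ (hits e))) (proj₂ (hits e)))
    inj : ∀ {e e'} → f e ≡ f e' → e ≡ e'
    inj {e} {e'} q = trans (sym (fe e)) (trans (cong (λ z → iter π (toℕ z) e₀) q) (fe e'))

  repeat : ∀ i j → i < j → iter π i e₀ ≡ iter π j e₀ → i + m₁ ≤ j
  repeat i j lt h with ℕP.m≤n⇒∃[o]m+o≡n lt
  ... | p , refl = ℕP.≤-trans (ℕP.+-monoʳ-≤ i (period-big p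
          (iter-inj π i (trans (sym (iter-+ π i (suc p) e₀)) (trans (cong (λ z → iter π z e₀) (ℕP.+-suc i p)) (sym h))))))
          (ℕP.≤-reflexive (ℕP.+-suc i p))

  -- Among `suc m₁` iterates two coincide; by `repeat` they are at least `m₁` apart, hence exactly
  -- `m₁`.
  period : iter π m₁ e₀ ≡ e₀
  period with FP.pigeonhole (ℕP.n<1+n m₁) (λ (i : Fin (suc m₁)) → iter π (toℕ i) e₀)
  ... | i , j , lt , h = iter-inj π (toℕ i) (trans (sym (iter-+ π (toℕ i) m₁ e₀))
          (trans (cong (λ z → iter π z e₀) (ℕP.≤-antisym (repeat _ _ lt h) le)) (sym h)))
    where le : toℕ j ≤ toℕ i + m₁
          le = ℕP.≤-trans (ℕP.≤-pred (FP.toℕ<n j)) (ℕP.m≤n+m m₁ (toℕ i))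

  seqF : Fin m₁ → Fin m₁
  seqF i = iter π (toℕ i) e₀

  seqF-inj : ∀ {i j} → seqF i ≡ seqF j → i ≡ j
  seqF-inj {i} {j} h with ℕP.<-cmp (toℕ i) (toℕ j)
  ... | tri< lt _ _ = ⊥-elim (ℕP.<⇒≱ (FP.toℕ<n j) (ℕP.≤-trans (ℕP.m≤n+m m₁ (toℕ i)) (repeat _ _ lt h)))
  ... | tri≈ _ e _ = FP.toℕ-injective e
  ... | tri> _ _ gt = ⊥-elim (ℕP.<⇒≱ (FP.toℕ<n i) (ℕP.≤-trans (ℕP.m≤n+m m₁ (toℕ j)) (repeat _ _ gt (sym h))))

  seqF-cyc : ∀ i k → seqF (cyc i k) ≡ iter π (toℕ i + k) e₀
  seqF-cyc i k = trans (cong (λ z → iter π z e₀) (FP.toℕ-fromℕ< (DM.m%n<n (toℕ i + k) m₁))) (iter-% m₁ period (toℕ i + k))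

  seqF-sur : ∀ e → ∃ λ i → seqF i ≡ e
  seqF-sur e = cyc zero (proj₁ (hits e)) , trans (seqF-cyc zero (proj₁ (hits e))) (proj₂ (hits e))

-- Exchanging transitions

pos : ℕ → Bool
pos zero    = false
pos (suc _) = true

-- A permutation π with tl (π e) = hd e is a system of closed trails.  The
-- transitions e → π₀ e with fx e are frozen, the others may be exchanged at a
-- common vertex.  hitF k z Y over-approximates, independently of the exchangeable
-- transitions, whether the S-walk of at most k arcs from z enters Y: reaching an
-- exchangeable transition too early counts as a hit.  hitB is its mirror image.
module Junction {m n : ℕ} (tl hd : Fin m → Fin n) (S : Fin m → Bool) (ℓ : ℕ)
                (π₀ : Perm m) (fx : Fin m → Bool) where

  -- The index counts transitions, so a walk of index `j` has `suc j` arcs. `FW` differs from `Wk`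
  -- in using frozen transitions only.
  data Wk (π : Perm m) : ℕ → Fin m → Fin m → Set where
    one  : ∀ {a} → S a ≡ true → Wk π 0 a a
    cons : ∀ {j a b} → S a ≡ true → Wk π j (to π a) b → Wk π (suc j) a b

  data FW : ℕ → Fin m → Fin m → Set where
    one  : ∀ {a} → S a ≡ true → FW 0 a a
    cons : ∀ {j a b} → S a ≡ true → fx a ≡ true → FW j (to π₀ a) b → FW (suc j) a b

  -- No walk of at most `k` arcs of `S` closes up. This suffices for paths: two equal vertices on a
  -- walk bound a closed part of it.
  Good : ℕ → Perm m → Set
  Good k π = ∀ j a b → j < k → Wk π j a b → hd b ≢ tl a

  Ext : Perm m → Set
  Ext π = (∀ e → tl (to π e) ≡ hd e) × (∀ e → fx e ≡ true → to π e ≡ to π₀ e)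

  hitF : ℕ → Fin m → (Fin n → Bool) → Bool
  hitF zero    z Y = false
  hitF (suc k) z Y = S z ∧ (Y (hd z) ∨ (if fx z then hitF k (to π₀ z) Y else pos k))

  hitB : ℕ → Fin m → (Fin n → Bool) → Bool
  hitB zero    x Y = false
  hitB (suc k) x Y = S x ∧ (Y (tl x) ∨ (if fx (from π₀ x) then hitB k (from π₀ x) Y else pos k))

  jout : Fin m → Bool
  jout z = not (fx (from π₀ z))

  jin : Fin m → Fin n → Bool
  jin x v = not (fx x) ∧ eqb (hd x) v

  -- The true reach under the present `π`, which `hitF` and `hitB` over-approximate. Having at most
  -- `k` elements, `Fb` and `Bb` also serve as the sets `Y` to be avoided.
  Fb : Perm m → ℕ → Fin m → Fin n → Bool
  Fb π zero    z v = false
  Fb π (suc k) z v = S z ∧ (eqb (hd z) v ∨ Fb π k (to π z) v)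

  Bb : Perm m → ℕ → Fin m → Fin n → Bool
  Bb π zero    x v = false
  Bb π (suc k) x v = S x ∧ (eqb (tl x) v ∨ Bb π k (from π x) v)

  wk-S : ∀ {π j a b} → Wk π j a b → S a ≡ true
  wk-S (one s)    = s
  wk-S (cons s _) = s

  Fb-intro : ∀ {π j z b} → Wk π j z b → ∀ k → j < k → Fb π k z (hd b) ≡ true
  Fb-intro {z = z} (one s) (suc k) _ = ∧-intro s (∨-introˡ (eqb-refl (hd z)))
  Fb-intro {z = z} {b} (cons s w) (suc k) (s≤s lt) = ∧-intro s (∨-introʳ {eqb (hd z) (hd b)} (Fb-intro w k lt))

  Bb-mono : ∀ π k k' x v → k ≤ k' → Bb π k x v ≡ true → Bb π k' x v ≡ true
  Bb-mono π (suc k) (suc k') x v (s≤s le) h with ∧-true {S x} h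
  ... | s , h' with ∨-true {eqb (tl x) v} h'
  ...   | inj₁ e = ∧-intro s (∨-introˡ e)
  ...   | inj₂ r = ∧-intro s (∨-introʳ {eqb (tl x) v} (Bb-mono π k k' (from π x) v le r))

  Bb-back : ∀ {π j a x v} → Wk π j a x → ∀ k → Bb π k a v ≡ true → Bb π (j + k) x v ≡ true
  Bb-back (one _) k h = h
  Bb-back {π} {suc j} {a} {x} {v} (cons s w) k h =
    subst (λ z → Bb π z x v ≡ true) (ℕP.+-suc j k)
      (Bb-back w (suc k) (∧-intro (wk-S w) (∨-introʳ {eqb (tl (to π a)) v}
        (subst (λ z → Bb π k z v ≡ true) (sym (ft π a)) h))))

  Bb-intro : ∀ {π j a x} → Wk π j a x → ∀ k → j < k → Bb π k x (tl a) ≡ true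
  Bb-intro {π} {j} {a} {x} w k lt =
    Bb-mono π (j + 1) k x (tl a) (ℕP.≤-trans (ℕP.≤-reflexive (ℕP.+-comm j 1)) lt)
      (Bb-back w 1 (∧-intro (wk-S w) (∨-introˡ (eqb-refl (tl a)))))

  Fb-size : ∀ π k z → cnt (Fb π k z) ≤ k
  Fb-size π zero    z = ℕP.≤-reflexive (cnt-zero {n} (λ _ → refl))
  Fb-size π (suc k) z = ℕP.≤-trans (cnt-mono {q = λ v → eqb (hd z) v ∨ Fb π k (to π z) v} (λ v h → proj₂ (∧-true {S z} h)))
    (ℕP.≤-trans (cnt-∨ (eqb (hd z)) (Fb π k (to π z))) (ℕP.+-mono-≤ (cnt-eqb≤1 (hd z)) (Fb-size π k (to π z))))

  Bb-size : ∀ π k x → cnt (Bb π k x) ≤ k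
  Bb-size π zero    x = ℕP.≤-reflexive (cnt-zero {n} (λ _ → refl))
  Bb-size π (suc k) x = ℕP.≤-trans (cnt-mono {q = λ v → eqb (tl x) v ∨ Bb π k (from π x) v} (λ v h → proj₂ (∧-true {S x} h)))
    (ℕP.≤-trans (cnt-∨ (eqb (tl x)) (Bb π k (from π x))) (ℕP.+-mono-≤ (cnt-eqb≤1 (tl x)) (Bb-size π k (from π x))))

  -- On frozen transitions `π` and `π₀` agree. At the first exchangeable one `hitF` already reports
  -- a hit if an arc of the walk is left, whatever `π` does there.
  hitF-intro : ∀ π → Ext π → ∀ k k' → k ≤ k' → ∀ z v Y → Y v ≡ true → Fb π k z v ≡ true → hitF k' z Y ≡ true
  hitF-intro π ex (suc k) (suc k') (s≤s le) z v Y yv h with ∧-true {S z} h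
  ... | s , h' with ∨-true {eqb (hd z) v} h'
  ...   | inj₁ e = ∧-intro s (∨-introˡ (trans (cong Y (does⇒ (hd z ≟ v) e)) yv))
  ...   | inj₂ r = ∧-intro s (∨-introʳ {Y (hd z)} go)
    where
    go : (if fx z then hitF k' (to π₀ z) Y else pos k') ≡ true
    go with fx z in eq
    ... | true = hitF-intro π ex k k' le (to π₀ z) v Y yv (subst (λ w → Fb π k w v ≡ true) (proj₂ ex z eq) r)
    ... | false = F-pos k k' le (to π z) r
      where F-pos : ∀ k k' → k ≤ k' → ∀ w → Fb π k w v ≡ true → pos k' ≡ true
            F-pos (suc _) (suc _) _ _ _ = refl

  from-fixed : ∀ π → Ext π → ∀ x → fx (from π₀ x) ≡ true → from π x ≡ from π₀ x
  from-fixed π ex x h = to-inj π (trans (tf π x) (sym (trans (proj₂ ex _ h) (tf π₀ x))))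

  fixed-from : ∀ π → Ext π → ∀ x → fx (from π₀ (to π x)) ≡ true → fx x ≡ true
  fixed-from π ex x h = subst (λ w → fx w ≡ true) (trans (sym (from-fixed π ex (to π x) h)) (ft π x)) h

  hitB-intro : ∀ π → Ext π → ∀ k k' → k ≤ k' → ∀ x v Y → Y v ≡ true → Bb π k x v ≡ true → hitB k' x Y ≡ true
  hitB-intro π ex (suc k) (suc k') (s≤s le) x v Y yv h with ∧-true {S x} h
  ... | s , h' with ∨-true {eqb (tl x) v} h'
  ...   | inj₁ e = ∧-intro s (∨-introˡ (trans (cong Y (does⇒ (tl x ≟ v) e)) yv))
  ...   | inj₂ r = ∧-intro s (∨-introʳ {Y (tl x)} go)
    where
    go : (if fx (from π₀ x) then hitB k' (from π₀ x) Y else pos k') ≡ true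
    go with fx (from π₀ x) in eq
    ... | true = hitB-intro π ex k k' le (from π₀ x) v Y yv (subst (λ w → Bb π k w v ≡ true) (from-fixed π ex x eq) r)
    ... | false = B-pos k k' le (from π x) r
      where B-pos : ∀ k k' → k ≤ k' → ∀ w → Bb π k w v ≡ true → pos k' ≡ true
            B-pos (suc _) (suc _) _ _ _ = refl

  -- Guarantees that a transition from `x` to `z` closes no walk made of at most `k` arcs up to `x`
  -- and at most `k` arcs from `z` on.
  NoConf : Perm m → ℕ → Fin m → Fin m → Set
  NoConf π k x z = ∀ v → Bb π k x v ≡ true → Fb π k z v ≡ true → ⊥

  good-iter : ∀ {k π} → Good k π → ∀ j a → j < k → (∀ i → i ≤ j → S (iter π i a) ≡ true) → hd (iter π j a) ≢ tl a
  good-iter {k} {π} good j a lt s = good j a (iter π j a) lt (walk j a s)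
    where
    walk : ∀ j a → (∀ i → i ≤ j → S (iter π i a) ≡ true) → Wk π j a (iter π j a)
    walk zero a s = one (s 0 z≤n)
    walk (suc j) a s = cons (s 0 z≤n) (subst (Wk π j (to π a)) (shift j) (walk j (to π a)
        (λ i le → trans (cong S (shift i)) (s (suc i) (s≤s le)))))
      where
      shift : ∀ i → iter π i (to π a) ≡ iter π (suc i) a
      shift zero = refl
      shift (suc i) = cong (to π) (shift i)

  module Swap (π : Perm m) (ex : Ext π) (k : ℕ) (good : Good k π) (x y : Fin m)
              (jx : fx x ≡ false) (jy : fx y ≡ false) (hxy : hd x ≡ hd y)
              (nc₁ : NoConf π k x (to π y)) (nc₂ : NoConf π k y (to π x)) where

    π' = swapP π x y

    ext' : Ext π'
    ext' = (λ e → trans (proj₁ ex _) (τ-key hd x y hxy e)) ,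
           λ e h → trans (cong (to π) (τ-other x y e (λ { refl → t≢f h jx }) (λ { refl → t≢f h jy }))) (proj₂ ex e h)

    data AW : ℕ → Fin m → Fin m → Set where
      one  : ∀ {a} → S a ≡ true → AW 0 a a
      cons : ∀ {j a b} → S a ≡ true → a ≢ x → a ≢ y → AW j (to π a) b → AW (suc j) a b

    aw⇒wk : ∀ {j a b} → AW j a b → Wk π j a b
    aw⇒wk (one s) = one s
    aw⇒wk (cons s _ _ w) = cons s (aw⇒wk w)

    Broken : ℕ → Fin m → Fin m → Set
    Broken j a b = ∃ λ i → ∃ λ i' → ∃ λ c → (c ≡ x ⊎ c ≡ y) × AW i a c × Wk π' i' (to π' c) b × j ≡ i + suc i'

    split : ∀ {j a b} → Wk π' j a b → AW j a b ⊎ Broken j a b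
    split (one s) = inj₁ (one s)
    split {suc j} {a} (cons s w) = go (a ≟ x) (a ≟ y)
      where
      go : Dec (a ≡ x) → Dec (a ≡ y) → _
      go (yes e) _ = inj₂ (0 , j , a , inj₁ e , one s , w , refl)
      go (no _) (yes e) = inj₂ (0 , j , a , inj₂ e , one s , w , refl)
      go (no nx) (no ny) with split w
      ... | inj₁ aw = inj₁ (cons s nx ny (subst (λ z → AW j z _) (cong (to π) (τ-other x y a nx ny)) aw))
      ... | inj₂ (i , i' , c , cc , aw , w' , e) = inj₂ (suc i , i' , c , cc ,
              cons s nx ny (subst (λ z → AW i z c) (cong (to π) (τ-other x y a nx ny)) aw) , w' , cong suc e)

    -- Behind an exchanged transition the walk leaves the vertex hd x, to which a
    -- short S-walk cannot return; so no second exchanged transition is met.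
    side : ∀ {i i' a b} u w → hd u ≡ hd w → (∀ c → c ≡ x ⊎ c ≡ y → hd c ≡ hd w) → NoConf π k u (to π w) →
           i < k → i' < k → AW i a u → Wk π' i' (to π w) b → hd b ≢ tl a
    side {i} {i'} {a} {b} u w huw hc nc li li' aw wk cl with split wk
    ... | inj₁ aw' = nc (tl a) (Bb-intro (aw⇒wk aw) k li)
                       (subst (λ v → Fb π k (to π w) v ≡ true) cl (Fb-intro (aw⇒wk aw') k li'))
    ... | inj₂ (i₂ , i₃ , c , cc , aw' , _ , e) =
          good i₂ (to π w) c (ℕP.≤-<-trans (ℕP.≤-trans (ℕP.m≤m+n i₂ (suc i₃)) (ℕP.≤-reflexive (sym e))) li')
               (aw⇒wk aw') (trans (hc c cc) (sym (proj₁ ex w)))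

    -- Here `j` may equal `k`: the parts before and behind an exchanged transition still have at
    -- most `k` arcs each. So an exchange creates no closed walks of `suc k` arcs either, which lets
    -- their number drop in `improve`.
    closed⇒avoids : ∀ {j a b} → j < suc k → Wk π' j a b → hd b ≡ tl a → AW j a b
    closed⇒avoids {j} {a} {b} lt w cl with split w
    ... | inj₁ aw = aw
    ... | inj₂ (i , i' , c , cc , aw , w' , e) = ⊥-elim (go cc)
      where
      le : i + suc i' ≤ k
      le = ℕP.≤-trans (ℕP.≤-reflexive (sym e)) (ℕP.≤-pred lt)
      li : i < k
      li = ℕP.≤-trans (ℕP.≤-trans (ℕP.m≤m+n (suc i) i') (ℕP.≤-reflexive (sym (ℕP.+-suc i i')))) le
      li' : i' < k
      li' = ℕP.≤-trans (ℕP.m≤n+m (suc i') i) le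
      go : c ≡ x ⊎ c ≡ y → ⊥
      go (inj₁ refl) = side x y hxy (λ { c (inj₁ refl) → hxy ; c (inj₂ refl) → refl }) nc₁ li li' aw
                         (subst (λ z → Wk π' i' z b) (cong (to π) (τ-x x y)) w') cl
      go (inj₂ refl) = side y x (sym hxy) (λ { c (inj₁ refl) → refl ; c (inj₂ refl) → sym hxy }) nc₂ li li' aw
                         (subst (λ z → Wk π' i' z b) (cong (to π) (τ-y x y)) w') cl

    good' : Good k π'
    good' j a b lt w cl = good j a b lt (aw⇒wk (closed⇒avoids (ℕP.m≤n⇒m≤1+n lt) w cl)) cl

    aw-avoids : ∀ {i j a b c} → i < j → AW j a b → Wk π i a c → c ≢ x
    aw-avoids (s≤s _)  (cons _ nx _ _) (one _)    = nx
    aw-avoids (s≤s lt) (cons _ _ _ w)  (cons _ v) = aw-avoids lt w v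

  module Main
    (TG : ∀ j a b → j < ℓ → FW j a b → hd b ≢ tl a)
    (cf : Fin n → ℕ)
    (HF : ∀ v Y → cnt Y ≤ ℓ → cnt (λ z → (jout z ∧ eqb (tl z) v) ∧ hitF ℓ z Y) ≤ cf v)
    (HB : ∀ v Y → cnt Y ≤ ℓ → cnt (λ x → jin x v ∧ hitB ℓ x Y) ≤ cf v)
    -- Of two complementary sets of exchangeable arcs at `v`, the larger one then has more than
    -- `2 * cf v` members, as `safe` demands.
    (big : ∀ v → 4 * cf v + 2 ≤ cnt (λ x → jin x v)) where

    -- The sets `Bb π k x` and `Fb π k (to π x)` do not depend on the partner `y`. By `HF` at most
    -- `cf v` partners lead forwards into the first one, and by `HB` at most `cf v` come from the
    -- second.
    safe : ∀ π → Ext π → ∀ k → k ≤ ℓ → ∀ x v → hd x ≡ v → (P : Fin m → Bool) → (∀ y → P y ≡ true → jin y v ≡ true) →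
           2 * cf v < cnt P → ∃ λ y → P y ≡ true × NoConf π k x (to π y) × NoConf π k y (to π x)
    safe π ex k le x v hx P Psub lt with cnt-pick P (λ y → (jin y v ∧ hitF ℓ (to π y) (Bb π k x)) ∨ (jin y v ∧ hitB ℓ y (Fb π k (to π x)))) (ℕP.≤-<-trans bound lt)
      where
      bound : _ ≤ 2 * cf v
      bound = ℕP.≤-trans (cnt-∨ (λ y → jin y v ∧ hitF ℓ (to π y) (Bb π k x)) (λ y → jin y v ∧ hitB ℓ y (Fb π k (to π x))))
        (ℕP.≤-trans (ℕP.+-mono-≤
          (ℕP.≤-trans (cnt-inj {p = λ y → jin y v ∧ hitF ℓ (to π y) (Bb π k x)}
                               {q = λ z → (jout z ∧ eqb (tl z) v) ∧ hitF ℓ z (Bb π k x)} (to π) (λ y h → out y h) (λ _ _ _ _ e → to-inj π e))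
                      (HF v (Bb π k x) (ℕP.≤-trans (Bb-size π k x) le)))
          (HB v (Fb π k (to π x)) (ℕP.≤-trans (Fb-size π k (to π x)) le)))
          (ℕP.≤-reflexive (sym (cong (cf v +_) (ℕP.+-identityʳ (cf v))))))
        where
        out : ∀ y → jin y v ∧ hitF ℓ (to π y) (Bb π k x) ≡ true →
              (jout (to π y) ∧ eqb (tl (to π y)) v) ∧ hitF ℓ (to π y) (Bb π k x) ≡ true
        out y h with ∧-true {jin y v} h
        ... | j , hf with ∧-true {not (fx y)} j
        ...   | nf , hv = ∧-intro (∧-intro (cong not (¬t⇒f (λ q → t≢f (fixed-from π ex y q) (not-true nf))))
                            (trans (cong (λ u → eqb u v) (proj₁ ex y)) hv)) hf
    ... | y , py , no' = y , py ,
          (λ w bw fw → t≢f (∨-introˡ (∧-intro (Psub y py) (hitF-intro π ex k ℓ le (to π y) w (Bb π k x) bw fw))) no') ,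
          (λ w bw fw → t≢f (∨-introʳ {jin y v ∧ hitF ℓ (to π y) (Bb π k x)} (∧-intro (Psub y py) (hitB-intro π ex k ℓ le y w (Fb π k (to π x)) fw bw))) no')

    cw : Perm m → ℕ → Fin m → Fin n → Bool
    cw π zero    a v = S a ∧ eqb (hd a) v
    cw π (suc j) a v = S a ∧ cw π j (to π a) v

    cw⇒ : ∀ π j a v → cw π j a v ≡ true → ∃ λ b → Wk π j a b × hd b ≡ v
    cw⇒ π zero a v h with ∧-true {S a} h
    ... | s , e = a , one s , does⇒ (hd a ≟ v) e
    cw⇒ π (suc j) a v h with ∧-true {S a} h
    ... | s , r with cw⇒ π j (to π a) v r
    ...   | b , w , e = b , cons s w , e

    ⇒cw : ∀ π j a b v → Wk π j a b → hd b ≡ v → cw π j a v ≡ true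
    ⇒cw π zero a b v (one s) refl = ∧-intro s (eqb-refl (hd a))
    ⇒cw π (suc j) a b v (cons s w) e = ∧-intro s (⇒cw π j (to π a) b v w e)

    free-transition : ∀ π → Ext π → ∀ {j a b} → Wk π j a b → FW j a b ⊎
      (∃ λ i → ∃ λ i' → ∃ λ c → fx c ≡ false × Wk π i a c × j ≡ i + suc i')
    free-transition π ex (one s) = inj₁ (one s)
    free-transition π ex {suc j} {a} (cons s w) with fx a in eq
    ... | false = inj₂ (0 , j , a , eq , one s , refl)
    ... | true with free-transition π ex w
    ...   | inj₁ f = inj₁ (cons s eq (subst (λ z → FW j z _) (proj₂ ex a eq) f))
    ...   | inj₂ (i , i' , c , jc , w' , e) = inj₂ (suc i , i' , c , jc , cons s w' , cong suc e)

    -- Induction on the number of arcs at which a closed walk of exactly `suc k` arcs begins. By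
    -- `TG` such a walk uses an exchangeable transition, at `x` say. After a safe exchange there,
    -- this walk is gone, and the closed walks of this length that remain were there before.
    improve : ∀ k → k < ℓ → ∀ fuel π → Ext π → Good k π → cnt (λ e → cw π k e (tl e)) ≤ fuel →
              Σ[ π' ∈ Perm m ] (Ext π' × Good (suc k) π')
    improve k lt fuel π ex good le with find? (λ e → cw π k e (tl e))
    ... | inj₂ none = π , ex , good'
      where good' : Good (suc k) π
            good' j a b lj w cl with ℕP.m<1+n⇒m<n∨m≡n lj
            ... | inj₁ l = good j a b l w cl
            ... | inj₂ refl = t≢f (⇒cw π j a b (tl a) w cl) (none a)
    ... | inj₁ (e , bad) with cw⇒ π k e (tl e) bad
    ...   | b , w , cl with free-transition π ex w
    ...     | inj₁ f = ⊥-elim (TG k e b lt f cl)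
    ...     | inj₂ (i , i' , x , jx , wx , eq) = again fuel le
      where
      v = hd x
      P : Fin m → Bool
      P y = jin y v ∧ not (eqb y x)
      bigP : 2 * cf v < cnt P
      bigP = ℕP.+-cancelˡ-≤ 1 _ _ (ℕP.≤-trans (ℕP.≤-trans (ar (cf v)) (big v))
               (ℕP.≤-trans (ℕP.≤-reflexive (cnt-split (λ y → jin y v) (λ y → eqb y x)))
                 (ℕP.+-monoˡ-≤ (cnt P) (cnt-unique (λ y → jin y v ∧ eqb y x) (λ y y' h h' →
                   trans (does⇒ (y ≟ x) (proj₂ (∧-true {jin y v} h))) (sym (does⇒ (y' ≟ x) (proj₂ (∧-true {jin y' v} h')))))))))
        where ar : ∀ c → suc (suc (2 * c)) ≤ 4 * c + 2
              ar c = ℕP.≤-trans (ℕP.≤-reflexive (l c)) (ℕP.+-monoˡ-≤ 2 (ℕP.*-monoˡ-≤ c {2} {4} (s≤s (s≤s z≤n))))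
                where l : ∀ c → suc (suc (2 * c)) ≡ 2 * c + 2
                      l = solve-∀
      sf = safe π ex k (ℕP.<⇒≤ lt) x v refl P (λ y h → proj₁ (∧-true {jin y v} h)) bigP
      y = proj₁ sf
      jy = ∧-true {not (fx y)} (proj₁ (∧-true {jin y v} (proj₁ (proj₂ sf))))
      module W = Swap π ex k good x y jx (not-true (proj₁ jy)) (sym (does⇒ (hd y ≟ v) (proj₂ jy)))
                      (proj₁ (proj₂ (proj₂ sf))) (proj₂ (proj₂ (proj₂ sf)))
      fewer : cnt (λ e → cw W.π' k e (tl e)) < cnt (λ e → cw π k e (tl e))
      fewer = cnt-strict {p = λ e → cw W.π' k e (tl e)} {q = λ e → cw π k e (tl e)} sub e gone bad
        where
        sub : ∀ a → cw W.π' k a (tl a) ≡ true → cw π k a (tl a) ≡ true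
        sub a h = ⇒cw π k a (proj₁ r) (tl a) (W.aw⇒wk (W.closed⇒avoids (ℕP.n<1+n k) (proj₁ (proj₂ r)) (proj₂ (proj₂ r)))) (proj₂ (proj₂ r))
          where r = cw⇒ W.π' k a (tl a) h
        gone : cw W.π' k e (tl e) ≡ false
        gone = ¬t⇒f (λ h → case cw⇒ W.π' k e (tl e) h of λ
          { (b' , w' , c') → W.aw-avoids (ℕP.≤-trans (ℕP.m<m+n i (s≤s z≤n)) (ℕP.≤-reflexive (sym eq)))
              (W.closed⇒avoids (ℕP.n<1+n k) w' c') wx refl })
      again : ∀ fuel → cnt (λ e → cw π k e (tl e)) ≤ fuel → _
      again zero le = ⊥-elim (ℕP.<⇒≱ fewer (ℕP.≤-trans le z≤n))
      again (suc fuel) le = improve k lt fuel W.π' W.ext' W.good' (ℕP.≤-pred (ℕP.≤-trans fewer le))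

    all-good : Ext π₀ → ∀ k → k ≤ ℓ → Σ[ π ∈ Perm m ] (Ext π × Good k π)
    all-good ex₀ zero _ = π₀ , ex₀ , λ _ _ _ ()
    all-good ex₀ (suc k) le with all-good ex₀ k (ℕP.<⇒≤ le)
    ... | π , ex , good = improve k le _ π ex good ℕP.≤-refl

    -- The pair offered by `merge-orbits` may conflict. Of the exchangeable arcs at its vertex,
    -- those in the orbit or those outside are the larger class; that class contains a safe partner
    -- for the arc of the pair in the other class.
    merged : Ext π₀ → ∀ e₀ → Σ[ π ∈ Perm m ] ((Ext π × Good ℓ π) ×
      (∀ x y → not (fx x) ≡ true → not (fx y) ≡ true → hd x ≡ hd y → orbit π e₀ x ≡ true → orbit π e₀ y ≡ true))
    merged ex₀ e₀ with all-good ex₀ ℓ ℕP.≤-refl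
    ... | π , eg = merge-orbits (λ π → Ext π × Good ℓ π) e₀ (λ x → not (fx x)) hd sw π eg
      where
      sw : ∀ π → Ext π × Good ℓ π → (O : Fin m → Bool) → ∀ x y → O x ≡ true → O y ≡ false →
           not (fx x) ≡ true → not (fx y) ≡ true → hd x ≡ hd y →
           ∃ λ x' → ∃ λ y' → O x' ≡ true × O y' ≡ false × (Ext (swapP π x' y') × Good ℓ (swapP π x' y'))
      sw π (ex , good) O x y ox oy jx jy hxy = go (cnt A ≤? cnt B)
        where
        v = hd x
        A B : Fin m → Bool
        A z = jin z v ∧ O z
        B z = jin z v ∧ not (O z)
        tot : 4 * cf v + 2 ≤ cnt A + cnt B
        tot = ℕP.≤-trans (big v) (ℕP.≤-reflexive (cnt-split (λ z → jin z v) O))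
        half : ∀ {a b} c → 4 * c + 2 ≤ a + b → a ≤ b → 2 * c < b
        half {a} {b} c t ab with suc (2 * c) ≤? b
        ... | yes h = h
        ... | no h = ⊥-elim (ℕP.<⇒≱ {a + b} {4 * c + 2} (ℕP.≤-trans (s≤s (ℕP.+-mono-≤ (ℕP.≤-trans ab b≤) b≤)) (ℕP.≤-trans (ℕP.≤-reflexive (l c)) (ℕP.+-monoʳ-≤ (4 * c) (s≤s z≤n)))) t)
          where b≤ : b ≤ 2 * c
                b≤ = ℕP.≤-pred (ℕP.≰⇒> h)
                l : ∀ c → suc (2 * c + 2 * c) ≡ 4 * c + 1
                l = solve-∀
        go : Dec (cnt A ≤ cnt B) → _
        go (yes le) with safe π ex ℓ ℕP.≤-refl x v refl B (λ z h → proj₁ (∧-true {jin z v} h)) (half (cf v) tot le)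
        ... | y' , by , nc₁ , nc₂ = x , y' , ox , not-true (proj₂ (∧-true {jin y' v} by)) , W.ext' , W.good'
          where
          j' = ∧-true {not (fx y')} (proj₁ (∧-true {jin y' v} by))
          module W = Swap π ex ℓ good x y' (not-true jx) (not-true (proj₁ j')) (sym (does⇒ (hd y' ≟ v) (proj₂ j'))) nc₁ nc₂
        go (no nle) with safe π ex ℓ ℕP.≤-refl y v (sym hxy) A (λ z h → proj₁ (∧-true {jin z v} h))
                           (half (cf v) (ℕP.≤-trans tot (ℕP.≤-reflexive (ℕP.+-comm (cnt A) _))) (ℕP.<⇒≤ (ℕP.≰⇒> nle)))
        ... | x' , ax , nc₁ , nc₂ = x' , y , proj₂ (∧-true {jin x' v} ax) , oy , W.ext' , W.good'
          where
          j' = ∧-true {not (fx x')} (proj₁ (∧-true {jin x' v} ax))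
          module W = Swap π ex ℓ good x' y (not-true (proj₁ j')) (not-true jy) (trans (does⇒ (hd x' ≟ v) (proj₂ j')) hxy) nc₂ nc₁

-- The local lemma

module _ {q : ℕ} where

  -- Probabilities are counted: independent uniform choices from `Fin q` form a vector, and
  -- inequalities between probabilities are stated with denominators cleared.
  cntV : ∀ n → (Vec (Fin q) n → Bool) → ℕ
  cntV zero    P = ⟦ P [] ⟧
  cntV (suc n) P = sumF (λ x → cntV n (λ f → P (x ∷ f)))

  cntV-mono : ∀ n {P Q : Vec (Fin q) n → Bool} → (∀ f → P f ≡ true → Q f ≡ true) → cntV n P ≤ cntV n Q
  cntV-mono zero    h = ⟦⟧-mono (h [])
  cntV-mono (suc n) h = sum-mono (λ x → cntV-mono n (λ f → h (x ∷ f)))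

  cntV-cong : ∀ n {P Q : Vec (Fin q) n → Bool} → (∀ f → P f ≡ Q f) → cntV n P ≡ cntV n Q
  cntV-cong zero    h = cong ⟦_⟧ (h [])
  cntV-cong (suc n) h = sum-cong (λ x → cntV-cong n (λ f → h (x ∷ f)))

  cntV-split : ∀ n (P Q : Vec (Fin q) n → Bool) → cntV n P ≡ cntV n (λ f → P f ∧ Q f) + cntV n (λ f → P f ∧ not (Q f))
  cntV-split zero    P Q = ⟦⟧-split (P []) (Q [])
  cntV-split (suc n) P Q = trans (sum-cong (λ x → cntV-split n (λ f → P (x ∷ f)) (λ f → Q (x ∷ f))))
    (sum-+ (λ x → cntV n (λ f → P (x ∷ f) ∧ Q (x ∷ f))) (λ x → cntV n (λ f → P (x ∷ f) ∧ not (Q (x ∷ f)))))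

  cntV-∨ : ∀ n (P Q : Vec (Fin q) n → Bool) → cntV n (λ f → P f ∨ Q f) ≤ cntV n P + cntV n Q
  cntV-∨ zero P Q with P [] | Q []
  ... | true  | b = s≤s z≤n
  ... | false | b = ℕP.≤-refl
  cntV-∨ (suc n) P Q = ℕP.≤-trans (sum-mono (λ x → cntV-∨ n (λ f → P (x ∷ f)) (λ f → Q (x ∷ f))))
    (ℕP.≤-reflexive (sum-+ (λ x → cntV n (λ f → P (x ∷ f))) (λ x → cntV n (λ f → Q (x ∷ f)))))

  cntV-false : ∀ n {P : Vec (Fin q) n → Bool} → (∀ f → P f ≡ false) → cntV n P ≡ 0
  cntV-false zero    h = cong ⟦_⟧ (h [])
  cntV-false (suc n) h = sum-0 (λ x → cntV-false n (λ f → h (x ∷ f)))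

  cntV-find : ∀ n (P : Vec (Fin q) n → Bool) → 1 ≤ cntV n P → ∃ λ f → P f ≡ true
  cntV-find zero P h with P [] in eq
  ... | true = [] , eq
  cntV-find (suc n) P h with find? (λ x → does (1 ≤? cntV n (λ f → P (x ∷ f))))
  ... | inj₁ (x , e) with cntV-find n (λ f → P (x ∷ f)) (does⇒ (1 ≤? _) e)
  ...   | f , pf = x ∷ f , pf
  cntV-find (suc n) P h | inj₂ z =
    ⊥-elim (ℕP.<⇒≢ h (sym (sum-0 (λ x → ℕP.n<1⇒n≡0 (ℕP.≰⇒> (does⇒¬ (1 ≤? _) (z x)))))))

  cntV-true : ∀ n → 1 ≤ q → 1 ≤ cntV n (λ _ → true)
  cntV-true zero    _ = ℕP.≤-refl
  cntV-true (suc n) (s≤s le) = ℕP.≤-trans (cntV-true n (s≤s le)) (ℕP.m≤m+n _ _)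

  Inv : ∀ {n} → Fin n → (Vec (Fin q) n → Bool) → Set
  Inv v P = ∀ f x → P (f [ v ]≔ x) ≡ P f

  -- All slices along the coordinate `v` have the same `P`-count, so a condition on that coordinate
  -- scales it by exactly `cnt B / q`.
  cntV-indep : ∀ n (v : Fin n) (P : Vec (Fin q) n → Bool) (B : Fin q → Bool) → Inv v P →
               cntV n (λ f → P f ∧ B (lookup f v)) * q ≡ cnt B * cntV n P
  cntV-indep (suc n) zero P B inv = begin
    sumF (λ x → cntV n (λ f → P (x ∷ f) ∧ B x)) * q        ≡⟨ ℕP.*-comm _ q ⟩
    q * sumF (λ x → cntV n (λ f → P (x ∷ f) ∧ B x))        ≡⟨ sum-* q (λ x → cntV n (λ f → P (x ∷ f) ∧ B x)) ⟨
    sumF (λ x → q * cntV n (λ f → P (x ∷ f) ∧ B x))        ≡⟨ sum-cong each ⟩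
    sumF (λ x → cntV (suc n) P * ⟦ B x ⟧)                  ≡⟨ sum-* (cntV (suc n) P) (λ x → ⟦ B x ⟧) ⟩
    cntV (suc n) P * cnt B                                 ≡⟨ ℕP.*-comm (cntV (suc n) P) _ ⟩
    cnt B * cntV (suc n) P                                 ∎
    where
    open ≡-Reasoning
    same : ∀ x → q * cntV n (λ f → P (x ∷ f)) ≡ cntV (suc n) P
    same x = trans (sym (sum-const q _)) (sum-cong (λ y → cntV-cong n (λ f → inv (y ∷ f) x)))
    each : ∀ x → q * cntV n (λ f → P (x ∷ f) ∧ B x) ≡ cntV (suc n) P * ⟦ B x ⟧
    each x with B x
    ... | true  = trans (cong (q *_) (cntV-cong n (λ f → BP.∧-identityʳ (P (x ∷ f))))) (trans (same x) (sym (ℕP.*-identityʳ _)))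
    ... | false = trans (cong (q *_) (cntV-false n (λ f → BP.∧-zeroʳ (P (x ∷ f))))) (trans (ℕP.*-zeroʳ q) (sym (ℕP.*-zeroʳ (cntV (suc n) P))))
  cntV-indep (suc n) (suc v) P B inv = begin
    sumF (λ x → cntV n (λ f → P (x ∷ f) ∧ B (lookup f v))) * q        ≡⟨ ℕP.*-comm _ q ⟩
    q * sumF (λ x → cntV n (λ f → P (x ∷ f) ∧ B (lookup f v)))        ≡⟨ sum-* q (λ x → cntV n (λ f → P (x ∷ f) ∧ B (lookup f v))) ⟨
    sumF (λ x → q * cntV n (λ f → P (x ∷ f) ∧ B (lookup f v)))        ≡⟨ sum-cong (λ x → trans (ℕP.*-comm q _) (cntV-indep n v (λ f → P (x ∷ f)) B (λ f y → inv (x ∷ f) y))) ⟩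
    sumF (λ x → cnt B * cntV n (λ f → P (x ∷ f)))                     ≡⟨ sum-* (cnt B) (λ x → cntV n (λ f → P (x ∷ f))) ⟩
    cnt B * cntV (suc n) P                                            ∎
    where open ≡-Reasoning

  Box : ℕ → Set
  Box n = List (Fin n × (Fin q → Bool))

  box : ∀ {n} → Box n → Vec (Fin q) n → Bool
  box []             f = true
  box ((v , B) ∷ bs) f = box bs f ∧ B (lookup f v)

  memb : ∀ {n} → Fin n → Box n → Bool
  memb v []             = false
  memb v ((w , _) ∷ bs) = does (v ≟ w) ∨ memb v bs

  distinct : ∀ {n} → Box n → Bool
  distinct []             = true
  distinct ((v , _) ∷ bs) = not (memb v bs) ∧ distinct bs

  box-inv : ∀ {n} (v : Fin n) bs → memb v bs ≡ false → Inv v (box bs)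
  box-inv v [] _ f x = refl
  box-inv v ((w , B) ∷ bs) h f x with v ≟ w
  ... | no ne = cong₂ _∧_ (box-inv v bs h f x) (cong B (VP.lookup∘update′ (λ e → ne (sym e)) f x))

  -- Conditions on distinct coordinates are independent, so `t` of them hold with probability at
  -- most `(b / q) ^ t`, even relative to an event `P` that ignores these coordinates.
  box-count : ∀ n b (bs : Box n) → All (λ p → cnt (proj₂ p) ≤ b) bs → distinct bs ≡ true →
              ∀ P → (∀ v → memb v bs ≡ true → Inv v P) →
              cntV n (λ f → P f ∧ box bs f) * q ^ length bs ≤ b ^ length bs * cntV n P
  box-count n b [] _ _ P inv = ℕP.≤-reflexive (trans (ℕP.*-identityʳ _)
    (trans (cntV-cong n (λ f → BP.∧-identityʳ (P f))) (sym (ℕP.*-identityˡ _))))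
  box-count n b ((v , B) ∷ bs) (le ∷ les) d P inv = begin
    cntV n (λ f → P f ∧ (box bs f ∧ B (lookup f v))) * (q * q ^ length bs)
      ≡⟨ cong (_* (q * q ^ length bs)) (cntV-cong n (λ f → sym (BP.∧-assoc (P f) _ _))) ⟩
    cntV n (λ f → (P f ∧ box bs f) ∧ B (lookup f v)) * (q * q ^ length bs)
      ≡⟨ ℕP.*-assoc (cntV n (λ f → (P f ∧ box bs f) ∧ B (lookup f v))) q (q ^ length bs) ⟨
    cntV n (λ f → (P f ∧ box bs f) ∧ B (lookup f v)) * q * q ^ length bs
      ≡⟨ cong (_* q ^ length bs) (cntV-indep n v (λ f → P f ∧ box bs f) B inv') ⟩
    cnt B * cntV n (λ f → P f ∧ box bs f) * q ^ length bs
      ≤⟨ ℕP.*-monoˡ-≤ (q ^ length bs) (ℕP.*-monoˡ-≤ (cntV n (λ f → P f ∧ box bs f)) le) ⟩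
    b * cntV n (λ f → P f ∧ box bs f) * q ^ length bs
      ≡⟨ ℕP.*-assoc b _ _ ⟩
    b * (cntV n (λ f → P f ∧ box bs f) * q ^ length bs)
      ≤⟨ ℕP.*-monoʳ-≤ b (box-count n b bs les (proj₂ (∧-true {not (memb v bs)} d)) P (λ w h → inv w (∨-introʳ {does (w ≟ v)} h))) ⟩
    b * (b ^ length bs * cntV n P)
      ≡⟨ ℕP.*-assoc b _ _ ⟨
    b * b ^ length bs * cntV n P ∎
    where
    open ℕP.≤-Reasoning
    inv' : Inv v (λ f → P f ∧ box bs f)
    inv' f x = cong₂ _∧_ (inv v (∨-introˡ (eqb-refl v)) f x) (box-inv v bs (not-true (proj₁ (∧-true d))) f x)

-- The Lovász local lemma: every event has at most D neighbours, is independent of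
-- any conjunction of complements of non-neighbours, and has probability at most P / Q.
module LocalLemma {q n : ℕ} {Idx : Set} (ev : Idx → Vec (Fin q) n → Bool) (nbr : Idx → List Idx)
  (Ind : Idx → Idx → Set) (nbr? : ∀ A C → C ∈ nbr A ⊎ Ind A C)
  (P Q D : ℕ) (few : ∀ A → length (nbr A) ≤ D) (1≤D : 1 ≤ D) (1≤Q : 1 ≤ Q) (small : 4 * (P * D) ≤ Q) where

  av : List Idx → Vec (Fin q) n → Bool
  av []      f = true
  av (C ∷ E) f = not (ev C f) ∧ av E f

  module _ (indep : ∀ A E → All (Ind A) E → cntV n (λ f → av E f ∧ ev A f) * Q ≤ P * cntV n (av E)) where
   private
    #_ : (Vec (Fin q) n → Bool) → ℕ
    # X = cntV n X

    Part : Idx → List Idx → Set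
    Part A E = Σ[ O ∈ List Idx ] (All (Ind A) O × (∀ f → av E f ≡ true → av O f ≡ true) ×
      (∀ f → av O f ≡ true → av E f ≡ false → ∃ λ B → B ∈ nbr A × ev B f ≡ true) ×
      (O ≡ E ⊎ length O < length E))

    part : ∀ A E → Part A E
    part A [] = [] , [] , (λ _ h → h) , (λ f _ ()) , inj₁ refl
    part A (C ∷ E) with nbr? A C | part A E
    ... | inj₁ c | O , all , sub , hit , sz = O , all , (λ f h → sub f (proj₂ (∧-true {not (ev C f)} h))) ,
          hit' , inj₂ (s≤s (le sz))
      where
      le : O ≡ E ⊎ length O < length E → length O ≤ length E
      le (inj₁ refl) = ℕP.≤-refl
      le (inj₂ l) = ℕP.<⇒≤ l
      hit' : ∀ f → av O f ≡ true → not (ev C f) ∧ av E f ≡ false → ∃ λ B → B ∈ nbr A × ev B f ≡ true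
      hit' f h h' with ev C f in eq
      ... | true = C , c , eq
      ... | false = hit f h h'
    ... | inj₂ i | O , all , sub , hit , sz = C ∷ O , i ∷ all ,
          (λ f h → ∧-intro (proj₁ (∧-true h)) (sub f (proj₂ (∧-true {not (ev C f)} h)))) , hit' , sz' sz
      where
      sz' : O ≡ E ⊎ length O < length E → C ∷ O ≡ C ∷ E ⊎ suc (length O) < suc (length E)
      sz' (inj₁ refl) = inj₁ refl
      sz' (inj₂ l) = inj₂ (s≤s l)
      hit' : ∀ f → not (ev C f) ∧ av O f ≡ true → not (ev C f) ∧ av E f ≡ false → ∃ λ B → B ∈ nbr A × ev B f ≡ true
      hit' f h h' with ev C f in eq
      ... | false = hit f h h'

    any : List Idx → Vec (Fin q) n → Bool
    any []      f = false
    any (B ∷ N) f = ev B f ∨ any N f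

    any-intro : ∀ N f B → B ∈ N → ev B f ≡ true → any N f ≡ true
    any-intro (_ ∷ N) f B (here refl) h = ∨-introˡ h
    any-intro (B' ∷ N) f B (there m) h = ∨-introʳ {ev B' f} (any-intro N f B m h)

    union : ∀ N (O : Vec (Fin q) n → Bool) c → (∀ B → # (λ f → O f ∧ ev B f) * Q ≤ c) →
            # (λ f → O f ∧ any N f) * Q ≤ length N * c
    union [] O c h = ℕP.≤-reflexive (cong (_* Q) (cntV-false n (λ f → BP.∧-zeroʳ (O f))))
    union (B ∷ N) O c h = begin
      # (λ f → O f ∧ (ev B f ∨ any N f)) * Q
        ≡⟨ cong (_* Q) (cntV-cong n (λ f → BP.∧-distribˡ-∨ (O f) (ev B f) (any N f))) ⟩
      # (λ f → (O f ∧ ev B f) ∨ (O f ∧ any N f)) * Q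
        ≤⟨ ℕP.*-monoˡ-≤ Q (cntV-∨ n (λ f → O f ∧ ev B f) (λ f → O f ∧ any N f)) ⟩
      (# (λ f → O f ∧ ev B f) + # (λ f → O f ∧ any N f)) * Q
        ≡⟨ ℕP.*-distribʳ-+ Q (# (λ f → O f ∧ ev B f)) _ ⟩
      # (λ f → O f ∧ ev B f) * Q + # (λ f → O f ∧ any N f) * Q
        ≤⟨ ℕP.+-mono-≤ (h B) (union N O c h) ⟩
      c + length N * c ∎
      where open ℕP.≤-Reasoning

    -- Given only that the non-neighbours `O` of `A` in `E` are avoided, `A` has probability at most
    -- `P / Q`. By induction the neighbours then occur with total probability at most
    -- `2 * P * D / Q`, which is at most one half, so passing from `O` to `E` at most doubles the
    -- bound.
    bound : ∀ k E → length E ≤ k → ∀ A → # (λ f → av E f ∧ ev A f) * Q ≤ 2 * P * # (av E)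
    bound k E le A with part A E
    ... | O , all , sub , hit , inj₁ refl = ℕP.≤-trans (indep A O all) (ℕP.*-monoˡ-≤ (# (av O)) (ℕP.m≤m+n P (P + 0)))
    bound zero [] le A | O , all , sub , hit , inj₂ ()
    bound zero (_ ∷ _) () A | O , all , sub , hit , inj₂ lt
    bound (suc k) E le A | O , all , sub , hit , inj₂ lt = begin
      # (λ f → av E f ∧ ev A f) * Q
        ≤⟨ ℕP.*-monoˡ-≤ Q (cntV-mono n (λ f h → ∧-intro (sub f (proj₁ (∧-true h))) (proj₂ (∧-true {av E f} h)))) ⟩
      # (λ f → av O f ∧ ev A f) * Q       ≤⟨ indep A O all ⟩
      P * # (av O)                        ≤⟨ ℕP.*-monoʳ-≤ P half ⟩
      P * (2 * # (av E))                  ≡⟨ lem P (# (av E)) ⟩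
      2 * P * # (av E)                    ∎
      where
      open ℕP.≤-Reasoning
      lem : ∀ p x → p * (2 * x) ≡ 2 * p * x
      lem = solve-∀
      ih : ∀ B → # (λ f → av O f ∧ ev B f) * Q ≤ 2 * P * # (av O)
      ih = bound k O (ℕP.≤-pred (ℕP.≤-trans lt le))
      σ = # (λ f → av O f ∧ any (nbr A) f)
      σ-small : 2 * σ ≤ # (av O)
      σ-small = ℕP.*-cancelʳ-≤ (2 * σ) (# (av O)) Q {{>-nonZero 1≤Q}} (begin
        2 * σ * Q                       ≡⟨ ℕP.*-assoc 2 σ Q ⟩
        2 * (σ * Q)                     ≤⟨ ℕP.*-monoʳ-≤ 2 (union (nbr A) (av O) (2 * P * # (av O)) ih) ⟩
        2 * (length (nbr A) * (2 * P * # (av O)))   ≤⟨ ℕP.*-monoʳ-≤ 2 (ℕP.*-monoˡ-≤ (2 * P * # (av O)) (few A)) ⟩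
        2 * (D * (2 * P * # (av O)))    ≡⟨ lem₂ D P (# (av O)) ⟩
        4 * (P * D) * # (av O)          ≤⟨ ℕP.*-monoˡ-≤ (# (av O)) small ⟩
        Q * # (av O)                    ≡⟨ ℕP.*-comm Q _ ⟩
        # (av O) * Q                    ∎)
        where lem₂ : ∀ d p x → 2 * (d * (2 * p * x)) ≡ 4 * (p * d) * x
              lem₂ = solve-∀
      cover : # (av O) ≤ # (av E) + σ
      cover = begin
        # (av O)   ≡⟨ cntV-split n (av O) (av E) ⟩
        # (λ f → av O f ∧ av E f) + # (λ f → av O f ∧ not (av E f))
          ≤⟨ ℕP.+-mono-≤ (cntV-mono n (λ f h → proj₂ (∧-true {av O f} h)))
               (cntV-mono n (λ f h → let r = hit f (proj₁ (∧-true h)) (not-true (proj₂ (∧-true {av O f} h))) in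
                 ∧-intro (proj₁ (∧-true h)) (any-intro (nbr A) f (proj₁ r) (proj₁ (proj₂ r)) (proj₂ (proj₂ r))))) ⟩
        # (av E) + σ ∎
      half : # (av O) ≤ 2 * # (av E)
      half = ℕP.+-cancelʳ-≤ (# (av O)) _ _ (begin
        # (av O) + # (av O)             ≡⟨ cong (# (av O) +_) (sym (ℕP.+-identityʳ _)) ⟩
        2 * # (av O)                    ≤⟨ ℕP.*-monoʳ-≤ 2 cover ⟩
        2 * (# (av E) + σ)              ≡⟨ ℕP.*-distribˡ-+ 2 (# (av E)) σ ⟩
        2 * # (av E) + 2 * σ            ≤⟨ ℕP.+-monoʳ-≤ _ σ-small ⟩
        2 * # (av E) + # (av O)         ∎)

    -- If no vector avoided both `A` and `E`, then `A` would be certain once `E` is avoided,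
    -- although its conditional probability is at most `2 * P / Q < 1`.
    positive : 1 ≤ q → ∀ E → 1 ≤ # (av E)
    positive 1≤q [] = cntV-true n 1≤q
    positive 1≤q (A ∷ E) with 1 ≤? # (av (A ∷ E))
    ... | yes h = h
    ... | no h = ⊥-elim (ℕP.<⇒≱ 2P<Q (ℕP.*-cancelʳ-≤ Q (2 * P) (# (av E)) {{>-nonZero (positive 1≤q E)}} (begin
        Q * # (av E)                    ≡⟨ ℕP.*-comm Q _ ⟩
        # (av E) * Q                    ≡⟨ cong (_* Q) (trans (cntV-split n (av E) (ev A)) (trans (cong (# (λ f → av E f ∧ ev A f) +_) zer) (ℕP.+-identityʳ _))) ⟩
        # (λ f → av E f ∧ ev A f) * Q   ≤⟨ bound (length E) E ℕP.≤-refl A ⟩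
        2 * P * # (av E)                ∎)))
      where
      open ℕP.≤-Reasoning
      zer : # (λ f → av E f ∧ not (ev A f)) ≡ 0
      zer = trans (cntV-cong n (λ f → BP.∧-comm (av E f) _)) (ℕP.n<1⇒n≡0 (ℕP.≰⇒> h))
      2P<Q : 2 * P < Q
      2P<Q with P ℕP.≟ 0
      ... | yes refl = 1≤Q
      ... | no p≢0 = ℕP.<-≤-trans (ℕP.*-monoˡ-< P {{≢-nonZero p≢0}} {2} {4} (s≤s (s≤s (s≤s z≤n))))
          (ℕP.≤-trans (ℕP.*-monoʳ-≤ 4 (ℕP.≤-trans (ℕP.≤-reflexive (sym (ℕP.*-identityʳ P))) (ℕP.*-monoʳ-≤ P 1≤D))) small)

   avoid : 1 ≤ q → ∀ E → ∃ λ f → av E f ≡ true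
   avoid 1≤q E = cntV-find n (av E) (positive 1≤q E)

  av-elim : ∀ {E f C} → C ∈ E → av E f ≡ true → ev C f ≡ false
  av-elim (here refl) h = not-true (proj₁ (∧-true h))
  av-elim {C' ∷ E} {f} (there m) h = av-elim m (proj₂ (∧-true {not (ev C' f)} h))

-- Tuples, and the dispersion of labels

length-concatMap : ∀ {A B : Set} (f : A → List B) c → (∀ x → length (f x) ≤ c) → ∀ xs → length (concatMap f xs) ≤ length xs * c
length-concatMap f c h [] = z≤n
length-concatMap f c h (x ∷ xs) = ℕP.≤-trans (ℕP.≤-reflexive (LP.length-++ (f x)))
  (ℕP.+-mono-≤ (h x) (length-concatMap f c h xs))

∈-concatMap : ∀ {A B : Set} (f : A → List B) {x xs y} → x ∈ xs → y ∈ f x → y ∈ concatMap f xs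
∈-concatMap f {xs = x ∷ xs} (here refl) q = ∈-++⁺ˡ q
∈-concatMap f {xs = x ∷ xs} (there p) q = ∈-++⁺ʳ (f x) (∈-concatMap f p q)

allVec : ∀ h t → List (Vec (Fin h) t)
allVec h zero    = [] ∷ []
allVec h (suc t) = concatMap (λ i → L.map (i ∷_) (allVec h t)) (tabulate id)

allVec-length : ∀ h t → length (allVec h t) ≤ h ^ t
allVec-length h zero    = ℕP.≤-refl
allVec-length h (suc t) = ℕP.≤-trans
  (length-concatMap (λ i → L.map (i ∷_) (allVec h t)) (h ^ t)
    (λ i → ℕP.≤-trans (ℕP.≤-reflexive (LP.length-map (i ∷_) (allVec h t))) (allVec-length h t)) (tabulate id))
  (ℕP.≤-reflexive (cong (_* h ^ t) (LP.length-tabulate {n = h} id)))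

∈-allVec : ∀ {h t} (τ : Vec (Fin h) t) → τ ∈ allVec h t
∈-allVec [] = here refl
∈-allVec {h} {suc t} (i ∷ τ) = ∈-concatMap (λ i → L.map (i ∷_) (allVec h t)) (∈-tabulate⁺ i) (∈-map⁺ (i ∷_) (∈-allVec τ))

InV : ∀ {h t} → Fin h → Vec (Fin h) t → Set
InV j []      = ⊥
InV j (i ∷ τ) = j ≡ i ⊎ InV j τ

data Picks {h : ℕ} (p : Fin h → Bool) : ∀ {t} → Vec (Fin h) t → Set where
  []   : Picks p []
  pickᵥ : ∀ {t i} {τ : Vec (Fin h) t} → p i ≡ true → (∀ j → InV j τ → j ≢ i) → Picks p τ → Picks p (i ∷ τ)

picks-map : ∀ {h t} {p q : Fin h → Bool} {τ : Vec (Fin h) t} → (∀ i → p i ≡ true → q i ≡ true) → Picks p τ → Picks q τ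
picks-map f [] = []
picks-map f (pickᵥ a b c) = pickᵥ (f _ a) b (picks-map f c)

picks-all : ∀ {h t} {p : Fin h → Bool} {τ : Vec (Fin h) t} → Picks p τ → ∀ j → InV j τ → p j ≡ true
picks-all (pickᵥ a _ c) j (inj₁ refl) = a
picks-all (pickᵥ _ _ c) j (inj₂ r)    = picks-all c j r

picks : ∀ {h} (p : Fin h → Bool) t → t ≤ cnt p → ∃ λ (τ : Vec (Fin h) t) → Picks p τ
picks p zero _ = [] , []
picks p (suc t) le with cnt-find {p = p} (ℕP.≤-trans (s≤s z≤n) le)
... | i , pi with picks (λ j → p j ∧ not (eqb j i)) t le'
  where
  le' : t ≤ cnt (λ j → p j ∧ not (eqb j i))
  le' = ℕP.+-cancelˡ-≤ 1 _ _ (ℕP.≤-trans le (ℕP.≤-trans (ℕP.≤-reflexive (cnt-split p (λ j → eqb j i)))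
    (ℕP.+-monoˡ-≤ _ (cnt-unique (λ j → p j ∧ eqb j i) (λ j j' a b →
      trans (does⇒ (j ≟ i) (proj₂ (∧-true {p j} a))) (sym (does⇒ (j' ≟ i) (proj₂ (∧-true {p j'} b)))))))))
... | τ , ps = i ∷ τ , pickᵥ pi (λ j m e → t≢f (dec-true (j ≟ i) e) (not-true (proj₂ (∧-true {p j} (picks-all ps j m)))))
                       (picks-map (λ j h → proj₁ (∧-true h)) ps)

-- Every group chooses one of q options; member i of the family φ sits in the group
-- grp φ i and is hit by the label X for at most b options of that group.  If b is small,
-- the options can be chosen so that no label hits more than T' members of a family.
module Disperse {nG q h K T' b Φ : ℕ} {F Lab : Set}
  (grp : F → Fin h → Fin nG) (fams : Fin nG → List F) (fam-ok : ∀ φ i → φ ∈ fams (grp φ i))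
  (fam-few : ∀ v → length (fams v) ≤ Φ) (labs : Fin nG → Fin K → Lab)
  (bad : F → Fin h → Lab → Fin q → Bool) (bad-few : ∀ φ i X → cnt (bad φ i X) ≤ b) where

  -- Bounds the events listed for one group: `Φ` families, all tuples of `suc T'` members, and `K`
  -- labels.
  Δ : ℕ
  Δ = Φ * (h ^ suc T' * K)

  private
    Idx : Set
    Idx = F × Vec (Fin h) (suc T') × Fin K

    bx : F → Lab → ∀ {t} → Vec (Fin h) t → Box {q} nG
    bx φ X []      = []
    bx φ X (i ∷ τ) = (grp φ i , bad φ i X) ∷ bx φ X τ

    bx-length : ∀ φ X {t} (τ : Vec (Fin h) t) → length (bx φ X τ) ≡ t
    bx-length φ X []      = refl
    bx-length φ X (i ∷ τ) = cong suc (bx-length φ X τ)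

    bx-few : ∀ φ X {t} (τ : Vec (Fin h) t) → All (λ p → cnt (proj₂ p) ≤ b) (bx φ X τ)
    bx-few φ X []      = []
    bx-few φ X (i ∷ τ) = bad-few φ i X ∷ bx-few φ X τ

    bx-mem : ∀ φ X {t} (τ : Vec (Fin h) t) v → memb v (bx φ X τ) ≡ true → ∃ λ j → InV j τ × v ≡ grp φ j
    bx-mem φ X (i ∷ τ) v m with ∨-true {does (v ≟ grp φ i)} m
    ... | inj₁ e = i , inj₁ refl , does⇒ (v ≟ grp φ i) e
    ... | inj₂ r with bx-mem φ X τ v r
    ...   | j , jm , e = j , inj₂ jm , e

    -- `Lab` may be unbounded, so an event names its label by an index into the `K` labels of the
    -- group of its first member. This keeps the number of events at a group bounded.
    lab : Idx → Lab
    lab (φ , i ∷ _ , k) = labs (grp φ i) k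

    boxOf : Idx → Box {q} nG
    boxOf A = bx (proj₁ A) (lab A) (proj₁ (proj₂ A))

    -- A tuple whose groups are not distinct yields the empty event, so the choices in a non-empty
    -- event are always independent.
    ev : Idx → Vec (Fin q) nG → Bool
    ev A f = distinct (boxOf A) ∧ box (boxOf A) f

    Ev : Fin nG → List Idx
    Ev v = concatMap (λ φ → concatMap (λ τ → tabulate (λ k → φ , τ , k)) (allVec h (suc T'))) (fams v)

    Ev-length : ∀ v → length (Ev v) ≤ Δ
    Ev-length v = ℕP.≤-trans (length-concatMap _ (h ^ suc T' * K) (λ φ →
        ℕP.≤-trans (length-concatMap (λ τ → tabulate (λ k → φ , τ , k)) K (λ τ → ℕP.≤-reflexive (LP.length-tabulate _)) (allVec h (suc T')))
                   (ℕP.*-monoˡ-≤ K (allVec-length h (suc T')))) (fams v))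
      (ℕP.*-monoˡ-≤ _ (fam-few v))

    ∈-Ev : ∀ φ i τ k → (φ , τ , k) ∈ Ev (grp φ i)
    ∈-Ev φ i τ k = ∈-concatMap (λ φ → concatMap (λ τ → tabulate (λ k → φ , τ , k)) (allVec h (suc T'))) (fam-ok φ i)
      (∈-concatMap (λ τ → tabulate (λ k → φ , τ , k)) (∈-allVec τ) (∈-tabulate⁺ k))

    nb : F → ∀ {t} → Vec (Fin h) t → List Idx
    nb φ []      = []
    nb φ (i ∷ τ) = Ev (grp φ i) ++ nb φ τ

    nb-length : ∀ φ {t} (τ : Vec (Fin h) t) → length (nb φ τ) ≤ t * Δ
    nb-length φ []      = z≤n
    nb-length φ (i ∷ τ) = ℕP.≤-trans (ℕP.≤-reflexive (LP.length-++ (Ev (grp φ i)))) (ℕP.+-mono-≤ (Ev-length (grp φ i)) (nb-length φ τ))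

    nbr : Idx → List Idx
    nbr (φ , τ , k) = nb φ τ

    Ind : Idx → Idx → Set
    Ind A C = ∀ v → memb v (boxOf A) ≡ true → Inv v (ev C)

    nb? : ∀ φ X {t} (τ : Vec (Fin h) t) C → C ∈ nb φ τ ⊎ (∀ v → memb v (bx φ X τ) ≡ true → memb v (boxOf C) ≡ false)
    nb? φ X [] C = inj₂ (λ v ())
    nb? φ X (i ∷ τ) C with memb (grp φ i) (boxOf C) in eq | nb? φ X τ C
    ... | true | _ with bx-mem (proj₁ C) (lab C) (proj₁ (proj₂ C)) (grp φ i) eq
    ...   | j , _ , e = inj₁ (∈-++⁺ˡ (subst (λ v → C ∈ Ev v) (sym e) (∈-Ev (proj₁ C) j _ _)))
    nb? φ X (i ∷ τ) C | false | inj₁ m = inj₁ (∈-++⁺ʳ (Ev (grp φ i)) m)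
    nb? φ X (i ∷ τ) C | false | inj₂ g = inj₂ h'
      where h' : ∀ v → does (v ≟ grp φ i) ∨ memb v (bx φ X τ) ≡ true → memb v (boxOf C) ≡ false
            h' v m with ∨-true {does (v ≟ grp φ i)} m
            ... | inj₁ e = trans (cong (λ w → memb w (boxOf C)) (does⇒ (v ≟ grp φ i) e)) eq
            ... | inj₂ r = g v r

    nbr? : ∀ A C → C ∈ nbr A ⊎ Ind A C
    nbr? A C with nb? (proj₁ A) (lab A) (proj₁ (proj₂ A)) C
    ... | inj₁ m = inj₁ m
    ... | inj₂ g = inj₂ (λ v m f x → cong (distinct (boxOf C) ∧_) (box-inv v (boxOf C) (g v m) f x))

  module _ (1≤q : 1 ≤ q) (1≤Δ : 1 ≤ Δ) (small : 4 * (b ^ suc T' * (suc T' * Δ)) ≤ q ^ suc T') where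

    private
      module LL = LocalLemma ev nbr Ind nbr? (b ^ suc T') (q ^ suc T') (suc T' * Δ)
        (λ A → nb-length (proj₁ A) (proj₁ (proj₂ A))) (ℕP.≤-trans 1≤Δ (ℕP.m≤m+n Δ _))
        (>-nonZero⁻¹ _ {{ℕP.m^n≢0 q (suc T') {{>-nonZero 1≤q}}}}) small

      av-inv : ∀ A E → All (Ind A) E → ∀ v → memb v (boxOf A) ≡ true → Inv v (LL.av E)
      av-inv A [] [] v m f x = refl
      av-inv A (C ∷ E) (i ∷ is) v m f x = cong₂ (λ a b → not a ∧ b) (i v m f x) (av-inv A E is v m f x)

      indep : ∀ A E → All (Ind A) E → cntV nG (λ f → LL.av E f ∧ ev A f) * q ^ suc T' ≤ b ^ suc T' * cntV nG (LL.av E)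
      indep A E is with distinct (boxOf A) in eq
      ... | false = ℕP.≤-trans (ℕP.≤-reflexive (cong (_* q ^ suc T') (cntV-false nG (λ f → BP.∧-zeroʳ (LL.av E f))))) z≤n
      ... | true = subst (λ t → cntV nG (λ f → LL.av E f ∧ box (boxOf A) f) * q ^ t ≤ b ^ t * cntV nG (LL.av E))
                     (bx-length (proj₁ A) (lab A) (proj₁ (proj₂ A)))
                     (box-count nG b (boxOf A) (bx-few _ _ (proj₁ (proj₂ A))) eq (LL.av E) (av-inv A E is))

      master : List Idx
      master = concatMap Ev (tabulate id)

      sol = LL.avoid indep 1≤q master

    choice : Vec (Fin q) nG
    choice = proj₁ sol

    hit : F → Lab → Fin h → Bool
    hit φ X i = bad φ i X (lookup choice (grp φ i))

    private
      never : ∀ φ i (τ : Vec (Fin h) T') k → distinct (boxOf (φ , i ∷ τ , k)) ≡ true → box (boxOf (φ , i ∷ τ , k)) choice ≡ true → ⊥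
      never φ i τ k d bt = t≢f (∧-intro d bt) (LL.av-elim (∈-concatMap Ev (∈-tabulate⁺ (grp φ i)) (∈-Ev φ i (i ∷ τ) k)) (proj₂ sol))

      bx-true : ∀ φ X {t} {τ : Vec (Fin h) t} → Picks (hit φ X) τ → box (bx φ X τ) choice ≡ true
      bx-true φ X [] = refl
      bx-true φ X (pickᵥ a _ c) = ∧-intro (bx-true φ X c) a

      bx-distinct : ∀ φ X → (∀ i j → hit φ X i ≡ true → hit φ X j ≡ true → grp φ i ≡ grp φ j → i ≡ j) →
                    ∀ {t} {τ : Vec (Fin h) t} → Picks (hit φ X) τ → distinct (bx φ X τ) ≡ true
      bx-distinct φ X u [] = refl
      bx-distinct φ X u {τ = i ∷ τ} (pickᵥ a ne c) = ∧-intro (cong not (¬t⇒f (λ m →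
        let (j , jm , e) = bx-mem φ X τ (grp φ i) m in
        ne j jm (u j i (picks-all c j jm) a (sym e))))) (bx-distinct φ X u c)

    -- More than `T'` hits would form a tuple whose groups are distinct by the first premise and
    -- whose label is listed by the second; one of the avoided events would occur.
    few-hits : ∀ φ X → (∀ i j → hit φ X i ≡ true → hit φ X j ≡ true → grp φ i ≡ grp φ j → i ≡ j) →
               (∀ i → hit φ X i ≡ true → ∃ λ k → labs (grp φ i) k ≡ X) → cnt (hit φ X) ≤ T'
    few-hits φ X u l = decide (suc T' ≤? cnt (hit φ X))
      where
      clash : ∀ (τ : Vec (Fin h) (suc T')) → Picks (hit φ X) τ → ⊥
      clash (i ∷ τ) ps@(pickᵥ a _ _) = never φ i τ (proj₁ (l i a))
        (subst (λ Y → distinct (bx φ Y (i ∷ τ)) ≡ true) (sym (proj₂ (l i a))) (bx-distinct φ X u ps))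
        (subst (λ Y → box (bx φ Y (i ∷ τ)) choice ≡ true) (sym (proj₂ (l i a))) (bx-true φ X ps))
      decide : Dec (suc T' ≤ cnt (hit φ X)) → cnt (hit φ X) ≤ T'
      decide (no nle) = ℕP.≤-pred (ℕP.≰⇒> nle)
      decide (yes le) = ⊥-elim (clash (proj₁ ps) (proj₂ ps))
        where ps = picks (hit φ X) (suc T') le

-- Trails through the levels

-- A conflict at `a` is removed by exchanging its image with that of some `a'`. At most `c`
-- candidates are ruled out by the row of `a` and at most `c` by the column of its old image, so a
-- harmless one exists and the number of conflicts drops.
conflict-free-perm : ∀ {h} (conf : Fin h → Fin h → Bool) c → (∀ a → cnt (conf a) ≤ c) →
  (∀ b → cnt (λ a → conf a b) ≤ c) → 2 * c < h → Σ[ π ∈ Perm h ] (∀ a → conf a (to π a) ≡ false)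
conflict-free-perm {h} conf c rows cols lt = go _ idP ℕP.≤-refl
  where
  go : ∀ fuel (π : Perm h) → cnt (λ a → conf a (to π a)) ≤ fuel → Σ[ π ∈ Perm h ] (∀ a → conf a (to π a) ≡ false)
  go fuel π le with find? (λ a → conf a (to π a))
  ... | inj₂ z = π , z
  ... | inj₁ (a , bad) with cnt-pick (λ _ → true) (λ a' → conf a (to π a') ∨ conf a' (to π a)) (ℕP.≤-<-trans bound few)
    where
    bound : cnt (λ a' → conf a (to π a') ∨ conf a' (to π a)) ≤ 2 * c
    bound = ℕP.≤-trans (cnt-∨ (λ a' → conf a (to π a')) (λ a' → conf a' (to π a)))
      (ℕP.+-mono-≤ (ℕP.≤-trans (ℕP.≤-reflexive (cnt-perm π (conf a))) (rows a))
        (ℕP.≤-trans (cols (to π a)) (ℕP.≤-reflexive (sym (ℕP.+-identityʳ c)))))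
    few : 2 * c < cnt {h} (λ _ → true)
    few = ℕP.<-≤-trans lt (ℕP.≤-reflexive (sym (trans (sum-const h 1) (ℕP.*-identityʳ h))))
  ...   | a' , _ , ok = again fuel le
    where
    π' = swapP π a a'
    ok₁ : conf a (to π a') ≡ false
    ok₁ = ¬t⇒f (λ t → t≢f (∨-introˡ t) ok)
    ok₂ : conf a' (to π a) ≡ false
    ok₂ = ¬t⇒f (λ t → t≢f (∨-introʳ {conf a (to π a')} t) ok)
    at-a : conf a (to π' a) ≡ false
    at-a = trans (cong (λ z → conf a (to π z)) (τ-x a a')) ok₁
    sub : ∀ i → conf i (to π' i) ≡ true → conf i (to π i) ≡ true
    sub i h = dec (i ≟ a) (i ≟ a')
      where
      dec : Dec (i ≡ a) → Dec (i ≡ a') → conf i (to π i) ≡ true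
      dec (yes refl) _ = bad
      dec (no _) (yes refl) = ⊥-elim (t≢f h (trans (cong (λ z → conf i (to π z)) (τ-y a i)) ok₂))
      dec (no na) (no na') = trans (cong (λ z → conf i (to π z)) (sym (τ-other a a' i na na'))) h
    fewer : cnt (λ i → conf i (to π' i)) < cnt (λ i → conf i (to π i))
    fewer = cnt-strict {p = λ i → conf i (to π' i)} {q = λ i → conf i (to π i)} sub a at-a bad
    again : ∀ fuel → cnt (λ i → conf i (to π i)) ≤ fuel → _
    again zero le = ⊥-elim (ℕP.<⇒≱ fewer (ℕP.≤-trans le z≤n))
    again (suc fuel) le = go fuel π' (ℕP.≤-pred (ℕP.≤-trans fewer le))

-- Peels off conflict-free permutations one by one and declares the pairs of each a conflict for the
-- rest, so `c` grows by one each time. Different options join a slot to different partners; this is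
-- why few of them are bad for a given label.
disjoint-options : ∀ {h} (conf : Fin h → Fin h → Bool) c q → (∀ a → cnt (conf a) ≤ c) →
  (∀ b → cnt (λ a → conf a b) ≤ c) → 2 * (c + q) ≤ h → Σ[ o ∈ (Fin q → Perm h) ]
  ((∀ s a → conf a (to (o s) a) ≡ false) × (∀ s s' a → to (o s) a ≡ to (o s') a → s ≡ s'))
disjoint-options conf c zero rows cols le = (λ ()) , (λ ()) , (λ ())
disjoint-options {h} conf c (suc q) rows cols le = o , ok , disj
  where
  first = conflict-free-perm conf c rows cols (ℕP.<-≤-trans (ℕP.*-monoʳ-< 2 (ℕP.m<m+n c (s≤s z≤n))) le)
  π = proj₁ first
  conf' : Fin h → Fin h → Bool
  conf' a b = conf a b ∨ eqb (to π a) b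
  rest = disjoint-options conf' (suc c) q
    (λ a → ℕP.≤-trans (cnt-∨ (conf a) (eqb (to π a))) (ℕP.≤-trans (ℕP.+-mono-≤ (rows a) (cnt-eqb≤1 (to π a))) (ℕP.≤-reflexive (ℕP.+-comm c 1))))
    (λ b → ℕP.≤-trans (cnt-∨ (λ a → conf a b) (λ a → eqb (to π a) b)) (ℕP.≤-trans (ℕP.+-mono-≤ (cols b)
      (cnt-unique (λ a → eqb (to π a) b) (λ i j x y → to-inj π (trans (does⇒ (to π i ≟ b) x) (sym (does⇒ (to π j ≟ b) y))))))
      (ℕP.≤-reflexive (ℕP.+-comm c 1))))
    (ℕP.≤-trans (ℕP.≤-reflexive (cong (2 *_) (sym (ℕP.+-suc c q)))) le)
  o : Fin (suc q) → Perm h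
  o = π ◂ proj₁ rest
  ok : ∀ s a → conf a (to (o s) a) ≡ false
  ok zero a = proj₂ first a
  ok (suc s) a = ¬t⇒f (λ t → t≢f (∨-introˡ t) (proj₁ (proj₂ rest) s a))
  ne : ∀ s a → to π a ≢ to (proj₁ rest s) a
  ne s a e = t≢f (∨-introʳ {conf a (to (proj₁ rest s) a)} (dec-true (to π a ≟ _) e)) (proj₁ (proj₂ rest) s a)
  disj : ∀ s s' a → to (o s) a ≡ to (o s') a → s ≡ s'
  disj zero zero a e = refl
  disj zero (suc s') a e = ⊥-elim (ne s' a e)
  disj (suc s) zero a e = ⊥-elim (ne s a (sym e))
  disj (suc s) (suc s') a e = cong suc (proj₂ (proj₂ rest) s s' a e)

cnt-cover : ∀ {h K} (p : Fin h → Bool) (R : Fin K → Fin h → Bool) c → (∀ b → p b ≡ true → ∃ λ k → R k b ≡ true) →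
            (∀ k → cnt (R k) ≤ c) → cnt p ≤ K * c
cnt-cover {h} {K} p R c cov few = begin
  cnt p                                   ≤⟨ sum-mono (λ b → one b) ⟩
  sumF (λ b → sumF (λ k → ⟦ R k b ⟧))     ≡⟨ sum-swap (λ b k → ⟦ R k b ⟧) ⟩
  sumF (λ k → cnt (R k))                  ≤⟨ sum-mono few ⟩
  sumF {K} (λ _ → c)                      ≡⟨ sum-const K c ⟩
  K * c                                   ∎
  where
  open ℕP.≤-Reasoning
  one : ∀ b → ⟦ p b ⟧ ≤ sumF (λ k → ⟦ R k b ⟧)
  one b with p b in eq
  ... | false = z≤n
  ... | true = cnt-pos {p = λ k → R k b} (proj₁ (cov b eq)) (proj₂ (cov b eq))

record Grouping (N h : ℕ) : Set where
  field
    nG    : ℕ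
    gr    : Fin N → Fin nG
    ps    : Fin N → Fin h
    mk    : Fin nG → Fin h → Fin N
    gr-mk : ∀ γ a → gr (mk γ a) ≡ γ
    ps-mk : ∀ γ a → ps (mk γ a) ≡ a
    mk-η  : ∀ s → mk (gr s) (ps s) ≡ s

  mk-inj : ∀ γ a a' → mk γ a ≡ mk γ a' → a ≡ a'
  mk-inj γ a a' e = trans (sym (ps-mk γ a)) (trans (cong ps e) (ps-mk γ a'))

  grouped : (Fin nG → Perm h) → Perm N
  grouped μ = perm (λ s → mk (gr s) (to (μ (gr s)) (ps s))) (λ s → mk (gr s) (from (μ (gr s)) (ps s))) ft' tf'
    where
    ft' : ∀ s → mk (gr (mk (gr s) (to (μ (gr s)) (ps s)))) (from (μ (gr (mk (gr s) (to (μ (gr s)) (ps s))))) (ps (mk (gr s) (to (μ (gr s)) (ps s))))) ≡ s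
    ft' s rewrite gr-mk (gr s) (to (μ (gr s)) (ps s)) | ps-mk (gr s) (to (μ (gr s)) (ps s)) | ft (μ (gr s)) (ps s) = mk-η s
    tf' : ∀ s → mk (gr (mk (gr s) (from (μ (gr s)) (ps s)))) (to (μ (gr (mk (gr s) (from (μ (gr s)) (ps s))))) (ps (mk (gr s) (from (μ (gr s)) (ps s))))) ≡ s
    tf' s rewrite gr-mk (gr s) (from (μ (gr s)) (ps s)) | ps-mk (gr s) (from (μ (gr s)) (ps s)) | tf (μ (gr s)) (ps s) = mk-η s

_∘ᴾ_ : ∀ {k} → Perm k → Perm k → Perm k
π ∘ᴾ ρ = perm (to π ∘ to ρ) (from ρ ∘ from π)
  (λ i → trans (cong (from ρ) (ft π _)) (ft ρ i)) (λ i → trans (cong (to π) (tf ρ _)) (tf π i))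

-- Arcs of the subgraph, of the rest of the graph, and auxiliary loops.
data Status : Set where
  alive dead virt : Status

isAlive : Status → Bool
isAlive alive = true
isAlive dead  = false
isAlive virt  = false

Label : ℕ → Set
Label n = Maybe (Fin n)

eqL : ∀ {n} → Label n → Label n → Bool
eqL x y = does (MP.≡-dec _≟_ x y)

eqL⇒ : ∀ {n} (x y : Label n) → eqL x y ≡ true → x ≡ y
eqL⇒ x y h = does⇒ (MP.≡-dec _≟_ x y) h

-- A vertex has the same slots at every level.  The arcs of level j leave the slot i and
-- enter the slot φ j i.  A permutation of slots joins the arcs entering level j to those
-- leaving level j + 1; together these permutations determine trails.  The label of an
-- auxiliary loop is nothing; oh and inh are the labels of a single arc, read forwards and
-- backwards, and bl₊ collects the labels on the alive final part of a trail.
module Slots {N n : ℕ} (vt : Fin N → Fin n) (φ : ℕ → Perm N) (st : ℕ → Fin N → Status) where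

  ostat : Status → Fin n → Label n → Bool
  ostat alive v X = eqL (just v) X
  ostat dead  v X = false
  ostat virt  v X = eqL nothing X

  -- For a dead arc `nothing` is only a default: a list of labels may be too long, since `ostat`
  -- decides what counts.
  lstat : Status → Fin n → Label n
  lstat alive v = just v
  lstat dead  v = nothing
  lstat virt  v = nothing

  ostat-label : ∀ s v X → ostat s v X ≡ true → lstat s v ≡ X
  ostat-label alive v X h = eqL⇒ (just v) X h
  ostat-label virt  v X h = eqL⇒ nothing X h

  oh : ℕ → Fin N → Label n → Bool
  oh j i X = ostat (st j i) (vt (to (φ j) i)) X

  inh : ℕ → Fin N → Label n → Bool
  inh j i X = ostat (st j i) (vt i) X

  Hits : Set
  Hits = Fin N → Label n → Bool

  bl₀ : Hits
  bl₀ s X = inh 0 (from (φ 0) s) X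

  bl₊ : ℕ → Perm N → Hits → Hits
  bl₊ j p bl s X = inh j t X ∨ (isAlive (st j t) ∧ bl (from p t) X)
    where t = from (φ j) s

  al₊ : ℕ → Perm N → (Fin N → Bool) → Fin N → Bool
  al₊ j p al s = isAlive (st j t) ∧ al (from p t)
    where t = from (φ j) s

  isAlive⇒ : ∀ {s} → isAlive s ≡ true → s ≡ alive
  isAlive⇒ {alive} _ = refl

  module Run (M : ℕ → Perm N) where
    BL : ℕ → Hits
    BL zero    = bl₀
    BL (suc j) = bl₊ (suc j) (M j) (BL j)

    -- Lists the labels of all arcs so far, whether or not the trail was alive there; `BL` selects
    -- among them.
    bv : ∀ j → Fin N → Fin (suc j) → Label n
    bv zero    s _       = lstat (st 0 (from (φ 0) s)) (vt (from (φ 0) s))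
    bv (suc j) s zero    = lstat (st (suc j) (from (φ (suc j)) s)) (vt (from (φ (suc j)) s))
    bv (suc j) s (suc k) = bv j (from (M j) (from (φ (suc j)) s)) k

    BL-label : ∀ j s X → BL j s X ≡ true → ∃ λ k → bv j s k ≡ X
    BL-label zero s X h = zero , ostat-label (st 0 (from (φ 0) s)) _ X h
    BL-label (suc j) s X h with ∨-true {inh (suc j) (from (φ (suc j)) s) X} h
    ... | inj₁ a = zero , ostat-label (st (suc j) (from (φ (suc j)) s)) _ X a
    ... | inj₂ b with BL-label j _ X (proj₂ (∧-true {isAlive (st (suc j) (from (φ (suc j)) s))} b))
    ...   | k , e = suc k , e

    -- slot of departure at level 0 ↦ slot of arrival at level j
    cur : ℕ → Perm N
    cur zero    = φ 0
    cur (suc j) = φ (suc j) ∘ᴾ (M j ∘ᴾ cur j)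

    alv : ℕ → Fin N → Bool
    alv zero    s = isAlive (st 0 (from (φ 0) s))
    alv (suc j)   = al₊ (suc j) (M j) (alv j)

    after : ℕ → Fin N → Fin N
    after j i = to (M j) (to (φ j) i)

    fl : ℕ → ℕ → Hits
    fl zero    j i X = oh j i X
    fl (suc r) j i X = oh j i X ∨ (isAlive (st j i) ∧ fl r (suc j) (after j i) X)

    data Alive : ℕ → Fin N → ℕ → Fin N → Set where
      one  : ∀ {j i} → st j i ≡ alive → Alive j i j i
      cons : ∀ {j i k i'} → st j i ≡ alive → Alive (suc j) (after j i) k i' → Alive j i k i'

-- The premises of `disjoint-options` and `Disperse` for one joining: `q` options in groups of size
-- `sz j`, families of `sz (suc j)` members, `sz j + sz j` families meeting a group, and
-- `suc (suc j)` labels for each of its slots.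
record Room (sz : ℕ → ℕ) (T' j : ℕ) : Set where
  field
    q     : ℕ
    room  : 2 * ((suc j + suc T') + q) ≤ sz j
    1≤q   : 1 ≤ q
    1≤Δ   : 1 ≤ (sz j + sz j) * (sz (suc j) ^ suc T' * (sz j * suc (suc j)))
    small : 4 * ((suc T') ^ suc T' * (suc T' * ((sz j + sz j) * (sz (suc j) ^ suc T' * (sz j * suc (suc j)))))) ≤ q ^ suc T'

module Levels {N n : ℕ} (vt : Fin N → Fin n) (φ : ℕ → Perm N) (st : ℕ → Fin N → Status)
  (sz : ℕ → ℕ) (gs : ∀ j → Grouping N (sz j)) (T' : ℕ)
  (gvt : ∀ j s s' → Grouping.gr (gs j) s ≡ Grouping.gr (gs j) s' → vt s ≡ vt s')
  (simple : ∀ j i i' → st j i ≡ alive → st j i' ≡ alive → vt i ≡ vt i' → vt (to (φ j) i) ≡ vt (to (φ j) i') → i ≡ i')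
  (virtT : ∀ r j i i' → st j i ≡ virt → st j i' ≡ virt → Grouping.gr (gs r) i ≡ Grouping.gr (gs r) i' → i ≡ i')
  (virtH : ∀ r j i i' → st j i ≡ virt → st j i' ≡ virt → Grouping.gr (gs r) (to (φ j) i) ≡ Grouping.gr (gs r) (to (φ j) i') → i ≡ i')
  where

  open Slots vt φ st public

  private
    both : ∀ s s' v v' X → ostat s v X ≡ true → ostat s' v' X ≡ true →
           (s ≡ alive × s' ≡ alive × v ≡ v') ⊎ (s ≡ virt × s' ≡ virt)
    both alive alive v v' X a b = inj₁ (refl , refl , MP.just-injective (trans (eqL⇒ (just v) X a) (sym (eqL⇒ (just v') X b))))
    both virt virt v v' X a b = inj₂ (refl , refl)
    both alive virt v v' X a b with trans (eqL⇒ (just v) X a) (sym (eqL⇒ nothing X b))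
    ... | ()
    both virt alive v v' X a b with trans (eqL⇒ (just v') X b) (sym (eqL⇒ nothing X a))
    ... | ()

  -- Here simplicity of the subgraph and rarity of the loops enter: among the arcs of one level
  -- leaving a group, which lies at a single vertex, no label occurs twice.
  oh-unique : ∀ r j i i' X → Grouping.gr (gs r) i ≡ Grouping.gr (gs r) i' → oh j i X ≡ true → oh j i' X ≡ true → i ≡ i'
  oh-unique r j i i' X g a b with both (st j i) (st j i') _ _ X a b
  ... | inj₁ (s , s' , e) = simple j i i' s s' (gvt r i i' g) e
  ... | inj₂ (s , s') = virtT r j i i' s s' g

  inh-unique : ∀ r j i i' X → Grouping.gr (gs r) (to (φ j) i) ≡ Grouping.gr (gs r) (to (φ j) i') → inh j i X ≡ true → inh j i' X ≡ true → i ≡ i'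
  inh-unique r j i i' X g a b with both (st j i) (st j i') _ _ X a b
  ... | inj₁ (s , s' , e) = simple j i i' s s' e (gvt r _ _ g)
  ... | inj₂ (s , s') = virtH r j i i' s s' g

  BackInv : ℕ → Hits → Set
  BackInv j bl = ∀ γ X → cnt (λ i → bl (Grouping.mk (gs j) γ i) X) ≤ suc T'

  -- `back` sorts the trails by their arrival at level `suc j`, `forth` by their departure at level
  -- 0. Both use the groups of size `sz (suc j)`, whereas the joining is made within the groups of
  -- size `sz j`.
  record StepOK (j : ℕ) (bl : Hits) (cu : Perm N) (al : Fin N → Bool) (p : Perm N) : Set where
    private
      module G = Grouping (gs j)
      module G' = Grouping (gs (suc j))
    field
      inGroup : ∀ s → G.gr (to p s) ≡ G.gr s
      avoids  : ∀ s → st (suc j) (to p s) ≡ alive → bl s (just (vt (to (φ (suc j)) (to p s)))) ≡ false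
      back    : BackInv (suc j) (bl₊ (suc j) p bl)
      forth   : ∀ γ X → cnt (λ i → al (to cu (G'.mk γ i)) ∧ oh (suc j) (to p (to cu (G'.mk γ i))) X) ≤ T'

  back₀ : BackInv 0 bl₀
  back₀ γ X = ℕP.≤-trans (cnt-unique _ (λ i i' a b → G.mk-inj γ i i' (from-inj (φ 0)
      (inh-unique 0 0 _ _ X (trans (cong G.gr (tf (φ 0) _)) (trans (G.gr-mk γ i) (sym (trans (cong G.gr (tf (φ 0) _)) (G.gr-mk γ i')))))
        a b)))) (s≤s z≤n)
    where module G = Grouping (gs 0)

  module Extend (j : ℕ) (bl : Hits) (bv : Fin N → Fin (suc j) → Label n) (bl-label : ∀ s X → bl s X ≡ true → ∃ λ k → bv s k ≡ X)
    (cu : Perm N) (al : Fin N → Bool) (inv : BackInv j bl) (q : ℕ)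
    (room : 2 * ((suc j + suc T') + q) ≤ sz j)
    (1≤q : 1 ≤ q)
    (1≤Δ : 1 ≤ (sz j + sz j) * (sz (suc j) ^ suc T' * (sz j * suc (suc j))))
    (small : 4 * ((suc T') ^ suc T' * (suc T' * ((sz j + sz j) * (sz (suc j) ^ suc T' * (sz j * suc (suc j)))))) ≤ q ^ suc T') where
    private
      h = sz j
      h' = sz (suc j)
      module G = Grouping (gs j)
      module G' = Grouping (gs (suc j))

      conf : Fin G.nG → Fin h → Fin h → Bool
      conf γ a b = isAlive (st (suc j) (G.mk γ b)) ∧ bl (G.mk γ a) (just (vt (to (φ (suc j)) (G.mk γ b))))

      alive-oh : ∀ t w → isAlive (st (suc j) t) ≡ true → vt (to (φ (suc j)) t) ≡ w → oh (suc j) t (just w) ≡ true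
      alive-oh t w h refl with st (suc j) t
      ... | alive = dec-true (MP.≡-dec _≟_ (just w) (just w)) refl

      -- The trail arriving at `a` has at most `suc j` labels, and each is the head of at most one
      -- alive arc leaving the group. In `cols`, conversely, the invariant says that the head of a
      -- given arc lies on at most `suc T'` arriving trails.
      rows : ∀ γ a → cnt (conf γ a) ≤ suc j + suc T'
      rows γ a = ℕP.≤-trans (cnt-cover (conf γ a) R 1 cov few)
          (ℕP.≤-trans (ℕP.≤-reflexive (ℕP.*-identityʳ (suc j))) (ℕP.m≤m+n _ _))
        where
        R : Fin (suc j) → Fin h → Bool
        R k b = isAlive (st (suc j) (G.mk γ b)) ∧ oh (suc j) (G.mk γ b) (bv (G.mk γ a) k)
        cov : ∀ b → conf γ a b ≡ true → ∃ λ k → R k b ≡ true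
        cov b h with ∧-true {isAlive (st (suc j) (G.mk γ b))} h
        ... | al , bl with bl-label _ _ bl
        ...   | k , e = k , ∧-intro al (trans (cong (oh (suc j) (G.mk γ b)) e) (alive-oh (G.mk γ b) _ al refl))
        few : ∀ k → cnt (R k) ≤ 1
        few k = cnt-unique (R k) (λ b b' x y → G.mk-inj γ b b' (oh-unique j (suc j) _ _ _
          (trans (G.gr-mk γ b) (sym (G.gr-mk γ b')))
          (proj₂ (∧-true {isAlive (st (suc j) (G.mk γ b))} x)) (proj₂ (∧-true {isAlive (st (suc j) (G.mk γ b'))} y))))

      cols : ∀ γ b → cnt (λ a → conf γ a b) ≤ suc j + suc T'
      cols γ b = ℕP.≤-trans (cnt-mono {p = λ a → conf γ a b} {q = λ a → bl (G.mk γ a) X} (λ a h → proj₂ (∧-true {isAlive (st (suc j) (G.mk γ b))} h)))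
          (ℕP.≤-trans (inv γ X) (ℕP.m≤n+m (suc T') (suc j)))
        where X = just (vt (to (φ (suc j)) (G.mk γ b)))

      opts : ∀ γ → _
      opts γ = disjoint-options (conf γ) (suc j + suc T') q (rows γ) (cols γ) room

      opt : Fin G.nG → Fin q → Perm h
      opt γ = proj₁ (opts γ)

      opt-disj : ∀ γ s s' a → to (opt γ s) a ≡ to (opt γ s') a → s ≡ s'
      opt-disj γ = proj₂ (proj₂ (opts γ))

      opt-disj⁻ : ∀ γ s s' b → from (opt γ s) b ≡ from (opt γ s') b → s ≡ s'
      opt-disj⁻ γ s s' b e = opt-disj γ s s' (from (opt γ s) b)
        (trans (tf (opt γ s) b) (sym (trans (cong (to (opt γ s')) e) (tf (opt γ s') b))))

      -- Families tagged `false` are groups of arrival at the next level, those tagged `true` groups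
      -- of departure at level 0. `port` is the slot at which a member passes through the present
      -- joining.
      F : Set
      F = Bool × Fin G'.nG

      port : F → Fin h' → Fin N
      port (false , γ') i = from (φ (suc j)) (G'.mk γ' i)
      port (true  , γ') i = to cu (G'.mk γ' i)

      grp : F → Fin h' → Fin G.nG
      grp f i = G.gr (port f i)

      bad : F → Fin h' → Label n → Fin q → Bool
      bad (false , γ') i X o = isAlive (st (suc j) t) ∧ bl (G.mk (G.gr t) (from (opt (G.gr t) o) (G.ps t))) X
        where t = port (false , γ') i
      bad (true , γ') i X o = al s ∧ oh (suc j) (G.mk (G.gr s) (to (opt (G.gr s) o) (G.ps s))) X
        where s = port (true , γ') i

      -- Different options join a slot to different partners, so a label is met backwards under at
      -- most `suc T'` options, by the invariant, and forwards under at most one, by `oh-unique`.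
      bad-few : ∀ f i X → cnt (bad f i X) ≤ suc T'
      bad-few (false , γ') i X = ℕP.≤-trans (cnt-inj {p = bad (false , γ') i X} {q = λ a → bl (G.mk γ a) X}
          (λ o → from (opt γ o) (G.ps t)) (λ o h → proj₂ (∧-true {isAlive (st (suc j) t)} h))
          (λ o o' _ _ e → opt-disj⁻ γ o o' (G.ps t) e)) (inv γ X)
        where t = port (false , γ') i
              γ = G.gr t
      bad-few (true , γ') i X = ℕP.≤-trans (cnt-unique (bad (true , γ') i X) (λ o o' x y →
          opt-disj γ o o' (G.ps s) (G.mk-inj γ _ _ (oh-unique j (suc j) _ _ X
            (trans (G.gr-mk γ _) (sym (G.gr-mk γ _))) (proj₂ (∧-true {al s} x)) (proj₂ (∧-true {al s} y)))))) (s≤s z≤n)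
        where s = port (true , γ') i
              γ = G.gr s

      fams : Fin G.nG → List F
      fams γ = tabulate (λ a → false , G'.gr (to (φ (suc j)) (G.mk γ a))) ++ tabulate (λ a → true , G'.gr (from cu (G.mk γ a)))

      fam-ok : ∀ f i → f ∈ fams (grp f i)
      fam-ok (false , γ') i = ∈-++⁺ˡ (subst (_∈ tabulate g) e (∈-tabulate⁺ {f = g} (G.ps t)))
        where
        t = port (false , γ') i
        g : Fin h → F
        g a = false , G'.gr (to (φ (suc j)) (G.mk (G.gr t) a))
        e : g (G.ps t) ≡ (false , γ')
        e = cong (false ,_) (trans (cong (λ s → G'.gr (to (φ (suc j)) s)) (G.mk-η t)) (trans (cong G'.gr (tf (φ (suc j)) _)) (G'.gr-mk γ' i)))
      fam-ok (true , γ') i = ∈-++⁺ʳ _ (subst (_∈ tabulate g) e (∈-tabulate⁺ {f = g} (G.ps t)))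
        where
        t = port (true , γ') i
        g : Fin h → F
        g a = true , G'.gr (from cu (G.mk (G.gr t) a))
        e : g (G.ps t) ≡ (true , γ')
        e = cong (true ,_) (trans (cong (λ s → G'.gr (from cu s)) (G.mk-η t)) (trans (cong G'.gr (ft cu _)) (G'.gr-mk γ' i)))

      fam-few : ∀ γ → length (fams γ) ≤ h + h
      fam-few γ = ℕP.≤-reflexive (trans (LP.length-++ (tabulate (λ a → false , G'.gr (to (φ (suc j)) (G.mk γ a)))))
        (cong₂ _+_ (LP.length-tabulate {n = h} _) (LP.length-tabulate {n = h} _)))

      slab : Fin N → Fin (suc (suc j)) → Label n
      slab s zero    = lstat (st (suc j) s) (vt (to (φ (suc j)) s))
      slab s (suc k) = bv s k

      labs : Fin G.nG → Fin (h * suc (suc j)) → Label n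
      labs γ k = slab (G.mk γ (proj₁ (remQuot {h} (suc (suc j)) k))) (proj₂ (remQuot {h} (suc (suc j)) k))

      labs-at : ∀ γ a k → labs γ (combine a k) ≡ slab (G.mk γ a) k
      labs-at γ a k = cong (λ r → slab (G.mk γ (proj₁ r)) (proj₂ r)) (FP.remQuot-combine {h} a k)

      module D = Disperse {T' = T'} grp fams fam-ok fam-few labs bad bad-few

      choice = D.choice 1≤q 1≤Δ small

      hit = D.hit 1≤q 1≤Δ small

      hit-unique : ∀ f X i i' → hit f X i ≡ true → hit f X i' ≡ true → grp f i ≡ grp f i' → i ≡ i'
      hit-unique (false , γ') X i i' x y g = G'.mk-inj γ' i i' (from-inj (φ (suc j)) (simple (suc j) _ _
        (isAlive⇒ (proj₁ (∧-true {isAlive (st (suc j) (port (false , γ') i))} x)))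
        (isAlive⇒ (proj₁ (∧-true {isAlive (st (suc j) (port (false , γ') i'))} y)))
        (gvt j _ _ g)
        (gvt (suc j) _ _ (trans (cong G'.gr (tf (φ (suc j)) _)) (trans (G'.gr-mk γ' i) (sym (trans (cong G'.gr (tf (φ (suc j)) _)) (G'.gr-mk γ' i'))))))))
      hit-unique (true , γ') X i i' x y g = G'.mk-inj γ' i i' (to-inj cu
          (trans (sym (G.mk-η s)) (trans (cong₂ G.mk g pe) (G.mk-η s'))))
        where
        s = port (true , γ') i
        s' = port (true , γ') i'
        o = λ γ → opt γ (lookup choice γ)
        same : G.mk (G.gr s) (to (o (G.gr s)) (G.ps s)) ≡ G.mk (G.gr s') (to (o (G.gr s')) (G.ps s'))
        same = oh-unique j (suc j) _ _ X (trans (G.gr-mk _ _) (trans g (sym (G.gr-mk _ _))))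
                 (proj₂ (∧-true {al s} x)) (proj₂ (∧-true {al s'} y))
        pe : G.ps s ≡ G.ps s'
        pe = to-inj (o (G.gr s')) (G.mk-inj (G.gr s') _ _ (trans (cong (λ γ → G.mk γ (to (o γ) (G.ps s))) (sym g)) same))

      hit-label : ∀ f X i → hit f X i ≡ true → ∃ λ k → labs (grp f i) k ≡ X
      hit-label (false , γ') X i x with bl-label _ X (proj₂ (∧-true {isAlive (st (suc j) (port (false , γ') i))} x))
      ... | k , e = _ , trans (labs-at _ _ (suc k)) e
      hit-label (true , γ') X i x = _ , trans (labs-at _ _ zero)
        (ostat-label (st (suc j) _) _ X (proj₂ (∧-true {al (port (true , γ') i)} x)))

      few-hits : ∀ f X → cnt (hit f X) ≤ T'
      few-hits f X = D.few-hits 1≤q 1≤Δ small f X (hit-unique f X) (hit-label f X)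

      μ : Fin G.nG → Perm h
      μ γ = opt γ (lookup choice γ)

    joined : Perm N
    joined = G.grouped μ

    stepOK : StepOK j bl cu al joined
    stepOK = record
      { inGroup = λ s → G.gr-mk (G.gr s) _
      ; avoids = avoids'
      ; back = back'
      ; forth = λ γ X → few-hits (true , γ) X }
      where
      avoids' : ∀ s → st (suc j) (to joined s) ≡ alive → bl s (just (vt (to (φ (suc j)) (to joined s)))) ≡ false
      avoids' s al = ¬t⇒f (λ t → t≢f (∧-intro (cong isAlive al)
          (trans (cong (λ z → bl z (just (vt (to (φ (suc j)) (to joined s))))) (G.mk-η s)) t))
          (proj₁ (proj₂ (opts (G.gr s))) (lookup choice (G.gr s)) (G.ps s)))
      back' : BackInv (suc j) (bl₊ (suc j) joined bl)
      -- One trail may carry `X` on its newest arc and `T'` trails on earlier ones: hence `suc T'`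
      -- in `BackInv`.
      back' γ X = ℕP.≤-trans (cnt-∨ (λ i → inh (suc j) (from (φ (suc j)) (G'.mk γ i)) X) (λ i → hit (false , γ) X i))
        (ℕP.+-mono-≤ (cnt-unique (λ i → inh (suc j) (from (φ (suc j)) (G'.mk γ i)) X) (λ i i' a b → G'.mk-inj γ i i' (from-inj (φ (suc j))
            (inh-unique (suc j) (suc j) _ _ X (trans (cong G'.gr (tf (φ (suc j)) _)) (trans (G'.gr-mk γ i) (sym (trans (cong G'.gr (tf (φ (suc j)) _)) (G'.gr-mk γ i'))))) a b))))
          (few-hits (false , γ) X))

  Step : (ℕ → Perm N) → ℕ → Set
  Step M j = StepOK j (Run.BL M j) (Run.cur M j) (Run.alv M j) (M j)

  private
    -- The data at level `j` depend only on the joinings below `j`, so appending a joining does not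
    -- spoil the earlier steps.
    agree : ∀ (M M' : ℕ → Perm N) j → (∀ i → i < j → M i ≡ M' i) →
            Run.BL M j ≡ Run.BL M' j × Run.cur M j ≡ Run.cur M' j × Run.alv M j ≡ Run.alv M' j
    agree M M' zero h = refl , refl , refl
    agree M M' (suc j) h with agree M M' j (λ i lt → h i (ℕP.m<n⇒m<1+n lt)) | h j (ℕP.n<1+n j)
    ... | a , b , c | e = cong₂ (bl₊ (suc j)) e a , cong₂ (λ p q → φ (suc j) ∘ᴾ (p ∘ᴾ q)) e b , cong₂ (al₊ (suc j)) e c

    step-subst : ∀ {j bl bl' cu cu' al al' p p'} → bl ≡ bl' × cu ≡ cu' × al ≡ al' → p ≡ p' →
                 StepOK j bl cu al p → StepOK j bl' cu' al' p'
    step-subst (refl , refl , refl) refl x = x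

    agree-step : ∀ (M M' : ℕ → Perm N) j → (∀ i → i < suc j → M i ≡ M' i) → Step M j → Step M' j
    agree-step M M' j h s = step-subst (agree M M' j (λ i lt → h i (ℕP.m<n⇒m<1+n lt))) (h j (ℕP.n<1+n j)) s

  extension : ∀ j bl (bv : Fin N → Fin (suc j) → Label n) → (∀ s X → bl s X ≡ true → ∃ λ k → bv s k ≡ X) →
    ∀ cu al → BackInv j bl → Room sz T' j → Σ[ p ∈ Perm N ] StepOK j bl cu al p
  extension j bl bv lb cu al inv r = Extend.joined j bl bv lb cu al inv q room 1≤q 1≤Δ small ,
                                     Extend.stepOK j bl bv lb cu al inv q room 1≤q 1≤Δ small
    where open Room r

  private
    snoc : ∀ κ M → (∀ j → j < κ → Step M j) → ∀ p → StepOK κ (Run.BL M κ) (Run.cur M κ) (Run.alv M κ) p →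
           Σ[ M' ∈ (ℕ → Perm N) ] (∀ j → j < suc κ → Step M' j)
    snoc κ M ok p sp = M' , ok'
      where
      M' : ℕ → Perm N
      M' i = if does (i ℕP.≟ κ) then p else M i
      M'κ : M' κ ≡ p
      M'κ = cong (if_then p else M κ) (dec-true (κ ℕP.≟ κ) refl)
      M'< : ∀ i → i < κ → M i ≡ M' i
      M'< i lt = sym (cong (if_then p else M i) (dec-false (i ℕP.≟ κ) (ℕP.<⇒≢ lt)))
      ok' : ∀ j → j < suc κ → Step M' j
      ok' j lt with ℕP.m<1+n⇒m<n∨m≡n lt
      ... | inj₁ l = agree-step M M' j (λ i li → M'< i (ℕP.≤-<-trans (ℕP.≤-pred li) l)) (ok j l)
      ... | inj₂ refl = step-subst (agree M M' κ M'<) (sym M'κ) sp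

  run : ∀ κ → (∀ j → j < κ → Room sz T' j) → Σ[ M ∈ (ℕ → Perm N) ] ((∀ j → j < κ → Step M j) × BackInv κ (Run.BL M κ))
  run zero _ = (λ _ → idP) , (λ _ ()) , back₀
  run (suc κ) rm = next (run κ (λ j lt → rm j (ℕP.m<n⇒m<1+n lt)))
    where
    next : Σ[ M ∈ (ℕ → Perm N) ] ((∀ j → j < κ → Step M j) × BackInv κ (Run.BL M κ)) →
           Σ[ M ∈ (ℕ → Perm N) ] ((∀ j → j < suc κ → Step M j) × BackInv (suc κ) (Run.BL M (suc κ)))
    next (M , ok , inv) with extension κ (Run.BL M κ) (Run.bv M κ) (Run.BL-label M κ) (Run.cur M κ) (Run.alv M κ) inv (rm κ (ℕP.n<1+n κ))
    ... | p , sp with snoc κ M ok p sp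
    ...   | M' , ok' = M' , ok' , StepOK.back (ok' κ (ℕP.n<1+n κ))

module _ {N h n : ℕ} (g : Grouping N h) (vt : Fin N → Fin n) where
  private module G = Grouping g

  cnt-groups : (P : Fin N → Bool) → cnt P ≡ sumF (λ γ → cnt (λ a → P (G.mk γ a)))
  cnt-groups P = trans (ℕP.≤-antisym
      (cnt-inj {p = P} {q = Q} (λ s → combine (G.gr s) (G.ps s))
        (λ s ps → trans (at (G.gr s) (G.ps s)) (trans (cong P (G.mk-η s)) ps))
        (λ s s' _ _ e → trans (sym (G.mk-η s)) (trans (cong₂ G.mk (FP.combine-injectiveˡ (G.gr s) (G.ps s) (G.gr s') (G.ps s') e) (FP.combine-injectiveʳ (G.gr s) (G.ps s) (G.gr s') (G.ps s') e)) (G.mk-η s'))))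
      (cnt-inj {p = Q} {q = P} (λ k → G.mk (proj₁ (remQuot {G.nG} h k)) (proj₂ (remQuot {G.nG} h k))) (λ k q → q)
        (λ k k' _ _ e → trans (sym (FP.combine-remQuot {G.nG} h k)) (trans (cong₂ combine (trans (sym (G.gr-mk _ _)) (trans (cong G.gr e) (G.gr-mk _ _))) (trans (sym (G.ps-mk _ _)) (trans (cong G.ps e) (G.ps-mk _ _)))) (FP.combine-remQuot {G.nG} h k')))))
    (trans (sum-combine G.nG {h} (λ k → ⟦ Q k ⟧)) (sum-cong (λ γ → cnt-cong (λ a → at γ a))))
    where
    Q : Fin (G.nG * h) → Bool
    Q k = P (G.mk (proj₁ (remQuot {G.nG} h k)) (proj₂ (remQuot {G.nG} h k)))
    at : ∀ γ a → Q (combine γ a) ≡ P (G.mk γ a)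
    at γ a = cong (λ r → P (G.mk (proj₁ r) (proj₂ r))) (FP.remQuot-combine {G.nG} γ a)

  -- Each group lies at a single vertex, so a bound for every group becomes the proportion `B / h`
  -- at every vertex, whatever its degree.
  group-ratio : (∀ s s' → G.gr s ≡ G.gr s' → vt s ≡ vt s') → (P : Fin N → Bool) (B : ℕ) →
    (∀ γ → cnt (λ a → P (G.mk γ a)) ≤ B) → ∀ v →
    h * cnt (λ s → eqb (vt s) v ∧ P s) ≤ B * cnt (λ s → eqb (vt s) v)
  group-ratio gvt P B le v = begin
    h * cnt (λ s → eqb (vt s) v ∧ P s)
      ≡⟨ cong (h *_) (cnt-groups (λ s → eqb (vt s) v ∧ P s)) ⟩
    h * sumF (λ γ → cnt (λ a → eqb (vt (G.mk γ a)) v ∧ P (G.mk γ a)))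
      ≡⟨ sum-* h (λ γ → cnt (λ a → eqb (vt (G.mk γ a)) v ∧ P (G.mk γ a))) ⟨
    sumF (λ γ → h * cnt (λ a → eqb (vt (G.mk γ a)) v ∧ P (G.mk γ a)))
      ≤⟨ sum-mono each ⟩
    sumF (λ γ → B * cnt (λ a → eqb (vt (G.mk γ a)) v))
      ≡⟨ sum-* B (λ γ → cnt (λ a → eqb (vt (G.mk γ a)) v)) ⟩
    B * sumF (λ γ → cnt (λ a → eqb (vt (G.mk γ a)) v))
      ≡⟨ cong (B *_) (cnt-groups (λ s → eqb (vt s) v)) ⟨
    B * cnt (λ s → eqb (vt s) v) ∎
    where
    open ℕP.≤-Reasoning
    each : ∀ γ → h * cnt (λ a → eqb (vt (G.mk γ a)) v ∧ P (G.mk γ a)) ≤ B * cnt (λ a → eqb (vt (G.mk γ a)) v)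
    each γ with find? (λ a → eqb (vt (G.mk γ a)) v)
    ... | inj₂ z = ℕP.≤-trans (ℕP.≤-reflexive (trans (cong (h *_) (cnt-zero (λ a → cong (_∧ P (G.mk γ a)) (z a)))) (ℕP.*-zeroʳ h))) z≤n
    ... | inj₁ (a₀ , e₀) = begin
      h * cnt (λ a → eqb (vt (G.mk γ a)) v ∧ P (G.mk γ a))
        ≤⟨ ℕP.*-monoʳ-≤ h (cnt-mono {q = λ a → P (G.mk γ a)} (λ a t → proj₂ (∧-true {eqb (vt (G.mk γ a)) v} t))) ⟩
      h * cnt (λ a → P (G.mk γ a))   ≤⟨ ℕP.*-monoʳ-≤ h (le γ) ⟩
      h * B                          ≡⟨ ℕP.*-comm h B ⟩
      B * h                          ≡⟨ cong (B *_) (trans (sum-const h 1) (ℕP.*-identityʳ h)) ⟨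
      B * cnt {h} (λ _ → true)       ≡⟨ cong (B *_) (cnt-cong (λ a → sym (trans (cong (λ u → eqb u v) (gvt _ _ (trans (G.gr-mk γ a) (sym (G.gr-mk γ a₀))))) e₀))) ⟩
      B * cnt (λ a → eqb (vt (G.mk γ a)) v) ∎

record TrailSystem {N n : ℕ} (vt : Fin N → Fin n) (φ : ℕ → Perm N) (st : ℕ → Fin N → Status) (κ x K : ℕ) : Set where
  field
    M : ℕ → Perm N
  open Slots vt φ st
  open Run M
  field
    M-vt    : ∀ j → j < κ → ∀ s → vt (to (M j) s) ≡ vt s
    acyclic : ∀ {j i k i'} → Alive j i k i' → k ≤ κ → vt (to (φ k) i') ≢ vt i
    few-f   : ∀ v X → x * cnt (λ i → eqb (vt i) v ∧ fl κ 0 i X) ≤ K * cnt (λ i → eqb (vt i) v)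
    few-b   : ∀ v X → x * cnt (λ s → eqb (vt s) v ∧ BL κ s X) ≤ K * cnt (λ s → eqb (vt s) v)

module _ {N n : ℕ} (vt : Fin N → Fin n) (φ : ℕ → Perm N) (st : ℕ → Fin N → Status)
  (sz : ℕ → ℕ) (gs : ∀ j → Grouping N (sz j)) (T' : ℕ)
  (gvt : ∀ j s s' → Grouping.gr (gs j) s ≡ Grouping.gr (gs j) s' → vt s ≡ vt s')
  (nest : ∀ j s s' → Grouping.gr (gs (suc j)) s ≡ Grouping.gr (gs (suc j)) s' → Grouping.gr (gs j) s ≡ Grouping.gr (gs j) s')
  (noloop : ∀ j i → st j i ≡ alive → vt (to (φ j) i) ≢ vt i)
  (simple : ∀ j i i' → st j i ≡ alive → st j i' ≡ alive → vt i ≡ vt i' → vt (to (φ j) i) ≡ vt (to (φ j) i') → i ≡ i')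
  (virtT : ∀ r j i i' → st j i ≡ virt → st j i' ≡ virt → Grouping.gr (gs r) i ≡ Grouping.gr (gs r) i' → i ≡ i')
  (virtH : ∀ r j i i' → st j i ≡ virt → st j i' ≡ virt → Grouping.gr (gs r) (to (φ j) i) ≡ Grouping.gr (gs r) (to (φ j) i') → i ≡ i')
  where
  private
    module Lv = Levels vt φ st sz gs T' gvt simple virtT virtH
    open Slots vt φ st

    nest* : ∀ j k → j ≤ k → ∀ s s' → Grouping.gr (gs k) s ≡ Grouping.gr (gs k) s' → Grouping.gr (gs j) s ≡ Grouping.gr (gs j) s'
    nest* j zero z≤n s s' e = e
    nest* j (suc k) le s s' e with ℕP.m≤n⇒m<n∨m≡n le
    ... | inj₁ lt = nest* j k (ℕP.≤-pred lt) s s' (nest k s s' e)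
    ... | inj₂ refl = e

    -- The forward bound of a level speaks of the groups of that level, while all levels are added
    -- up in the groups of level `κ`; a finer group lies inside a coarser one.
    refine : ∀ j k → j ≤ k → (P : Fin N → Bool) (c : ℕ) → (∀ γ → cnt (λ a → P (Grouping.mk (gs j) γ a)) ≤ c) →
             ∀ γ → cnt (λ a → P (Grouping.mk (gs k) γ a)) ≤ c
    refine j k le P c h γ with find? (λ a → P (Grouping.mk (gs k) γ a))
    ... | inj₂ z = ℕP.≤-trans (ℕP.≤-reflexive (cnt-zero z)) z≤n
    ... | inj₁ (a₀ , _) = ℕP.≤-trans (cnt-inj {p = λ a → P (K.mk γ a)} {q = λ b → P (J.mk γ' b)} (λ a → J.ps (K.mk γ a))
        (λ a pa → trans (cong P (back a)) pa)
        (λ a a' _ _ e → K.mk-inj γ a a' (trans (sym (back a)) (trans (cong (J.mk γ') e) (back a'))))) (h γ')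
      where
      module J = Grouping (gs j)
      module K = Grouping (gs k)
      γ' = J.gr (K.mk γ a₀)
      back : ∀ a → J.mk γ' (J.ps (K.mk γ a)) ≡ K.mk γ a
      back a = trans (cong (λ z → J.mk z (J.ps (K.mk γ a))) (nest* j k le _ _ (trans (K.gr-mk γ a₀) (sym (K.gr-mk γ a))))) (J.mk-η _)

    alive-oh : ∀ j i → st j i ≡ alive → inh j i (just (vt i)) ≡ true
    alive-oh j i e rewrite e = dec-true (MP.≡-dec _≟_ (just (vt i)) (just (vt i))) refl

  module _ (κ : ℕ) (M : ℕ → Perm N) (ok : ∀ j → j < κ → Lv.Step M j) (inv : Lv.BackInv κ (Run.BL M κ)) where
    private
      open module R = Run M

      own : ∀ j i → st j i ≡ alive → BL j (to (φ j) i) (just (vt i)) ≡ true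
      own zero i e rewrite ft (φ 0) i = alive-oh 0 i e
      own (suc j) i e rewrite ft (φ (suc j)) i = ∨-introˡ (alive-oh (suc j) i e)

      -- A vertex `w` on the alive part of a trail stays on its record while the trail is alive, so
      -- `avoids` keeps every later head away from `w`.
      next : ∀ {j i k i'} w s → BL j s (just w) ≡ true → i ≡ to (M j) s → Alive (suc j) i k i' → k ≤ κ → vt (to (φ k) i') ≢ w
      next {j} w s h refl (one al) le refl = t≢f h (Lv.StepOK.avoids (ok j le) s al)
      next {j} {i} w s h refl (cons al rest) le =
        next w (to (φ (suc j)) i) (∨-introʳ {inh (suc j) (from (φ (suc j)) (to (φ (suc j)) i)) (just w)} more) refl rest le
        where
        more : isAlive (st (suc j) (from (φ (suc j)) (to (φ (suc j)) i))) ∧ BL j (from (M j) (from (φ (suc j)) (to (φ (suc j)) i))) (just w) ≡ true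
        more rewrite ft (φ (suc j)) i | al | ft (M j) s = h

      acyclic' : ∀ {j i k i'} → Alive j i k i' → k ≤ κ → vt (to (φ k) i') ≢ vt i
      acyclic' (one al) le = noloop _ _ al
      acyclic' {j} {i} (cons al rest) le = next (vt i) (to (φ j) i) (own j i al) refl rest le

      tslot : ℕ → Fin N → Fin N
      tslot zero    i = i
      tslot (suc j) i = to (M j) (to (cur j) i)

      before : ℕ → Fin N → Bool
      before zero    i = true
      before (suc j) i = alv j (to (cur j) i)

      R : Label n → ℕ → Fin N → Bool
      R X j i = before j i ∧ oh j (tslot j i) X

      cur-tslot : ∀ j i → to (cur j) i ≡ to (φ j) (tslot j i)
      cur-tslot zero    i = refl
      cur-tslot (suc j) i = refl

      before-suc : ∀ j i → before j i ≡ true → isAlive (st j (tslot j i)) ≡ true → before (suc j) i ≡ true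
      before-suc zero    i b a rewrite ft (φ 0) i = a
      before-suc (suc j) i b a rewrite ft (φ (suc j)) (to (M j) (to (cur j) i)) | ft (M j) (to (cur j) i) = ∧-intro a b

      fl-split : ∀ X r j i → before j i ≡ true → fl r j (tslot j i) X ≡ true → ∃ λ j' → j' ≤ j + r × R X j' i ≡ true
      fl-split X zero j i b h = j , ℕP.m≤m+n j 0 , ∧-intro b h
      fl-split X (suc r) j i b h with ∨-true {oh j (tslot j i) X} h
      ... | inj₁ o = j , ℕP.m≤m+n j (suc r) , ∧-intro b o
      ... | inj₂ o with ∧-true {isAlive (st j (tslot j i))} o
      ...   | a , f with fl-split X r (suc j) i (before-suc j i b a) (trans (cong (λ z → fl r (suc j) (to (M j) z) X) (cur-tslot j i)) f)
      ...     | j' , le , rr = j' , ℕP.≤-trans le (ℕP.≤-reflexive (sym (ℕP.+-suc j r))) , rr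

      R-few : ∀ X j → j ≤ κ → ∀ γ → cnt (λ a → R X j (Grouping.mk (gs κ) γ a)) ≤ suc T'
      R-few X zero le γ = ℕP.≤-trans (cnt-unique (λ a → R X 0 (G.mk γ a)) (λ a a' p q → G.mk-inj γ a a'
          (Lv.oh-unique κ 0 _ _ X (trans (G.gr-mk γ a) (sym (G.gr-mk γ a'))) p q))) (s≤s z≤n)
        where module G = Grouping (gs κ)
      R-few X (suc j) le γ = ℕP.m≤n⇒m≤1+n (refine (suc j) κ le (R X (suc j)) T' (λ γ' → Lv.StepOK.forth (ok j le) γ' X) γ)

      fl-few : ∀ X γ → cnt (λ a → fl κ 0 (Grouping.mk (gs κ) γ a) X) ≤ suc κ * suc T'
      fl-few X γ = cnt-cover (λ a → fl κ 0 (G.mk γ a) X) (λ (k : Fin (suc κ)) a → R X (toℕ k) (G.mk γ a)) (suc T') cov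
          (λ k → R-few X (toℕ k) (ℕP.≤-pred (FP.toℕ<n k)) γ)
        where
        module G = Grouping (gs κ)
        cov : ∀ a → fl κ 0 (G.mk γ a) X ≡ true → ∃ λ (k : Fin (suc κ)) → R X (toℕ k) (G.mk γ a) ≡ true
        cov a h with fl-split X κ 0 (G.mk γ a) refl h
        ... | j' , le , r = fromℕ< (s≤s le) , trans (cong (λ z → R X z (G.mk γ a)) (FP.toℕ-fromℕ< (s≤s le))) r

    trail-system : TrailSystem vt φ st κ (sz κ) (suc κ * suc T')
    trail-system = record
      { M = M
      ; M-vt = λ j lt s → gvt j _ _ (Lv.StepOK.inGroup (ok j lt) s)
      ; acyclic = acyclic'
      ; few-f = λ v X → group-ratio (gs κ) vt (gvt κ) (λ i → fl κ 0 i X) _ (fl-few X) v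
      ; few-b = λ v X → group-ratio (gs κ) vt (gvt κ) (λ s → BL κ s X) _ (λ γ → ℕP.≤-trans (inv γ X) (ℕP.m≤m+n (suc T') _)) v }

  trails : ∀ κ → (∀ j → j < κ → Room sz T' j) → TrailSystem vt φ st κ (sz κ) (suc κ * suc T')
  trails κ rm with Lv.run κ rm
  ... | M , ok , inv = trail-system κ M ok inv

-- Pairing the ends of trails and links

isVirt : Status → Bool
isVirt virt  = true
isVirt alive = false
isVirt dead  = false

isJust : ∀ {A : Set} → Maybe A → Bool
isJust (just _) = true
isJust nothing  = false

if-true : ∀ {b x y} → (if b then x else y) ≡ true → (b ≡ true × x ≡ true) ⊎ (b ≡ false × y ≡ true)
if-true {true}  h = inj₁ (refl , h)
if-true {false} h = inj₂ (refl , h)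

both-true : ∀ {a b} → a ≡ true → b ≡ true → 1 ≤ ⟦ a ⟧ * ⟦ b ⟧
both-true refl refl = ℕP.≤-refl

≤⇒suc : ∀ {a b} → suc a ≤ b → ∃ λ j → b ≡ suc j
≤⇒suc {b = suc j} _ = j , refl

-- The arcs outside Z lie on the trails of a trail system, which are cut at the auxiliary
-- loops; on Z the permutation πZ is followed except where fZ fails.
record Parts (m n N : ℕ) : Set where
  field
    tl hd : Fin m → Fin n
    S Z : Fin m → Bool
    vt : Fin N → Fin n
    φ : ℕ → Perm N
    st : ℕ → Fin N → Status
    κ x K : ℕ
    T : TrailSystem vt φ st κ x K
    lv : Fin m → ℕ
    sl : Fin m → Fin N
    lv≤ : ∀ e → Z e ≡ false → lv e ≤ κ
    sl-tl : ∀ e → Z e ≡ false → vt (sl e) ≡ tl e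
    sl-hd : ∀ e → Z e ≡ false → vt (to (φ (lv e)) (sl e)) ≡ hd e
    sl-st : ∀ e → Z e ≡ false → st (lv e) (sl e) ≡ (if S e then alive else dead)
    sl-inj : ∀ e e' → Z e ≡ false → Z e' ≡ false → lv e ≡ lv e' → sl e ≡ sl e' → e ≡ e'
    arc : ∀ j i → j ≤ κ → isVirt (st j i) ≡ false → ∃ λ e → Z e ≡ false × lv e ≡ j × sl e ≡ i
    rv : Fin n → ℕ
    virt-out : ∀ v → sumF {suc κ} (λ j → cnt (λ i → isVirt (st (toℕ j) i) ∧ eqb (vt i) v)) ≤ rv v
    virt-in : ∀ v → sumF {suc κ} (λ j → cnt (λ i → isVirt (st (toℕ j) i) ∧ eqb (vt (to (φ (toℕ j)) i)) v)) ≤ rv v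
    πZ : Perm m
    fZ : Fin m → Bool
    cz : ℕ
    πZ-Z : ∀ e → Z (to πZ e) ≡ Z e
    πZ-ok : ∀ e → Z e ≡ true → tl (to πZ e) ≡ hd e
    fZ-short : ∀ e → Z e ≡ true → fZ e ≡ true → fZ (to πZ e) ≡ false
    fZ-path : ∀ e → Z e ≡ true → fZ e ≡ true → S e ≡ true → S (to πZ e) ≡ true → hd (to πZ e) ≢ tl e
    noloop : ∀ e → S e ≡ true → hd e ≢ tl e
    fZ-few : ∀ v → cnt (λ e → Z e ∧ (not (fZ e) ∧ eqb (hd e) v)) ≤ cz
    fZ-at : ∀ v → ∃ λ e → Z e ≡ true × fZ e ≡ false × hd e ≡ v
    e₀ : Fin m
    single : ∀ e → Z e ≡ true → orbit πZ e₀ e ≡ true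
    e₀-Z : Z e₀ ≡ true
    inout : ∀ v → fib _≟_ hd v ≡ fib _≟_ tl v
    ℓ : ℕ
    ℓ≤ : ℓ ≤ suc κ
    1≤x : 1 ≤ x
    -- Four times the number of conflicts plus two, for the exchanges, plus `rv v` for the slots at
    -- `v` that are entered at level `κ` by a loop.
    room : ∀ v → 4 * (suc ℓ * (DM._/_ (K * cnt (λ i → eqb (vt i) v)) x {{>-nonZero 1≤x}}) + (rv v + cz)) + 2 + rv v ≤ cnt (λ i → eqb (vt i) v)

module Assembly {m n N : ℕ} (input : Parts m n N) where
  open Parts input

  open TrailSystem T
  open Slots vt φ st
  open Run M
  private
    c Bd : Fin n → ℕ
    c v = cnt (λ i → eqb (vt i) v)
    Bd v = DM._/_ (K * c v) x {{>-nonZero 1≤x}}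

    nslot : Fin m → Fin N
    nslot e = after (lv e) (sl e)

    -- A view of the partial transition map. The value `nothing` occurs at a cut of `Z`, at the end
    -- of the last level and in front of an auxiliary loop; exactly these transitions are
    -- exchangeable.
    data NX (e : Fin m) : Maybe (Fin m) → Set where
      Zfix  : Z e ≡ true → fZ e ≡ true → NX e (just (to πZ e))
      Zcut  : Z e ≡ true → fZ e ≡ false → NX e nothing
      Rfix  : ∀ {e'} → Z e ≡ false → lv e < κ → Z e' ≡ false → lv e' ≡ suc (lv e) → sl e' ≡ nslot e → NX e (just e')
      Rlast : Z e ≡ false → lv e ≡ κ → NX e nothing
      Rvirt : Z e ≡ false → lv e < κ → isVirt (st (suc (lv e)) (nslot e)) ≡ true → NX e nothing

    nxv : ∀ e → Σ (Maybe (Fin m)) (NX e)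
    nxv e with Z e in ze
    ... | true with fZ e in fe
    ...   | true = just (to πZ e) , Zfix ze fe
    ...   | false = nothing , Zcut ze fe
    nxv e | false with ℕP.m≤n⇒m<n∨m≡n (lv≤ e ze)
    ...   | inj₂ eq = nothing , Rlast ze eq
    ...   | inj₁ lt with isVirt (st (suc (lv e)) (nslot e)) in vv
    ...     | true = nothing , Rvirt ze lt vv
    ...     | false with arc (suc (lv e)) (nslot e) lt vv
    ...       | e' , ze' , le' , se' = just e' , Rfix ze lt ze' le' se'

    nx : Fin m → Maybe (Fin m)
    nx e = proj₁ (nxv e)

    view : ∀ e {r} → nx e ≡ r → NX e r
    view e refl = proj₂ (nxv e)

    real : ∀ e → Z e ≡ false → isVirt (st (lv e) (sl e)) ≡ false
    real e ze rewrite sl-st e ze with S e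
    ... | true = refl
    ... | false = refl

    nx-R : ∀ e e' → Z e ≡ false → Z e' ≡ false → lv e < κ → lv e' ≡ suc (lv e) → sl e' ≡ nslot e → nx e ≡ just e'
    nx-R e e' ze ze' lt le se = go (proj₁ (nxv e)) (proj₂ (nxv e))
      where
      go : ∀ r → NX e r → r ≡ just e'
      go _ (Zfix a _) = ⊥-elim (t≢f a ze)
      go _ (Zcut a _) = ⊥-elim (t≢f a ze)
      go _ (Rfix _ _ z l s) = cong just (sl-inj _ _ z ze' (trans l (sym le)) (trans s (sym se)))
      go _ (Rlast _ l) = ⊥-elim (ℕP.<⇒≢ lt l)
      go _ (Rvirt _ _ v) = ⊥-elim (t≢f (subst₂ (λ j i → isVirt (st j i) ≡ true) (sym le) (sym se) v) (real e' ze'))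

    nx-Z : ∀ w z → Z z ≡ true → to πZ w ≡ z → fZ w ≡ true → nx w ≡ just z
    nx-Z w z zz refl f = go (proj₁ (nxv w)) (proj₂ (nxv w))
      where
      zw : Z w ≡ true
      zw = trans (sym (πZ-Z w)) zz
      go : ∀ r → NX w r → r ≡ just (to πZ w)
      go _ (Zfix _ _) = refl
      go _ (Zcut _ a) = ⊥-elim (t≢f f a)
      go _ (Rfix a _ _ _ _) = ⊥-elim (t≢f zw a)
      go _ (Rlast a _) = ⊥-elim (t≢f zw a)
      go _ (Rvirt a _ _) = ⊥-elim (t≢f zw a)

    nx-ok : ∀ e e' → nx e ≡ just e' → tl e' ≡ hd e
    nx-ok e e' h with view e h
    ... | Zfix z f = πZ-ok e z
    ... | Rfix z lt z' l s = trans (sym (sl-tl e' z')) (trans (cong vt s) (trans (M-vt (lv e) lt _) (sl-hd e z)))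

    after-inj : ∀ j {i i'} → after j i ≡ after j i' → i ≡ i'
    after-inj j h = to-inj (φ j) (to-inj (M j) h)

    nx-inj : ∀ e₁ e₂ e' → nx e₁ ≡ just e' → nx e₂ ≡ just e' → e₁ ≡ e₂
    nx-inj e₁ e₂ e' h₁ h₂ = go (view e₁ h₁) (view e₂ h₂)
      where
      go : NX e₁ (just e') → NX e₂ (just e') → e₁ ≡ e₂
      go (Zfix z₁ _) w₂ = zz w₂ refl
        where zz : ∀ {r} → NX e₂ (just r) → r ≡ to πZ e₁ → e₁ ≡ e₂
              zz (Zfix _ _) q = to-inj πZ (sym q)
              zz (Rfix _ _ z' _ _) refl = ⊥-elim (t≢f (trans (πZ-Z e₁) z₁) z')
      go (Rfix z₁ _ z' l₁ s₁) w₂ = zz w₂ refl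
        where zz : ∀ {r} → NX e₂ (just r) → r ≡ e' → e₁ ≡ e₂
              zz (Zfix z₂ _) refl = ⊥-elim (t≢f (trans (πZ-Z e₂) z₂) z')
              zz (Rfix z₂ _ _ l₂ s₂) refl = sl-inj e₁ e₂ z₁ z₂ ll (after-inj (lv e₁) (trans (sym s₁) (trans s₂ (cong (λ j → after j (sl e₂)) (sym ll)))))
                where ll : lv e₁ ≡ lv e₂
                      ll = ℕP.suc-injective (trans (sym l₁) l₂)

    next-R : ∀ w z → NX w (just z) → Z w ≡ false → Z z ≡ false × lv w < κ × lv z ≡ suc (lv w) × sl z ≡ nslot w
    next-R w _ (Zfix a _) zw = ⊥-elim (t≢f a zw)
    next-R w z (Rfix _ lt z' l s) _ = z' , lt , l , s

    prev-R : ∀ w z → NX w (just z) → Z z ≡ false → Z w ≡ false × lv w < κ × lv z ≡ suc (lv w) × sl z ≡ nslot w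
    prev-R w _ (Zfix a _) zz = ⊥-elim (t≢f (trans (πZ-Z w) a) zz)
    prev-R w z (Rfix zw lt _ l s) _ = zw , lt , l , s

    end-R : ∀ z → NX z nothing → Z z ≡ false → lv z ≡ κ ⊎ (lv z < κ × isVirt (st (suc (lv z)) (nslot z)) ≡ true)
    end-R z (Zcut a _) zz = ⊥-elim (t≢f a zz)
    end-R z (Rlast _ l) _ = inj₁ l
    end-R z (Rvirt _ lt v) _ = inj₂ (lt , v)

    next-Z : ∀ w z → NX w (just z) → Z w ≡ true → fZ w ≡ true × z ≡ to πZ w
    next-Z w _ (Zfix _ f) _ = f , refl
    next-Z w z (Rfix a _ _ _ _) zw = ⊥-elim (t≢f zw a)

    fx : Fin m → Bool
    fx e = isJust (nx e)

  module Core (π₀ : Perm m) (π₀-ok : ∀ e → tl (to π₀ e) ≡ hd e) (π₀-nx : ∀ e e' → nx e ≡ just e' → to π₀ e ≡ e') where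
   private
    fx⇒ : ∀ e → fx e ≡ true → nx e ≡ just (to π₀ e)
    fx⇒ e h with nx e in eq
    ... | just e' = cong just (sym (π₀-nx e e' eq))

    nx⇒fx : ∀ {e e'} → nx e ≡ just e' → fx e ≡ true
    nx⇒fx h = cong isJust h

    fx-false : ∀ e → fx e ≡ false → nx e ≡ nothing
    fx-false e h with nx e
    ... | nothing = refl

    module Jn = Junction tl hd S ℓ π₀ fx

    nx-jout : ∀ {w z} → nx w ≡ just z → fx (from π₀ z) ≡ true
    nx-jout {w} {z} h = trans (cong fx (trans (cong (from π₀) (sym (π₀-nx w z h))) (ft π₀ w))) (nx⇒fx h)

    st-alive : ∀ e → Z e ≡ false → S e ≡ true → st (lv e) (sl e) ≡ alive
    st-alive e z s = trans (sl-st e z) (cong (if_then alive else dead) s)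

    fw-alive : ∀ {j a b} → Z a ≡ false → Jn.FW j a b → Z b ≡ false × Alive (lv a) (sl a) (lv b) (sl b)
    fw-alive {a = a} za (Jn.one s) = za , one (st-alive a za s)
    fw-alive {a = a} {b} za (Jn.cons s f w) with next-R a (to π₀ a) (view a (fx⇒ a f)) za
    ... | z' , lt , l , s' with fw-alive z' w
    ...   | zb , al = zb , cons (st-alive a za s) (subst₂ (λ j i → Alive j i (lv b) (sl b)) l s' al)

    -- Frozen walks on `Z` have at most two arcs by `fZ-short`, and these do not close up.
    fw-Z : ∀ {j a b} → Z a ≡ true → Jn.FW j a b → hd b ≢ tl a
    fw-Z {a = a} za (Jn.one s) cl = noloop a s cl
    fw-Z {a = a} {b} za (Jn.cons s f w) cl with next-Z a (to π₀ a) (view a (fx⇒ a f)) za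
    ... | fz , e = go w e
      where
      go : ∀ {j a'} → Jn.FW j a' b → a' ≡ to πZ a → ⊥
      go (Jn.one s') refl = fZ-path a za fz s s' cl
      go (Jn.cons {a = a'} s' f' _) refl =
        t≢f (proj₁ (next-Z a' (to π₀ a') (view a' (fx⇒ a' f')) (trans (πZ-Z a) za))) (fZ-short a za fz)

    TG : ∀ j a b → j < ℓ → Jn.FW j a b → hd b ≢ tl a
    TG j a b lt w cl = go (Z a) refl
      where
      go : ∀ z → Z a ≡ z → ⊥
      go true za = fw-Z za w cl
      go false za with fw-alive za w
      ... | zb , al = acyclic al (lv≤ b zb) (trans (sl-hd b zb) (trans cl (sym (sl-tl a za))))

    -- If a proper arc arrived at the slot in front of `z`, the transition from it to `z` would be
    -- frozen.
    pred-virt : ∀ z j → Z z ≡ false → lv z ≡ suc j → fx (from π₀ z) ≡ false →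
                isVirt (st j (from (φ j) (from (M j) (sl z)))) ≡ true
    pred-virt z j zz lz nf with isVirt (st j (from (φ j) (from (M j) (sl z)))) in eq
    ... | true = refl
    ... | false with arc j (from (φ j) (from (M j) (sl z))) (ℕP.≤-trans (ℕP.n≤1+n j) (ℕP.≤-trans (ℕP.≤-reflexive (sym lz)) (lv≤ z zz))) eq
    ...   | w , zw , refl , sw = ⊥-elim (t≢f (nx-jout (nx-R w z zw zz (ℕP.≤-trans (ℕP.≤-reflexive (sym lz)) (lv≤ z zz)) lz
             (sym (trans (cong (λ i → to (M (lv w)) (to (φ (lv w)) i)) sw) (trans (cong (to (M (lv w))) (tf (φ (lv w)) _)) (tf (M (lv w)) _)))))) nf)

    -- Where a loop cuts the trail, the walk may continue anywhere. The label `nothing` therefore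
    -- counts as a hit of every `Y`, which turns `ℓ` into `suc ℓ` in `someY-count`.
    someY : Hits → (Fin n → Bool) → Fin N → Bool
    someY H Y i = H i nothing ∨ anyF (λ y → Y y ∧ H i (just y))

    someY-⋆ : ∀ H Y i → H i nothing ≡ true → someY H Y i ≡ true
    someY-⋆ H Y i h = ∨-introˡ h

    someY-y : ∀ H Y i y → Y y ≡ true → H i (just y) ≡ true → someY H Y i ≡ true
    someY-y H Y i y a b = ∨-introʳ {H i nothing} (anyF-intro (λ y → Y y ∧ H i (just y)) y (∧-intro a b))

    someY-mono : ∀ (H H' : Hits) Y i i' → (∀ X → H i X ≡ true → H' i' X ≡ true) → someY H Y i ≡ true → someY H' Y i' ≡ true
    someY-mono H H' Y i i' f h with ∨-true {H i nothing} h
    ... | inj₁ a = someY-⋆ H' Y i' (f nothing a)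
    ... | inj₂ b with anyF-elim (λ y → Y y ∧ H i (just y)) b
    ...   | y , p = someY-y H' Y i' y (proj₁ (∧-true p)) (f (just y) (proj₂ (∧-true {Y y} p)))

    someY-count : ∀ (H : Hits) v → (∀ X → cnt (λ i → eqb (vt i) v ∧ H i X) ≤ Bd v) → ∀ Y → cnt Y ≤ ℓ →
                  cnt (λ i → eqb (vt i) v ∧ someY H Y i) ≤ suc ℓ * Bd v
    someY-count H v few Y le = begin
      cnt (λ i → eqb (vt i) v ∧ someY H Y i)
        ≤⟨ cnt-mono {q = λ i → P₀ i ∨ P₁ i} (λ i h → sp i h) ⟩
      cnt (λ i → P₀ i ∨ P₁ i)                      ≤⟨ cnt-∨ P₀ P₁ ⟩
      cnt P₀ + cnt P₁                              ≤⟨ ℕP.+-mono-≤ (few nothing) P₁-few ⟩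
      Bd v + ℓ * Bd v                              ∎
      where
      open ℕP.≤-Reasoning
      P₀ P₁ : Fin N → Bool
      P₀ i = eqb (vt i) v ∧ H i nothing
      P₁ i = eqb (vt i) v ∧ anyF (λ y → Y y ∧ H i (just y))
      sp : ∀ i → eqb (vt i) v ∧ someY H Y i ≡ true → P₀ i ∨ P₁ i ≡ true
      sp i h with ∧-true {eqb (vt i) v} h
      ... | a , b with ∨-true {H i nothing} b
      ...   | inj₁ c = ∨-introˡ (∧-intro a c)
      ...   | inj₂ c = ∨-introʳ {P₀ i} (∧-intro a c)
      pt : ∀ i → ⟦ P₁ i ⟧ ≤ sumF (λ y → ⟦ Y y ⟧ * ⟦ eqb (vt i) v ∧ H i (just y) ⟧)
      pt i with P₁ i in eq
      ... | false = z≤n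
      ... | true with ∧-true {eqb (vt i) v} eq
      ...   | a , b with anyF-elim (λ y → Y y ∧ H i (just y)) b
      ...     | y , p = ℕP.≤-trans (both-true {Y y} (proj₁ (∧-true {Y y} p)) (∧-intro a (proj₂ (∧-true {Y y} p))))
                          (term≤sum (λ y → ⟦ Y y ⟧ * ⟦ eqb (vt i) v ∧ H i (just y) ⟧) y)
      P₁-few : cnt P₁ ≤ ℓ * Bd v
      P₁-few = begin
        cnt P₁                                                                   ≤⟨ sum-mono pt ⟩
        sumF (λ i → sumF (λ y → ⟦ Y y ⟧ * ⟦ eqb (vt i) v ∧ H i (just y) ⟧))       ≡⟨ sum-swap (λ i y → ⟦ Y y ⟧ * ⟦ eqb (vt i) v ∧ H i (just y) ⟧) ⟩
        sumF (λ y → sumF (λ i → ⟦ Y y ⟧ * ⟦ eqb (vt i) v ∧ H i (just y) ⟧))       ≡⟨ sum-cong (λ y → sum-* ⟦ Y y ⟧ (λ i → ⟦ eqb (vt i) v ∧ H i (just y) ⟧)) ⟩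
        sumF (λ y → ⟦ Y y ⟧ * cnt (λ i → eqb (vt i) v ∧ H i (just y)))            ≤⟨ sum-mono (λ y → ℕP.*-monoʳ-≤ ⟦ Y y ⟧ (few (just y))) ⟩
        sumF (λ y → ⟦ Y y ⟧ * Bd v)                                              ≡⟨ sum-cong (λ y → ℕP.*-comm ⟦ Y y ⟧ (Bd v)) ⟩
        sumF (λ y → Bd v * ⟦ Y y ⟧)                                              ≡⟨ sum-* (Bd v) (λ y → ⟦ Y y ⟧) ⟩
        Bd v * cnt Y                                                             ≤⟨ ℕP.*-monoʳ-≤ (Bd v) le ⟩
        Bd v * ℓ                                                                 ≡⟨ ℕP.*-comm (Bd v) ℓ ⟩
        ℓ * Bd v                                                                 ∎

    div-bound : ∀ {y v} → x * y ≤ K * c v → y ≤ Bd v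
    div-bound {y} {v} h = ℕP.≤-trans (ℕP.≤-reflexive (sym (trans (cong (λ u → DM._/_ u x {{>-nonZero 1≤x}}) (ℕP.*-comm x y)) (DM.m*n/n≡m y x {{>-nonZero 1≤x}}))))
                                     (DM./-monoˡ-≤ x {{>-nonZero 1≤x}} h)

    fl-oh : ∀ r j i X → oh j i X ≡ true → fl r j i X ≡ true
    fl-oh zero j i X h = h
    fl-oh (suc r) j i X h = ∨-introˡ h

    oh-alive : ∀ j i v → st j i ≡ alive → vt (to (φ j) i) ≡ v → oh j i (just v) ≡ true
    oh-alive j i v e refl rewrite e = dec-true (MP.≡-dec _≟_ (just v) (just v)) refl

    oh-virt : ∀ j i → isVirt (st j i) ≡ true → oh j i nothing ≡ true
    oh-virt j i e with st j i
    ... | virt = refl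

    inh-alive : ∀ j i v → st j i ≡ alive → vt i ≡ v → inh j i (just v) ≡ true
    inh-alive j i v e refl rewrite e = dec-true (MP.≡-dec _≟_ (just v) (just v)) refl

    inh-virt : ∀ j i → isVirt (st j i) ≡ true → inh j i nothing ≡ true
    inh-virt j i e with st j i
    ... | virt = refl

    -- By `k ≤ suc r` the walk is too short to run beyond level `κ`. An exchangeable transition with
    -- arcs still to come thus lies in front of a loop, which `fl` records as `nothing`.
    hitF-fl : ∀ k z Y → Z z ≡ false → ∀ r → lv z + r ≡ κ → k ≤ suc r → Jn.hitF k z Y ≡ true → someY (fl r (lv z)) Y (sl z) ≡ true
    hitF-fl₊ : ∀ k z Y → Z z ≡ false → S z ≡ true → ∀ r → lv z + r ≡ κ → k ≤ r →
      (fx z ≡ true × Jn.hitF k (to π₀ z) Y ≡ true) ⊎ (fx z ≡ false × pos k ≡ true) → someY (fl r (lv z)) Y (sl z) ≡ true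
    hitF-fl (suc k) z Y zz r eq (s≤s le) h with ∧-true {S z} h
    ... | s , h' with ∨-true {Y (hd z)} h'
    ...   | inj₁ y = someY-y (fl r (lv z)) Y (sl z) (hd z) y (fl-oh r (lv z) (sl z) _ (oh-alive (lv z) (sl z) (hd z) (st-alive z zz s) (sl-hd z zz)))
    ...   | inj₂ q = hitF-fl₊ k z Y zz s r eq le (if-true q)
    hitF-fl₊ zero z Y zz s r eq le (inj₁ (_ , ()))
    hitF-fl₊ zero z Y zz s r eq le (inj₂ (_ , ()))
    hitF-fl₊ (suc k) z Y zz s (suc r) eq le (inj₁ (fz , q)) with next-R z (to π₀ z) (view z (fx⇒ z fz)) zz
    ... | z' , lt , l , s' =
      someY-mono (fl r (lv (to π₀ z))) (fl (suc r) (lv z)) Y (sl (to π₀ z)) (sl z) up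
        (hitF-fl (suc k) (to π₀ z) Y z' r (trans (cong (_+ r) l) (trans (sym (ℕP.+-suc (lv z) r)) eq)) le q)
      where
      up : ∀ X → fl r (lv (to π₀ z)) (sl (to π₀ z)) X ≡ true → fl (suc r) (lv z) (sl z) X ≡ true
      up X g = ∨-introʳ {oh (lv z) (sl z) X} (∧-intro (cong isAlive (st-alive z zz s)) (subst₂ (λ j i → fl r j i X ≡ true) l s' g))
    hitF-fl₊ (suc k) z Y zz s (suc r) eq le (inj₂ (fz , q)) with end-R z (view z (fx-false z fz)) zz
    ... | inj₁ l = ⊥-elim (ℕP.m≢1+m+n (lv z) (trans l (trans (sym eq) (ℕP.+-suc (lv z) r))))
    ... | inj₂ (_ , vv) = someY-⋆ (fl (suc r) (lv z)) Y (sl z) (∨-introʳ {oh (lv z) (sl z) nothing}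
            (∧-intro (cong isAlive (st-alive z zz s)) (fl-oh r (suc (lv z)) (nslot z) nothing (oh-virt (suc (lv z)) (nslot z) vv))))

    hsl : Fin m → Fin N
    hsl e = to (φ (lv e)) (sl e)

    BL-own : ∀ j i X → inh j i X ≡ true → BL j (to (φ j) i) X ≡ true
    BL-own zero i X h rewrite ft (φ 0) i = h
    BL-own (suc j) i X h rewrite ft (φ (suc j)) i = ∨-introˡ h

    BL-prev : ∀ j i X → isAlive (st (suc j) i) ≡ true → BL j (from (M j) i) X ≡ true → BL (suc j) (to (φ (suc j)) i) X ≡ true
    BL-prev j i X a h rewrite ft (φ (suc j)) i = ∨-introʳ {inh (suc j) i X} (∧-intro a h)

    BL-virt : ∀ j s → isVirt (st j (from (φ j) s)) ≡ true → BL j s nothing ≡ true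
    BL-virt j s h = subst (λ z → BL j z nothing ≡ true) (tf (φ j) s) (BL-own j (from (φ j) s) nothing (inh-virt j _ h))

    -- Mirror image of `hitF-fl`: by `k ≤ suc (lv z)` the walk cannot go back beyond level 0.
    hitB-BL : ∀ k z Y → Z z ≡ false → k ≤ suc (lv z) → Jn.hitB k z Y ≡ true → someY (BL (lv z)) Y (hsl z) ≡ true
    hitB-BL₊ : ∀ k z Y → Z z ≡ false → S z ≡ true → k ≤ lv z →
      (fx (from π₀ z) ≡ true × Jn.hitB k (from π₀ z) Y ≡ true) ⊎ (fx (from π₀ z) ≡ false × pos k ≡ true) → someY (BL (lv z)) Y (hsl z) ≡ true
    hitB-BL (suc k) z Y zz (s≤s le) h with ∧-true {S z} h
    ... | s , h' with ∨-true {Y (tl z)} h'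
    ...   | inj₁ y = someY-y (BL (lv z)) Y (hsl z) (tl z) y (BL-own (lv z) (sl z) _ (inh-alive (lv z) (sl z) (tl z) (st-alive z zz s) (sl-tl z zz)))
    ...   | inj₂ q = hitB-BL₊ k z Y zz s le (if-true q)
    hitB-BL₊ k z Y zz s le (inj₁ (fz , q)) with prev-R (from π₀ z) z (subst (λ u → NX (from π₀ z) (just u)) (tf π₀ z) (view _ (fx⇒ (from π₀ z) fz))) zz
    ... | zw , lt , l , s' = someY-mono (BL (lv w)) (BL (lv z)) Y (hsl w) (hsl z) up
            (hitB-BL k w Y zw (ℕP.≤-trans le (ℕP.≤-reflexive l)) q)
      where
      w = from π₀ z
      up : ∀ X → BL (lv w) (hsl w) X ≡ true → BL (lv z) (hsl z) X ≡ true
      up X g = subst₂ (λ j i → BL j (to (φ j) i) X ≡ true) (sym l) (sym s') (BL-prev (lv w) (nslot w) X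
        (cong isAlive (subst₂ (λ j i → st j i ≡ alive) l s' (st-alive z zz s)))
        (trans (cong (λ i → BL (lv w) i X) (ft (M (lv w)) _)) g))
    hitB-BL₊ zero z Y zz s le (inj₂ (_ , ()))
    hitB-BL₊ (suc k) z Y zz s le (inj₂ (fz , q)) with ≤⇒suc le
    ... | j , l = someY-⋆ (BL (lv z)) Y (hsl z) (subst (λ i → BL i (to (φ i) (sl z)) nothing ≡ true) (sym l)
            (BL-prev j (sl z) nothing (cong isAlive (subst (λ i → st i (sl z) ≡ alive) l (st-alive z zz s)))
              (BL-virt j _ (pred-virt z j zz l fz))))

    cl : ℕ → Fin (suc κ)
    cl k with k ≤? κ
    ... | yes le = fromℕ< (s≤s le)
    ... | no _ = zero

    toℕ-cl : ∀ k → k ≤ κ → toℕ (cl k) ≡ k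
    toℕ-cl k le with k ≤? κ
    ... | yes le' = FP.toℕ-fromℕ< (s≤s le')
    ... | no nle = ⊥-elim (nle le)

    -- One summand for each kind of exchangeable transition: ends of trails, gaps at loops, cuts of
    -- `Z`. Only the first needs the bounds of the trail system; the other kinds are few altogether.
    cf : Fin n → ℕ
    cf v = suc ℓ * Bd v + (rv v + cz)

    three : ∀ (p A B C : Fin m → Bool) a b c → (∀ e → p e ≡ true → A e ≡ true ⊎ (B e ≡ true ⊎ C e ≡ true)) →
            cnt A ≤ a → cnt B ≤ b → cnt C ≤ c → cnt p ≤ a + (b + c)
    three p A B C a b c cov la lb lc = ℕP.≤-trans (cnt-mono {p = p} {q = λ e → A e ∨ (B e ∨ C e)} (λ e h → go e (cov e h)))
      (ℕP.≤-trans (cnt-∨ A (λ e → B e ∨ C e)) (ℕP.+-mono-≤ la (ℕP.≤-trans (cnt-∨ B C) (ℕP.+-mono-≤ lb lc))))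
      where go : ∀ e → A e ≡ true ⊎ (B e ≡ true ⊎ C e ≡ true) → A e ∨ (B e ∨ C e) ≡ true
            go e (inj₁ h) = ∨-introˡ h
            go e (inj₂ (inj₁ h)) = ∨-introʳ {A e} (∨-introˡ h)
            go e (inj₂ (inj₂ h)) = ∨-introʳ {A e} (∨-introʳ {B e} h)

    VT VH : Fin n → Fin (suc κ * N) → Bool
    VT v k = isVirt (st (toℕ (proj₁ (remQuot {suc κ} N k))) (proj₂ (remQuot {suc κ} N k))) ∧ eqb (vt (proj₂ (remQuot {suc κ} N k))) v
    VH v k = isVirt (st (toℕ (proj₁ (remQuot {suc κ} N k))) (proj₂ (remQuot {suc κ} N k))) ∧ eqb (vt (to (φ (toℕ (proj₁ (remQuot {suc κ} N k)))) (proj₂ (remQuot {suc κ} N k)))) v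

    VT-few : ∀ v → cnt (VT v) ≤ rv v
    VT-few v = ℕP.≤-trans (ℕP.≤-reflexive (trans (sum-combine (suc κ) (λ k → ⟦ VT v k ⟧))
      (sum-cong (λ j → sum-cong (λ i → cong (λ r → ⟦ isVirt (st (toℕ (proj₁ r)) (proj₂ r)) ∧ eqb (vt (proj₂ r)) v ⟧) (FP.remQuot-combine {suc κ} j i)))))) (virt-out v)

    VH-few : ∀ v → cnt (VH v) ≤ rv v
    VH-few v = ℕP.≤-trans (ℕP.≤-reflexive (trans (sum-combine (suc κ) (λ k → ⟦ VH v k ⟧))
      (sum-cong (λ j → sum-cong (λ i → cong (λ r → ⟦ isVirt (st (toℕ (proj₁ r)) (proj₂ r)) ∧ eqb (vt (to (φ (toℕ (proj₁ r))) (proj₂ r))) v ⟧) (FP.remQuot-combine {suc κ} j i)))))) (virt-in v)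

    VT-at : ∀ v j i → j ≤ κ → isVirt (st j i) ≡ true → vt i ≡ v → VT v (combine (cl j) i) ≡ true
    VT-at v j i le h e = trans (cong (λ r → isVirt (st (toℕ (proj₁ r)) (proj₂ r)) ∧ eqb (vt (proj₂ r)) v) (FP.remQuot-combine {suc κ} (cl j) i))
      (subst (λ k → isVirt (st k i) ∧ eqb (vt i) v ≡ true) (sym (toℕ-cl j le)) (∧-intro h (dec-true (vt i ≟ v) e)))

    VH-at : ∀ v j i → j ≤ κ → isVirt (st j i) ≡ true → vt (to (φ j) i) ≡ v → VH v (combine (cl j) i) ≡ true
    VH-at v j i le h e = trans (cong (λ r → isVirt (st (toℕ (proj₁ r)) (proj₂ r)) ∧ eqb (vt (to (φ (toℕ (proj₁ r))) (proj₂ r))) v) (FP.remQuot-combine {suc κ} (cl j) i))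
      (subst (λ k → isVirt (st k i) ∧ eqb (vt (to (φ k) i)) v ≡ true) (sym (toℕ-cl j le)) (∧-intro h (dec-true (vt (to (φ j) i) ≟ v) e)))

    cl-inj : ∀ j j' (i i' : Fin N) → j ≤ κ → j' ≤ κ → combine (cl j) i ≡ combine (cl j') i' → j ≡ j' × i ≡ i'
    cl-inj j j' i i' le le' e =
      trans (sym (toℕ-cl j le)) (trans (cong toℕ (FP.combine-injectiveˡ (cl j) i (cl j') i' e)) (toℕ-cl j' le')) ,
      FP.combine-injectiveʳ (cl j) i (cl j') i' e

    -- An exchangeable transition leads to the first arc of a trail, to the arc behind an
    -- auxiliary loop, or to an arc of Z.
    HF : ∀ v Y → cnt Y ≤ ℓ → cnt (λ z → (Jn.jout z ∧ eqb (tl z) v) ∧ Jn.hitF ℓ z Y) ≤ cf v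
    HF v Y le = three _ A B C (suc ℓ * Bd v) (rv v) cz cov A-few B-few C-few
      where
      A B C : Fin m → Bool
      A z = not (Z z) ∧ (does (lv z ℕP.≟ 0) ∧ (eqb (tl z) v ∧ Jn.hitF ℓ z Y))
      B z = not (Z z) ∧ (does (1 ≤? lv z) ∧ (eqb (tl z) v ∧ not (fx (from π₀ z))))
      C z = Z z ∧ (not (fZ (from πZ z)) ∧ eqb (tl z) v)
      cov : ∀ z → (Jn.jout z ∧ eqb (tl z) v) ∧ Jn.hitF ℓ z Y ≡ true → A z ≡ true ⊎ (B z ≡ true ⊎ C z ≡ true)
      cov z h = go (Z z) refl
        where
        jo = proj₁ (∧-true {Jn.jout z} (proj₁ (∧-true {Jn.jout z ∧ eqb (tl z) v} h)))
        tv = proj₂ (∧-true {Jn.jout z} (proj₁ (∧-true {Jn.jout z ∧ eqb (tl z) v} h)))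
        hf = proj₂ (∧-true {Jn.jout z ∧ eqb (tl z) v} h)
        go : ∀ b → Z z ≡ b → A z ≡ true ⊎ (B z ≡ true ⊎ C z ≡ true)
        go true zz = inj₂ (inj₂ (∧-intro zz (∧-intro (cong not (¬t⇒f (λ f → t≢f (nx-jout (nx-Z (from πZ z) z zz (tf πZ z) f)) (not-true jo)))) tv)))
        go false zz with lv z ℕP.≟ 0
        ... | yes l0 = inj₁ (∧-intro (cong not zz) (∧-intro (dec-true (lv z ℕP.≟ 0) l0) (∧-intro tv hf)))
        ... | no l0 = inj₂ (inj₁ (∧-intro (cong not zz) (∧-intro (dec-true (1 ≤? lv z) (ℕP.n≢0⇒n>0 l0)) (∧-intro tv jo))))
      A-few : cnt A ≤ suc ℓ * Bd v
      A-few = ℕP.≤-trans (cnt-inj {p = A} {q = λ i → eqb (vt i) v ∧ someY (fl κ 0) Y i} sl f-ok f-inj)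
                (someY-count (fl κ 0) v (λ X → div-bound (few-f v X)) Y le)
        where
        parts : ∀ z → A z ≡ true → Z z ≡ false × lv z ≡ 0 × tl z ≡ v × Jn.hitF ℓ z Y ≡ true
        parts z h = not-true (proj₁ (∧-true h)) , does⇒ (lv z ℕP.≟ 0) (proj₁ (∧-true {does (lv z ℕP.≟ 0)} r)) ,
            does⇒ (tl z ≟ v) (proj₁ (∧-true {eqb (tl z) v} r₂)) , proj₂ (∧-true {eqb (tl z) v} r₂)
          where r = proj₂ (∧-true {not (Z z)} h)
                r₂ = proj₂ (∧-true {does (lv z ℕP.≟ 0)} r)
        f-ok : ∀ z → A z ≡ true → eqb (vt (sl z)) v ∧ someY (fl κ 0) Y (sl z) ≡ true
        f-ok z h with parts z h
        ... | zz , l0 , tv , hf = ∧-intro (dec-true (vt (sl z) ≟ v) (trans (sl-tl z zz) tv))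
              (subst (λ j → someY (fl κ j) Y (sl z) ≡ true) l0 (hitF-fl ℓ z Y zz κ (cong (_+ κ) l0) ℓ≤ hf))
        f-inj : ∀ z z' → A z ≡ true → A z' ≡ true → sl z ≡ sl z' → z ≡ z'
        f-inj z z' h h' e with parts z h | parts z' h'
        ... | zz , l0 , _ | zz' , l0' , _ = sl-inj z z' zz zz' (trans l0 (sym l0')) e
      B-few : cnt B ≤ rv v
      B-few = ℕP.≤-trans (cnt-inj {p = B} {q = VH v} g g-ok g-inj) (VH-few v)
        where
        pl : Fin m → ℕ
        pl z = lv z ∸ 1
        ps : Fin m → Fin N
        ps z = from (φ (pl z)) (from (M (pl z)) (sl z))
        g : Fin m → Fin (suc κ * N)
        g z = combine (cl (pl z)) (ps z)
        parts : ∀ z → B z ≡ true → Z z ≡ false × lv z ≡ suc (pl z) × tl z ≡ v × fx (from π₀ z) ≡ false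
        parts z h = not-true (proj₁ (∧-true h)) , sym (ℕP.m+[n∸m]≡n (does⇒ (1 ≤? lv z) (proj₁ (∧-true {does (1 ≤? lv z)} r)))) ,
            does⇒ (tl z ≟ v) (proj₁ (∧-true {eqb (tl z) v} r₂)) , not-true (proj₂ (∧-true {eqb (tl z) v} r₂))
          where r = proj₂ (∧-true {not (Z z)} h)
                r₂ = proj₂ (∧-true {does (1 ≤? lv z)} r)
        pl< : ∀ z → B z ≡ true → pl z < κ
        pl< z h with parts z h
        ... | zz , l , _ = ℕP.≤-trans (ℕP.≤-reflexive (sym l)) (lv≤ z zz)
        g-ok : ∀ z → B z ≡ true → VH v (g z) ≡ true
        g-ok z h with parts z h | pl< z h
        ... | zz , l , tv , nf | lt = VH-at v (pl z) (ps z) (ℕP.<⇒≤ lt) (pred-virt z (pl z) zz l nf)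
              (trans (cong vt (tf (φ (pl z)) _)) (trans (trans (sym (M-vt (pl z) lt _)) (cong vt (tf (M (pl z)) _))) (trans (sl-tl z zz) tv)))
        g-inj : ∀ z z' → B z ≡ true → B z' ≡ true → g z ≡ g z' → z ≡ z'
        g-inj z z' h h' e with parts z h | parts z' h' | cl-inj (pl z) (pl z') (ps z) (ps z') (ℕP.<⇒≤ (pl< z h)) (ℕP.<⇒≤ (pl< z' h')) e
        ... | zz , l , _ | zz' , l' , _ | pe , se = sl-inj z z' zz zz' (trans l (trans (cong suc pe) (sym l')))
              (from-inj (M (pl z)) (from-inj (φ (pl z)) (trans se (cong (λ j → from (φ j) (from (M j) (sl z'))) (sym pe)))))
      C-few : cnt C ≤ cz
      C-few = ℕP.≤-trans (cnt-inj {p = C} {q = λ e → Z e ∧ (not (fZ e) ∧ eqb (hd e) v)} (from πZ) f-ok (λ _ _ _ _ → from-inj πZ)) (fZ-few v)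
        where
        f-ok : ∀ z → C z ≡ true → Z (from πZ z) ∧ (not (fZ (from πZ z)) ∧ eqb (hd (from πZ z)) v) ≡ true
        f-ok z h = ∧-intro zw (∧-intro (proj₁ (∧-true r)) (trans (cong (λ u → eqb u v) (trans (sym (πZ-ok _ zw)) (cong tl (tf πZ z)))) (proj₂ (∧-true {not (fZ (from πZ z))} r))))
          where r = proj₂ (∧-true {Z z} h)
                zw : Z (from πZ z) ≡ true
                zw = trans (sym (πZ-Z (from πZ z))) (trans (cong Z (tf πZ z)) (proj₁ (∧-true h)))

    -- An exchangeable transition starts from the last arc of a trail, from the arc in front of a
    -- loop, or from an arc of `Z` where `fZ` fails.
    HB : ∀ v Y → cnt Y ≤ ℓ → cnt (λ z → Jn.jin z v ∧ Jn.hitB ℓ z Y) ≤ cf v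
    HB v Y le = three _ A B C (suc ℓ * Bd v) (rv v) cz cov A-few B-few (fZ-few v)
      where
      A B C : Fin m → Bool
      A z = not (Z z) ∧ (does (lv z ℕP.≟ κ) ∧ (eqb (hd z) v ∧ Jn.hitB ℓ z Y))
      B z = not (Z z) ∧ (does (suc (lv z) ≤? κ) ∧ (eqb (hd z) v ∧ isVirt (st (suc (lv z)) (nslot z))))
      C z = Z z ∧ (not (fZ z) ∧ eqb (hd z) v)
      cov : ∀ z → Jn.jin z v ∧ Jn.hitB ℓ z Y ≡ true → A z ≡ true ⊎ (B z ≡ true ⊎ C z ≡ true)
      cov z h = go (Z z) refl
        where
        nf = proj₁ (∧-true {not (fx z)} (proj₁ (∧-true {Jn.jin z v} h)))
        hv = proj₂ (∧-true {not (fx z)} (proj₁ (∧-true {Jn.jin z v} h)))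
        hb = proj₂ (∧-true {Jn.jin z v} h)
        go : ∀ b → Z z ≡ b → A z ≡ true ⊎ (B z ≡ true ⊎ C z ≡ true)
        go true zz = inj₂ (inj₂ (∧-intro zz (∧-intro (cong not (¬t⇒f (λ f → t≢f (nx⇒fx (nx-Z z (to πZ z) (trans (πZ-Z z) zz) refl f)) (not-true nf)))) hv)))
        go false zz with end-R z (view z (fx-false z (not-true nf))) zz
        ... | inj₁ l = inj₁ (∧-intro (cong not zz) (∧-intro (dec-true (lv z ℕP.≟ κ) l) (∧-intro hv hb)))
        ... | inj₂ (lt , vv) = inj₂ (inj₁ (∧-intro (cong not zz) (∧-intro (dec-true (suc (lv z) ≤? κ) lt) (∧-intro hv vv))))
      A-few : cnt A ≤ suc ℓ * Bd v
      A-few = ℕP.≤-trans (cnt-inj {p = A} {q = λ i → eqb (vt i) v ∧ someY (BL κ) Y i} hsl f-ok f-inj)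
                (someY-count (BL κ) v (λ X → div-bound (few-b v X)) Y le)
        where
        parts : ∀ z → A z ≡ true → Z z ≡ false × lv z ≡ κ × hd z ≡ v × Jn.hitB ℓ z Y ≡ true
        parts z h = not-true (proj₁ (∧-true h)) , does⇒ (lv z ℕP.≟ κ) (proj₁ (∧-true {does (lv z ℕP.≟ κ)} r)) ,
            does⇒ (hd z ≟ v) (proj₁ (∧-true {eqb (hd z) v} r₂)) , proj₂ (∧-true {eqb (hd z) v} r₂)
          where r = proj₂ (∧-true {not (Z z)} h)
                r₂ = proj₂ (∧-true {does (lv z ℕP.≟ κ)} r)
        f-ok : ∀ z → A z ≡ true → eqb (vt (hsl z)) v ∧ someY (BL κ) Y (hsl z) ≡ true
        f-ok z h with parts z h
        ... | zz , l , hv , hb = ∧-intro (dec-true (vt (hsl z) ≟ v) (trans (sl-hd z zz) hv))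
              (subst (λ j → someY (BL j) Y (hsl z) ≡ true) l (hitB-BL ℓ z Y zz (ℕP.≤-trans ℓ≤ (ℕP.≤-reflexive (cong suc (sym l)))) hb))
        f-inj : ∀ z z' → A z ≡ true → A z' ≡ true → hsl z ≡ hsl z' → z ≡ z'
        f-inj z z' h h' e with parts z h | parts z' h'
        ... | zz , l , _ | zz' , l' , _ = sl-inj z z' zz zz' ll (to-inj (φ (lv z)) (trans e (cong (λ j → to (φ j) (sl z')) (sym ll))))
          where ll = trans l (sym l')
      B-few : cnt B ≤ rv v
      B-few = ℕP.≤-trans (cnt-inj {p = B} {q = VT v} g g-ok g-inj) (VT-few v)
        where
        g : Fin m → Fin (suc κ * N)
        g z = combine (cl (suc (lv z))) (nslot z)
        parts : ∀ z → B z ≡ true → Z z ≡ false × lv z < κ × hd z ≡ v × isVirt (st (suc (lv z)) (nslot z)) ≡ true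
        parts z h = not-true (proj₁ (∧-true h)) , does⇒ (suc (lv z) ≤? κ) (proj₁ (∧-true {does (suc (lv z) ≤? κ)} r)) ,
            does⇒ (hd z ≟ v) (proj₁ (∧-true {eqb (hd z) v} r₂)) , proj₂ (∧-true {eqb (hd z) v} r₂)
          where r = proj₂ (∧-true {not (Z z)} h)
                r₂ = proj₂ (∧-true {does (suc (lv z) ≤? κ)} r)
        g-ok : ∀ z → B z ≡ true → VT v (g z) ≡ true
        g-ok z h with parts z h
        ... | zz , lt , hv , vv = VT-at v (suc (lv z)) (nslot z) lt vv (trans (M-vt (lv z) lt _) (trans (sl-hd z zz) hv))
        g-inj : ∀ z z' → B z ≡ true → B z' ≡ true → g z ≡ g z' → z ≡ z'
        g-inj z z' h h' e with parts z h | parts z' h'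
        ... | zz , lt , _ | zz' , lt' , _ with cl-inj (suc (lv z)) (suc (lv z')) (nslot z) (nslot z') lt lt' e
        ...   | pe , se = sl-inj z z' zz zz' ll (after-inj (lv z) (trans se (cong (λ j → after j (sl z')) (sym ll))))
          where ll = ℕP.suc-injective pe

    -- Each of the `c v` slots at `v` is entered once at level `κ`. At most `rv v` of them are
    -- entered by loops; the other arcs end their trails and are exchangeable.
    big : ∀ v → 4 * cf v + 2 ≤ cnt (λ z → Jn.jin z v)
    big v = ℕP.+-cancelʳ-≤ (rv v) _ _ (ℕP.≤-trans (room v) (begin
      c v                                          ≡⟨ cnt-split (λ s → eqb (vt s) v) nv ⟩
      cnt (λ s → eqb (vt s) v ∧ nv s) + cnt (λ s → eqb (vt s) v ∧ not (nv s))
        ≤⟨ ℕP.+-mono-≤ (cnt-inj {p = λ s → eqb (vt s) v ∧ nv s} {q = λ z → Jn.jin z v} g g-ok g-inj)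
             (ℕP.≤-trans (cnt-inj {p = λ s → eqb (vt s) v ∧ not (nv s)} {q = VH v} (λ s → combine (cl κ) (from (φ κ) s)) v-ok v-inj) (VH-few v)) ⟩
      cnt (λ z → Jn.jin z v) + rv v ∎))
      where
      open ℕP.≤-Reasoning
      nv : Fin N → Bool
      nv s = not (isVirt (st κ (from (φ κ) s)))
      arc' : ∀ s → nv s ≡ true → ∃ λ e → Z e ≡ false × lv e ≡ κ × sl e ≡ from (φ κ) s
      arc' s h = arc κ (from (φ κ) s) ℕP.≤-refl (not-true h)
      pickA : ∀ s b → nv s ≡ b → Fin m
      pickA s true h = proj₁ (arc' s h)
      pickA s false h = e₀
      g : Fin N → Fin m
      g s = pickA s (nv s) refl
      pickA-ok : ∀ s b (h : nv s ≡ b) → nv s ≡ true → Z (pickA s b h) ≡ false × lv (pickA s b h) ≡ κ × sl (pickA s b h) ≡ from (φ κ) s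
      pickA-ok s true h _ = proj₂ (arc' s h)
      pickA-ok s false h t = ⊥-elim (t≢f t h)
      gp : ∀ s → nv s ≡ true → Z (g s) ≡ false × lv (g s) ≡ κ × sl (g s) ≡ from (φ κ) s
      gp s = pickA-ok s (nv s) refl
      g-ok : ∀ s → eqb (vt s) v ∧ nv s ≡ true → Jn.jin (g s) v ≡ true
      g-ok s h with ∧-true {eqb (vt s) v} h
      ... | e , t with gp s t
      ...   | zz , l , ss = ∧-intro (cong not (¬t⇒f (λ f → last (next-R (g s) _ (view (g s) (fx⇒ (g s) f)) zz))))
              (trans (cong (λ u → eqb u v) (trans (sym (sl-hd (g s) zz)) (cong vt (trans (cong₂ (λ j i → to (φ j) i) l ss) (tf (φ κ) s))))) e)
        where last : Z (to π₀ (g s)) ≡ false × lv (g s) < κ × _ → ⊥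
              last (_ , lt , _) = ℕP.<⇒≢ lt l
      g-inj : ∀ s s' → eqb (vt s) v ∧ nv s ≡ true → eqb (vt s') v ∧ nv s' ≡ true → g s ≡ g s' → s ≡ s'
      g-inj s s' h h' e = from-inj (φ κ) (trans (sym (proj₂ (proj₂ (gp s (proj₂ (∧-true {eqb (vt s) v} h))))))
                            (trans (cong sl e) (proj₂ (proj₂ (gp s' (proj₂ (∧-true {eqb (vt s') v} h')))))))
      v-ok : ∀ s → eqb (vt s) v ∧ not (nv s) ≡ true → VH v (combine (cl κ) (from (φ κ) s)) ≡ true
      v-ok s h with ∧-true {eqb (vt s) v} h
      ... | e , t = VH-at v κ (from (φ κ) s) ℕP.≤-refl (trans (sym (BP.not-involutive _)) t)
                      (trans (cong vt (tf (φ κ) s)) (does⇒ (vt s ≟ v) e))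
      v-inj : ∀ s s' → _ → _ → combine (cl κ) (from (φ κ) s) ≡ combine (cl κ) (from (φ κ) s') → s ≡ s'
      v-inj s s' _ _ e = from-inj (φ κ) (FP.combine-injectiveʳ (cl κ) _ (cl κ) _ e)

    ext-ok : Jn.Ext π₀
    ext-ok = π₀-ok , λ _ _ → refl

   open Jn public using (Good; Ext)

   merged : Σ[ π ∈ Perm m ] ((Ext π × Good ℓ π) × (∀ u w → not (fx u) ≡ true → not (fx w) ≡ true → hd u ≡ hd w →
              orbit π e₀ u ≡ true → orbit π e₀ w ≡ true))
   merged = Jn.Main.merged TG cf HF HB big ext-ok e₀

   module Connected (π : Perm m) (ext : Ext π) (merge : ∀ u w → not (fx u) ≡ true → not (fx w) ≡ true → hd u ≡ hd w →
                       orbit π e₀ u ≡ true → orbit π e₀ w ≡ true) where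
    private
      O = orbit π e₀
      O-back : ∀ e → O (to π e) ≡ true → O e ≡ true
      O-back = perm-closed-back π O (orbit-to π e₀)
      D : Fin m → Bool
      D e = O e ∨ not (Z e)
      onZ : ∀ e → Z e ≡ true → D e ≡ true → O e ≡ true
      onZ e z d with ∨-true {O e} d
      ... | inj₁ o = o
      ... | inj₂ nz = ⊥-elim (t≢f z (not-true nz))
      -- At a cut, the transition of `πZ` may have been exchanged away, but the arc that now
      -- precedes `to πZ e` is exchangeable and enters the same vertex, so `merge` puts it into the
      -- orbit.
      stepZ : ∀ e → Z e ≡ true → O e ≡ true → ∀ b → fZ e ≡ b → O (to πZ e) ≡ true
      stepZ e z o true f = subst (λ u → O u ≡ true) (trans (proj₂ ext e (nx⇒fx fix)) (π₀-nx e _ fix)) (orbit-to π e₀ e o)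
        where fix = nx-Z e (to πZ e) (trans (πZ-Z e) z) refl f
      stepZ e z o false f = subst (λ u → O u ≡ true) (tf π (to πZ e)) (orbit-to π e₀ y (merge e y nfe nfy he o))
        where
        y = from π (to πZ e)
        he : hd e ≡ hd y
        he = trans (sym (πZ-ok e z)) (trans (cong tl (sym (tf π _))) (proj₁ ext y))
        nothingZ : ∀ u → Z u ≡ true → fZ u ≡ false → ∀ r → NX u r → isJust r ≡ false
        nothingZ u zu fu _ (Zfix _ a) = ⊥-elim (t≢f a fu)
        nothingZ u zu fu _ (Zcut _ _) = refl
        nothingZ u zu fu _ (Rfix a _ _ _ _) = ⊥-elim (t≢f zu a)
        nothingZ u zu fu _ (Rlast _ _) = refl
        nothingZ u zu fu _ (Rvirt _ _ _) = refl
        nfe : not (fx e) ≡ true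
        nfe = cong not (nothingZ e z f (nx e) (proj₂ (nxv e)))
        into : ∀ z' → NX y (just z') → z' ≡ to πZ e → ⊥
        into _ (Zfix _ fy) q = t≢f fy (trans (cong fZ (to-inj πZ q)) f)
        into _ (Rfix _ _ z' _ _) refl = t≢f (trans (πZ-Z e) z) z'
        nfy : not (fx y) ≡ true
        nfy = cong not (¬t⇒f (λ g → into (to π₀ y) (view y (fx⇒ y g)) (trans (sym (proj₂ ext y g)) (tf π _))))
      O-Z : ∀ e → Z e ≡ true → O e ≡ true
      O-Z e z = onZ e z (orbit-least πZ e₀ D (∨-introˡ (orbit-base π e₀)) closed e (single e z))
        where
        closed : ∀ e → D e ≡ true → D (to πZ e) ≡ true
        closed e d = go (Z e) refl
          where go : ∀ b → Z e ≡ b → D (to πZ e) ≡ true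
                go true z = ∨-introˡ (stepZ e z (onZ e z d) (fZ e) refl)
                go false z = ∨-introʳ {O (to πZ e)} (cong not (trans (πZ-Z e) z))
      -- Following a trail through the levels leads to an exchangeable transition. At its vertex an
      -- arc of `Z` is exchangeable too, so `merge` applies; membership in the orbit is then carried
      -- back along the trail.
      climb : ∀ r e → Z e ≡ false → lv e + r ≡ κ → ∀ b → fx e ≡ b → O e ≡ true
      climb r e z eq false nf with fZ-at (hd e)
      ... | x' , zx , fx' , hx = merge x' e (cong not (nothingZ (nx x') (proj₂ (nxv x')))) (cong not nf) hx (O-Z x' zx)
        where
        nothingZ : ∀ r → NX x' r → isJust r ≡ false
        nothingZ _ (Zfix _ a) = ⊥-elim (t≢f a fx')
        nothingZ _ (Zcut _ _) = refl
        nothingZ _ (Rfix a _ _ _ _) = ⊥-elim (t≢f zx a)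
        nothingZ _ (Rlast _ _) = refl
        nothingZ _ (Rvirt _ _ _) = refl
      climb zero e z eq true f = ⊥-elim (ℕP.<⇒≢ (proj₁ (proj₂ (next-R e _ (view e (fx⇒ e f)) z))) (trans (sym (ℕP.+-identityʳ _)) eq))
      climb (suc r) e z eq true f with next-R e _ (view e (fx⇒ e f)) z
      ... | z' , lt , l , _ = O-back e (subst (λ u → O u ≡ true) (sym (proj₂ ext e f))
              (climb r (to π₀ e) z' (trans (cong (_+ r) l) (trans (sym (ℕP.+-suc (lv e) r)) eq)) (fx (to π₀ e)) refl))
    everything : ∀ e → O e ≡ true
    everything e = go (Z e) refl
      where go : ∀ b → Z e ≡ b → O e ≡ true
            go true z = O-Z e z
            go false z = climb (κ ∸ lv e) e z (ℕP.m+[n∸m]≡n (lv≤ e z)) (fx e) refl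

   conclude : Σ[ π ∈ Perm m ] ((Ext π × Good ℓ π) × (∀ u w → not (fx u) ≡ true → not (fx w) ≡ true → hd u ≡ hd w →
                orbit π e₀ u ≡ true → orbit π e₀ w ≡ true)) →
     Σ[ π ∈ Perm m ] ((∀ e → tl (to π e) ≡ hd e) ×
       (∀ j a → j < ℓ → (∀ i → i ≤ j → S (iter π i a) ≡ true) → hd (iter π j a) ≢ tl a) × (∀ e → orbit π e₀ e ≡ true))
   conclude (π , (ext , good) , merge) = π , proj₁ ext , Jn.good-iter good , Connected.everything π ext merge

  tour : Σ[ π ∈ Perm m ] ((∀ e → tl (to π e) ≡ hd e) ×
    (∀ j a → j < ℓ → (∀ i → i ≤ j → S (iter π i a) ≡ true) → hd (iter π j a) ≢ tl a) × (∀ e → orbit π e₀ e ≡ true))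
  tour = Core.conclude (proj₁ ext₀) (proj₁ (proj₂ ext₀)) (proj₂ (proj₂ ext₀))
           (Core.merged (proj₁ ext₀) (proj₁ (proj₂ ext₀)) (proj₂ (proj₂ ext₀)))
    where
    base = perm-of-fibres _≟_ hd tl inout
    ext₀ = extend-partial tl hd (proj₁ base) (proj₂ base) nx nx-ok nx-inj

-- Parity, and a sparse connected even subgraph

xsum : ∀ {n} → (Fin n → Bool) → Bool
xsum {zero}  f = false
xsum {suc n} f = f zero xor xsum (λ i → f (suc i))

xor-inter : ∀ a b c d → (a xor b) xor (c xor d) ≡ (a xor c) xor (b xor d)
xor-inter a b c d = trans (BP.xor-assoc a b (c xor d)) (trans (cong (a xor_)
  (trans (sym (BP.xor-assoc b c d)) (trans (cong (_xor d) (BP.xor-comm b c)) (BP.xor-assoc c b d))))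
  (sym (BP.xor-assoc a c (b xor d))))

xsum-cong : ∀ {n} {f g : Fin n → Bool} → (∀ i → f i ≡ g i) → xsum f ≡ xsum g
xsum-cong {zero}  h = refl
xsum-cong {suc n} h = cong₂ _xor_ (h zero) (xsum-cong (λ i → h (suc i)))

xsum-xor : ∀ {n} (f g : Fin n → Bool) → xsum (λ i → f i xor g i) ≡ xsum f xor xsum g
xsum-xor {zero}  f g = refl
xsum-xor {suc n} f g = trans (cong ((f zero xor g zero) xor_) (xsum-xor (λ i → f (suc i)) (λ i → g (suc i))))
                             (xor-inter (f zero) (g zero) _ _)

xsum-false : ∀ {n} {f : Fin n → Bool} → (∀ i → f i ≡ false) → xsum f ≡ false
xsum-false {zero}  h = refl
xsum-false {suc n} h = cong₂ _xor_ (h zero) (xsum-false (λ i → h (suc i)))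

xsum-∧ : ∀ {n} b (f : Fin n → Bool) → xsum (λ i → b ∧ f i) ≡ b ∧ xsum f
xsum-∧ {n} false f = xsum-false {n} (λ _ → refl)
xsum-∧ true  f = refl

xsum-delta : ∀ {n} (k : Fin n) (f : Fin n → Bool) → xsum (λ i → eqb k i ∧ f i) ≡ f k
xsum-delta {suc n} zero    f = trans (cong (f zero xor_) (xsum-false {n} (λ _ → refl))) (BP.xor-identityʳ (f zero))
xsum-delta {suc n} (suc k) f = xsum-delta k (λ i → f (suc i))

xsum-swap : ∀ {n k} (f : Fin n → Fin k → Bool) → xsum (λ i → xsum (f i)) ≡ xsum (λ j → xsum (λ i → f i j))
xsum-swap {zero}  {k} f = sym (xsum-false {k} (λ _ → refl))
xsum-swap {suc n} f = trans (cong (xsum (f zero) xor_) (xsum-swap (λ i → f (suc i))))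
                            (sym (xsum-xor (f zero) (λ j → xsum (λ i → f (suc i) j))))

odd : ℕ → Bool
odd zero    = false
odd (suc k) = not (odd k)

odd-+ : ∀ a b → odd (a + b) ≡ odd a xor odd b
odd-+ zero    b = refl
odd-+ (suc a) b = trans (cong not (odd-+ a b)) (lem (odd a) (odd b))
  where lem : ∀ x y → not (x xor y) ≡ not x xor y
        lem true  y = BP.not-involutive y
        lem false y = refl

odd-cnt : ∀ {n} (p : Fin n → Bool) → odd (cnt p) ≡ xsum p
odd-cnt {zero}  p = refl
odd-cnt {suc n} p = trans (odd-+ ⟦ p zero ⟧ _) (cong₂ _xor_ (lem (p zero)) (odd-cnt (λ i → p (suc i))))
  where lem : ∀ b → odd ⟦ b ⟧ ≡ b
        lem true  = refl
        lem false = refl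

even-half : ∀ k → odd k ≡ false → ∃ λ j → k ≡ 2 * j
even-half zero _ = 0 , refl
even-half (suc (suc k)) h with even-half k (trans (sym (BP.not-involutive (odd k))) h)
... | j , refl = suc j , lem j
  where lem : ∀ j → suc (suc (2 * j)) ≡ 2 * suc j
        lem = solve-∀

nand : ∀ {a b} → not a ∧ not b ≡ false → a ≡ false → b ≡ true
nand {false} {true} _ _ = refl

-- In a digraph rooted at r in which every set avoiding r is entered by two arcs, there are two
-- arc-disjoint spanning arborescences (Edmonds); the second one is used to correct the
-- parities of the degrees of the first.
module Skeleton {m n : ℕ} (tl hd : Fin m → Fin n) (r : Fin n)
  (cut : ∀ (Y : Fin n → Bool) → Y r ≡ false → ∀ y → Y y ≡ true → ∀ bad → cnt bad ≤ 1 →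
         ∃ λ e → bad e ≡ false × Y (tl e) ≡ false × Y (hd e) ≡ true) where

  E : (Fin m → Bool) → Fin n → Fin n → Bool
  E al u w = anyF (λ e → al e ∧ (eqb (tl e) u ∧ eqb (hd e) w))

  E-intro : ∀ al e → al e ≡ true → E al (tl e) (hd e) ≡ true
  E-intro al e h = anyF-intro (λ e' → al e' ∧ (eqb (tl e') (tl e) ∧ eqb (hd e') (hd e))) e (∧-intro h (∧-intro (eqb-refl (tl e)) (eqb-refl (hd e))))

  E-elim : ∀ al {u w} → E al u w ≡ true → ∃ λ e → al e ≡ true × tl e ≡ u × hd e ≡ w
  E-elim al {u} {w} h with anyF-elim (λ e → al e ∧ (eqb (tl e) u ∧ eqb (hd e) w)) h
  ... | e , p = e , proj₁ (∧-true {al e} p) , does⇒ (tl e ≟ u) (proj₁ (∧-true {eqb (tl e) u} q)) , does⇒ (hd e ≟ w) (proj₂ (∧-true {eqb (tl e) u} q))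
    where q = proj₂ (∧-true {al e} p)

  star-map : ∀ {al al'} → (∀ e → al e ≡ true → al' e ≡ true) → ∀ {v} → Star (E al) r v → Star (E al') r v
  star-map f ε = ε
  star-map {al} {al'} f (s ▸ h) with E-elim al h
  ... | e , a , refl , refl = star-map f s ▸ E-intro al' e (f e a)

  exit : ∀ {al} (C : Fin n → Bool) → C r ≡ true → ∀ {w} → Star (E al) r w → C w ≡ false →
         ∃ λ e → al e ≡ true × C (tl e) ≡ true × C (hd e) ≡ false
  exit C cr ε cw = ⊥-elim (t≢f cr cw)
  exit {al} C cr (_▸_ {v} s h) cw with E-elim al h
  ... | e , a , refl , refl with C (tl e) in eq
  ...   | true = e , a , eq , cw
  ...   | false = exit C cr s eq

  private
    rs : (Fin m → Bool) → Fin n → Bool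
    rs al = proj₁ (closure (E al) r)

    rs-base : ∀ al → rs al r ≡ true
    rs-base al = proj₁ (proj₂ (closure (E al) r))

    rs-step : ∀ al e → al e ≡ true → rs al (tl e) ≡ true → rs al (hd e) ≡ true
    rs-step al e h c = proj₁ (proj₂ (proj₂ (closure (E al) r))) (tl e) (hd e) c (E-intro al e h)

    rs-star : ∀ al v → rs al v ≡ true → Star (E al) r v
    rs-star al = proj₂ (proj₂ (proj₂ (closure (E al) r)))

    U : (Fin m → Bool) → Fin n → Bool
    U F v = eqb r v ∨ anyF (λ e → F e ∧ eqb (hd e) v)

    U-base : ∀ F → U F r ≡ true
    U-base F = ∨-introˡ (eqb-refl r)

    U-hd : ∀ F e → F e ≡ true → U F (hd e) ≡ true
    U-hd F e h = ∨-introʳ {eqb r (hd e)} (anyF-intro (λ e' → F e' ∧ eqb (hd e') (hd e)) e (∧-intro h (eqb-refl (hd e))))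

    upd-mono : ∀ (F : Fin m → Bool) e i → F i ≡ true → upd F e true i ≡ true
    upd-mono F e i h with i ≟ e
    ... | yes _ = refl
    ... | no _ = h

    upd-inv : ∀ (F : Fin m → Bool) e i → upd F e true i ≡ true → i ≡ e ⊎ F i ≡ true
    upd-inv F e i h with i ≟ e
    ... | yes p = inj₁ p
    ... | no _ = inj₂ h

    U-mono : ∀ F e v → U F v ≡ true → U (upd F e true) v ≡ true
    U-mono F e v h with ∨-true {eqb r v} h
    ... | inj₁ a = ∨-introˡ a
    ... | inj₂ b with anyF-elim (λ i → F i ∧ eqb (hd i) v) b
    ...   | i , p = ∨-introʳ {eqb r v} (anyF-intro (λ i → upd F e true i ∧ eqb (hd i) v) i (∧-intro (upd-mono F e i (proj₁ (∧-true {F i} p))) (proj₂ (∧-true {F i} p))))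

    U-inv : ∀ F e v → U (upd F e true) v ≡ true → v ≡ hd e ⊎ U F v ≡ true
    U-inv F e v h with ∨-true {eqb r v} h
    ... | inj₁ a = inj₂ (∨-introˡ a)
    ... | inj₂ b with anyF-elim (λ i → upd F e true i ∧ eqb (hd i) v) b
    ...   | i , p with upd-inv F e i (proj₁ (∧-true {upd F e true i} p)) | does⇒ (hd i ≟ v) (proj₂ (∧-true {upd F e true i} p))
    ...     | inj₁ refl | q = inj₁ (sym q)
    ...     | inj₂ fi | refl = inj₂ (U-hd F i fi)

  Arborescence : (Fin m → Bool) → Set
  Arborescence F = (∀ v → cnt (λ e → F e ∧ eqb (hd e) v) ≤ 1) × (∀ v → Star (E F) r v)

  -- Shared by both arborescences, which differ in the property kept while growing: the first leaves
  -- a complement that still reaches everything, the second avoids the first.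
  module Grow (Inv : (Fin m → Bool) → Set)
    (extend : ∀ F → Inv F → ∀ v → U F v ≡ false → ∃ λ e → U F (tl e) ≡ true × U F (hd e) ≡ false × Inv (upd F e true)) where

    go : ∀ fuel F → Inv F → (∀ v → cnt (λ e → F e ∧ eqb (hd e) v) ≤ 1) → (∀ v → U F v ≡ true → Star (E F) r v) →
         n ≤ fuel + cnt (U F) → Σ[ F ∈ (Fin m → Bool) ] (Inv F × Arborescence F)
    go fuel F inv in1 st le with find? (λ v → not (U F v))
    ... | inj₂ z = F , inv , in1 , λ v → st v (trans (sym (BP.not-involutive _)) (cong not (z v)))
    ... | inj₁ (v , nv) with extend F inv v (not-true nv)
    ...   | e , ut , uh , inv' = grow fuel le
      where
      F' = upd F e true
      in1' : ∀ v → cnt (λ i → F' i ∧ eqb (hd i) v) ≤ 1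
      in1' v with hd e ≟ v
      ... | yes refl = cnt-unique (λ i → F' i ∧ eqb (hd i) v) (λ i j a b → trans (only i a) (sym (only j b)))
        where only : ∀ i → F' i ∧ eqb (hd i) v ≡ true → i ≡ e
              only i h with upd-inv F e i (proj₁ (∧-true {F' i} h))
              ... | inj₁ q = q
              ... | inj₂ fi = ⊥-elim (t≢f (trans (cong (U F) (sym (does⇒ (hd i ≟ v) (proj₂ (∧-true {F' i} h))))) (U-hd F i fi)) uh)
      ... | no ne = ℕP.≤-trans (cnt-mono {p = λ i → F' i ∧ eqb (hd i) v} {q = λ i → F i ∧ eqb (hd i) v} (λ i h → back i h)) (in1 v)
        where back : ∀ i → F' i ∧ eqb (hd i) v ≡ true → F i ∧ eqb (hd i) v ≡ true
              back i h with upd-inv F e i (proj₁ (∧-true {F' i} h))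
              ... | inj₁ refl = ⊥-elim (ne (does⇒ (hd i ≟ v) (proj₂ (∧-true {F' i} h))))
              ... | inj₂ fi = ∧-intro fi (proj₂ (∧-true {F' i} h))
      st' : ∀ v → U F' v ≡ true → Star (E F') r v
      st' v h with U-inv F e v h
      ... | inj₁ refl = star-map (upd-mono F e) (st (tl e) ut) ▸ E-intro F' e (upd-eq F e true)
      ... | inj₂ u = star-map (upd-mono F e) (st v u)
      lt : cnt (U F) < cnt (U F')
      lt = cnt-strict {p = U F} {q = U F'} (U-mono F e) (hd e) uh (U-hd F' e (upd-eq F e true))
      grow : ∀ fuel → n ≤ fuel + cnt (U F) → Σ[ F ∈ (Fin m → Bool) ] (Inv F × Arborescence F)
      grow zero le = ⊥-elim (ℕP.<⇒≱ lt (ℕP.≤-trans (cnt≤n (U F')) le))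
      grow (suc fuel) le = go fuel F' inv' in1' st' (ℕP.≤-trans le (ℕP.≤-trans (ℕP.≤-reflexive (sym (ℕP.+-suc fuel _))) (ℕP.+-monoʳ-≤ fuel lt)))

    result : Inv (λ _ → false) → Σ[ F ∈ (Fin m → Bool) ] (Inv F × Arborescence F)
    result inv = go n (λ _ → false) inv (λ v → ℕP.≤-trans (ℕP.≤-reflexive (cnt-zero {m} (λ _ → refl))) z≤n) st (ℕP.m≤m+n n _)
      where st : ∀ v → U (λ _ → false) v ≡ true → Star (E (λ _ → false)) r v
            st v h with ∨-true {eqb r v} h
            ... | inj₁ a = subst (Star (E (λ _ → false)) r) (does⇒ (r ≟ v) a) ε
            ... | inj₂ b with anyF-elim (λ e → false ∧ eqb (hd e) v) b
            ...   | _ , ()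

  private
    Spans : (Fin m → Bool) → Set
    Spans F = ∀ v → rs (λ e → not (F e)) v ≡ true

    -- If removing the arc e leaving U makes the set B unreachable, a second arc e' enters
    -- B ∖ U; it leaves U inside B, and removing e' instead of e leaves more vertices reachable.
    extend₁ : ∀ F → Spans F → ∀ v → U F v ≡ false → ∃ λ e → U F (tl e) ≡ true × U F (hd e) ≡ false × Spans (upd F e true)
    extend₁ F sp v nv with exit {λ e → not (F e)} (U F) (U-base F) (rs-star (λ e → not (F e)) v (sp v)) nv
    ... | e , _ , ut , uh = loop n e ut uh (ℕP.m≤m+n n _)
      where
      al : Fin m → Fin m → Bool
      al e i = not (upd F e true i)
      C : Fin m → Fin n → Bool
      C e = rs (al e)
      al-intro : ∀ e i → F i ≡ false → i ≢ e → al e i ≡ true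
      al-intro e i f ne = cong not (trans (upd-ne F e true i ne) f)
      al-F : ∀ e i → al e i ≡ true → not (F i) ≡ true
      al-F e i h = cong not (¬t⇒f (λ f → t≢f (upd-mono F e i f) (not-true h)))
      leave : ∀ e w → C e w ≡ false → C e (tl e) ≡ true × C e (hd e) ≡ false
      leave e w nw with exit {λ e → not (F e)} (C e) (rs-base (al e)) (rs-star (λ e → not (F e)) w (sp w)) nw
      ... | f , nf , ct , ch with f ≟ e
      ...   | yes refl = ct , ch
      ...   | no ne = ⊥-elim (t≢f (rs-step (al e) f (al-intro e f (not-true nf) ne) ct) ch)
      loop : ∀ fuel e → U F (tl e) ≡ true → U F (hd e) ≡ false → n ≤ fuel + cnt (C e) →
             ∃ λ e → U F (tl e) ≡ true × U F (hd e) ≡ false × Spans (upd F e true)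
      loop fuel e ut uh le with find? (λ w → not (C e w))
      ... | inj₂ z = e , ut , uh , λ w → trans (sym (BP.not-involutive _)) (cong not (z w))
      ... | inj₁ (w , nw) with leave e w (not-true nw)
      ...   | ct , ch with cut (λ v → not (C e v) ∧ not (U F v)) (cong (_∧ not (U F r)) (cong not (rs-base (al e))))
                         (hd e) (∧-intro (cong not ch) (cong not uh)) (eqb e) (cnt-eqb≤1 e)
      ...     | e' , ne , yt , yh = again fuel le
        where
        ne' : e' ≢ e
        ne' q = t≢f (dec-true (e ≟ e') (sym q)) ne
        cF : F e' ≡ false
        cF = ¬t⇒f (λ f → t≢f (U-hd F e' f) (not-true (proj₂ (∧-true {not (C e (hd e'))} yh))))
        ch' : C e (hd e') ≡ false
        ch' = not-true (proj₁ (∧-true yh))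
        ct' : C e (tl e') ≡ false
        ct' = ¬t⇒f (λ c → t≢f (rs-step (al e) e' (al-intro e e' cF ne') c) ch')
        ut' : U F (tl e') ≡ true
        ut' = nand yt ct'
        uh' : U F (hd e') ≡ false
        uh' = not-true (proj₂ (∧-true {not (C e (hd e'))} yh))
        -- What is reached without `e` is also reached without `e'`, whose head lies outside `C e`;
        -- by `leave` the tail of `e'` is gained.
        sub : ∀ {v} → Star (E (al e)) r v → C e v ≡ true × C e' v ≡ true
        sub ε = rs-base (al e) , rs-base (al e')
        sub (s ▸ h) with E-elim (al e) h | sub s
        ... | f , a , refl , refl | c , c' = cv , rs-step (al e') f (al-intro e' f (not-true (al-F e f a)) (λ { refl → t≢f cv ch' })) c'
          where cv = rs-step (al e) f a c
        c'tl : C e' (tl e') ≡ true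
        c'tl with C e' (tl e') in q
        ... | true = refl
        ... | false = ⊥-elim (t≢f (proj₁ (leave e' (tl e') q)) q)
        lt : cnt (C e) < cnt (C e')
        lt = cnt-strict {p = C e} {q = C e'} (λ v c → proj₂ (sub (rs-star (al e) v c))) (tl e') ct' c'tl
        again : ∀ fuel → n ≤ fuel + cnt (C e) → _
        again zero le = ⊥-elim (ℕP.<⇒≱ lt (ℕP.≤-trans (cnt≤n (C e')) le))
        again (suc fuel) le = loop fuel e' ut' uh' (ℕP.≤-trans le (ℕP.≤-trans (ℕP.≤-reflexive (sym (ℕP.+-suc fuel _))) (ℕP.+-monoʳ-≤ fuel lt)))

    spans₀ : Spans (λ _ → false)
    spans₀ v with rs (λ _ → true) v in eq
    ... | true = refl
    ... | false with cut (λ w → not (rs (λ _ → true) w)) (cong not (rs-base (λ _ → true))) v (cong not eq) (λ _ → false) (ℕP.≤-trans (ℕP.≤-reflexive (cnt-zero {m} (λ _ → refl))) z≤n)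
    ...   | e , _ , yt , yh = ⊥-elim (t≢f (rs-step (λ _ → true) e refl (trans (sym (BP.not-involutive _)) (cong not yt))) (not-true yh))

  first : Σ[ A ∈ (Fin m → Bool) ] (Spans A × Arborescence A)
  first = Grow.result Spans extend₁ spans₀

  module Second (A : Fin m → Bool) (sp : Spans A) (arb : Arborescence A) where
    Off : (Fin m → Bool) → Set
    Off F = ∀ e → F e ≡ true → A e ≡ false

    second : Σ[ B ∈ (Fin m → Bool) ] (Off B × Arborescence B)
    second = Grow.result Off ext (λ _ ())
      where
      ext : ∀ F → Off F → ∀ v → U F v ≡ false → ∃ λ e → U F (tl e) ≡ true × U F (hd e) ≡ false × Off (upd F e true)
      ext F off v nv with exit {λ e → not (A e)} (U F) (U-base F) (rs-star (λ e → not (A e)) v (sp v)) nv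
      ... | e , na , ut , uh = e , ut , uh , off'
        where off' : Off (upd F e true)
              off' i h with upd-inv F e i h
              ... | inj₁ refl = not-true na
              ... | inj₂ f = off i f

  ∂ : (Fin m → Bool) → Fin n → Bool
  ∂ X v = xsum (λ e → X e ∧ (eqb (tl e) v xor eqb (hd e) v))

  module Join (B : Fin m → Bool) (reach : ∀ v → Star (E B) r v) (p : Fin n → Bool) (even : xsum p ≡ false) where
    chi : ∀ {v} → Star (E B) r v → Fin m → Bool
    chi ε e' = false
    chi (s ▸ h) e' = chi s e' xor eqb (proj₁ (E-elim B h)) e'

    chi-off : ∀ {v} (s : Star (E B) r v) e → B e ≡ false → chi s e ≡ false
    chi-off ε e b = refl
    chi-off (s ▸ h) e b = cong₂ _xor_ (chi-off s e b) (dec-false (proj₁ (E-elim B h) ≟ e) (λ { refl → t≢f (proj₁ (proj₂ (E-elim B h))) b }))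

    ∂-xor : ∀ X Y v → ∂ (λ e → X e xor Y e) v ≡ ∂ X v xor ∂ Y v
    ∂-xor X Y v = trans (xsum-cong (λ e → lem (X e) (Y e) _)) (xsum-xor (λ e → X e ∧ (eqb (tl e) v xor eqb (hd e) v)) (λ e → Y e ∧ (eqb (tl e) v xor eqb (hd e) v)))
      where lem : ∀ a b c → (a xor b) ∧ c ≡ (a ∧ c) xor (b ∧ c)
            lem a b true  = trans (BP.∧-identityʳ _) (cong₂ _xor_ (sym (BP.∧-identityʳ a)) (sym (BP.∧-identityʳ b)))
            lem a b false = trans (BP.∧-zeroʳ _) (sym (cong₂ _xor_ (BP.∧-zeroʳ a) (BP.∧-zeroʳ b)))

    ∂-chi : ∀ {w} (s : Star (E B) r w) v → ∂ (chi s) v ≡ eqb r v xor eqb w v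
    ∂-chi ε v = trans (xsum-false {m} (λ _ → refl)) (sym (BP.xor-same (eqb r v)))
    ∂-chi (_▸_ {u} {w} s h) v = trans (∂-xor (chi s) (eqb (proj₁ (E-elim B h))) v)
      (trans (cong₂ _xor_ (∂-chi s v) (trans (xsum-delta (proj₁ (E-elim B h)) (λ e → eqb (tl e) v xor eqb (hd e) v))
         (cong₂ (λ a b → eqb a v xor eqb b v) (proj₁ (proj₂ (proj₂ (E-elim B h)))) (proj₂ (proj₂ (proj₂ (E-elim B h)))))))
        (lem (eqb r v) (eqb u v) (eqb w v)))
      where lem : ∀ a b c → (a xor b) xor (b xor c) ≡ a xor c
            lem a b c = trans (BP.xor-assoc a b _) (cong (a xor_) (trans (sym (BP.xor-assoc b b c)) (cong (_xor c) (BP.xor-same b))))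

    -- A join of the odd vertices: the sum modulo 2 of the paths in `B` from `r` to the vertices of
    -- `p`. Each path contributes its two ends, and as their number is even, the contributions at
    -- `r` cancel.
    J : Fin m → Bool
    J e = xsum (λ w → p w ∧ chi (reach w) e)

    J-off : ∀ e → B e ≡ false → J e ≡ false
    J-off e b = xsum-false (λ w → trans (cong (p w ∧_) (chi-off (reach w) e b)) (BP.∧-zeroʳ (p w)))

    ∂-J : ∀ v → ∂ J v ≡ p v
    ∂-J v = begin
      xsum (λ e → xsum (λ w → p w ∧ chi (reach w) e) ∧ inc e)
        ≡⟨ xsum-cong (λ e → trans (BP.∧-comm _ (inc e)) (sym (xsum-∧ (inc e) (λ w → p w ∧ chi (reach w) e)))) ⟩
      xsum (λ e → xsum (λ w → inc e ∧ (p w ∧ chi (reach w) e)))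
        ≡⟨ xsum-swap (λ e w → inc e ∧ (p w ∧ chi (reach w) e)) ⟩
      xsum (λ w → xsum (λ e → inc e ∧ (p w ∧ chi (reach w) e)))
        ≡⟨ xsum-cong (λ w → trans (xsum-cong (λ e → trans (BP.∧-comm (inc e) _) (BP.∧-assoc (p w) _ _))) (xsum-∧ (p w) (λ e → chi (reach w) e ∧ inc e))) ⟩
      xsum (λ w → p w ∧ ∂ (chi (reach w)) v)
        ≡⟨ xsum-cong (λ w → trans (cong (p w ∧_) (∂-chi (reach w) v)) (lem (p w) (eqb r v) (eqb w v) (eqb v w) (does-sym _≟_ w v))) ⟩
      xsum (λ w → (eqb r v ∧ p w) xor (eqb v w ∧ p w))
        ≡⟨ xsum-xor (λ w → eqb r v ∧ p w) (λ w → eqb v w ∧ p w) ⟩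
      xsum (λ w → eqb r v ∧ p w) xor xsum (λ w → eqb v w ∧ p w)
        ≡⟨ cong₂ _xor_ (trans (xsum-∧ (eqb r v) p) (trans (cong (eqb r v ∧_) even) (BP.∧-zeroʳ _))) (xsum-delta v p) ⟩
      p v ∎
      where
      open ≡-Reasoning
      inc : Fin m → Bool
      inc e = eqb (tl e) v xor eqb (hd e) v
      lem : ∀ a b c d → c ≡ d → a ∧ (b xor c) ≡ (b ∧ a) xor (d ∧ a)
      lem false b c d refl = sym (cong₂ _xor_ (BP.∧-zeroʳ b) (BP.∧-zeroʳ c))
      lem true  b c d refl = sym (cong₂ _xor_ (BP.∧-identityʳ b) (BP.∧-identityʳ c))

  -- Each arc contributes once at each of its two ends, so modulo 2 nothing remains.
  ∂-total : ∀ X → xsum (∂ X) ≡ false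
  ∂-total X = trans (xsum-swap (λ v e → X e ∧ (eqb (tl e) v xor eqb (hd e) v)))
    (xsum-false (λ e → trans (xsum-∧ (X e) (λ v → eqb (tl e) v xor eqb (hd e) v))
      (trans (cong (X e ∧_) (trans (xsum-xor (eqb (tl e)) (eqb (hd e))) (cong₂ _xor_ (one' (tl e)) (one' (hd e))))) (BP.∧-zeroʳ (X e)))))
    where one' : ∀ (u : Fin n) → xsum (eqb u) ≡ true
          one' u = trans (xsum-cong (λ v → sym (BP.∧-identityʳ (eqb u v)))) (xsum-delta u (λ _ → true))

  record EvenSpanning : Set where
    field
      Z A   : Fin m → Bool
      A⊆Z   : ∀ e → A e ≡ true → Z e ≡ true
      reach : ∀ v → Star (E A) r v
      -- Heads are those of the given orientation, in which each arborescence enters a vertex at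
      -- most once; tails have no such bound.
      few   : ∀ v → cnt (λ e → Z e ∧ eqb (hd e) v) ≤ 2
      even  : ∀ v → ∃ λ k → cnt (λ e → Z e ∧ eqb (tl e) v) + cnt (λ e → Z e ∧ eqb (hd e) v) ≡ 2 * k

  evenSpanning : EvenSpanning
  evenSpanning with first
  ... | A , sp , arb with Second.second A sp arb
  ...   | B , off , arbB = record { Z = Z ; A = A ; A⊆Z = A⊆Z ; reach = proj₂ arb ; few = few ; even = even }
    where
    module Jo = Join B (proj₂ arbB) (∂ A) (∂-total A)
    Z : Fin m → Bool
    Z e = A e xor Jo.J e
    A⊆Z : ∀ e → A e ≡ true → Z e ≡ true
    A⊆Z e a = cong₂ _xor_ a (Jo.J-off e (¬t⇒f (λ b → t≢f a (off e b))))
    sub : ∀ e → Z e ≡ true → A e ≡ true ⊎ B e ≡ true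
    sub e z with A e | B e in eq
    ... | true | _ = inj₁ refl
    ... | false | true = inj₂ refl
    ... | false | false = ⊥-elim (t≢f z (Jo.J-off e eq))
    few : ∀ v → cnt (λ e → Z e ∧ eqb (hd e) v) ≤ 2
    few v = ℕP.≤-trans (cnt-mono {p = λ e → Z e ∧ eqb (hd e) v} {q = λ e → (A e ∧ eqb (hd e) v) ∨ (B e ∧ eqb (hd e) v)} s')
        (ℕP.≤-trans (cnt-∨ (λ e → A e ∧ eqb (hd e) v) (λ e → B e ∧ eqb (hd e) v)) (ℕP.+-mono-≤ (proj₁ arb v) (proj₁ arbB v)))
      where s' : ∀ e → Z e ∧ eqb (hd e) v ≡ true → (A e ∧ eqb (hd e) v) ∨ (B e ∧ eqb (hd e) v) ≡ true
            s' e h with sub e (proj₁ (∧-true {Z e} h))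
            ... | inj₁ a = ∨-introˡ (∧-intro a (proj₂ (∧-true {Z e} h)))
            ... | inj₂ b = ∨-introʳ {A e ∧ eqb (hd e) v} (∧-intro b (proj₂ (∧-true {Z e} h)))
    even : ∀ v → ∃ λ k → cnt (λ e → Z e ∧ eqb (tl e) v) + cnt (λ e → Z e ∧ eqb (hd e) v) ≡ 2 * k
    even v = even-half _ (begin
      odd (cnt (λ e → Z e ∧ eqb (tl e) v) + cnt (λ e → Z e ∧ eqb (hd e) v))
        ≡⟨ odd-+ (cnt (λ e → Z e ∧ eqb (tl e) v)) _ ⟩
      odd (cnt (λ e → Z e ∧ eqb (tl e) v)) xor odd (cnt (λ e → Z e ∧ eqb (hd e) v))
        ≡⟨ cong₂ _xor_ (odd-cnt (λ e → Z e ∧ eqb (tl e) v)) (odd-cnt (λ e → Z e ∧ eqb (hd e) v)) ⟩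
      xsum (λ e → Z e ∧ eqb (tl e) v) xor xsum (λ e → Z e ∧ eqb (hd e) v)
        ≡⟨ xsum-xor (λ e → Z e ∧ eqb (tl e) v) (λ e → Z e ∧ eqb (hd e) v) ⟨
      xsum (λ e → (Z e ∧ eqb (tl e) v) xor (Z e ∧ eqb (hd e) v))
        ≡⟨ xsum-cong (λ e → lem (Z e) (eqb (tl e) v) (eqb (hd e) v)) ⟩
      ∂ Z v                      ≡⟨ Jo.∂-xor A Jo.J v ⟩
      ∂ A v xor ∂ Jo.J v         ≡⟨ cong (∂ A v xor_) (Jo.∂-J v) ⟩
      ∂ A v xor ∂ A v            ≡⟨ BP.xor-same (∂ A v) ⟩
      false ∎)
      where
      open ≡-Reasoning
      lem : ∀ a b c → (a ∧ b) xor (a ∧ c) ≡ a ∧ (b xor c)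
      lem true  b c = refl
      lem false b c = refl

-- The closed trail on the even subgraph and its links

∧-falseˡ : ∀ {a b} → a ≡ false → a ∧ b ≡ false
∧-falseˡ refl = refl

-- The edges outside `P` are replaced by loops at `r`, which add the same amount to both sides of
-- the balance.
orient-within : ∀ {m n} (P : Fin m → Bool) (s t : Fin m → Fin n) (r : Fin n) →
  (∀ v → ∃ λ k → cnt (λ e → P e ∧ eqb (s e) v) + cnt (λ e → P e ∧ eqb (t e) v) ≡ 2 * k) →
  Σ[ o ∈ (Fin m → Bool) ] (∀ v → cnt (λ e → P e ∧ eqb (pick o s t e) v) ≡ cnt (λ e → P e ∧ eqb (pick o t s e) v))
orient-within {m} P s t r ev with orient _≟_ (λ e → if P e then s e else r) (λ e → if P e then t e else r)
... | o , bal = o , eq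
  where
  s' t' : Fin m → _
  s' e = if P e then s e else r
  t' e = if P e then t e else r
  off : _ → ℕ
  off v = cnt (λ e → not (P e) ∧ eqb r v)
  split : ∀ v (f g f' g' : Fin m → _) → (∀ e → f' e ≡ (if P e then f e else r)) → (∀ e → g' e ≡ (if P e then g e else r)) →
          fib _≟_ (pick o f' g') v ≡ cnt (λ e → P e ∧ eqb (pick o f g e) v) + off v
  split v f g f' g' hf hg = trans (sum-cong pt) (sum-+ (λ e → ⟦ P e ∧ eqb (pick o f g e) v ⟧) (λ e → ⟦ not (P e) ∧ eqb r v ⟧))
    where
    pt : ∀ e → ⟦ eqb (pick o f' g' e) v ⟧ ≡ ⟦ P e ∧ eqb (pick o f g e) v ⟧ + ⟦ not (P e) ∧ eqb r v ⟧
    pt e rewrite hf e | hg e with P e | o e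
    ... | true  | true  = sym (ℕP.+-identityʳ _)
    ... | true  | false = sym (ℕP.+-identityʳ _)
    ... | false | true  = refl
    ... | false | false = refl
  tot : ∀ v → cnt (λ e → P e ∧ eqb (pick o s t e) v) + cnt (λ e → P e ∧ eqb (pick o t s e) v) ≡
              cnt (λ e → P e ∧ eqb (s e) v) + cnt (λ e → P e ∧ eqb (t e) v)
  tot v = trans (sym (sum-+ (λ e → ⟦ P e ∧ eqb (pick o s t e) v ⟧) (λ e → ⟦ P e ∧ eqb (pick o t s e) v ⟧)))
         (trans (sum-cong pt) (sum-+ (λ e → ⟦ P e ∧ eqb (s e) v ⟧) (λ e → ⟦ P e ∧ eqb (t e) v ⟧)))
    where
    pt : ∀ e → ⟦ P e ∧ eqb (pick o s t e) v ⟧ + ⟦ P e ∧ eqb (pick o t s e) v ⟧ ≡ ⟦ P e ∧ eqb (s e) v ⟧ + ⟦ P e ∧ eqb (t e) v ⟧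
    pt e with o e
    ... | true  = refl
    ... | false = ℕP.+-comm ⟦ P e ∧ eqb (t e) v ⟧ _
  shift : ∀ {a b} c → a + c ≤ suc (b + c) → a ≤ suc b
  shift c h = ℕP.+-cancelʳ-≤ c _ _ h
  eq : ∀ v → cnt (λ e → P e ∧ eqb (pick o s t e) v) ≡ cnt (λ e → P e ∧ eqb (pick o t s e) v)
  eq v with ev v
  ... | k , ek = trans (proj₁ both) (sym (proj₂ both))
    where
    a = split v s t s' t' (λ _ → refl) (λ _ → refl)
    b = split v t s t' s' (λ _ → refl) (λ _ → refl)
    both = even-balanced k (trans (tot v) ek)
      (shift (off v) (subst₂ (λ x y → x ≤ suc y) a b (proj₁ (bal v))))
      (shift (off v) (subst₂ (λ x y → x ≤ suc y) b a (proj₂ (bal v))))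

-- A closed trail through all arcs of the spanning even subgraph Z, cut wherever it passes the
-- head, in the old orientation, of one of its arcs: as old indegrees in Z are at most two, few
-- cuts are made at a vertex, and the pieces have at most two arcs.
module Reorient {m n : ℕ} (tl₁ hd₁ : Fin m → Fin n) (r : Fin n) (other : Fin n) (other≢r : other ≢ r)
  (cut : ∀ (Y : Fin n → Bool) → Y r ≡ false → ∀ y → Y y ≡ true → ∀ bad → cnt bad ≤ 1 →
         ∃ λ e → bad e ≡ false × Y (tl₁ e) ≡ false × Y (hd₁ e) ≡ true)
  (inout₁ : ∀ v → cnt (λ e → eqb (tl₁ e) v) ≡ cnt (λ e → eqb (hd₁ e) v))
  (S : Fin m → Bool) (noloop₁ : ∀ e → S e ≡ true → tl₁ e ≢ hd₁ e)
  (simple₁ : ∀ e f → S e ≡ true → S f ≡ true → (tl₁ e ≡ tl₁ f × hd₁ e ≡ hd₁ f) ⊎ (tl₁ e ≡ hd₁ f × hd₁ e ≡ tl₁ f) → e ≡ f)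
  (es : Skeleton.EvenSpanning tl₁ hd₁ r cut) where
  private module Sk = Skeleton tl₁ hd₁ r cut
  open Sk.EvenSpanning es public using (Z; A; A⊆Z; reach; few; even)

  private
    nZ : Fin m → Bool
    nZ e = not (Z e)

    ∧-swap : ∀ (P : Fin m → Bool) (f : Fin m → Fin n) v → cnt (λ e → eqb (f e) v) ≡ cnt (λ e → P e ∧ eqb (f e) v) + cnt (λ e → not (P e) ∧ eqb (f e) v)
    ∧-swap P f v = trans (cnt-split (λ e → eqb (f e) v) P)
      (cong₂ _+_ (cnt-cong (λ e → BP.∧-comm (eqb (f e) v) (P e))) (cnt-cong (λ e → BP.∧-comm (eqb (f e) v) (not (P e)))))

    evenR : ∀ v → ∃ λ k → cnt (λ e → nZ e ∧ eqb (tl₁ e) v) + cnt (λ e → nZ e ∧ eqb (hd₁ e) v) ≡ 2 * k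
    evenR v = even-half _ (xor-cancel (proj₁ par) (proj₂ par))
      where
      a = cnt (λ e → Z e ∧ eqb (tl₁ e) v)
      b = cnt (λ e → Z e ∧ eqb (hd₁ e) v)
      a' = cnt (λ e → nZ e ∧ eqb (tl₁ e) v)
      b' = cnt (λ e → nZ e ∧ eqb (hd₁ e) v)
      odd-2* : ∀ k → odd (2 * k) ≡ false
      odd-2* k = trans (odd-+ k (k + 0)) (trans (cong (λ z → odd k xor odd z) (ℕP.+-identityʳ k)) (BP.xor-same (odd k)))
      whole : (a + b) + (a' + b') ≡ 2 * cnt (λ e → eqb (hd₁ e) v)
      whole = trans (+-interchange a b a' b') (trans (cong₂ _+_ (trans (sym (∧-swap Z tl₁ v)) (inout₁ v)) (sym (∧-swap Z hd₁ v)))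
                (cong (cnt (λ e → eqb (hd₁ e) v) +_) (sym (ℕP.+-identityʳ _))))
      par : odd (a + b) ≡ false × odd (a + b) xor odd (a' + b') ≡ false
      par = trans (cong odd (proj₂ (even v))) (odd-2* (proj₁ (even v))) ,
            trans (sym (odd-+ (a + b) (a' + b'))) (trans (cong odd whole) (odd-2* (cnt (λ e → eqb (hd₁ e) v))))
      xor-cancel : ∀ {x y} → x ≡ false → x xor y ≡ false → y ≡ false
      xor-cancel refl h = h

    orientation : Σ[ o ∈ (Fin m → Bool) ] ((∀ v → cnt (λ e → Z e ∧ eqb (pick o tl₁ hd₁ e) v) ≡ cnt (λ e → Z e ∧ eqb (pick o hd₁ tl₁ e) v)) ×
      (∀ v → cnt (λ e → nZ e ∧ eqb (pick o tl₁ hd₁ e) v) ≡ cnt (λ e → nZ e ∧ eqb (pick o hd₁ tl₁ e) v)))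
    orientation = o ,
      (λ v → trans (cnt-cong (λ e → o-Z e tl₁ hd₁ v)) (trans (proj₂ oZ v) (sym (cnt-cong (λ e → o-Z e hd₁ tl₁ v))))) ,
      (λ v → trans (cnt-cong (λ e → o-R e tl₁ hd₁ v)) (trans (proj₂ oR v) (sym (cnt-cong (λ e → o-R e hd₁ tl₁ v)))))
      where
      oZ = orient-within Z tl₁ hd₁ r even
      oR = orient-within nZ tl₁ hd₁ r evenR
      o : Fin m → Bool
      o e = if Z e then proj₁ oZ e else proj₁ oR e
      o-Z : ∀ e (f g : Fin m → Fin n) v → Z e ∧ eqb (pick o f g e) v ≡ Z e ∧ eqb (pick (proj₁ oZ) f g e) v
      o-Z e f g v with Z e
      ... | true = refl
      ... | false = refl
      o-R : ∀ e (f g : Fin m → Fin n) v → nZ e ∧ eqb (pick o f g e) v ≡ nZ e ∧ eqb (pick (proj₁ oR) f g e) v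
      o-R e f g v with Z e
      ... | true = refl
      ... | false = refl

  abstract
    o : Fin m → Bool
    o = proj₁ orientation

    oriented : (∀ v → cnt (λ e → Z e ∧ eqb (pick o tl₁ hd₁ e) v) ≡ cnt (λ e → Z e ∧ eqb (pick o hd₁ tl₁ e) v)) ×
      (∀ v → cnt (λ e → nZ e ∧ eqb (pick o tl₁ hd₁ e) v) ≡ cnt (λ e → nZ e ∧ eqb (pick o hd₁ tl₁ e) v))
    oriented = proj₂ orientation

  tl hd : Fin m → Fin n
  tl = pick o tl₁ hd₁
  hd = pick o hd₁ tl₁

  ends-of : ∀ e → (tl e ≡ tl₁ e × hd e ≡ hd₁ e) ⊎ (tl e ≡ hd₁ e × hd e ≡ tl₁ e)
  ends-of e with o e
  ... | true  = inj₁ (refl , refl)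
  ... | false = inj₂ (refl , refl)

  balZ : ∀ v → cnt (λ e → Z e ∧ eqb (tl e) v) ≡ cnt (λ e → Z e ∧ eqb (hd e) v)
  balZ = proj₁ oriented

  balR : ∀ v → cnt (λ e → not (Z e) ∧ eqb (tl e) v) ≡ cnt (λ e → not (Z e) ∧ eqb (hd e) v)
  balR = proj₂ oriented

  inout : ∀ v → fib _≟_ hd v ≡ fib _≟_ tl v
  inout v = trans (∧-swap Z hd v) (trans (cong₂ _+_ (sym (balZ v)) (sym (balR v))) (sym (∧-swap Z tl v)))

  -- At most two arcs of `Z` have their old head at `v`. Any other arc with old head `v` still
  -- begins or ends there, and outside `Z` equally many arcs begin and end at `v`.
  degR : ∀ v → cnt (λ e → eqb (hd₁ e) v) ≤ 2 * cnt (λ e → not (Z e) ∧ eqb (tl e) v) + 2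
  degR v = begin
    cnt (λ e → eqb (hd₁ e) v)                                                ≡⟨ ∧-swap Z hd₁ v ⟩
    cnt (λ e → Z e ∧ eqb (hd₁ e) v) + cnt (λ e → nZ e ∧ eqb (hd₁ e) v)       ≤⟨ ℕP.+-mono-≤ (few v) (ℕP.≤-trans (cnt-mono {q = λ e → (nZ e ∧ eqb (tl e) v) ∨ (nZ e ∧ eqb (hd e) v)} sub) (cnt-∨ (λ e → nZ e ∧ eqb (tl e) v) (λ e → nZ e ∧ eqb (hd e) v))) ⟩
    2 + (cnt (λ e → nZ e ∧ eqb (tl e) v) + cnt (λ e → nZ e ∧ eqb (hd e) v))  ≡⟨ cong (λ z → 2 + (cnt (λ e → nZ e ∧ eqb (tl e) v) + z)) (sym (balR v)) ⟩
    2 + (D + D)                                                              ≡⟨ lem D ⟩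
    2 * D + 2                                                                ∎
    where
    open ℕP.≤-Reasoning
    D = cnt (λ e → nZ e ∧ eqb (tl e) v)
    lem : ∀ d → 2 + (d + d) ≡ 2 * d + 2
    lem = solve-∀
    sub : ∀ e → nZ e ∧ eqb (hd₁ e) v ≡ true → (nZ e ∧ eqb (tl e) v) ∨ (nZ e ∧ eqb (hd e) v) ≡ true
    sub e h with ends-of e
    ... | inj₁ (_ , q) = ∨-introʳ {nZ e ∧ eqb (tl e) v} (trans (cong (λ u → nZ e ∧ eqb u v) q) h)
    ... | inj₂ (q , _) = ∨-introˡ (trans (cong (λ u → nZ e ∧ eqb u v) q) h)

  noloop : ∀ e → S e ≡ true → hd e ≢ tl e
  noloop e s q with ends-of e
  ... | inj₁ (a , b) = noloop₁ e s (trans (sym a) (trans (sym q) b))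
  ... | inj₂ (a , b) = noloop₁ e s (trans (sym b) (trans q a))

  simple : ∀ e f → S e ≡ true → S f ≡ true → tl e ≡ tl f → hd e ≡ hd f → e ≡ f
  simple e f se sf p q with ends-of e | ends-of f
  ... | inj₁ (a , b) | inj₁ (c , d) = simple₁ e f se sf (inj₁ (trans (sym a) (trans p c) , trans (sym b) (trans q d)))
  ... | inj₁ (a , b) | inj₂ (c , d) = simple₁ e f se sf (inj₂ (trans (sym a) (trans p c) , trans (sym b) (trans q d)))
  ... | inj₂ (a , b) | inj₁ (c , d) = simple₁ e f se sf (inj₂ (trans (sym b) (trans q d) , trans (sym a) (trans p c)))
  ... | inj₂ (a , b) | inj₂ (c , d) = simple₁ e f se sf (inj₁ (trans (sym b) (trans q d) , trans (sym a) (trans p c)))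

  antiparallel : ∀ e f → S e ≡ true → S f ≡ true → tl e ≡ hd f → hd e ≡ tl f → e ≡ f
  antiparallel e f se sf p q with ends-of e | ends-of f
  ... | inj₁ (a , b) | inj₁ (c , d) = simple₁ e f se sf (inj₂ (trans (sym a) (trans p d) , trans (sym b) (trans q c)))
  ... | inj₁ (a , b) | inj₂ (c , d) = simple₁ e f se sf (inj₁ (trans (sym a) (trans p d) , trans (sym b) (trans q c)))
  ... | inj₂ (a , b) | inj₁ (c , d) = simple₁ e f se sf (inj₁ (trans (sym b) (trans q c) , trans (sym a) (trans p d)))
  ... | inj₂ (a , b) | inj₂ (c , d) = simple₁ e f se sf (inj₂ (trans (sym b) (trans q c) , trans (sym a) (trans p d)))

  private
    -- The common key `nothing` of the arcs outside `Z` forces a permutation that respects keys to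
    -- preserve `Z`.
    key : (Fin m → Fin n) → Fin m → Maybe (Fin n)
    key f e = if Z e then just (f e) else nothing

    ZPerm : Perm m → Set
    ZPerm π = ∀ e → key tl (to π e) ≡ key hd e

    key-just : ∀ f v → fib (MP.≡-dec _≟_) (key f) (just v) ≡ cnt (λ e → Z e ∧ eqb (f e) v)
    key-just f v = cnt-cong pt
      where pt : ∀ e → does (MP.≡-dec _≟_ (key f e) (just v)) ≡ Z e ∧ eqb (f e) v
            pt e with Z e
            ... | true = refl
            ... | false = refl

    key-nothing : ∀ f → fib (MP.≡-dec _≟_) (key f) nothing ≡ cnt nZ
    key-nothing f = cnt-cong pt
      where pt : ∀ e → does (MP.≡-dec _≟_ (key f e) nothing) ≡ nZ e
            pt e with Z e
            ... | true = refl
            ... | false = refl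

    start : Σ[ π ∈ Perm m ] ZPerm π
    start = perm-of-fibres (MP.≡-dec _≟_) (key hd) (key tl) fibs
      where
      fibs : ∀ k → fib (MP.≡-dec _≟_) (key hd) k ≡ fib (MP.≡-dec _≟_) (key tl) k
      fibs (just v) = trans (key-just hd v) (trans (sym (balZ v)) (sym (key-just tl v)))
      fibs nothing = trans (key-nothing hd) (sym (key-nothing tl))

    key-Z : ∀ (f g : Fin m → Fin n) e e' → key f e ≡ key g e' → Z e ≡ Z e'
    key-Z f g e e' h with Z e | Z e'
    ... | true | true = refl
    ... | false | false = refl

    key-v : ∀ (f g : Fin m → Fin n) e e' → key f e ≡ key g e' → Z e ≡ true → f e ≡ g e'
    key-v f g e e' h z with Z e | Z e'
    ... | true | true = MP.just-injective h

    key-cong : ∀ e e' → Z e ≡ true → Z e' ≡ true → hd e ≡ hd e' → key hd e ≡ key hd e'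
    key-cong e e' z z' q rewrite z | z' = cong just q

    swapZ : ∀ π → ZPerm π → (O : Fin m → Bool) → ∀ x y → O x ≡ true → O y ≡ false → Z x ≡ true → Z y ≡ true → hd x ≡ hd y →
            ∃ λ x' → ∃ λ y' → O x' ≡ true × O y' ≡ false × ZPerm (swapP π x' y')
    swapZ π inv O x y ox oy zx zy q = x , y , ox , oy , λ e → trans (inv _) (τ-key (key hd) x y (key-cong x y zx zy q) e)

    -- Some arc of `A` leaves `r` in the old orientation, since `other` is reached. If it was
    -- turned, it enters `r`; otherwise its predecessor under the permutation does.
    at-root : ∃ λ e → Z e ≡ true × hd e ≡ r
    at-root with Sk.exit {A} (eqb r) (eqb-refl r) (reach other) (dec-false (r ≟ other) (λ q → other≢r (sym q)))
    ... | a , aa , t , _ with ends-of a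
    ...   | inj₂ (_ , q) = a , A⊆Z a aa , trans q (sym (does⇒ (r ≟ tl₁ a) t))
    ...   | inj₁ (q , _) = from π a , zb , hb
      where
      π = proj₁ start
      zb : Z (from π a) ≡ true
      zb = trans (sym (key-Z tl hd (to π (from π a)) (from π a) (proj₂ start _))) (trans (cong Z (tf π a)) (A⊆Z a aa))
      hb : hd (from π a) ≡ r
      hb = trans (sym (key-v tl hd _ _ (proj₂ start (from π a)) (trans (cong Z (tf π a)) (A⊆Z a aa))))
             (trans (cong tl (tf π a)) (trans q (sym (does⇒ (r ≟ tl₁ a) t))))

  abstract
    e₀ : Fin m
    e₀ = proj₁ at-root

    e₀-Z : Z e₀ ≡ true
    e₀-Z = proj₁ (proj₂ at-root)

    e₀-hd : hd e₀ ≡ r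
    e₀-hd = proj₂ (proj₂ at-root)

  module Tour (π : Perm m) (inv : ZPerm π)
    (merge : ∀ x y → Z x ≡ true → Z y ≡ true → hd x ≡ hd y → orbit π e₀ x ≡ true → orbit π e₀ y ≡ true) where

    π-Z : ∀ e → Z (to π e) ≡ Z e
    π-Z e = key-Z tl hd _ _ (inv e)

    π-ok : ∀ e → Z e ≡ true → tl (to π e) ≡ hd e
    π-ok e z = key-v tl hd _ _ (inv e) (trans (π-Z e) z)

    private
      before-Z : ∀ a → Z a ≡ true → Z (from π a) ≡ true
      before-Z a z = trans (sym (π-Z _)) (trans (cong Z (tf π a)) z)

      before-hd : ∀ a → Z a ≡ true → hd (from π a) ≡ tl a
      before-hd a z = trans (sym (π-ok _ (before-Z a z))) (cong tl (tf π a))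

      O = orbit π e₀

      -- Induction along the path in `A`: whether or not an arc was turned, it carries the orbit
      -- from its old tail to its old head, where `merge` collects all arcs of `Z` that enter.
      entering : ∀ {v} → Star (Sk.E A) r v → ∀ e → Z e ≡ true → hd e ≡ v → O e ≡ true
      entering ε e z h = merge e₀ e e₀-Z z (trans e₀-hd (sym h)) (orbit-base π e₀)
      entering (s ▸ h) e z he with Sk.E-elim A h
      ... | a , aa , refl , refl with ends-of a
      ...   | inj₁ (p , q) = merge a e (A⊆Z a aa) z (trans q (sym he))
              (subst (λ u → O u ≡ true) (tf π a) (orbit-to π e₀ (from π a)
                (entering s (from π a) (before-Z a (A⊆Z a aa)) (trans (before-hd a (A⊆Z a aa)) p))))
      ...   | inj₂ (p , q) = merge (from π a) e (before-Z a (A⊆Z a aa)) z (trans (before-hd a (A⊆Z a aa)) (trans p (sym he)))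
              (perm-closed-back π O (orbit-to π e₀) (from π a)
                (trans (cong O (tf π a)) (entering s a (A⊆Z a aa) q)))

    single : ∀ e → Z e ≡ true → O e ≡ true
    single e z = entering (reach (hd e)) e z refl

    -- A transition is cut at the old head of either of its two arcs. The additional cut after `e₀`
    -- takes care of `r`, which no arc of `A` has to enter.
    fZ : Fin m → Bool
    fZ e = not (eqb (hd₁ e) (hd e)) ∧ (not (eqb (hd₁ (to π e)) (hd e)) ∧ not (eqb e e₀))

    -- The old head of the middle arc `to π e` is one of its two present ends, and the trail is cut
    -- there.
    fZ-short : ∀ e → Z e ≡ true → fZ e ≡ true → fZ (to π e) ≡ false
    fZ-short e z f with ends-of (to π e)
    ... | inj₁ (_ , q) = ∧-falseˡ (cong not (dec-true (hd₁ (to π e) ≟ hd (to π e)) (sym q)))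
    ... | inj₂ (q , _) = ⊥-elim (t≢f (dec-true (hd₁ (to π e) ≟ hd e) (trans (sym q) (π-ok e z)))
            (not-true (proj₁ (∧-true {not (eqb (hd₁ (to π e)) (hd e))} (proj₂ (∧-true {not (eqb (hd₁ e) (hd e))} f))))))

    -- Two arcs of `S` closing up would be antiparallel, hence equal by simplicity, hence a loop.
    fZ-path : ∀ e → Z e ≡ true → fZ e ≡ true → S e ≡ true → S (to π e) ≡ true → hd (to π e) ≢ tl e
    fZ-path e z f s s' q = noloop e s (trans (sym (π-ok e z)) (cong tl (sym same)))
      where same : e ≡ to π e
            same = antiparallel e (to π e) s s' (sym q) (sym (π-ok e z))

    -- `5 = 2 + 2 + 1`: at most two arcs before and two behind a cut have their old head at `v`, and
    -- `e₀` adds one.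
    fZ-few : ∀ v → cnt (λ e → Z e ∧ (not (fZ e) ∧ eqb (hd e) v)) ≤ 5
    fZ-few v = ℕP.≤-trans (cnt-mono {p = λ e → Z e ∧ (not (fZ e) ∧ eqb (hd e) v)} {q = λ e → P₁ e ∨ (P₂ e ∨ eqb e₀ e)} sub)
      (ℕP.≤-trans (cnt-∨ P₁ (λ e → P₂ e ∨ eqb e₀ e)) (ℕP.+-mono-≤ (few v) (ℕP.≤-trans (cnt-∨ P₂ (eqb e₀))
        (ℕP.+-mono-≤ (ℕP.≤-trans (cnt-inj {p = P₂} {q = P₁} (to π) (λ e h → trans (cong (_∧ eqb (hd₁ (to π e)) v) (π-Z e)) h) (λ _ _ _ _ → to-inj π)) (few v)) (cnt-eqb≤1 e₀)))))
      where
      P₁ P₂ : Fin m → Bool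
      P₁ e = Z e ∧ eqb (hd₁ e) v
      P₂ e = Z e ∧ eqb (hd₁ (to π e)) v
      sub : ∀ e → Z e ∧ (not (fZ e) ∧ eqb (hd e) v) ≡ true → P₁ e ∨ (P₂ e ∨ eqb e₀ e) ≡ true
      sub e h with ∧-true {Z e} h
      ... | z , h' with ∧-true {not (fZ e)} h'
      ...   | nf , hv with does⇒ (hd e ≟ v) hv
      ...     | refl = go (eqb (hd₁ e) (hd e)) (eqb (hd₁ (to π e)) (hd e)) (does-sym _≟_ e e₀) nf
        where
        go : ∀ x y → eqb e e₀ ≡ eqb e₀ e → not (not x ∧ (not y ∧ not (eqb e e₀))) ≡ true →
             (Z e ∧ x) ∨ ((Z e ∧ y) ∨ eqb e₀ e) ≡ true
        go true y q _ rewrite z = refl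
        go false true q _ rewrite z = refl
        go false false q h rewrite z = trans (sym q) (trans (sym (BP.not-involutive _)) h)

    fZ-at : ∀ v → ∃ λ e → Z e ≡ true × fZ e ≡ false × hd e ≡ v
    fZ-at v = go (reach v)
      where
      go : ∀ {v} → Star (Sk.E A) r v → ∃ λ e → Z e ≡ true × fZ e ≡ false × hd e ≡ v
      go ε = e₀ , e₀-Z , ¬t⇒f (λ f → t≢f (eqb-refl e₀) (not-true (proj₂ (∧-true {not (eqb (hd₁ (to π e₀)) (hd e₀))} (proj₂ (∧-true {not (eqb (hd₁ e₀) (hd e₀))} f)))))) , e₀-hd
      go (s ▸ h) with Sk.E-elim A h
      ... | a , aa , refl , refl with ends-of a
      ...   | inj₁ (p , q) = a , A⊆Z a aa , ∧-falseˡ (cong not (dec-true (hd₁ a ≟ hd a) (sym q))) , q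
      ...   | inj₂ (p , q) = b , before-Z a (A⊆Z a aa) , ¬t⇒f (λ f → t≢f (dec-true (hd₁ (to π b) ≟ hd b) (trans (cong hd₁ (tf π a)) (sym hb)))
                (not-true (proj₁ (∧-true {not (eqb (hd₁ (to π b)) (hd b))} (proj₂ (∧-true {not (eqb (hd₁ b) (hd b))} f)))))) , hb
        where b = from π a
              hb : hd b ≡ hd₁ a
              hb = trans (before-hd a (A⊆Z a aa)) p

  zperm : Σ[ π ∈ Perm m ] (ZPerm π × (∀ x y → Z x ≡ true → Z y ≡ true → hd x ≡ hd y → orbit π e₀ x ≡ true → orbit π e₀ y ≡ true))
  zperm = merge-orbits ZPerm e₀ Z hd swapZ (proj₁ start) (proj₂ start)

-- Division into levels

cnt-below : ∀ M r → r ≤ M → cnt {M} (λ i → does (toℕ i <? r)) ≡ r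
cnt-below M zero le = cnt-zero {M} (λ i → dec-false (toℕ i <? 0) (λ ()))
cnt-below (suc M) (suc r) (s≤s le) = cong₂ _+_ (cong ⟦_⟧ (dec-true (0 <? suc r) (s≤s z≤n)))
  (trans (cnt-cong {M} (λ i → bool-ext (λ h → dec-true (toℕ i <? r) (ℕP.≤-pred (does⇒ (suc (toℕ i) <? suc r) h)))
                                   (λ h → dec-true (suc (toℕ i) <? suc r) (s≤s (does⇒ (toℕ i <? r) h))))) (cnt-below M r le))

-- Orienting the bipartite graph of tails and heads within the classes halves each class exactly.
split-levels : ∀ k {N n} (P : Fin N → Bool) (s t : Fin N → Fin n) (c : Fin n → ℕ) →
  (∀ v → cnt (λ e → P e ∧ eqb (s e) v) ≡ 2 ^ k * c v) → (∀ v → cnt (λ e → P e ∧ eqb (t e) v) ≡ 2 ^ k * c v) →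
  Σ[ lev ∈ (Fin N → ℕ) ] ((∀ e → lev e < 2 ^ k) × (∀ v j → j < 2 ^ k →
    cnt (λ e → (P e ∧ does (lev e ℕP.≟ j)) ∧ eqb (s e) v) ≡ c v × cnt (λ e → (P e ∧ does (lev e ℕP.≟ j)) ∧ eqb (t e) v) ≡ c v))
split-levels zero {N} P s t c hs ht = (λ _ → 0) , (λ _ → s≤s z≤n) ,
  λ { v zero _ → trans (cnt-cong (λ e → cong (_∧ eqb (s e) v) (BP.∧-identityʳ (P e)))) (trans (hs v) (ℕP.*-identityˡ (c v))) ,
                 trans (cnt-cong (λ e → cong (_∧ eqb (t e) v) (BP.∧-identityʳ (P e)))) (trans (ht v) (ℕP.*-identityˡ (c v)))
    ; v (suc j) (s≤s ()) }
split-levels (suc k) {N} {n} P s t c hs ht = combineLevels (split-levels k P s t (λ v → 2 * c v) (λ v → trans (hs v) (dbl v)) (λ v → trans (ht v) (dbl v)))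
  where
  dbl : ∀ v → 2 ^ suc k * c v ≡ 2 ^ k * (2 * c v)
  dbl v = lem (2 ^ k) (c v)
    where lem : ∀ a b → (a + (a + 0)) * b ≡ a * (2 * b)
          lem = solve-∀
  -- The copies `false` and `true` of a vertex stand for tails and heads, separately for each level
  -- found so far; each arc becomes an edge between two copies, and those outside `P` become loops
  -- at `nothing`. The direction of an edge decides the half of its arc.
  Node = Maybe (Bool × (ℕ × Fin n))
  _≈_ : DecidableEquality Node
  _≈_ = MP.≡-dec (PP.≡-dec BP._≟_ (PP.≡-dec ℕP._≟_ _≟_))
  combineLevels : _ → _
  combineLevels (lev , lev< , lc) = lev' , lev'< , λ v j lt → counts v j lt
    where
    node : Bool → (Fin N → Fin n) → Fin N → Node
    node b f e = if P e then just (b , lev e , f e) else nothing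
    or = orient _≈_ (node false s) (node true t)
    o = proj₁ or
    at : Bool → (Fin N → Fin n) → ℕ → Fin n → (Fin N → Bool) → ℕ
    at b f j v w = cnt (λ e → ((P e ∧ does (lev e ℕP.≟ j)) ∧ eqb (f e) v) ∧ w e)
    same : ∀ b f e j v → does (node b f e ≈ just (b , j , v)) ≡ (P e ∧ does (lev e ℕP.≟ j)) ∧ eqb (f e) v
    same b f e j v with P e
    ... | false = refl
    ... | true = bool-ext fw bw
      where
      fw : does (just (b , lev e , f e) ≈ just (b , j , v)) ≡ true → does (lev e ℕP.≟ j) ∧ eqb (f e) v ≡ true
      fw h with does⇒ (just (b , lev e , f e) ≈ just (b , j , v)) h
      ... | refl = ∧-intro (dec-true (lev e ℕP.≟ lev e) refl) (eqb-refl (f e))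
      bw : does (lev e ℕP.≟ j) ∧ eqb (f e) v ≡ true → does (just (b , lev e , f e) ≈ just (b , j , v)) ≡ true
      bw h = dec-true (just (b , lev e , f e) ≈ just (b , j , v))
               (cong₂ (λ x y → just (b , x , y)) (does⇒ (lev e ℕP.≟ j) (proj₁ (∧-true h))) (does⇒ (f e ≟ v) (proj₂ (∧-true {does (lev e ℕP.≟ j)} h))))
    differ : ∀ b f e j v → does (node (not b) f e ≈ just (b , j , v)) ≡ false
    differ b f e j v with P e
    ... | false = refl
    ... | true = dec-false (just (not b , lev e , f e) ≈ just (b , j , v)) (λ q → BP.not-¬ refl (sym (cong proj₁ (MP.just-injective q))))
    outs : ∀ j v → fib _≈_ (pick o (node false s) (node true t)) (just (false , j , v)) ≡ at false s j v o
    outs j v = cnt-cong pt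
      where pt : ∀ e → does (pick o (node false s) (node true t) e ≈ just (false , j , v)) ≡ ((P e ∧ does (lev e ℕP.≟ j)) ∧ eqb (s e) v) ∧ o e
            pt e with o e
            ... | true = trans (same false s e j v) (sym (BP.∧-identityʳ _))
            ... | false = trans (differ false t e j v) (sym (BP.∧-zeroʳ ((P e ∧ does (lev e ℕP.≟ j)) ∧ eqb (s e) v)))
    ins : ∀ j v → fib _≈_ (pick o (node true t) (node false s)) (just (false , j , v)) ≡ at false s j v (not ∘ o)
    ins j v = cnt-cong pt
      where pt : ∀ e → does (pick o (node true t) (node false s) e ≈ just (false , j , v)) ≡ ((P e ∧ does (lev e ℕP.≟ j)) ∧ eqb (s e) v) ∧ not (o e)
            pt e with o e
            ... | false = trans (same false s e j v) (sym (BP.∧-identityʳ _))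
            ... | true = trans (differ false t e j v) (sym (BP.∧-zeroʳ ((P e ∧ does (lev e ℕP.≟ j)) ∧ eqb (s e) v)))
    outt : ∀ j v → fib _≈_ (pick o (node true t) (node false s)) (just (true , j , v)) ≡ at true t j v o
    outt j v = cnt-cong pt
      where pt : ∀ e → does (pick o (node true t) (node false s) e ≈ just (true , j , v)) ≡ ((P e ∧ does (lev e ℕP.≟ j)) ∧ eqb (t e) v) ∧ o e
            pt e with o e
            ... | true = trans (same true t e j v) (sym (BP.∧-identityʳ _))
            ... | false = trans (differ true s e j v) (sym (BP.∧-zeroʳ ((P e ∧ does (lev e ℕP.≟ j)) ∧ eqb (t e) v)))
    int : ∀ j v → fib _≈_ (pick o (node false s) (node true t)) (just (true , j , v)) ≡ at true t j v (not ∘ o)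
    int j v = cnt-cong pt
      where pt : ∀ e → does (pick o (node false s) (node true t) e ≈ just (true , j , v)) ≡ ((P e ∧ does (lev e ℕP.≟ j)) ∧ eqb (t e) v) ∧ not (o e)
            pt e with o e
            ... | false = trans (same true t e j v) (sym (BP.∧-identityʳ _))
            ... | true = trans (differ true s e j v) (sym (BP.∧-zeroʳ ((P e ∧ does (lev e ℕP.≟ j)) ∧ eqb (t e) v)))
    halfs : ∀ j v → j < 2 ^ k → at false s j v o ≡ c v × at false s j v (not ∘ o) ≡ c v
    halfs j v lt = even-balanced (c v)
      (trans (sym (cnt-split (λ e → (P e ∧ does (lev e ℕP.≟ j)) ∧ eqb (s e) v) o)) (proj₁ (lc v j lt)))
      (subst₂ (λ x y → x ≤ suc y) (outs j v) (ins j v) (proj₁ (proj₂ or (just (false , j , v)))))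
      (subst₂ (λ x y → x ≤ suc y) (ins j v) (outs j v) (proj₂ (proj₂ or (just (false , j , v)))))
    halft : ∀ j v → j < 2 ^ k → at true t j v o ≡ c v × at true t j v (not ∘ o) ≡ c v
    halft j v lt = even-balanced (c v)
      (trans (sym (cnt-split (λ e → (P e ∧ does (lev e ℕP.≟ j)) ∧ eqb (t e) v) o)) (proj₂ (lc v j lt)))
      (subst₂ (λ x y → x ≤ suc y) (outt j v) (int j v) (proj₂ (proj₂ or (just (true , j , v)))))
      (subst₂ (λ x y → x ≤ suc y) (int j v) (outt j v) (proj₁ (proj₂ or (just (true , j , v)))))
    lev' : Fin N → ℕ
    lev' e = if o e then lev e else 2 ^ k + lev e
    lev'< : ∀ e → lev' e < 2 ^ suc k
    lev'< e with o e
    ... | true = ℕP.<-≤-trans (lev< e) (ℕP.m≤m+n (2 ^ k) _)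
    ... | false = ℕP.<-≤-trans (ℕP.+-monoʳ-< (2 ^ k) (lev< e)) (ℕP.≤-reflexive (cong (2 ^ k +_) (sym (ℕP.+-identityʳ _))))
    low : ∀ f j v → j < 2 ^ k → cnt (λ e → (P e ∧ does (lev' e ℕP.≟ j)) ∧ eqb (f e) v) ≡ at false f j v o
    low f j v lt = cnt-cong pt
      where pt : ∀ e → (P e ∧ does (lev' e ℕP.≟ j)) ∧ eqb (f e) v ≡ ((P e ∧ does (lev e ℕP.≟ j)) ∧ eqb (f e) v) ∧ o e
            pt e with o e
            ... | true = sym (BP.∧-identityʳ _)
            ... | false rewrite dec-false (2 ^ k + lev e ℕP.≟ j) (λ q → ℕP.<⇒≱ lt (ℕP.≤-trans (ℕP.m≤m+n (2 ^ k) _) (ℕP.≤-reflexive q))) | BP.∧-zeroʳ (P e) =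
                    sym (BP.∧-zeroʳ ((P e ∧ does (lev e ℕP.≟ j)) ∧ eqb (f e) v))
    high : ∀ f j v → cnt (λ e → (P e ∧ does (lev' e ℕP.≟ 2 ^ k + j)) ∧ eqb (f e) v) ≡ at false f j v (not ∘ o)
    high f j v = cnt-cong pt
      where pt : ∀ e → (P e ∧ does (lev' e ℕP.≟ 2 ^ k + j)) ∧ eqb (f e) v ≡ ((P e ∧ does (lev e ℕP.≟ j)) ∧ eqb (f e) v) ∧ not (o e)
            pt e with o e
            ... | false = trans (cong (λ b → (P e ∧ b) ∧ eqb (f e) v) (bool-ext
                    (λ h → dec-true (lev e ℕP.≟ j) (ℕP.+-cancelˡ-≡ (2 ^ k) _ _ (does⇒ (2 ^ k + lev e ℕP.≟ 2 ^ k + j) h)))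
                    (λ h → dec-true (2 ^ k + lev e ℕP.≟ 2 ^ k + j) (cong (2 ^ k +_) (does⇒ (lev e ℕP.≟ j) h))))) (sym (BP.∧-identityʳ _))
            ... | true rewrite dec-false (lev e ℕP.≟ 2 ^ k + j) (λ q → ℕP.<⇒≱ (lev< e) (ℕP.≤-trans (ℕP.m≤m+n (2 ^ k) j) (ℕP.≤-reflexive (sym q)))) | BP.∧-zeroʳ (P e) =
                    sym (BP.∧-zeroʳ ((P e ∧ does (lev e ℕP.≟ j)) ∧ eqb (f e) v))
    counts : ∀ v j → j < 2 ^ suc k →
      cnt (λ e → (P e ∧ does (lev' e ℕP.≟ j)) ∧ eqb (s e) v) ≡ c v × cnt (λ e → (P e ∧ does (lev' e ℕP.≟ j)) ∧ eqb (t e) v) ≡ c v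
    counts v j lt with j <? 2 ^ k
    ... | yes l = trans (low s j v l) (proj₁ (halfs j v l)) , trans (low t j v l) (proj₁ (halft j v l))
    ... | no nl with ℕP.m≤n⇒∃[o]m+o≡n (ℕP.≮⇒≥ nl)
    ...   | i , refl = trans (high s i v) (proj₂ (halfs i v li)) , trans (high t i v) (proj₂ (halft i v li))
      where li : i < 2 ^ k
            li = ℕP.+-cancelˡ-< (2 ^ k) _ _ (ℕP.<-≤-trans lt (ℕP.≤-reflexive (cong (2 ^ k +_) (ℕP.+-identityʳ _))))

-- Blocks of slots and their nesting

multiset : ∀ {n} (c : Fin n → ℕ) → Σ[ M ∈ ℕ ] Σ[ f ∈ (Fin M → Fin n) ] (∀ v → cnt (λ i → eqb (f i) v) ≡ c v)
multiset {zero} c = 0 , (λ ()) , λ ()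
multiset {suc n} c with multiset (λ v → c (suc v))
... | M , f , fc = c zero + M , g , gc
  where
  g : Fin (c zero + M) → Fin (suc n)
  g i = [ (λ _ → zero) , (λ j → suc (f j)) ]′ (splitAt (c zero) i)
  gc : ∀ v → cnt (λ i → eqb (g i) v) ≡ c v
  gc v = trans (sum-↑ (c zero) (λ i → ⟦ eqb (g i) v ⟧)) (trans (cong₂ _+_
      (sum-cong (λ i → cong (λ r → ⟦ eqb ([ (λ _ → zero) , (λ j → suc (f j)) ]′ r) v ⟧) (FP.splitAt-↑ˡ (c zero) i M)))
      (sum-cong (λ j → cong (λ r → ⟦ eqb ([ (λ _ → zero) , (λ j → suc (f j)) ]′ r) v ⟧) (FP.splitAt-↑ʳ (c zero) M j)))) (fin v))
    where
    fin : ∀ v → cnt {c zero} (λ _ → eqb zero v) + cnt (λ j → eqb (suc (f j)) v) ≡ c v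
    fin zero = trans (cong₂ _+_ (trans (sum-const (c zero) 1) (ℕP.*-identityʳ _)) (cnt-zero {M} (λ _ → refl))) (ℕP.+-identityʳ _)
    fin (suc v) = cong₂ _+_ (cnt-zero {c zero} (λ _ → refl)) (fc v)

arithmetic : ∀ {N} h nG → N ≡ nG * h → Grouping N h
arithmetic h nG refl = record
  { nG = nG
  ; gr = λ s → proj₁ (remQuot {nG} h s)
  ; ps = λ s → proj₂ (remQuot {nG} h s)
  ; mk = combine
  ; gr-mk = λ γ a → cong proj₁ (FP.remQuot-combine {nG} γ a)
  ; ps-mk = λ γ a → cong proj₂ (FP.remQuot-combine {nG} γ a)
  ; mk-η = FP.combine-remQuot {nG} h }

arithmetic-toℕ : ∀ {N} h nG (eq : N ≡ nG * h) s →
  toℕ s ≡ h * toℕ (Grouping.gr (arithmetic h nG eq) s) + toℕ (Grouping.ps (arithmetic h nG eq) s)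
arithmetic-toℕ h nG refl s = trans (cong toℕ (sym (FP.combine-remQuot {nG} h s)))
  (FP.toℕ-combine (proj₁ (remQuot {nG} h s)) (proj₂ (remQuot {nG} h s)))

div-unique : ∀ {m h g p} .{{_ : NonZero h}} → m ≡ h * g + p → p < h → m DM./ h ≡ g
div-unique {m} {h} {g} {p} eq lt = begin
  m DM./ h                       ≡⟨ cong (DM._/ h) (trans eq (trans (ℕP.+-comm (h * g) p) (cong (p +_) (ℕP.*-comm h g)))) ⟩
  (p + g * h) DM./ h             ≡⟨ DM.+-distrib-/-∣ʳ p (Dv.divides-refl g) ⟩
  p DM./ h + g * h DM./ h        ≡⟨ cong₂ _+_ (DM.m<n⇒m/n≡0 lt) (DM.m*n/n≡m g h) ⟩
  g                              ∎
  where open ≡-Reasoning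

-- Block numbers are quotients, and dividing by `h` and then by `f` amounts to dividing by `h'`.
arithmetic-nest : ∀ {N} h nG (eq : N ≡ nG * h) h' nG' (eq' : N ≡ nG' * h') f → h' ≡ f * h → 1 ≤ f → 1 ≤ h → ∀ s s' →
  Grouping.gr (arithmetic h nG eq) s ≡ Grouping.gr (arithmetic h nG eq) s' →
  Grouping.gr (arithmetic h' nG' eq') s ≡ Grouping.gr (arithmetic h' nG' eq') s'
arithmetic-nest {N} h nG eq h' nG' eq' f hf 1≤f 1≤h s s' e =
  FP.toℕ-injective (trans (coarse s) (trans (cong (λ z → DM._/_ (toℕ z) f {{nzf}}) e) (sym (coarse s'))))
  where
  module G = Grouping (arithmetic h nG eq)
  module G' = Grouping (arithmetic h' nG' eq')
  nzf = >-nonZero 1≤f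
  nzh : NonZero h'
  nzh = >-nonZero (ℕP.≤-trans (ℕP.*-mono-≤ 1≤f 1≤h) (ℕP.≤-reflexive (sym hf)))
  coarse : ∀ s → toℕ (G'.gr s) ≡ DM._/_ (toℕ (G.gr s)) f {{nzf}}
  coarse s = trans (sym (div-unique {{nzh}} (arithmetic-toℕ h' nG' eq' s) (FP.toℕ<n (G'.ps s))))
                   (div-unique {{nzh}} fine small)
    where
    g = toℕ (G.gr s)
    p = toℕ (G.ps s)
    d = DM._/_ g f {{nzf}}
    m' = DM._%_ g f {{nzf}}
    fine : toℕ s ≡ h' * d + (h * m' + p)
    fine = begin
      toℕ s                        ≡⟨ arithmetic-toℕ h nG eq s ⟩
      h * g + p                    ≡⟨ cong (λ z → h * z + p) (DM.m≡m%n+[m/n]*n g f {{nzf}}) ⟩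
      h * (m' + d * f) + p         ≡⟨ lem h m' d f p ⟩
      f * h * d + (h * m' + p)     ≡⟨ cong (λ z → z * d + (h * m' + p)) hf ⟨
      h' * d + (h * m' + p)        ∎
      where
      open ≡-Reasoning
      lem : ∀ h m d f p → h * (m + d * f) + p ≡ f * h * d + (h * m + p)
      lem = solve-∀
    small : h * m' + p < h'
    small = begin-strict
      h * m' + p       <⟨ ℕP.+-monoʳ-< (h * m') (FP.toℕ<n (G.ps s)) ⟩
      h * m' + h       ≡⟨ ℕP.+-comm (h * m') h ⟩
      h + h * m'       ≡⟨ ℕP.*-suc h m' ⟨
      h * suc m'       ≤⟨ ℕP.*-monoʳ-≤ h (DM.m%n<n g f {{nzf}}) ⟩
      h * f            ≡⟨ trans (ℕP.*-comm h f) (sym hf) ⟩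
      h'               ∎
      where open ℕP.≤-Reasoning

pair-does : ∀ {n} (a v : Fin n) (b w : Bool) → does (PP.≡-dec _≟_ BP._≟_ (a , b) (v , w)) ≡ eqb a v ∧ does (b BP.≟ w)
pair-does a v b w = bool-ext fw
  (λ h → dec-true (PP.≡-dec _≟_ BP._≟_ (a , b) (v , w)) (cong₂ _,_ (does⇒ (a ≟ v) (proj₁ (∧-true h))) (does⇒ (b BP.≟ w) (proj₂ (∧-true {eqb a v} h)))))
  where
  fw : does (PP.≡-dec _≟_ BP._≟_ (a , b) (v , w)) ≡ true → eqb a v ∧ does (b BP.≟ w) ≡ true
  fw h with does⇒ (PP.≡-dec _≟_ BP._≟_ (a , b) (v , w)) h
  ... | refl = ∧-intro (eqb-refl a) (dec-true (b BP.≟ b) refl)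

-- The elements of P are numbered by slots so that each block of h slots has a fixed vertex and
-- contains at most one virtual element.
module Numbering {N' nG h n : ℕ} (vert : Fin nG → Fin n) (1≤h : 1 ≤ h) where
  block : Fin (nG * h) → Fin nG
  block s = proj₁ (remQuot {nG} h s)

  record Numbered (P : Fin N' → Bool) (s : Fin N' → Fin n) (isV : Fin N' → Bool) : Set where
    field
      at   : Fin (nG * h) → Fin N'
      at-P : ∀ i → P (at i) ≡ true
      at-s : ∀ i → s (at i) ≡ vert (block i)
      inj  : ∀ i i' → at i ≡ at i' → i ≡ i'
      sur  : ∀ e → P e ≡ true → ∃ λ i → at i ≡ e
      one  : ∀ i i' → isV (at i) ≡ true → isV (at i') ≡ true → block i ≡ block i' → i ≡ i'

  number : ∀ P s isV (G : Fin n → ℕ) → (∀ v → cnt (λ γ → eqb (vert γ) v) ≡ G v) →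
    (∀ v → cnt (λ e → P e ∧ eqb (s e) v) ≡ h * G v) → (∀ v → cnt (λ e → (P e ∧ eqb (s e) v) ∧ isV e) ≤ G v) → Numbered P s isV
  number P s isV G vc pc vv = record
    { at = at ; at-P = λ i → proj₁ (key-inv (at i) _ (ok i)) ; at-s = λ i → proj₁ (PP.,-injective (proj₂ (key-inv (at i) _ (ok i))))
    ; inj = proj₁ (proj₂ (proj₂ en)) ; sur = λ e pe → proj₂ (proj₂ (proj₂ en)) e (s e , isV e) (key-P e pe)
    ; one = one' }
    where
    num : Fin n → ℕ
    num v = cnt (λ e → (P e ∧ eqb (s e) v) ∧ isV e)
    sub : ∀ v → ∃ λ (q : Fin nG → Bool) → (∀ γ → q γ ≡ true → eqb (vert γ) v ≡ true) × cnt q ≡ num v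
    sub v = cnt-sub (λ γ → eqb (vert γ) v) (num v) (ℕP.≤-trans (vv v) (ℕP.≤-reflexive (sym (vc v))))
    -- At each vertex as many blocks are marked as there are virtual elements, and these elements
    -- take the position `z₀` of the marked blocks.
    mark : Fin nG → Bool
    mark γ = proj₁ (sub (vert γ)) γ
    mark-cnt : ∀ v → cnt (λ γ → eqb (vert γ) v ∧ mark γ) ≡ num v
    mark-cnt v = trans (cnt-cong (λ γ → bool-ext (fw γ) (bw γ))) (proj₂ (proj₂ (sub v)))
      where
      fw : ∀ γ → eqb (vert γ) v ∧ mark γ ≡ true → proj₁ (sub v) γ ≡ true
      fw γ t with does⇒ (vert γ ≟ v) (proj₁ (∧-true {eqb (vert γ) v} t))
      ... | refl = proj₂ (∧-true {eqb (vert γ) v} t)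
      bw : ∀ γ → proj₁ (sub v) γ ≡ true → eqb (vert γ) v ∧ mark γ ≡ true
      bw γ t = ∧-intro e (trans (cong (λ u → proj₁ (sub u) γ) (does⇒ (vert γ ≟ v) e)) t)
        where e = proj₁ (proj₂ (sub v)) γ t
    z₀ : Fin h
    z₀ = fromℕ< 1≤h
    vslot : Fin (nG * h) → Bool
    vslot i = mark (block i) ∧ eqb z₀ (proj₂ (remQuot {nG} h i))
    Key = Fin n × Bool
    _≈_ : DecidableEquality Key
    _≈_ = PP.≡-dec _≟_ BP._≟_
    key : Fin N' → Maybe Key
    key e = if P e then just (s e , isV e) else nothing
    key-P : ∀ e → P e ≡ true → key e ≡ just (s e , isV e)
    key-P e pe = cong (if_then just (s e , isV e) else nothing) pe
    key-inv : ∀ e k → key e ≡ just k → P e ≡ true × (s e , isV e) ≡ k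
    key-inv e k q with P e
    ... | true = refl , MP.just-injective q
    slot : Fin (nG * h) → Key
    slot i = vert (block i) , vslot i
    beq : Bool → Bool → Bool
    beq b w = does (b BP.≟ w)
    keys : ∀ v w → cnt (λ e → does (MP.≡-dec _≈_ (key e) (just (v , w)))) ≡ cnt (λ e → (P e ∧ eqb (s e) v) ∧ beq (isV e) w)
    keys v w = cnt-cong pt
      where pt : ∀ e → does (MP.≡-dec _≈_ (key e) (just (v , w))) ≡ (P e ∧ eqb (s e) v) ∧ beq (isV e) w
            pt e with P e
            ... | false = refl
            ... | true = pair-does (s e) v (isV e) w
    beq-true : ∀ b → beq b true ≡ b
    beq-true true = refl
    beq-true false = refl
    beq-false : ∀ b → beq b false ≡ not b
    beq-false true = refl
    beq-false false = refl
    blocks : (Q : Fin nG → Bool) (R : Fin h → Bool) → cnt (λ i → Q (block i) ∧ R (proj₂ (remQuot {nG} h i))) ≡ cnt Q * cnt R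
    blocks Q R = trans (sum-combine nG (λ i → ⟦ Q (block i) ∧ R (proj₂ (remQuot {nG} h i)) ⟧))
      (trans (sum-cong (λ γ → trans (sum-cong (λ a → cong (λ r → ⟦ Q (proj₁ r) ∧ R (proj₂ r) ⟧) (FP.remQuot-combine {nG} γ a))) (row (Q γ))))
        (trans (sum-* (cnt R) (λ γ → ⟦ Q γ ⟧)) (ℕP.*-comm (cnt R) (cnt Q))))
      where row : ∀ b → cnt (λ a → b ∧ R a) ≡ cnt R * ⟦ b ⟧
            row true = sym (ℕP.*-identityʳ _)
            row false = trans (cnt-zero {h} (λ _ → refl)) (sym (ℕP.*-zeroʳ (cnt R)))
    one-slot : cnt (eqb z₀) ≡ 1
    one-slot = ℕP.≤-antisym (cnt-eqb≤1 z₀) (cnt-pos z₀ (eqb-refl z₀))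
    slots-v : ∀ v → cnt (λ i → eqb (vert (block i)) v ∧ vslot i) ≡ num v
    slots-v v = trans (cnt-cong (λ i → sym (BP.∧-assoc (eqb (vert (block i)) v) _ _)))
      (trans (blocks (λ γ → eqb (vert γ) v ∧ mark γ) (eqb z₀)) (trans (cong₂ _*_ (mark-cnt v) one-slot) (ℕP.*-identityʳ _)))
    slots-all : ∀ v → cnt (λ i → eqb (vert (block i)) v) ≡ h * G v
    slots-all v = trans (cnt-cong (λ i → sym (BP.∧-identityʳ (eqb (vert (block i)) v))))
      (trans (blocks (λ γ → eqb (vert γ) v) (λ _ → true)) (trans (cong₂ _*_ (vc v) (trans (sum-const h 1) (ℕP.*-identityʳ h))) (ℕP.*-comm (G v) h)))
    slots : ∀ v w → fib _≈_ slot (v , w) ≡ cnt (λ i → eqb (vert (block i)) v ∧ beq (vslot i) w)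
    slots v w = cnt-cong (λ i → pair-does (vert (block i)) v (vslot i) w)
    agree : ∀ k → cnt (λ e → does (MP.≡-dec _≈_ (key e) (just k))) ≡ fib _≈_ slot k
    agree (v , true) = trans (keys v true) (trans (cnt-cong (λ e → cong ((P e ∧ eqb (s e) v) ∧_) (beq-true (isV e))))
      (trans (sym (slots-v v)) (trans (cnt-cong (λ i → cong (eqb (vert (block i)) v ∧_) (sym (beq-true (vslot i))))) (sym (slots v true)))))
    agree (v , false) = trans (keys v false) (trans (cnt-cong (λ e → cong ((P e ∧ eqb (s e) v) ∧_) (beq-false (isV e))))
      (trans rest (trans (cnt-cong (λ i → cong (eqb (vert (block i)) v ∧_) (sym (beq-false (vslot i))))) (sym (slots v false)))))
      where
      rest : cnt (λ e → (P e ∧ eqb (s e) v) ∧ not (isV e)) ≡ cnt (λ i → eqb (vert (block i)) v ∧ not (vslot i))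
      rest = ℕP.+-cancelˡ-≡ (num v) _ _ (trans (sym (cnt-split (λ e → P e ∧ eqb (s e) v) isV))
        (trans (pc v) (trans (sym (slots-all v)) (trans (cnt-split (λ i → eqb (vert (block i)) v) vslot)
          (cong (_+ cnt (λ i → eqb (vert (block i)) v ∧ not (vslot i))) (slots-v v))))))
    en = enumerate _≈_ key slot agree
    at = proj₁ en
    ok : ∀ i → key (at i) ≡ just (slot i)
    ok = proj₁ (proj₂ en)
    one' : ∀ i i' → isV (at i) ≡ true → isV (at i') ≡ true → block i ≡ block i' → i ≡ i'
    one' i i' v v' b = trans (sym (FP.combine-remQuot {nG} h i)) (trans (cong₂ combine b (trans (sym (pos₀ i v)) (pos₀ i' v'))) (FP.combine-remQuot {nG} h i'))
      where
      pos₀ : ∀ i → isV (at i) ≡ true → z₀ ≡ proj₂ (remQuot {nG} h i)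
      pos₀ i v = does⇒ (z₀ ≟ _) (proj₂ (∧-true {mark (block i)} (trans (sym (proj₂ (PP.,-injective (proj₂ (key-inv (at i) _ (ok i)))))) v)))

-- Construction of the trail system

cnt-splitAt : ∀ a {b} (F : Fin a ⊎ Fin b → Bool) →
  cnt (λ x → F (splitAt a x)) ≡ cnt (λ k → F (inj₁ k)) + cnt (λ e → F (inj₂ e))
cnt-splitAt a {b} F = trans (sum-↑ a (λ x → ⟦ F (splitAt a x) ⟧)) (cong₂ _+_
  (sum-cong (λ k → cong (λ r → ⟦ F r ⟧) (FP.splitAt-↑ˡ a k b)))
  (sum-cong (λ e → cong (λ r → ⟦ F r ⟧) (FP.splitAt-↑ʳ a b e))))

record ZTour {m n : ℕ} (tl hd : Fin m → Fin n) (S Z : Fin m → Bool) (cz : ℕ) : Set where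
  field
    πZ       : Perm m
    fZ       : Fin m → Bool
    πZ-Z     : ∀ e → Z (to πZ e) ≡ Z e
    πZ-ok    : ∀ e → Z e ≡ true → tl (to πZ e) ≡ hd e
    fZ-short : ∀ e → Z e ≡ true → fZ e ≡ true → fZ (to πZ e) ≡ false
    fZ-path  : ∀ e → Z e ≡ true → fZ e ≡ true → S e ≡ true → S (to πZ e) ≡ true → hd (to πZ e) ≢ tl e
    fZ-few   : ∀ v → cnt (λ e → Z e ∧ (not (fZ e) ∧ eqb (hd e) v)) ≤ cz
    fZ-at    : ∀ v → ∃ λ e → Z e ≡ true × fZ e ≡ false × hd e ≡ v
    e₀       : Fin m
    single   : ∀ e → Z e ≡ true → orbit πZ e₀ e ≡ true
    e₀-Z     : Z e₀ ≡ true

-- One half of `c` pays for the trails, by `16 * (suc ℓ * K) ≤ x`, and the other half for loops and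
-- cuts.
room-arith : ∀ ℓ K x c r z .{{_ : NonZero x}} → 1 ≤ K → 16 * (suc ℓ * K) ≤ x → 2 * (5 * r + 4 * z + 2) ≤ c →
  4 * (suc ℓ * (K * c DM./ x) + (r + z)) + 2 + r ≤ c
room-arith ℓ K x c r z 1≤K hx hc = ℕP.*-cancelˡ-≤ 2 (begin
  2 * (4 * (suc ℓ * B + (r + z)) + 2 + r)            ≡⟨ lem (suc ℓ) B r z ⟩
  8 * (suc ℓ * B) + 2 * (5 * r + 4 * z + 2)          ≤⟨ ℕP.+-mono-≤ (ℕP.*-monoˡ-≤ (suc ℓ * B) {8} {16} (ℕP.m≤m+n 8 8)) hc ⟩
  16 * (suc ℓ * B) + c                               ≤⟨ ℕP.+-monoˡ-≤ c small ⟩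
  c + c                                              ≡⟨ cong (c +_) (ℕP.+-identityʳ c) ⟨
  2 * c                                              ∎)
  where
  open ℕP.≤-Reasoning
  B = K * c DM./ x
  lem : ∀ l b r z → 2 * (4 * (l * b + (r + z)) + 2 + r) ≡ 8 * (l * b) + 2 * (5 * r + 4 * z + 2)
  lem = solve-∀
  lem₂ : ∀ l b k → 16 * (l * b) * k ≡ 16 * (l * k) * b
  lem₂ = solve-∀
  small : 16 * (suc ℓ * B) ≤ c
  small = ℕP.*-cancelʳ-≤ _ _ K {{>-nonZero 1≤K}} (begin
    16 * (suc ℓ * B) * K     ≡⟨ lem₂ (suc ℓ) B K ⟩
    16 * (suc ℓ * K) * B     ≤⟨ ℕP.*-monoˡ-≤ B hx ⟩
    x * B                    ≡⟨ ℕP.*-comm x B ⟩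
    B * x                    ≤⟨ DM.m/n*n≤m (K * c) x ⟩
    K * c                    ≡⟨ ℕP.*-comm K c ⟩
    c * K                    ∎)

-- The arcs outside Z, together with rv v auxiliary loops at each vertex v, are divided into
-- suc κ levels, each of which has h * G v arcs leaving and entering v.
module Build {m n : ℕ} (tl hd : Fin m → Fin n) (S Z : Fin m → Bool)
  (noloop : ∀ e → S e ≡ true → hd e ≢ tl e)
  (simple : ∀ e f → S e ≡ true → S f ≡ true → tl e ≡ tl f → hd e ≡ hd f → e ≡ f)
  (k κ : ℕ) (levels : 2 ^ k ≡ suc κ) (T' Md : ℕ) (sz : ℕ → ℕ) (1≤sz : ∀ j → 1 ≤ sz j)
  (ed : ∀ j → ∃ λ e → sz 0 ≡ e * sz j × 1 ≤ e)
  (fd : ∀ j → ∃ λ f → sz j ≡ f * sz (suc j) × 1 ≤ f)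
  (D G rv : Fin n → ℕ)
  (D-tl : ∀ v → cnt (λ e → not (Z e) ∧ eqb (tl e) v) ≡ D v)
  (D-hd : ∀ v → cnt (λ e → not (Z e) ∧ eqb (hd e) v) ≡ D v)
  (DG : ∀ v → rv v + D v ≡ 2 ^ k * (sz 0 * G v)) (rv≤Md : ∀ v → rv v ≤ Md) (rv≤G : ∀ v → rv v ≤ G v)
  (v₀ : Fin n) (1≤G : 1 ≤ G v₀) where

  private
    h = sz 0

    -- Every vertex gets `Md` candidates for loops, of which `yact` admits the first `rv v`; so the
    -- candidates form a product.
    X : Set
    X = Fin (n * Md) ⊎ Fin m

    N' = n * Md + m

    dec : Fin N' → X
    dec = splitAt (n * Md)

    yv : Fin (n * Md) → Fin n
    yv a = proj₁ (remQuot {n} Md a)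

    ytl yhd : X → Fin n
    ytl = [ yv , tl ]′
    yhd = [ yv , hd ]′

    yV yact : X → Bool
    yV = [ (λ _ → true) , (λ _ → false) ]′
    yact = [ (λ a → does (toℕ (proj₂ (remQuot {n} Md a)) <? rv (yv a))) , (λ e → not (Z e)) ]′

    yst : X → Status
    yst = [ (λ _ → virt) , (λ e → if S e then alive else dead) ]′

    loops : ∀ v → cnt (λ a → yact (inj₁ a) ∧ eqb (yv a) v) ≡ rv v
    loops v = begin
      cnt (λ a → yact (inj₁ a) ∧ eqb (yv a) v)
        ≡⟨ sum-combine n (λ a → ⟦ yact (inj₁ a) ∧ eqb (yv a) v ⟧) ⟩
      sumF {n} (λ u → sumF {Md} (λ i → ⟦ yact (inj₁ (combine u i)) ∧ eqb (yv (combine u i)) v ⟧))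
        ≡⟨ sum-cong {n} (λ u → trans (sum-cong {Md} (λ i → cong (λ r → ⟦ does (toℕ (proj₂ r) <? rv (proj₁ r)) ∧ eqb (proj₁ r) v ⟧) (FP.remQuot-combine {n} u i))) (row u)) ⟩
      sumF {n} (λ u → ⟦ eqb v u ⟧ * rv u)     ≡⟨ sum-delta v rv ⟩
      rv v ∎
      where
      open ≡-Reasoning
      row : ∀ u → sumF {Md} (λ i → ⟦ does (toℕ i <? rv u) ∧ eqb u v ⟧) ≡ ⟦ eqb v u ⟧ * rv u
      row u = trans (cong (λ b → sumF {Md} (λ i → ⟦ does (toℕ i <? rv u) ∧ b ⟧)) (does-sym _≟_ u v)) (go (eqb v u))
        where go : ∀ b → sumF {Md} (λ i → ⟦ does (toℕ i <? rv u) ∧ b ⟧) ≡ ⟦ b ⟧ * rv u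
              go true = trans (cnt-cong {Md} {q = λ i → does (toℕ i <? rv u)} (λ i → BP.∧-identityʳ (does (toℕ i <? rv u)))) (trans (cnt-below Md (rv u) (rv≤Md u)) (sym (ℕP.*-identityˡ _)))
              go false = cnt-zero {Md} (λ i → BP.∧-zeroʳ (does (toℕ i <? rv u)))

    act isV : Fin N' → Bool
    act x = yact (dec x)
    isV x = yV (dec x)

    xtl xhd : Fin N' → Fin n
    xtl x = ytl (dec x)
    xhd x = yhd (dec x)

    act-tl : ∀ v → cnt (λ x → act x ∧ eqb (xtl x) v) ≡ 2 ^ k * (h * G v)
    act-tl v = trans (cnt-splitAt (n * Md) (λ y → yact y ∧ eqb (ytl y) v)) (trans (cong₂ _+_ (loops v) (D-tl v)) (DG v))

    act-hd : ∀ v → cnt (λ x → act x ∧ eqb (xhd x) v) ≡ 2 ^ k * (h * G v)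
    act-hd v = trans (cnt-splitAt (n * Md) (λ y → yact y ∧ eqb (yhd y) v)) (trans (cong₂ _+_ (loops v) (D-hd v)) (DG v))

    virt-tl : ∀ v → cnt (λ x → (act x ∧ eqb (xtl x) v) ∧ isV x) ≡ rv v
    virt-tl v = trans (cnt-splitAt (n * Md) (λ y → (yact y ∧ eqb (ytl y) v) ∧ yV y))
      (trans (cong₂ _+_ (trans (cnt-cong {q = λ a → yact (inj₁ a) ∧ eqb (yv a) v} (λ a → BP.∧-identityʳ (yact (inj₁ a) ∧ eqb (yv a) v))) (loops v)) (cnt-zero {m} (λ e → BP.∧-zeroʳ (yact (inj₂ e) ∧ eqb (tl e) v)))) (ℕP.+-identityʳ _))

    virt-hd : ∀ v → cnt (λ x → (act x ∧ eqb (xhd x) v) ∧ isV x) ≡ rv v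
    virt-hd v = trans (cnt-splitAt (n * Md) (λ y → (yact y ∧ eqb (yhd y) v) ∧ yV y))
      (trans (cong₂ _+_ (trans (cnt-cong {q = λ a → yact (inj₁ a) ∧ eqb (yv a) v} (λ a → BP.∧-identityʳ (yact (inj₁ a) ∧ eqb (yv a) v))) (loops v)) (cnt-zero {m} (λ e → BP.∧-zeroʳ (yact (inj₂ e) ∧ eqb (hd e) v)))) (ℕP.+-identityʳ _))

    sp = split-levels k act xtl xhd (λ v → h * G v) act-tl act-hd

  module Leveled (lev : Fin N' → ℕ) (lev< : ∀ x → lev x < 2 ^ k)
    (lc : ∀ v j → j < 2 ^ k → cnt (λ x → (act x ∧ does (lev x ℕP.≟ j)) ∧ eqb (xtl x) v) ≡ h * G v ×
                              cnt (λ x → (act x ∧ does (lev x ℕP.≟ j)) ∧ eqb (xhd x) v) ≡ h * G v)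
    (nG : ℕ) (vert : Fin nG → Fin n) (vc : ∀ v → cnt (λ γ → eqb (vert γ) v) ≡ G v) where

    module Nb = Numbering {N'} {nG} {h} vert (1≤sz 0)
    open Nb using (block)

    P : ℕ → Fin N' → Bool
    P j x = act x ∧ does (lev x ℕP.≟ j)

    private
      few : ∀ (s : Fin N' → Fin n) → (∀ v → cnt (λ x → (act x ∧ eqb (s x) v) ∧ isV x) ≡ rv v) → ∀ j v →
            cnt (λ x → (P j x ∧ eqb (s x) v) ∧ isV x) ≤ G v
      few s c j v = ℕP.≤-trans (cnt-mono {p = λ x → (P j x ∧ eqb (s x) v) ∧ isV x} {q = λ x → (act x ∧ eqb (s x) v) ∧ isV x}
        (λ x t → ∧-intro (∧-intro (proj₁ (∧-true {act x} (proj₁ (∧-true {P j x} (proj₁ (∧-true {P j x ∧ eqb (s x) v} t))))))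
                           (proj₂ (∧-true {P j x} (proj₁ (∧-true {P j x ∧ eqb (s x) v} t))))) (proj₂ (∧-true {P j x ∧ eqb (s x) v} t))))
        (ℕP.≤-trans (ℕP.≤-reflexive (c v)) (rv≤G v))

    numT : ∀ j → j < 2 ^ k → Nb.Numbered (P j) xtl isV
    numT j lt = Nb.number (P j) xtl isV G vc (λ v → proj₁ (lc v j lt)) (few xtl virt-tl j)

    numH : ∀ j → j < 2 ^ k → Nb.Numbered (P j) xhd isV
    numH j lt = Nb.number (P j) xhd isV G vc (λ v → proj₂ (lc v j lt)) (few xhd virt-hd j)

    module Slotted (nT : ∀ j → j < 2 ^ k → Nb.Numbered (P j) xtl isV) (nH : ∀ j → j < 2 ^ k → Nb.Numbered (P j) xhd isV) where
      N : ℕ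
      N = nG * h

      private
        -- `φ` and `st` have to be total, so the levels beyond `κ` repeat level 0.
        clamp : ℕ → ℕ
        clamp j = if does (j <? 2 ^ k) then j else 0

        clamp-id : ∀ j → j < 2 ^ k → clamp j ≡ j
        clamp-id j lt = cong (if_then j else 0) (dec-true (j <? 2 ^ k) lt)

        clamp< : ∀ j → clamp j < 2 ^ k
        clamp< j = go (j <? 2 ^ k)
          where go : Dec (j < 2 ^ k) → clamp j < 2 ^ k
                go (yes lt) = ℕP.≤-trans (s≤s (ℕP.≤-reflexive (clamp-id j lt))) lt
                go (no nl) = ℕP.≤-trans (s≤s (ℕP.≤-reflexive (cong (if_then j else 0) (dec-false (j <? 2 ^ k) nl))))
                               (ℕP.≤-trans (s≤s z≤n) (ℕP.≤-reflexive (sym levels)))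

        module NT j = Nb.Numbered (nT (clamp j) (clamp< j))
        module NH j = Nb.Numbered (nH (clamp j) (clamp< j))

      tE : ℕ → Fin N → Fin N'
      tE j = NT.at j

      vt : Fin N → Fin n
      vt s = vert (block s)

      φ : ℕ → Perm N
      φ j = perm (λ i → proj₁ (NH.sur j (tE j i) (NT.at-P j i))) (λ s → proj₁ (NT.sur j (NH.at j s) (NH.at-P j s)))
        (λ i → NT.inj j _ _ (trans (proj₂ (NT.sur j _ _)) (proj₂ (NH.sur j _ _))))
        (λ s → NH.inj j _ _ (trans (proj₂ (NH.sur j _ _)) (proj₂ (NT.sur j _ _))))

      private
        hE-φ : ∀ j i → NH.at j (to (φ j) i) ≡ tE j i
        hE-φ j i = proj₂ (NH.sur j (tE j i) (NT.at-P j i))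

        vt-φ : ∀ j i → vt (to (φ j) i) ≡ xhd (tE j i)
        vt-φ j i = trans (sym (NH.at-s j (to (φ j) i))) (cong xhd (hE-φ j i))

      st : ℕ → Fin N → Status
      st j i = yst (dec (tE j i))

      private
        real : ∀ y → yst y ≡ alive → ∃ λ e → y ≡ inj₂ e × S e ≡ true
        real (inj₂ e) q with S e in eq
        ... | true = e , refl , eq

        virtual : ∀ y → yst y ≡ virt → yV y ≡ true
        virtual (inj₁ a) q = refl
        virtual (inj₂ e) q with S e
        virtual (inj₂ e) () | true
        virtual (inj₂ e) () | false

        isVirt-yV : ∀ y → isVirt (yst y) ≡ yV y
        isVirt-yV (inj₁ a) = refl
        isVirt-yV (inj₂ e) with S e
        ... | true = refl
        ... | false = refl

        dec-inj : ∀ x x' → dec x ≡ dec x' → x ≡ x'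
        dec-inj x x' q = trans (sym (FP.join-splitAt (n * Md) m x)) (trans (cong (join (n * Md) m) q) (FP.join-splitAt (n * Md) m x'))

        noloop' : ∀ j i → st j i ≡ alive → vt (to (φ j) i) ≢ vt i
        noloop' j i a q with real (dec (tE j i)) a
        ... | e , de , se = noloop e se (trans (cong yhd (sym de)) (trans (sym (vt-φ j i)) (trans q (trans (sym (NT.at-s j i)) (cong ytl de)))))

        simple' : ∀ j i i' → st j i ≡ alive → st j i' ≡ alive → vt i ≡ vt i' → vt (to (φ j) i) ≡ vt (to (φ j) i') → i ≡ i'
        simple' j i i' a a' q q' with real (dec (tE j i)) a | real (dec (tE j i')) a'
        ... | e , de , se | e' , de' , se' = NT.inj j i i' (dec-inj _ _ (trans de (trans (cong inj₂ same) (sym de'))))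
          where same : e ≡ e'
                same = simple e e' se se'
                  (trans (cong ytl (sym de)) (trans (NT.at-s j i) (trans q (trans (sym (NT.at-s j i')) (cong ytl de')))))
                  (trans (cong yhd (sym de)) (trans (sym (vt-φ j i)) (trans q' (trans (vt-φ j i') (cong yhd de')))))

      private
        size : ∀ j → N ≡ nG * proj₁ (ed j) * sz j
        size j = trans (cong (nG *_) (proj₁ (proj₂ (ed j)))) (sym (ℕP.*-assoc nG (proj₁ (ed j)) (sz j)))

      gs : ∀ j → Grouping N (sz j)
      gs j = arithmetic (sz j) (nG * proj₁ (ed j)) (size j)

      private
        g-block : ∀ j s s' → Grouping.gr (gs j) s ≡ Grouping.gr (gs j) s' → block s ≡ block s'
        g-block j = arithmetic-nest (sz j) (nG * proj₁ (ed j)) (size j) h nG refl (proj₁ (ed j)) (proj₁ (proj₂ (ed j))) (proj₂ (proj₂ (ed j))) (1≤sz j)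

        nest : ∀ j s s' → Grouping.gr (gs (suc j)) s ≡ Grouping.gr (gs (suc j)) s' → Grouping.gr (gs j) s ≡ Grouping.gr (gs j) s'
        nest j = arithmetic-nest (sz (suc j)) (nG * proj₁ (ed (suc j))) (size (suc j)) (sz j) (nG * proj₁ (ed j)) (size j) (proj₁ (fd j)) (proj₁ (proj₂ (fd j))) (proj₂ (proj₂ (fd j))) (1≤sz (suc j))

        gvt : ∀ j s s' → Grouping.gr (gs j) s ≡ Grouping.gr (gs j) s' → vt s ≡ vt s'
        gvt j s s' q = cong vert (g-block j s s' q)

        virtT : ∀ r j i i' → st j i ≡ virt → st j i' ≡ virt → Grouping.gr (gs r) i ≡ Grouping.gr (gs r) i' → i ≡ i'
        virtT r j i i' a a' q = NT.one j i i' (virtual (dec (tE j i)) a) (virtual (dec (tE j i')) a') (g-block r i i' q)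

        virtH : ∀ r j i i' → st j i ≡ virt → st j i' ≡ virt → Grouping.gr (gs r) (to (φ j) i) ≡ Grouping.gr (gs r) (to (φ j) i') → i ≡ i'
        virtH r j i i' a a' q = to-inj (φ j) (NH.one j _ _ (trans (cong isV (hE-φ j i)) (virtual (dec (tE j i)) a)) (trans (cong isV (hE-φ j i')) (virtual (dec (tE j i')) a')) (g-block r _ _ q))

      system : (∀ j → j < κ → Room sz T' j) → TrailSystem vt φ st κ (sz κ) (suc κ * suc T')
      system = trails vt φ st sz gs T' gvt nest noloop' simple' virtT virtH κ

      private
        re : Fin m → Fin N'
        re e = n * Md ↑ʳ e

        dec-re : ∀ e → dec (re e) ≡ inj₂ e
        dec-re e = FP.splitAt-↑ʳ (n * Md) m e

        -- A dummy slot for the arcs of `Z`, taken from a block at `v₀`.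
        s₀ : Fin N
        s₀ = combine (proj₁ γ₀) (fromℕ< (1≤sz 0))
          where γ₀ = cnt-find {p = λ γ → eqb (vert γ) v₀} (ℕP.≤-trans 1≤G (ℕP.≤-reflexive (sym (vc v₀))))

      lv : Fin m → ℕ
      lv e = lev (re e)

      private
        lv-clamp : ∀ e → clamp (lv e) ≡ lv e
        lv-clamp e = clamp-id (lv e) (lev< (re e))

        P-re : ∀ e → Z e ≡ false → P (clamp (lv e)) (re e) ≡ true
        P-re e z = ∧-intro (trans (cong yact (dec-re e)) (cong not z)) (dec-true (lv e ℕP.≟ clamp (lv e)) (sym (lv-clamp e)))

        slot : ∀ e b → Z e ≡ b → Fin N
        slot e true _ = s₀
        slot e false z = proj₁ (NT.sur (lv e) (re e) (P-re e z))

      sl : Fin m → Fin N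
      sl e = slot e (Z e) refl

      private
        sl-at : ∀ e → Z e ≡ false → tE (lv e) (sl e) ≡ re e
        sl-at e z = go (Z e) refl z
          where go : ∀ b (q : Z e ≡ b) → b ≡ false → tE (lv e) (slot e b q) ≡ re e
                go false q _ = proj₂ (NT.sur (lv e) (re e) (P-re e q))

        re-inj : ∀ e e' → re e ≡ re e' → e ≡ e'
        re-inj e e' q = SP.inj₂-injective (trans (sym (dec-re e)) (trans (cong dec q) (dec-re e')))

      lv≤ : ∀ e → Z e ≡ false → lv e ≤ κ
      lv≤ e _ = ℕP.≤-pred (ℕP.≤-trans (lev< (re e)) (ℕP.≤-reflexive levels))

      sl-tl : ∀ e → Z e ≡ false → vt (sl e) ≡ tl e
      sl-tl e z = trans (sym (NT.at-s (lv e) (sl e))) (trans (cong xtl (sl-at e z)) (cong ytl (dec-re e)))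

      sl-hd : ∀ e → Z e ≡ false → vt (to (φ (lv e)) (sl e)) ≡ hd e
      sl-hd e z = trans (vt-φ (lv e) (sl e)) (trans (cong xhd (sl-at e z)) (cong yhd (dec-re e)))

      sl-st : ∀ e → Z e ≡ false → st (lv e) (sl e) ≡ (if S e then alive else dead)
      sl-st e z = cong yst (trans (cong dec (sl-at e z)) (dec-re e))

      sl-inj : ∀ e e' → Z e ≡ false → Z e' ≡ false → lv e ≡ lv e' → sl e ≡ sl e' → e ≡ e'
      sl-inj e e' z z' l q = re-inj e e' (trans (sym (sl-at e z)) (trans (cong₂ tE l q) (sl-at e' z')))

      arc : ∀ j i → j ≤ κ → isVirt (st j i) ≡ false → ∃ λ e → Z e ≡ false × lv e ≡ j × sl e ≡ i
      arc j i le nv = go (dec (tE j i)) refl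
        where
        lt : j < 2 ^ k
        lt = ℕP.≤-trans (s≤s le) (ℕP.≤-reflexive (sym levels))
        go : ∀ y → dec (tE j i) ≡ y → ∃ λ e → Z e ≡ false × lv e ≡ j × sl e ≡ i
        go (inj₁ a) q = ⊥-elim (t≢f (cong yV q) (trans (sym (isVirt-yV (dec (tE j i)))) nv))
        go (inj₂ e) q = e , z , l , NT.inj j _ _ (trans (cong (λ u → tE u (sl e)) (sym l)) (trans (sl-at e z) (sym x)))
          where
          x : tE j i ≡ re e
          x = dec-inj _ _ (trans q (sym (dec-re e)))
          z : Z e ≡ false
          z = not-true (trans (cong yact (sym q)) (proj₁ (∧-true {act (tE j i)} (NT.at-P j i))))
          l : lv e ≡ j
          l = trans (cong lev (sym x)) (trans (does⇒ (lev (tE j i) ℕP.≟ clamp j) (proj₂ (∧-true {act (tE j i)} (NT.at-P j i)))) (clamp-id j lt))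

      private
        pairs : (V : Fin N' → Bool) (c : ℕ) → cnt (λ x → (act x ∧ V x) ∧ isV x) ≡ c → (W : ℕ → Fin N → Bool) →
          (∀ j i → W j i ≡ V (tE j i)) → sumF {suc κ} (λ j → cnt (λ i → isVirt (st (toℕ j) i) ∧ W (toℕ j) i)) ≤ c
        pairs V c vc' W wv = ℕP.≤-trans (ℕP.≤-reflexive (sym (trans (sum-combine (suc κ) (λ a → ⟦ Q (remQuot {suc κ} N a) ⟧))
            (sum-cong (λ j → sum-cong (λ i → cong (λ r → ⟦ Q r ⟧) (FP.remQuot-combine {suc κ} j i)))))))
          (ℕP.≤-trans (cnt-inj {p = λ a → Q (remQuot {suc κ} N a)} {q = λ x → (act x ∧ V x) ∧ isV x} (λ a → f (remQuot {suc κ} N a)) (λ a → f-ok (remQuot {suc κ} N a))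
            (λ a a' _ _ e → trans (sym (FP.combine-remQuot {suc κ} N a)) (trans (cong (λ r → combine (proj₁ r) (proj₂ r)) (f-inj (remQuot {suc κ} N a) (remQuot {suc κ} N a') e)) (FP.combine-remQuot {suc κ} N a'))))
            (ℕP.≤-reflexive vc'))
          where
          Q : Fin (suc κ) × Fin N → Bool
          Q (j , i) = isVirt (st (toℕ j) i) ∧ W (toℕ j) i
          f : Fin (suc κ) × Fin N → Fin N'
          f (j , i) = tE (toℕ j) i
          f-ok : ∀ r → Q r ≡ true → (act (f r) ∧ V (f r)) ∧ isV (f r) ≡ true
          f-ok (j , i) q = ∧-intro (∧-intro (proj₁ (∧-true {act (tE (toℕ j) i)} (NT.at-P (toℕ j) i))) (trans (sym (wv (toℕ j) i)) (proj₂ (∧-true {isVirt (st (toℕ j) i)} q))))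
                             (trans (sym (isVirt-yV (dec (tE (toℕ j) i)))) (proj₁ (∧-true q)))
          f-inj : ∀ r r' → f r ≡ f r' → r ≡ r'
          f-inj (j , i) (j' , i') e = cong₂ _,_ jj (NT.inj (toℕ j) i i' (trans e (cong (λ u → tE u i') (sym (cong toℕ jj)))))
            where
            lv-of : ∀ (j : Fin (suc κ)) i → lev (tE (toℕ j) i) ≡ toℕ j
            lv-of j i = trans (does⇒ (lev (tE (toℕ j) i) ℕP.≟ clamp (toℕ j)) (proj₂ (∧-true {act (tE (toℕ j) i)} (NT.at-P (toℕ j) i))))
              (clamp-id (toℕ j) (ℕP.≤-trans (FP.toℕ<n j) (ℕP.≤-reflexive (sym levels))))
            jj : j ≡ j'
            jj = FP.toℕ-injective (trans (sym (lv-of j i)) (trans (cong lev e) (lv-of j' i')))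

      virt-out : ∀ v → sumF {suc κ} (λ j → cnt (λ i → isVirt (st (toℕ j) i) ∧ eqb (vt i) v)) ≤ rv v
      virt-out v = pairs (λ x → eqb (xtl x) v) (rv v) (virt-tl v) (λ j i → eqb (vt i) v) (λ j i → cong (λ u → eqb u v) (sym (NT.at-s j i)))

      virt-in : ∀ v → sumF {suc κ} (λ j → cnt (λ i → isVirt (st (toℕ j) i) ∧ eqb (vt (to (φ (toℕ j)) i)) v)) ≤ rv v
      virt-in v = pairs (λ x → eqb (xhd x) v) (rv v) (virt-hd v) (λ j i → eqb (vt (to (φ j) i)) v) (λ j i → cong (λ u → eqb u v) (vt-φ j i))

      vt-count : ∀ v → cnt (λ s → eqb (vt s) v) ≡ G v * h
      vt-count v = trans (sum-combine nG {h} (λ s → ⟦ eqb (vt s) v ⟧)) (trans (sum-cong (λ γ → trans (sum-cong {h} (λ a → cong (λ r → ⟦ eqb (vert (proj₁ r)) v ⟧) (FP.remQuot-combine {nG} γ a)))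
          (trans (sum-const h ⟦ eqb (vert γ) v ⟧) refl)))
        (trans (sum-* h (λ γ → ⟦ eqb (vert γ) v ⟧)) (trans (cong (h *_) (vc v)) (ℕP.*-comm h (G v)))))

      assembled : ∀ {cz} → ZTour tl hd S Z cz → (∀ j → j < κ → Room sz T' j) → (∀ v → fib _≟_ hd v ≡ fib _≟_ tl v) →
        ∀ ℓ → ℓ ≤ suc κ → 16 * (suc ℓ * (suc κ * suc T')) ≤ sz κ → (∀ v → 2 * (5 * rv v + 4 * cz + 2) ≤ G v * h) →
        Σ[ e₀ ∈ Fin m ] Σ[ π ∈ Perm m ] ((∀ e → tl (to π e) ≡ hd e) ×
          (∀ j a → j < ℓ → (∀ i → i ≤ j → S (iter π i a) ≡ true) → hd (iter π j a) ≢ tl a) × (∀ e → orbit π e₀ e ≡ true))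
      assembled {cz} zt rooms inout ℓ le hx hc = ZTour.e₀ zt , Assembly.tour parts
        where
        parts : Parts m n N
        parts = record
          { tl = tl ; hd = hd ; S = S ; Z = Z ; vt = vt ; φ = φ ; st = st ; κ = κ ; x = sz κ ; K = suc κ * suc T' ; T = system rooms
          ; lv = lv ; sl = sl ; lv≤ = lv≤ ; sl-tl = sl-tl ; sl-hd = sl-hd ; sl-st = sl-st ; sl-inj = sl-inj ; arc = arc
          ; rv = rv ; virt-out = virt-out ; virt-in = virt-in ; cz = cz ; noloop = noloop ; inout = inout ; ℓ = ℓ ; ℓ≤ = le ; 1≤x = 1≤sz κ
          ; room = λ v → room-arith ℓ (suc κ * suc T') (sz κ) (cnt (λ i → eqb (vt i) v)) (rv v) cz {{>-nonZero (1≤sz κ)}} (s≤s z≤n) hx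
              (ℕP.≤-trans (hc v) (ℕP.≤-reflexive (sym (vt-count v))))
          ; ZTour zt }

  built : ∀ {cz} → ZTour tl hd S Z cz → (∀ j → j < κ → Room sz T' j) → (∀ v → fib _≟_ hd v ≡ fib _≟_ tl v) →
    ∀ ℓ → ℓ ≤ suc κ → 16 * (suc ℓ * (suc κ * suc T')) ≤ sz κ → (∀ v → 2 * (5 * rv v + 4 * cz + 2) ≤ G v * h) →
    Σ[ e₀ ∈ Fin m ] Σ[ π ∈ Perm m ] ((∀ e → tl (to π e) ≡ hd e) ×
      (∀ j a → j < ℓ → (∀ i → i ≤ j → S (iter π i a) ≡ true) → hd (iter π j a) ≢ tl a) × (∀ e → orbit π e₀ e ≡ true))
  built = Leveled.Slotted.assembled lev lev< lc nG vert vc (Leveled.numT lev lev< lc nG vert vc) (Leveled.numH lev lev< lc nG vert vc)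
    where
    lev = proj₁ sp
    lev< = proj₁ (proj₂ sp)
    lc = proj₂ (proj₂ sp)
    ms = multiset G
    nG = proj₁ ms
    vert = proj₁ (proj₂ ms)
    vc = proj₂ (proj₂ ms)

-- Choice of the constants

-- The group sizes, from the finest one x upwards.
hh : ℕ → ℕ → ℕ
hh x zero    = x
hh x (suc i) = 4 * (hh x i * hh x i)

1≤² : ∀ {y} → 1 ≤ y → y ≤ y * y
1≤² {y} h = ℕP.≤-trans (ℕP.≤-reflexive (sym (ℕP.*-identityʳ y))) (ℕP.*-monoʳ-≤ y h)

x≤hh : ∀ x → 1 ≤ x → ∀ i → x ≤ hh x i
x≤hh x h zero = ℕP.≤-refl
x≤hh x h (suc i) = ℕP.≤-trans (x≤hh x h i) (ℕP.≤-trans (1≤² (ℕP.≤-trans h (x≤hh x h i))) (ℕP.m≤m+n _ _))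

hh-div : ∀ x → 1 ≤ x → ∀ i → ∃ λ f → hh x (suc i) ≡ f * hh x i × 1 ≤ f
hh-div x h i = 4 * hh x i , sym (ℕP.*-assoc 4 (hh x i) (hh x i)) , ℕP.≤-trans (ℕP.≤-trans h (x≤hh x h i)) (ℕP.m≤m+n _ _)

hh-divs : ∀ x → 1 ≤ x → ∀ i k → ∃ λ f → hh x (k + i) ≡ f * hh x i × 1 ≤ f
hh-divs x h i zero = 1 , sym (ℕP.*-identityˡ _) , ℕP.≤-refl
hh-divs x h i (suc k) with hh-div x h (k + i) | hh-divs x h i k
... | f , p , 1≤f | g , q , 1≤g = f * g , trans p (trans (cong (f *_) q) (sym (ℕP.*-assoc f g _))) , ℕP.*-mono-≤ 1≤f 1≤g

-- The part of the left side of `Room.small` that is left when the powers of the group size are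
-- split off.
load : ℕ → ℕ → ℕ
load T j = 4 * (T ^ T * (T * ((4 + 4) * (4 * suc (suc j)))))

load-mono : ∀ T {i j} → i ≤ j → load T i ≤ load T j
load-mono T le = ℕP.*-monoʳ-≤ 4 (ℕP.*-monoʳ-≤ (T ^ T) (ℕP.*-monoʳ-≤ T (ℕP.*-monoʳ-≤ (4 + 4) (ℕP.*-monoʳ-≤ 4 (s≤s (s≤s le))))))

^-square : ∀ x t → (x * x) ^ t ≡ x ^ t * x ^ t
^-square x zero = refl
^-square x (suc t) = trans (cong (x * x *_) (^-square x t)) (lem x (x ^ t))
  where lem : ∀ a b → a * a * (b * b) ≡ a * b * (a * b)
        lem = solve-∀

-- A group of size `4 * (x * x)` has room for `q = x * x` options. After one factor `x ^ suc T'` of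
-- `q ^ suc T'` is cancelled, the local lemma asks for the last hypothesis.
room-at : ∀ (sz : ℕ → ℕ) T' j x → sz j ≡ 4 * (x * x) → sz (suc j) ≡ x → 1 ≤ x → suc j + suc T' ≤ x →
          load (suc T') j * (x * x * (x * x)) ≤ x ^ suc T' → Room sz T' j
room-at sz T' j x e e' 1≤x le hp = record
  { q = x * x
  ; room = ℕP.≤-trans (ℕP.*-monoʳ-≤ 2 (ℕP.+-monoˡ-≤ (x * x) (ℕP.≤-trans le (1≤² 1≤x)))) (ℕP.≤-reflexive (trans (lem₁ (x * x)) (sym e)))
  ; 1≤q = 1≤xx
  ; 1≤Δ = ℕP.*-mono-≤ (ℕP.≤-trans 1≤sz (ℕP.m≤m+n (sz j) (sz j))) (ℕP.*-mono-≤ 1≤pow (ℕP.*-mono-≤ 1≤sz (s≤s {n = suc j} z≤n)))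
  ; small = ℕP.≤-trans (ℕP.≤-reflexive (trans (cong₂ (λ a b → 4 * (suc T' ^ suc T' * (suc T' * ((a + a) * (b ^ suc T' * (a * suc (suc j))))))) e e')
                          (lem₂ 4 (suc T' ^ suc T') (suc T') 4 (x * x) (x ^ suc T') (suc (suc j)))))
      (ℕP.≤-trans (ℕP.*-monoˡ-≤ (x ^ suc T') hp) (ℕP.≤-reflexive (sym (^-square x (suc T')))))
  }
  where
  1≤xx : 1 ≤ x * x
  1≤xx = ℕP.*-mono-≤ 1≤x 1≤x
  1≤sz : 1 ≤ sz j
  1≤sz = ℕP.≤-trans 1≤xx (ℕP.≤-trans (ℕP.m≤m+n (x * x) _) (ℕP.≤-reflexive (sym e)))
  1≤pow : 1 ≤ sz (suc j) ^ suc T'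
  1≤pow = >-nonZero⁻¹ _ {{ℕP.m^n≢0 (sz (suc j)) (suc T') {{>-nonZero (ℕP.≤-trans 1≤x (ℕP.≤-reflexive (sym e')))}}}}
  lem₁ : ∀ w → 2 * (w + w) ≡ 4 * w
  lem₁ = solve-∀
  lem₂ : ∀ a A b c w y J → a * (A * (b * ((c * w + c * w) * (y * (c * w * J))))) ≡ a * (A * (b * ((c + c) * (c * J)))) * (w * w) * y
  lem₂ = solve-∀

-- T' = 4: the fifth power beats the square of the square by one factor x.
sizes : ∀ ℓ κ → ∃ λ T' → ∃ λ x → 1 ≤ x × suc κ + suc T' ≤ x × 16 * (suc ℓ * (suc κ * suc T')) ≤ x ×
  (∀ y j → x ≤ y → j ≤ κ → load (suc T') j * (y * y * (y * y)) ≤ y ^ suc T')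
sizes ℓ κ = 4 , x , ℕP.≤-trans (s≤s z≤n) a≤ , a≤ , b≤ , λ y j xy jk → power (load 5 j) y (ℕP.≤-trans (load-mono 5 jk) (ℕP.≤-trans c≤ xy))
  where
  a = suc κ + 5
  b = 16 * (suc ℓ * (suc κ * 5))
  x = a + (b + load 5 κ)
  a≤ : a ≤ x
  a≤ = ℕP.m≤m+n a _
  b≤ : b ≤ x
  b≤ = ℕP.≤-trans (ℕP.m≤m+n b _) (ℕP.m≤n+m _ a)
  c≤ : load 5 κ ≤ x
  c≤ = ℕP.≤-trans (ℕP.m≤n+m _ b) (ℕP.m≤n+m _ a)
  power : ∀ c y → c ≤ y → c * (y * y * (y * y)) ≤ y ^ 5
  power c y le = ℕP.≤-trans (ℕP.*-monoˡ-≤ _ le) (ℕP.≤-reflexive (lem y))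
    where lem : ∀ y → y * (y * y * (y * y)) ≡ y * (y * (y * (y * (y * 1))))
          lem = solve-∀

n≤2^n : ∀ n → n ≤ 2 ^ n
n≤2^n zero = z≤n
n≤2^n (suc n) = ℕP.≤-trans (ℕP.+-mono-≤ (1≤2^ n) (n≤2^n n)) (ℕP.≤-reflexive (cong (2 ^ n +_) (sym (ℕP.+-identityʳ _))))
  where 1≤2^ : ∀ n → 1 ≤ 2 ^ n
        1≤2^ n = >-nonZero⁻¹ _ {{ℕP.m^n≢0 2 n}}

-- Cuts and eulerian tours of the multigraph

sum-allFin : ∀ {m} (f : Fin m → ℕ) → sum (L.map f (L.allFin m)) ≡ sumF f
sum-allFin f = trans (cong sum (LP.map-tabulate id f)) (go f)
  where go : ∀ {m} (f : Fin m → ℕ) → sum (tabulate f) ≡ sumF f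
        go {zero} f = refl
        go {suc m} f = cong (f zero +_) (go (λ i → f (suc i)))

cnt≤1-unique : ∀ {n} {p : Fin n → Bool} → cnt p ≤ 1 → ∀ i j → p i ≡ true → p j ≡ true → i ≡ j
cnt≤1-unique {p = p} le i j pi pj with i ≟ j
... | yes e = e
... | no ne = ⊥-elim (ℕP.<⇒≱ (ℕP.≤-<-trans (cnt-pos {p = eqb i} i (eqb-refl i))
    (cnt-strict {p = eqb i} {q = p} (λ k e → trans (cong p (sym (does⇒ (i ≟ k) e))) pi) j (dec-false (i ≟ j) ne) pj)) le)

module _ (G : Multigraph) where
  private
    V = Fin (n G)
    Ed = Fin (m G)

  joins-swap : ∀ {e u v} → Joins G e u v → Joins G e v u
  joins-swap (inj₁ p) = inj₂ p
  joins-swap (inj₂ p) = inj₁ p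

  joins-unique : ∀ {e u v u' v'} → Joins G e u v → Joins G e u' v' → (u ≡ u' × v ≡ v') ⊎ (u ≡ v' × v ≡ u')
  joins-unique (inj₁ p) (inj₁ q) = inj₁ (PP.,-injective (trans (sym p) q))
  joins-unique (inj₁ p) (inj₂ q) = inj₂ (PP.,-injective (trans (sym p) q))
  joins-unique (inj₂ p) (inj₁ q) with PP.,-injective (trans (sym p) q)
  ... | a , b = inj₂ (b , a)
  joins-unique (inj₂ p) (inj₂ q) with PP.,-injective (trans (sym p) q)
  ... | a , b = inj₁ (b , a)

  -- In a balanced orientation a set is entered as often as it is left, so a set entered
  -- at most once would be separated by two edges.
  module _ (tl hd : Ed → V) (tj : ∀ e → Joins G e (tl e) (hd e)) (bal : ∀ v → fib _≟_ tl v ≡ fib _≟_ hd v)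
           (ec : EdgeConnected 4 G) (r : V) where
    two-enter : ∀ (Y : V → Bool) → Y r ≡ false → ∀ y → Y y ≡ true → ∀ (bad : Ed → Bool) → cnt bad ≤ 1 →
                ∃ λ e → bad e ≡ false × Y (tl e) ≡ false × Y (hd e) ≡ true
    two-enter Y Yr y Yy bad b1 with find? (λ e → (not (Y (tl e)) ∧ Y (hd e)) ∧ not (bad e))
    ... | inj₁ (e , h) = e , not-true (proj₂ (∧-true {not (Y (tl e)) ∧ Y (hd e)} h)) , not-true (proj₁ (∧-true (proj₁ (∧-true {not (Y (tl e)) ∧ Y (hd e)} h)))) ,
                         proj₂ (∧-true {not (Y (tl e))} (proj₁ (∧-true {not (Y (tl e)) ∧ Y (hd e)} h)))
    ... | inj₂ none = ⊥-elim (cross (proj₂ ec F F<4 r y) Yr)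
      where
      ent lea : Ed → Bool
      ent e = not (Y (tl e)) ∧ Y (hd e)
      lea e = not (Y (hd e)) ∧ Y (tl e)
      ent≤1 : cnt ent ≤ 1
      ent≤1 = ℕP.≤-trans (cnt-mono {p = ent} {q = bad} (λ e t → trans (sym (BP.not-involutive _)) (cong not (nb e t)))) b1
        where nb : ∀ e → ent e ≡ true → not (bad e) ≡ false
              nb e t = trans (sym (cong (_∧ not (bad e)) t)) (none e)
      flux : cnt (λ e → Y (tl e)) ≡ cnt (λ e → Y (hd e))
      flux = trans (sum-push tl (λ v → ⟦ Y v ⟧)) (trans (sum-cong (λ v → cong (_* ⟦ Y v ⟧) (bal v))) (sym (sum-push hd (λ v → ⟦ Y v ⟧))))
      lea≤1 : cnt lea ≤ 1
      lea≤1 = ℕP.≤-trans (ℕP.≤-reflexive (ℕP.+-cancelˡ-≡ (cnt (λ e → Y (tl e) ∧ Y (hd e))) _ _ (begin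
          cnt (λ e → Y (tl e) ∧ Y (hd e)) + cnt lea
            ≡⟨ cong (cnt (λ e → Y (tl e) ∧ Y (hd e)) +_) (cnt-cong (λ e → BP.∧-comm (not (Y (hd e))) (Y (tl e)))) ⟩
          cnt (λ e → Y (tl e) ∧ Y (hd e)) + cnt (λ e → Y (tl e) ∧ not (Y (hd e)))   ≡⟨ cnt-split (λ e → Y (tl e)) (λ e → Y (hd e)) ⟨
          cnt (λ e → Y (tl e))                                                     ≡⟨ flux ⟩
          cnt (λ e → Y (hd e))                                                     ≡⟨ cnt-split (λ e → Y (hd e)) (λ e → Y (tl e)) ⟩
          cnt (λ e → Y (hd e) ∧ Y (tl e)) + cnt (λ e → Y (hd e) ∧ not (Y (tl e)))
            ≡⟨ cong₂ _+_ (cnt-cong (λ e → BP.∧-comm (Y (hd e)) (Y (tl e)))) (cnt-cong (λ e → BP.∧-comm (Y (hd e)) (not (Y (tl e))))) ⟩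
          cnt (λ e → Y (tl e) ∧ Y (hd e)) + cnt ent ∎))) ent≤1
        where open ≡-Reasoning
      pickOne : ∀ (p : Ed → Bool) → cnt p ≤ 1 → Σ[ F ∈ List Ed ] (length F ≤ 1 × (∀ e → p e ≡ true → e ∈ F))
      pickOne p le with find? p
      ... | inj₁ (e , h) = e ∷ [] , ℕP.≤-refl , λ e' h' → here (cnt≤1-unique le e' e h' h)
      ... | inj₂ z = [] , z≤n , λ e h → ⊥-elim (t≢f h (z e))
      F₁ = pickOne ent ent≤1
      F₂ = pickOne lea lea≤1
      F = proj₁ F₁ ++ proj₁ F₂
      F<4 : length F < 4
      F<4 = ℕP.≤-trans (s≤s (ℕP.≤-trans (ℕP.≤-reflexive (LP.length-++ (proj₁ F₁))) (ℕP.+-mono-≤ (proj₁ (proj₂ F₁)) (proj₁ (proj₂ F₂))))) (s≤s (s≤s (s≤s z≤n)))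
      cross : ∀ {u} → Reach G (λ e → ¬ (e ∈ F)) u y → Y u ≡ false → ⊥
      cross here Yu = t≢f Yy Yu
      cross {u} (step {w = w} e nF j rest) Yu with Y w in Yw
      ... | false = cross rest Yw
      ... | true with joins-unique j (tj e)
      ...   | inj₁ (refl , refl) = nF (∈-++⁺ˡ (proj₂ (proj₂ F₁) e (∧-intro (cong not Yu) Yw)))
      ...   | inj₂ (refl , refl) = nF (∈-++⁺ʳ (proj₁ F₁) (proj₂ (proj₂ F₂) e (∧-intro (cong not Yu) Yw)))

-- Equal vertices at positions `j < k` of a segment would close a walk of `k - j` arcs in `S`, and
-- this number is at most `ℓ`.
closed-tour : (G : Multigraph) (S : Fin (m G) → Bool) (ℓ : ℕ) (tl hd : Fin (m G) → Fin (n G)) → (∀ e → Joins G e (tl e) (hd e)) →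
  (Σ[ e₀ ∈ Fin (m G) ] Σ[ π ∈ Perm (m G) ] ((∀ e → tl (to π e) ≡ hd e) ×
      (∀ j a → j < ℓ → (∀ i → i ≤ j → S (iter π i a) ≡ true) → hd (iter π j a) ≢ tl a) × (∀ e → orbit π e₀ e ≡ true))) →
  Σ (EulerTour G) (λ T → GoodTour G S ℓ T)
closed-tour record { m = zero } S ℓ tl hd tj (() , _)
closed-tour G@(record { m = suc m' }) S ℓ tl hd tj (e₀ , π , ok , good , all) = T , goodT
  where
  module SO = SingleOrbit π e₀ all
  T : EulerTour G
  T = record
    { seq = SO.seqF
    ; bij = SO.seqF-inj , λ e → proj₁ (SO.seqF-sur e) , λ { refl → proj₂ (SO.seqF-sur e) }
    ; vtx = λ i → tl (SO.seqF i)
    ; fits = λ i → subst (Joins G (SO.seqF i) (tl (SO.seqF i)))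
        (sym (trans (cong tl (trans (SO.seqF-cyc i 1) (cong (λ k → iter π k e₀) (ℕP.+-comm (toℕ i) 1)))) (ok (SO.seqF i)))) (tj (SO.seqF i))
    }
  apart : ∀ i t → t ≤ ℓ → (∀ k → k < t → S (SO.seqF (cyc i k)) ≡ true) → ∀ j k → k ≤ t → j < k →
          tl (SO.seqF (cyc i j)) ≢ tl (SO.seqF (cyc i k))
  apart i t tℓ s j k kt jk q with ℕP.m≤n⇒∃[o]m+o≡n jk
  ... | p , refl = good p a (ℕP.≤-trans (ℕP.≤-trans (s≤s (ℕP.m≤n+m p j)) kt) tℓ) alive' (trans (sym (ok _)) (trans (cong tl (sym end)) (trans (sym q) (cong tl (SO.seqF-cyc i j)))))
    where
    a = iter π (toℕ i + j) e₀
    along : ∀ c → SO.seqF (cyc i (j + c)) ≡ iter π c a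
    along c = trans (SO.seqF-cyc i (j + c)) (trans (cong (λ z → iter π z e₀) (trans (sym (ℕP.+-assoc (toℕ i) j c)) (ℕP.+-comm (toℕ i + j) c))) (iter-+ π c (toℕ i + j) e₀))
    end : SO.seqF (cyc i (suc j + p)) ≡ to π (iter π p a)
    end = trans (cong (λ z → SO.seqF (cyc i z)) (sym (ℕP.+-suc j p))) (along (suc p))
    alive' : ∀ c → c ≤ p → S (iter π c a) ≡ true
    alive' c le = trans (cong S (sym (along c))) (s (j + c) (ℕP.≤-trans (s≤s (ℕP.+-monoʳ-≤ j le)) kt))
  goodT : GoodTour G S ℓ T
  goodT i t _ tℓ s j k jt kt ne q with ℕP.<-cmp j k
  ... | tri< lt _ _ = apart i t tℓ s j k kt lt q
  ... | tri≈ _ e _ = ne e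
  ... | tri> _ _ gt = apart i t tℓ s k j jt gt (sym q)

-- The degree bound and the conclusion

module Theorem (ℓ κ : ℕ) (levels : 2 ^ ℓ ≡ suc κ) (T' x : ℕ) (1≤x : 1 ≤ x) (wide : suc κ + suc T' ≤ x)
  (fine : 16 * (suc ℓ * (suc κ * suc T')) ≤ x)
  (powers : ∀ y j → x ≤ y → j ≤ κ → load (suc T') j * (y * y * (y * y)) ≤ y ^ suc T') where

  -- The sizes decrease with the level: the joining at level `j` disperses over the groups of level
  -- `suc j` and needs the square of their size as its number of options. Beyond `κ`, truncated
  -- subtraction keeps the size `x`.
  sz : ℕ → ℕ
  sz j = hh x (κ ∸ j)

  1≤sz : ∀ j → 1 ≤ sz j
  1≤sz j = ℕP.≤-trans 1≤x (x≤hh x 1≤x (κ ∸ j))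

  ed : ∀ j → ∃ λ e → sz 0 ≡ e * sz j × 1 ≤ e
  ed j with j ≤? κ
  ... | yes le = subst (λ z → ∃ λ e → hh x z ≡ e * sz j × 1 ≤ e) (ℕP.m+[n∸m]≡n le) (hh-divs x 1≤x (κ ∸ j) j)
  ... | no nle rewrite ℕP.m≤n⇒m∸n≡0 (ℕP.<⇒≤ (ℕP.≰⇒> nle)) = subst (λ z → ∃ λ e → hh x z ≡ e * x × 1 ≤ e) (ℕP.+-identityʳ κ) (hh-divs x 1≤x 0 κ)

  down : ∀ j → j < κ → κ ∸ j ≡ suc (κ ∸ suc j)
  down j lt = ℕP.+-∸-assoc 1 lt

  fd : ∀ j → ∃ λ f → sz j ≡ f * sz (suc j) × 1 ≤ f
  fd j with suc j ≤? κ
  ... | yes lt = subst (λ z → ∃ λ f → hh x z ≡ f * sz (suc j) × 1 ≤ f) (sym (down j lt)) (hh-div x 1≤x (κ ∸ suc j))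
  ... | no nlt = 1 , trans (cong (hh x) (trans (ℕP.m≤n⇒m∸n≡0 (ℕP.≮⇒≥ nlt)) (sym (ℕP.m≤n⇒m∸n≡0 (ℕP.m≤n⇒m≤1+n (ℕP.≮⇒≥ nlt)))))) (sym (ℕP.*-identityˡ _)) , ℕP.≤-refl

  rooms : ∀ j → j < κ → Room sz T' j
  rooms j lt = room-at sz T' j y (cong (hh x) (down j lt)) refl (ℕP.≤-trans 1≤x xy)
      (ℕP.≤-trans (ℕP.≤-trans (ℕP.+-monoˡ-≤ (suc T') (s≤s (ℕP.<⇒≤ lt))) wide) xy) (powers y j xy (ℕP.<⇒≤ lt))
    where y = hh x (κ ∸ suc j)
          xy = x≤hh x 1≤x (κ ∸ suc j)

  finest : 16 * (suc ℓ * (suc κ * suc T')) ≤ sz κ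
  finest = subst (λ i → 16 * (suc ℓ * (suc κ * suc T')) ≤ hh x i) (sym (ℕP.n∸n≡0 κ)) fine

  Md : ℕ
  Md = 2 ^ ℓ * sz 0

  1≤Md : 1 ≤ Md
  1≤Md = ℕP.*-mono-≤ (ℕP.≤-trans (s≤s z≤n) (ℕP.≤-reflexive (sym levels))) (1≤sz 0)

  instance
    nzMd : NonZero Md
    nzMd = >-nonZero 1≤Md

  -- `10 * Md + 44` is `2 * (5 * Md + 4 * 5 + 2)`, the demand of `room-arith` with at most `Md`
  -- loops and `5` cuts at a vertex; the factor `Md` converts `fill` into a number of arcs. By
  -- `degR`, degree `4 * D₀ + 4` leaves at least `D₀` arcs in each direction outside `Z`.
  D₀ d : ℕ
  D₀ = Md * (10 * Md + 44)
  d = 4 * D₀ + 4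

  fill : ℕ → ℕ
  fill D = suc (D DM./ Md)

  -- The loops round `D` up to a multiple of `Md`. If `Md` divides `D`, a full `Md` is added,
  -- matching the unconditional `suc` in `fill`.
  pad : ℕ → ℕ
  pad D = Md ∸ D DM.% Md

  pad≤ : ∀ D → pad D ≤ Md
  pad≤ D = ℕP.m∸n≤m Md (D DM.% Md)

  pad-fill : ∀ D → pad D + D ≡ 2 ^ ℓ * (sz 0 * fill D)
  pad-fill D = begin
    pad D + D                                     ≡⟨ cong (pad D +_) (DM.m≡m%n+[m/n]*n D Md) ⟩
    pad D + (D DM.% Md + D DM./ Md * Md)          ≡⟨ ℕP.+-assoc (pad D) _ _ ⟨
    pad D + D DM.% Md + D DM./ Md * Md            ≡⟨ cong (_+ D DM./ Md * Md) (ℕP.m∸n+n≡m (ℕP.<⇒≤ (DM.m%n<n D Md))) ⟩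
    fill D * Md                                   ≡⟨ ℕP.*-comm (fill D) Md ⟩
    Md * fill D                                   ≡⟨ ℕP.*-assoc (2 ^ ℓ) (sz 0) (fill D) ⟩
    2 ^ ℓ * (sz 0 * fill D)                       ∎
    where open ≡-Reasoning

  fill≥ : ∀ D → D₀ ≤ D → 10 * Md + 44 ≤ fill D
  fill≥ D le = ℕP.m≤n⇒m≤1+n (ℕP.≤-trans (ℕP.≤-reflexive (sym (trans (cong (DM._/ Md) (ℕP.*-comm Md _)) (DM.m*n/n≡m (10 * Md + 44) Md)))) (DM./-monoˡ-≤ Md le))

  pad≤fill : ∀ D → D₀ ≤ D → pad D ≤ fill D
  pad≤fill D le = ℕP.≤-trans (pad≤ D) (ℕP.≤-trans (ℕP.≤-trans (ℕP.m≤m+n Md (9 * Md)) (ℕP.m≤m+n _ 44)) (fill≥ D le))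

  enough : ∀ D → D₀ ≤ D → 2 * (5 * pad D + 4 * 5 + 2) ≤ fill D * sz 0
  enough D le = begin
    2 * (5 * pad D + 4 * 5 + 2)    ≤⟨ ℕP.*-monoʳ-≤ 2 (ℕP.+-monoˡ-≤ 2 (ℕP.+-monoˡ-≤ (4 * 5) (ℕP.*-monoʳ-≤ 5 (pad≤ D)))) ⟩
    2 * (5 * Md + 4 * 5 + 2)       ≡⟨ lem Md ⟩
    10 * Md + 44                   ≤⟨ fill≥ D le ⟩
    fill D                         ≡⟨ ℕP.*-identityʳ (fill D) ⟨
    fill D * 1                     ≤⟨ ℕP.*-monoʳ-≤ (fill D) (1≤sz 0) ⟩
    fill D * sz 0                  ∎
    where open ℕP.≤-Reasoning
          lem : ∀ a → 2 * (5 * a + 4 * 5 + 2) ≡ 10 * a + 44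
          lem = solve-∀

  module _ (G : Multigraph) (ec : EdgeConnected 4 G) (ev : ∀ v → Even (deg G v)) (md : MinDegreeAtLeast d G)
           (S : Fin (m G) → Bool) (simp : Simple G S) where
    private
      s t : Fin (m G) → Fin (n G)
      s e = proj₁ (ends G e)
      t e = proj₂ (ends G e)

      deg-fib : ∀ v → deg G v ≡ fib _≟_ s v + fib _≟_ t v
      deg-fib v = trans (sum-allFin (λ e → [ s e ≟ v ] + [ t e ≟ v ])) (sum-+ (λ e → ⟦ eqb (s e) v ⟧) (λ e → ⟦ eqb (t e) v ⟧))

      or = orient _≟_ s t
      o = proj₁ or

      module Oriented (tl₁ hd₁ : Fin (m G) → Fin (n G)) (tj : ∀ e → Joins G e (tl₁ e) (hd₁ e))
                      (half : ∀ v → deg G v ≡ 2 * fib _≟_ hd₁ v) (bal : ∀ v → fib _≟_ tl₁ v ≡ fib _≟_ hd₁ v) where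
        r other : Fin (n G)
        r = fromℕ< (ℕP.≤-trans (s≤s z≤n) (proj₁ ec))
        other = fromℕ< (proj₁ ec)

        other≢r : other ≢ r
        other≢r q = case trans (sym (FP.toℕ-fromℕ< (proj₁ ec))) (trans (cong toℕ q) (FP.toℕ-fromℕ< (ℕP.≤-trans (s≤s z≤n) (proj₁ ec)))) of λ ()

        cut = two-enter G tl₁ hd₁ tj bal ec r

        noloop₁ : ∀ e → S e ≡ true → tl₁ e ≢ hd₁ e
        noloop₁ e se q with joins-unique G (tj e) (inj₁ refl)
        ... | inj₁ (a , b) = proj₁ simp e se (trans (sym a) (trans q b))
        ... | inj₂ (a , b) = proj₁ simp e se (trans (sym b) (trans (sym q) a))

        simple₁ : ∀ e f → S e ≡ true → S f ≡ true → (tl₁ e ≡ tl₁ f × hd₁ e ≡ hd₁ f) ⊎ (tl₁ e ≡ hd₁ f × hd₁ e ≡ tl₁ f) → e ≡ f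
        simple₁ e f se sf q with e ≟ f
        ... | yes p = p
        ... | no ne = ⊥-elim (proj₂ simp e f se sf ne (joined q))
          where
          likewise : ∀ {u w} → Joins G e u w → Joins G f u w → Joins G f (s e) (t e)
          likewise j jf with joins-unique G j (inj₁ refl)
          ... | inj₁ (refl , refl) = jf
          ... | inj₂ (refl , refl) = joins-swap G jf
          joined : (tl₁ e ≡ tl₁ f × hd₁ e ≡ hd₁ f) ⊎ (tl₁ e ≡ hd₁ f × hd₁ e ≡ tl₁ f) → Joins G f (s e) (t e)
          joined (inj₁ (a , b)) = likewise (tj e) (subst₂ (Joins G f) (sym a) (sym b) (tj f))
          joined (inj₂ (a , b)) = likewise (tj e) (subst₂ (Joins G f) (sym a) (sym b) (joins-swap G (tj f)))

        module Split (es : Skeleton.EvenSpanning tl₁ hd₁ r cut) where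
          open module Ro = Reorient tl₁ hd₁ r other other≢r cut bal S noloop₁ simple₁ es
            using (Z; tl; hd; ends-of; balR; inout; degR; noloop; simple; zperm)

          D : Fin (n G) → ℕ
          D v = cnt (λ e → not (Z e) ∧ eqb (tl e) v)

          D₀≤D : ∀ v → D₀ ≤ D v
          D₀≤D v = ℕP.*-cancelˡ-≤ 4 (ℕP.+-cancelʳ-≤ 4 _ _ (begin
            4 * D₀ + 4             ≤⟨ md v ⟩
            deg G v                ≡⟨ half v ⟩
            2 * fib _≟_ hd₁ v      ≤⟨ ℕP.*-monoʳ-≤ 2 (degR v) ⟩
            2 * (2 * D v + 2)      ≡⟨ lem (D v) ⟩
            4 * D v + 4            ∎))
            where open ℕP.≤-Reasoning
                  lem : ∀ a → 2 * (2 * a + 2) ≡ 4 * a + 4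
                  lem = solve-∀

          tj' : ∀ e → Joins G e (tl e) (hd e)
          tj' e with ends-of e
          ... | inj₁ (a , b) = subst₂ (Joins G e) (sym a) (sym b) (tj e)
          ... | inj₂ (a , b) = subst₂ (Joins G e) (sym a) (sym b) (joins-swap G (tj e))

          zt : ZTour tl hd S Z 5
          zt = record { πZ = proj₁ zperm ; fZ = Z'.fZ ; πZ-Z = Z'.π-Z ; πZ-ok = Z'.π-ok ; fZ-short = Z'.fZ-short ; fZ-path = Z'.fZ-path
                      ; fZ-few = Z'.fZ-few ; fZ-at = Z'.fZ-at ; e₀ = Ro.e₀ ; single = Z'.single ; e₀-Z = Ro.e₀-Z }
            where module Z' = Ro.Tour (proj₁ zperm) (proj₁ (proj₂ zperm)) (proj₂ (proj₂ zperm))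

          result : Σ (EulerTour G) (λ T → GoodTour G S ℓ T)
          result = closed-tour G S ℓ tl hd tj' (Build.built tl hd S Z noloop simple ℓ κ levels T' Md sz 1≤sz ed fd
              D (λ v → fill (D v)) (λ v → pad (D v)) (λ v → refl) (λ v → sym (balR v)) (λ v → pad-fill (D v)) (λ v → pad≤ (D v))
              (λ v → pad≤fill (D v) (D₀≤D v)) r (s≤s z≤n) zt rooms inout ℓ (ℕP.≤-trans (n≤2^n ℓ) (ℕP.≤-reflexive levels))
              finest (λ v → enough (D v) (D₀≤D v)))

        answer : Σ (EulerTour G) (λ T → GoodTour G S ℓ T)
        answer = Split.result (Skeleton.evenSpanning tl₁ hd₁ r cut)

    good-tour : Σ (EulerTour G) (λ T → GoodTour G S ℓ T)
    good-tour = Oriented.answer (pick o s t) (pick o t s) tj half bal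
      where
      balanced : ∀ v → fib _≟_ (pick o s t) v ≡ proj₁ (ev v) × fib _≟_ (pick o t s) v ≡ proj₁ (ev v)
      balanced v = even-balanced (proj₁ (ev v)) (trans (orient-sum _≟_ o s t v) (trans (sym (deg-fib v)) (proj₂ (ev v))))
                     (proj₁ (proj₂ or v)) (proj₂ (proj₂ or v))
      bal : ∀ v → fib _≟_ (pick o s t) v ≡ fib _≟_ (pick o t s) v
      bal v = trans (proj₁ (balanced v)) (sym (proj₂ (balanced v)))
      half : ∀ v → deg G v ≡ 2 * fib _≟_ (pick o t s) v
      half v = trans (proj₂ (ev v)) (cong (2 *_) (sym (proj₂ (balanced v))))
      tj : ∀ e → Joins G e (pick o s t e) (pick o t s e)
      tj e with o e
      ... | true  = inj₁ refl
      ... | false = inj₂ refl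

private
  degree-bound : ∀ ℓ κ → 2 ^ ℓ ≡ suc κ → (∃ λ T' → ∃ λ x → 1 ≤ x × suc κ + suc T' ≤ x × 16 * (suc ℓ * (suc κ * suc T')) ≤ x ×
      (∀ y j → x ≤ y → j ≤ κ → load (suc T') j * (y * y * (y * y)) ≤ y ^ suc T')) → ∃ λ (d : ℕ) →
    (G : Multigraph) → EdgeConnected 4 G → Eulerian G → MinDegreeAtLeast d G →
    (S : Fin (m G) → Bool) → Simple G S → Σ (EulerTour G) (λ T → GoodTour G S ℓ T)
  degree-bound ℓ κ levels (T' , x , 1≤x , wide , fine , powers) = Theorem.d ℓ κ levels T' x 1≤x wide fine powers ,
    λ G ec eu md S simp → Theorem.good-tour ℓ κ levels T' x 1≤x wide fine powers G ec (proj₂ eu) md S simp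

theorem1p6 : (ℓ : ℕ) → 1 ≤ ℓ → ∃ λ (d : ℕ) →
    (G : Multigraph) → EdgeConnected 4 G → Eulerian G → MinDegreeAtLeast d G →
    (S : Fin (m G) → Bool) → Simple G S →
    Σ (EulerTour G) (λ T → GoodTour G S ℓ T)
-- The number of levels is `2 ^ ℓ`: a power of two, for the repeated halving, and at least `ℓ`. The
-- last level is `κ`.
theorem1p6 ℓ _ with ≤⇒suc {b = 2 ^ ℓ} (>-nonZero⁻¹ (2 ^ ℓ) {{ℕP.m^n≢0 2 ℓ}})
... | κ , levels = degree-bound ℓ κ levels (sizes ℓ κ)
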